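{- Representatives of $\Lambda/4\Lambda$ of minimal norm may be found among Leech vectors of type up to $16$, according to the weighted equality $$\begin{aligned}4^{24}=\,&1+|O_2|+|O_3|+|O_4|+|O_5|+|O_{6a}|+|O_{6b}|+|O_7|+\tfrac12|O_{8a}|+|O_{8b}|+|O_{8c}|+|O_{9a}|+|O_{9b}|+|O_{10a}|\\&+\tfrac12|O_{10b}|+|O_{10c}|+\tfrac12|O_{11a}|+|O_{11b}|+\tfrac12|O_{12a}|+|O_{12c}|+\tfrac14|O_{12d}|+\tfrac12|O_{12e}|+|O_{12f}|\\&+\tfrac12|O_{13b}|+\tfrac13|O_{13c}|+\tfrac16|O_{14b}|+\tfrac14|O_{14d}|+\tfrac18|O_{14e}|+\tfrac1{14}(|O_{15b}|+|O_{15d}|)+\tfrac1{48}|O_{16a}|+\tfrac1{32}|O_{16e}|,\end{aligned}$$ in which each orbit appearing consists of vectors of minimal norm in their class modulo $4\Lambda$, and the weight (the reciprocal of the coefficient) of each orbit is the $4$-weight of the vectors in that orbit. Moreover: (i) $O_{15b}$ and $O_{15d}$ are conjugate modulo $4\Lambda$, but they are not conjugate modulo $4\Lambda$ to the other orbits of type $15$; (ii) every orbit $O_x$ appearing in the equality and not of type $15$ is not conjugate modulo $4\Lambda$ to any other orbit $O_y$ of type $y\le x$; hence the $4$-weight of $O_x$ coincides with the $4$-weight of any vector in $O_x$; (iii) the $4$-weights of the orbits $O_{15b}$ and $O_{15d}$ are $2$ and $12$ respectively, which differ from the $4$-weight of any vector in $O_{15b}$ or $O_{15d}$, namely $14$.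
   Context: Let $\Lambda$ be the Leech lattice with bilinear form $(\cdot,\cdot)$ and $\operatorname{Co}_0$ its automorphism group. The type of $v\in\Lambda$ is $\frac12(v,v)$. For $t\ge1$, the $t$-weight of a vector $v\in\Lambda$ is $\#\{u\in\Lambda:u\in v+t\Lambda,\ (u,u)=(v,v)\}$, and the $t$-weight of an orbit $\operatorname{Co}_0v$ is $\#\{u\in\operatorname{Co}_0v:u\in v+t\Lambda\}$. Two orbits $\operatorname{Co}_0v$, $\operatorname{Co}_0u$ are conjugate modulo $t\Lambda$ if $v-\sigma(u)\in t\Lambda$ for some $\sigma\in\operatorname{Co}_0$. Let $p=65520$. The $\operatorname{Co}_0$-orbits of type $\le16$ are $O_0=\{0\}$ and (subscript = type, cardinality in parentheses, distinct within each type): $O_2$ ($3p$), $O_3$ ($256p$), $O_4$ ($6075p$), $O_5$ ($70656p$), $O_{6a}$ ($518400p$), $O_{6b}$ ($6900p$), $O_7$ ($2861568p$), $O_{8a}$ ($3p$), $O_{8b}$ ($12295800p$), $O_{8c}$ ($141312p$), $O_{9a}$ ($12441600p$), $O_{9b}$ ($32972800p$), $O_{10a}$ ($143078400p$), $O_{10b}$ ($279450p$), $O_{10c}$ ($1430784p$), $O_{11a}$ ($19430400p$), $O_{11b}$ ($393465600p$), $O_{12a}$ ($256p$), $O_{12b}$ ($141312p$), $O_{12c}$ ($12441600p$), $O_{12d}$ ($2049300p$), $O_{12e}$ ($393465600p$), $O_{12f}$ ($667699200p$), $O_{13a}$ ($12441600p$), $O_{13b}$ ($1007271936p$), $O_{13c}$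 ($1573862400p$), $O_{14a}$ ($286156800p$), $O_{14b}$ ($5508518400p$), $O_{14c}$ ($13800p$), $O_{14d}$ ($19430400p$), $O_{14e}$ ($49183200p$), $O_{15a}$ ($2861568p$), $O_{15b}$ ($1335398400p$), $O_{15c}$ ($19430400p$), $O_{15d}$ ($8012390400p$), $O_{15e}$ ($3147724800p$), $O_{16a}$ ($6075p$), $O_{16b}$ ($12441600p$), $O_{16c}$ ($286156800p$), $O_{16d}$ ($98366400p$), $O_{16e}$ ($5901984000p$), $O_{16f}$ ($16024780800p$), $O_{16g}$ ($3147724800p$). $|O|$ denotes the cardinality of $O$. -}

module Defs where

open import Data.Bool using (Bool; true; false; _xor_; _∧_)
open import Data.Nat as ℕ using (ℕ; zero; suc; _≤_)
open import Data.Integer as ℤ using (ℤ; +_)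
open import Data.Integer.DivMod using (_%ℕ_)
open import Data.Fin using (Fin; toℕ; zero)
open import Data.Vec using (Vec; []; _∷_; lookup; zipWith; foldr′; map)
open import Data.List using (List; []; _∷_; length)
open import Data.List.Relation.Unary.Any using (Any)
open import Data.List.Relation.Unary.Unique.Propositional using (Unique)
open import Data.List.Membership.Propositional using (_∈_)
open import Data.Product using (Σ; ∃; _×_; _,_)
open import Relation.Binary.PropositionalEquality using (_≡_)
open import Relation.Nullary.Decidable using (⌊_⌋)
open import Function.Bundles using (_⇔_)

-- The extended binary Golay code C ⊆ 𝔽₂²⁴.
-- Generator matrix [ I₁₂ | J − A ], A the adjacency matrix of the
-- icosahedron (checked: 4096 codewords of weights 0,8,12,16,24).
-- C is self-dual, so c ∈ C iff c is orthogonal to every generator row.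

private
  I O : Bool
  I = true
  O = false

golayRows : List (Vec Bool 24)
golayRows =
  (I ∷ O ∷ O ∷ O ∷ O ∷ O ∷ O ∷ O ∷ O ∷ O ∷ O ∷ O ∷ I ∷ O ∷ O ∷ O ∷ O ∷ O ∷ I ∷ I ∷ I ∷ I ∷ I ∷ I ∷ []) ∷
  (O ∷ I ∷ O ∷ O ∷ O ∷ O ∷ O ∷ O ∷ O ∷ O ∷ O ∷ O ∷ O ∷ I ∷ O ∷ I ∷ I ∷ O ∷ O ∷ O ∷ I ∷ I ∷ I ∷ I ∷ []) ∷
  (O ∷ O ∷ I ∷ O ∷ O ∷ O ∷ O ∷ O ∷ O ∷ O ∷ O ∷ O ∷ O ∷ O ∷ I ∷ O ∷ I ∷ I ∷ I ∷ O ∷ O ∷ I ∷ I ∷ I ∷ []) ∷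
  (O ∷ O ∷ O ∷ I ∷ O ∷ O ∷ O ∷ O ∷ O ∷ O ∷ O ∷ O ∷ O ∷ I ∷ O ∷ I ∷ O ∷ I ∷ I ∷ I ∷ O ∷ O ∷ I ∷ I ∷ []) ∷
  (O ∷ O ∷ O ∷ O ∷ I ∷ O ∷ O ∷ O ∷ O ∷ O ∷ O ∷ O ∷ O ∷ I ∷ I ∷ O ∷ I ∷ O ∷ I ∷ I ∷ I ∷ O ∷ O ∷ I ∷ []) ∷
  (O ∷ O ∷ O ∷ O ∷ O ∷ I ∷ O ∷ O ∷ O ∷ O ∷ O ∷ O ∷ O ∷ O ∷ I ∷ I ∷ O ∷ I ∷ O ∷ I ∷ I ∷ I ∷ O ∷ I ∷ []) ∷
  (O ∷ O ∷ O ∷ O ∷ O ∷ O ∷ I ∷ O ∷ O ∷ O ∷ O ∷ O ∷ I ∷ O ∷ I ∷ I ∷ I ∷ O ∷ I ∷ O ∷ I ∷ I ∷ O ∷ O ∷ []) ∷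
  (O ∷ O ∷ O ∷ O ∷ O ∷ O ∷ O ∷ I ∷ O ∷ O ∷ O ∷ O ∷ I ∷ O ∷ O ∷ I ∷ I ∷ I ∷ O ∷ I ∷ O ∷ I ∷ I ∷ O ∷ []) ∷
  (O ∷ O ∷ O ∷ O ∷ O ∷ O ∷ O ∷ O ∷ I ∷ O ∷ O ∷ O ∷ I ∷ I ∷ O ∷ O ∷ I ∷ I ∷ I ∷ O ∷ I ∷ O ∷ I ∷ O ∷ []) ∷
  (O ∷ O ∷ O ∷ O ∷ O ∷ O ∷ O ∷ O ∷ O ∷ I ∷ O ∷ O ∷ I ∷ I ∷ I ∷ O ∷ O ∷ I ∷ I ∷ I ∷ O ∷ I ∷ O ∷ O ∷ []) ∷
  (O ∷ O ∷ O ∷ O ∷ O ∷ O ∷ O ∷ O ∷ O ∷ O ∷ I ∷ O ∷ I ∷ I ∷ I ∷ I ∷ O ∷ O ∷ O ∷ I ∷ I ∷ O ∷ I ∷ O ∷ []) ∷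
  (O ∷ O ∷ O ∷ O ∷ O ∷ O ∷ O ∷ O ∷ O ∷ O ∷ O ∷ I ∷ I ∷ I ∷ I ∷ I ∷ I ∷ I ∷ O ∷ O ∷ O ∷ O ∷ O ∷ I ∷ []) ∷
  []

parity : ∀ {n} → Vec Bool n → Bool
parity = foldr′ _xor_ false

orthogonal : Vec Bool 24 → Vec Bool 24 → Set
orthogonal c r = parity (zipWith _∧_ c r) ≡ false

data AllRows (c : Vec Bool 24) : List (Vec Bool 24) → Set where
  []  : AllRows c []
  _∷_ : ∀ {r rs} → orthogonal c r → AllRows c rs → AllRows c (r ∷ rs)

IsGolay : Vec Bool 24 → Set
IsGolay c = AllRows c golayRows

-- The Leech lattice Λ, in the standard coordinates of Conway–Sloane:
-- a vector of Λ is represented by x ∈ ℤ²⁴ standing for x/√8, and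
-- x ∈ Λ iff  (1) all xᵢ ≡ m (mod 2) for a common m ∈ {0,1},
--            (2) Σ xᵢ ≡ 4m (mod 8),
--            (3) for each a mod 4, {i : xᵢ ≡ a (mod 4)} is a C-set.

Vec24 : Set
Vec24 = Vec ℤ 24

sumℤ : ∀ {n} → Vec ℤ n → ℤ
sumℤ = foldr′ ℤ._+_ (+ 0)

InΛ : Vec24 → Set
InΛ x =
  (∀ i → lookup x i %ℕ 2 ≡ lookup x zero %ℕ 2) ×
  (sumℤ x %ℕ 8 ≡ 4 ℕ.* (lookup x zero %ℕ 2)) ×
  (∀ (a : Fin 4) → IsGolay (map (λ xi → ⌊ (xi %ℕ 4) ℕ.≟ toℕ a ⌋) x))

-- 8 (x, y) : the bilinear form is (x,y) = (Σ xᵢ yᵢ)/8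
form8 : Vec24 → Vec24 → ℤ
form8 x y = sumℤ (zipWith ℤ._*_ x y)

-- v has type t, i.e. (v,v)/2 = t, i.e. Σ vᵢ² = 16 t
HasType : Vec24 → ℕ → Set
HasType v t = form8 v v ≡ + (16 ℕ.* t)

TypeAtMost : Vec24 → ℕ → Set
TypeAtMost v t = ∃ λ s → s ≤ t × HasType v s

_-ᵥ_ : Vec24 → Vec24 → Vec24
x -ᵥ y = zipWith ℤ._-_ x y

_+ᵥ_ : Vec24 → Vec24 → Vec24
x +ᵥ y = zipWith ℤ._+_ x y

In4Λ : Vec24 → Set
In4Λ x = ∃ λ w → InΛ w × x ≡ map (ℤ._*_ (+ 4)) w

-- Co₀ = Aut(Λ): bijective additive maps Λ → Λ preserving ( , ).
-- (Values of σ outside Λ are irrelevant.)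

record Co₀ (σ : Vec24 → Vec24) : Set where
  field
    maps       : ∀ u → InΛ u → InΛ (σ u)
    additive   : ∀ u v → InΛ u → InΛ v → σ (u +ᵥ v) ≡ σ u +ᵥ σ v
    isometry   : ∀ u v → InΛ u → InΛ v → form8 (σ u) (σ v) ≡ form8 u v
    inverse    : Vec24 → Vec24
    inv-maps   : ∀ u → InΛ u → InΛ (inverse u)
    inv-left   : ∀ u → InΛ u → inverse (σ u) ≡ u
    inv-right  : ∀ u → InΛ u → σ (inverse u) ≡ u

InOrbit : Vec24 → Vec24 → Set
InOrbit v u = ∃ λ σ → Co₀ σ × σ v ≡ u

HasSize : (Vec24 → Set) → ℕ → Set
HasSize P N = Σ (List Vec24) λ l → Unique l × length l ≡ N × (∀ u → (P u ⇔ (u ∈ l)))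

IsOrbit : ℕ → ℕ → Vec24 → Set
IsOrbit t c v = InΛ v × HasType v t × HasSize (InOrbit v) c

Weight4 : Vec24 → Vec24 → Set
Weight4 v u = InΛ u × In4Λ (u -ᵥ v) × form8 u u ≡ form8 v v

OrbitWeight4 : Vec24 → Vec24 → Set
OrbitWeight4 v u = InOrbit v u × In4Λ (u -ᵥ v)

Conj4 : Vec24 → Vec24 → Set
Conj4 v u = ∃ λ σ → Co₀ σ × In4Λ (v -ᵥ σ u)

MinimalInClass : Vec24 → Set
MinimalInClass v = ∀ u → InΛ u → In4Λ (u -ᵥ v) → form8 v v ℤ.≤ form8 u u

p : ℕ
p = 65520

|O₀| |O₂| |O₃| |O₄| |O₅| |O₆ₐ| |O₆ᵦ| |O₇| |O₈ₐ| |O₈ᵦ| |O₈c| |O₉ₐ| |O₉ᵦ| : ℕ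
|O₁₀ₐ| |O₁₀ᵦ| |O₁₀c| |O₁₁ₐ| |O₁₁ᵦ| |O₁₂ₐ| |O₁₂ᵦ| |O₁₂c| |O₁₂d| |O₁₂e| |O₁₂f| : ℕ
|O₁₃ₐ| |O₁₃ᵦ| |O₁₃c| |O₁₄ₐ| |O₁₄ᵦ| |O₁₄c| |O₁₄d| |O₁₄e| : ℕ
|O₁₅ₐ| |O₁₅ᵦ| |O₁₅c| |O₁₅d| |O₁₅e| : ℕ
|O₁₆ₐ| |O₁₆ᵦ| |O₁₆c| |O₁₆d| |O₁₆e| |O₁₆f| |O₁₆g| : ℕ
|O₀| = 1
|O₂| = 3 ℕ.* p
|O₃| = 256 ℕ.* p
|O₄| = 6075 ℕ.* p
|O₅| = 70656 ℕ.* p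
|O₆ₐ| = 518400 ℕ.* p
|O₆ᵦ| = 6900 ℕ.* p
|O₇| = 2861568 ℕ.* p
|O₈ₐ| = 3 ℕ.* p
|O₈ᵦ| = 12295800 ℕ.* p
|O₈c| = 141312 ℕ.* p
|O₉ₐ| = 12441600 ℕ.* p
|O₉ᵦ| = 32972800 ℕ.* p
|O₁₀ₐ| = 143078400 ℕ.* p
|O₁₀ᵦ| = 279450 ℕ.* p
|O₁₀c| = 1430784 ℕ.* p
|O₁₁ₐ| = 19430400 ℕ.* p
|O₁₁ᵦ| = 393465600 ℕ.* p
|O₁₂ₐ| = 256 ℕ.* p
|O₁₂ᵦ| = 141312 ℕ.* p
|O₁₂c| = 12441600 ℕ.* p
|O₁₂d| = 2049300 ℕ.* p
|O₁₂e| = 393465600 ℕ.* p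
|O₁₂f| = 667699200 ℕ.* p
|O₁₃ₐ| = 12441600 ℕ.* p
|O₁₃ᵦ| = 1007271936 ℕ.* p
|O₁₃c| = 1573862400 ℕ.* p
|O₁₄ₐ| = 286156800 ℕ.* p
|O₁₄ᵦ| = 5508518400 ℕ.* p
|O₁₄c| = 13800 ℕ.* p
|O₁₄d| = 19430400 ℕ.* p
|O₁₄e| = 49183200 ℕ.* p
|O₁₅ₐ| = 2861568 ℕ.* p
|O₁₅ᵦ| = 1335398400 ℕ.* p
|O₁₅c| = 19430400 ℕ.* p
|O₁₅d| = 8012390400 ℕ.* p
|O₁₅e| = 3147724800 ℕ.* p
|O₁₆ₐ| = 6075 ℕ.* p
|O₁₆ᵦ| = 12441600 ℕ.* p
|O₁₆c| = 286156800 ℕ.* p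
|O₁₆d| = 98366400 ℕ.* p
|O₁₆e| = 5901984000 ℕ.* p
|O₁₆f| = 16024780800 ℕ.* p
|O₁₆g| = 3147724800 ℕ.* p

record Entry : Set where
  constructor ⟨_,_,_⟩
  field
    type   : ℕ
    card   : ℕ
    weight : ℕ

appearing : List Entry
appearing =
  ⟨ 0 , |O₀| , 1 ⟩ ∷ ⟨ 2 , |O₂| , 1 ⟩ ∷ ⟨ 3 , |O₃| , 1 ⟩ ∷ ⟨ 4 , |O₄| , 1 ⟩ ∷
  ⟨ 5 , |O₅| , 1 ⟩ ∷ ⟨ 6 , |O₆ₐ| , 1 ⟩ ∷ ⟨ 6 , |O₆ᵦ| , 1 ⟩ ∷ ⟨ 7 , |O₇| , 1 ⟩ ∷
  ⟨ 8 , |O₈ₐ| , 2 ⟩ ∷ ⟨ 8 , |O₈ᵦ| , 1 ⟩ ∷ ⟨ 8 , |O₈c| , 1 ⟩ ∷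
  ⟨ 9 , |O₉ₐ| , 1 ⟩ ∷ ⟨ 9 , |O₉ᵦ| , 1 ⟩ ∷
  ⟨ 10 , |O₁₀ₐ| , 1 ⟩ ∷ ⟨ 10 , |O₁₀ᵦ| , 2 ⟩ ∷ ⟨ 10 , |O₁₀c| , 1 ⟩ ∷
  ⟨ 11 , |O₁₁ₐ| , 2 ⟩ ∷ ⟨ 11 , |O₁₁ᵦ| , 1 ⟩ ∷
  ⟨ 12 , |O₁₂ₐ| , 2 ⟩ ∷ ⟨ 12 , |O₁₂c| , 1 ⟩ ∷ ⟨ 12 , |O₁₂d| , 4 ⟩ ∷
  ⟨ 12 , |O₁₂e| , 2 ⟩ ∷ ⟨ 12 , |O₁₂f| , 1 ⟩ ∷
  ⟨ 13 , |O₁₃ᵦ| , 2 ⟩ ∷ ⟨ 13 , |O₁₃c| , 3 ⟩ ∷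
  ⟨ 14 , |O₁₄ᵦ| , 6 ⟩ ∷ ⟨ 14 , |O₁₄d| , 4 ⟩ ∷ ⟨ 14 , |O₁₄e| , 8 ⟩ ∷
  ⟨ 15 , |O₁₅ᵦ| , 14 ⟩ ∷ ⟨ 15 , |O₁₅d| , 14 ⟩ ∷
  ⟨ 16 , |O₁₆ₐ| , 48 ⟩ ∷ ⟨ 16 , |O₁₆e| , 32 ⟩ ∷
  []

module Submission where

-- The proof is a count.  Write r₁, r₂, … for representatives of the orbits in the equality, with O₁₅ᵦ left out.
-- From below, the orbits are large: starting from 0, each representative is r′ + βa with r′ an earlier one, a minimal
-- and β ≤ 3, and counting the pairs (u , a) with u in the orbit of r′ in two ways bounds the new orbit by the orbit of
-- a under the stabiliser of r′, which two matrices generate.  From above, few vectors of a class modulo 4Λ are short: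
-- if u = r + 4w is not longer than r, then w is minimal and found in the list of all minimal vectors, or r + 2w has
-- type at most 4 and is determined by r modulo 2Λ up to sign, unless it belongs to a frame of vectors of type 4.
-- Classes of different orbits differ in type or in the inner products modulo 4 with the minimal vectors.  Since the
-- resulting lower bounds for the number of classes already add up to 4²⁴, all the estimates are sharp and every class
-- is represented.  The vectors of type 15 congruent to those of O₁₅d, but outside of it, then make up O₁₅ᵦ.
-- Finally, a vector of type t in an orbit of size c which is congruent to a shorter one would, by counting congruent
-- pairs, share its class with too many vectors of type t: their inner products are too negative for a Gram matrix.

open import Defs
open import Data.Bool using (Bool; true; false; _xor_; _∧_; not; T; if_then_else_)
open import Data.Empty using (⊥; ⊥-elim)
open import Data.Nat as ℕ using (ℕ; zero; suc; z≤n; s≤s)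
import Data.Nat.Properties as ℕₚ
open import Data.Integer as ℤ using (ℤ; +_; -[1+_]; _+_; _*_; -_; _-_; +≤+)
import Data.Integer.Properties as ℤₚ
open import Data.Integer.Tactic.RingSolver using (solve-∀)
open import Data.Integer.Divisibility.Signed using (_∣_; divides; _∣?_)
open import Data.Fin as Fin using (Fin; zero; suc; toℕ)
open import Data.Vec using (Vec; []; _∷_; lookup; zipWith; map; replicate; tabulate)
open import Data.Product using (∃; _×_; _,_; proj₁; proj₂)
open import Data.Sum using (_⊎_; inj₁; inj₂; [_,_]′)
open import Function using (_∘_; id; case_of_)
open import Relation.Nullary using (¬_; Dec; yes; no; does)
open import Relation.Nullary.Decidable using (⌊_⌋; map′; _×-dec_)
open import Relation.Binary.PropositionalEquality using (_≡_; _≢_; refl; sym; trans; cong; cong₂; subst; subst₂; module ≡-Reasoning)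

-- The statement knows an orbit only by its type and its cardinality, and neither a classification
-- of the orbits nor the order of `Co₀` is at hand. Hence no size is derived from a stabiliser:
-- every certificate is one-sided, explicit automorphisms giving lower bounds and exhaustive lists
-- giving upper bounds, and equality comes only from the total 4²⁴. For the same reason an arbitrary
-- vector of the prescribed type and orbit size still has to be placed in a constructed orbit; this
-- is the purpose of the Gram matrix argument. O₁₅ᵦ must stay out of the count because its vectors
-- lie in the classes of O₁₅d. All inner products of each representative with the 196560 minimal
-- vectors have to be evaluated. A vector is therefore a single natural number in base 2²⁰: an inner
-- product is then one digit of one product, and a matrix acts by 24 multiplications and one
-- reduction. The inner products modulo 4 are condensed into a single sum over the minimal vectors,
-- which already separates the orbits of equal type.

decided : ∀ {P : Set} (d : Dec P) → does d ≡ true → P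
decided (yes p) _ = p

-- Linear algebra over ℤ

infixl 6 _⊕_ _⊖_
infixr 7 _⊙_

_⊕_ _⊖_ : ∀ {n} → Vec ℤ n → Vec ℤ n → Vec ℤ n
_⊕_ = zipWith _+_
_⊖_ = zipWith _-_

_⊙_ : ∀ {n} → ℤ → Vec ℤ n → Vec ℤ n
k ⊙ x = map (k *_) x

𝟎 : ∀ {n} → Vec ℤ n
𝟎 = replicate _ (+ 0)

⟪_,_⟫ : ∀ {n} → Vec ℤ n → Vec ℤ n → ℤ
⟪ x , y ⟫ = sumℤ (zipWith _*_ x y)

⟪⟫-comm : ∀ {n} (x y : Vec ℤ n) → ⟪ x , y ⟫ ≡ ⟪ y , x ⟫
⟪⟫-comm [] [] = refl
⟪⟫-comm (a ∷ x) (b ∷ y) = cong₂ _+_ (ℤₚ.*-comm a b) (⟪⟫-comm x y)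

⟪⟫-⊕ʳ : ∀ {n} (x y z : Vec ℤ n) → ⟪ x , y ⊕ z ⟫ ≡ ⟪ x , y ⟫ + ⟪ x , z ⟫
⟪⟫-⊕ʳ [] [] [] = refl
⟪⟫-⊕ʳ (a ∷ x) (b ∷ y) (c ∷ z) rewrite ⟪⟫-⊕ʳ x y z = eq a b c ⟪ x , y ⟫ ⟪ x , z ⟫
  where
  eq : ∀ a b c p q → a * (b + c) + (p + q) ≡ (a * b + p) + (a * c + q)
  eq = solve-∀

⟪⟫-⊙ʳ : ∀ {n} (x : Vec ℤ n) k y → ⟪ x , k ⊙ y ⟫ ≡ k * ⟪ x , y ⟫
⟪⟫-⊙ʳ [] k [] = sym (ℤₚ.*-zeroʳ k)
⟪⟫-⊙ʳ (a ∷ x) k (b ∷ y) rewrite ⟪⟫-⊙ʳ x k y = eq a b k ⟪ x , y ⟫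
  where
  eq : ∀ a b k p → a * (k * b) + k * p ≡ k * (a * b + p)
  eq = solve-∀

⟪⟫-𝟎ʳ : ∀ {n} (x : Vec ℤ n) → ⟪ x , 𝟎 ⟫ ≡ + 0
⟪⟫-𝟎ʳ [] = refl
⟪⟫-𝟎ʳ (a ∷ x) rewrite ⟪⟫-𝟎ʳ x | ℤₚ.*-zeroʳ a = refl

⟪⟫-⊕ˡ : ∀ {n} (x y z : Vec ℤ n) → ⟪ x ⊕ y , z ⟫ ≡ ⟪ x , z ⟫ + ⟪ y , z ⟫
⟪⟫-⊕ˡ x y z = trans (⟪⟫-comm (x ⊕ y) z) (trans (⟪⟫-⊕ʳ z x y) (cong₂ _+_ (⟪⟫-comm z x) (⟪⟫-comm z y)))

⟪⟫-⊙ˡ : ∀ {n} k (x y : Vec ℤ n) → ⟪ k ⊙ x , y ⟫ ≡ k * ⟪ x , y ⟫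
⟪⟫-⊙ˡ k x y = trans (⟪⟫-comm (k ⊙ x) y) (trans (⟪⟫-⊙ʳ y k x) (cong (k *_) (⟪⟫-comm y x)))

⊖-as-⊕ : ∀ {n} (x y : Vec ℤ n) → x ⊖ y ≡ x ⊕ (ℤ.-1ℤ ⊙ y)
⊖-as-⊕ [] [] = refl
⊖-as-⊕ (a ∷ x) (b ∷ y) = cong₂ _∷_ (cong (_+_ a) (sym (ℤₚ.-1*i≡-i b))) (⊖-as-⊕ x y)

⟪⟫-⊖ʳ : ∀ {n} (x y z : Vec ℤ n) → ⟪ x , y ⊖ z ⟫ ≡ ⟪ x , y ⟫ - ⟪ x , z ⟫
⟪⟫-⊖ʳ x y z = trans (cong ⟪ x ,_⟫ (⊖-as-⊕ y z)) (trans (⟪⟫-⊕ʳ x y _)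
  (cong (_+_ ⟪ x , y ⟫) (trans (⟪⟫-⊙ʳ x ℤ.-1ℤ z) (ℤₚ.-1*i≡-i ⟪ x , z ⟫))))

norm-comb : ∀ {n} a b (x y : Vec ℤ n) →
  ⟪ a ⊙ x ⊕ b ⊙ y , a ⊙ x ⊕ b ⊙ y ⟫ ≡ a * a * ⟪ x , x ⟫ + + 2 * (a * b) * ⟪ x , y ⟫ + b * b * ⟪ y , y ⟫
norm-comb a b [] [] = eq a b
  where
  eq : ∀ a b → + 0 ≡ a * a * + 0 + + 2 * (a * b) * + 0 + b * b * + 0
  eq = solve-∀
norm-comb a b (x ∷ xs) (y ∷ ys) rewrite norm-comb a b xs ys = eq a b x y _ _ _
  where
  eq : ∀ a b x y p q r → (a * x + b * y) * (a * x + b * y) + (a * a * p + + 2 * (a * b) * q + b * b * r)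
     ≡ a * a * (x * x + p) + + 2 * (a * b) * (x * y + q) + b * b * (y * y + r)
  eq = solve-∀

square-nonneg : ∀ a → + 0 ℤ.≤ a * a
square-nonneg (+ n) = subst (+ 0 ℤ.≤_) (ℤₚ.pos-* n n) (+≤+ z≤n)
square-nonneg -[1+ n ] = +≤+ z≤n

norm-nonneg : ∀ {n} (x : Vec ℤ n) → + 0 ℤ.≤ ⟪ x , x ⟫
norm-nonneg [] = +≤+ z≤n
norm-nonneg (a ∷ x) = ℤₚ.+-mono-≤ (square-nonneg a) (norm-nonneg x)

norm-zero : ∀ {n} (x : Vec ℤ n) → ⟪ x , x ⟫ ℤ.≤ + 0 → x ≡ 𝟎
norm-zero [] _ = refl
norm-zero (a ∷ x) h = cong₂ _∷_ (root a a²≤0) (norm-zero x (ℤₚ.≤-trans (ℤₚ.≤-trans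
    (ℤₚ.≤-reflexive (sym (ℤₚ.+-identityˡ _))) (ℤₚ.+-monoˡ-≤ ⟪ x , x ⟫ (square-nonneg a))) h))
  where
  a²≤0 : a * a ℤ.≤ + 0
  a²≤0 = ℤₚ.≤-trans (ℤₚ.≤-trans (ℤₚ.≤-reflexive (sym (ℤₚ.+-identityʳ _))) (ℤₚ.+-monoʳ-≤ (a * a) (norm-nonneg x))) h
  root : ∀ a → a * a ℤ.≤ + 0 → a ≡ + 0
  root (+ zero) _ = refl
  root (+ suc n) (+≤+ ())
  root -[1+ n ] (+≤+ ())

-- The row vector `cs` times the matrix with rows `vs`. The product of two matrices `N` and `M` is
-- accordingly `map (λ u → comb u M) N`, and `comb-comb` is associativity.
comb : ∀ {m n} → Vec ℤ m → Vec (Vec ℤ n) m → Vec ℤ n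
comb [] [] = 𝟎
comb (c ∷ cs) (v ∷ vs) = c ⊙ v ⊕ comb cs vs

⟪⟫-comb : ∀ {m n} (x : Vec ℤ n) (cs : Vec ℤ m) vs → ⟪ x , comb cs vs ⟫ ≡ ⟪ cs , map ⟪ x ,_⟫ vs ⟫
⟪⟫-comb x [] [] = ⟪⟫-𝟎ʳ x
⟪⟫-comb x (c ∷ cs) (v ∷ vs) = trans (⟪⟫-⊕ʳ x (c ⊙ v) (comb cs vs)) (cong₂ _+_ (⟪⟫-⊙ʳ x c v) (⟪⟫-comb x cs vs))

⊕-identityˡ : ∀ {n} (x : Vec ℤ n) → 𝟎 ⊕ x ≡ x
⊕-identityˡ [] = refl
⊕-identityˡ (a ∷ x) = cong₂ _∷_ (ℤₚ.+-identityˡ a) (⊕-identityˡ x)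

⊕-identityʳ : ∀ {n} (x : Vec ℤ n) → x ⊕ 𝟎 ≡ x
⊕-identityʳ [] = refl
⊕-identityʳ (a ∷ x) = cong₂ _∷_ (ℤₚ.+-identityʳ a) (⊕-identityʳ x)

⊕-interchange : ∀ {n} (x y z w : Vec ℤ n) → (x ⊕ y) ⊕ (z ⊕ w) ≡ (x ⊕ z) ⊕ (y ⊕ w)
⊕-interchange [] [] [] [] = refl
⊕-interchange (a ∷ x) (b ∷ y) (c ∷ z) (d ∷ w) = cong₂ _∷_ (eq a b c d) (⊕-interchange x y z w)
  where
  eq : ∀ a b c d → (a + b) + (c + d) ≡ (a + c) + (b + d)
  eq = solve-∀

⊙-⊕ : ∀ {n} k (x y : Vec ℤ n) → k ⊙ (x ⊕ y) ≡ k ⊙ x ⊕ k ⊙ y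
⊙-⊕ k [] [] = refl
⊙-⊕ k (a ∷ x) (b ∷ y) = cong₂ _∷_ (ℤₚ.*-distribˡ-+ k a b) (⊙-⊕ k x y)

⊙-⊖ : ∀ {n} k (x y : Vec ℤ n) → k ⊙ (x ⊖ y) ≡ k ⊙ x ⊖ k ⊙ y
⊙-⊖ k [] [] = refl
⊙-⊖ k (a ∷ x) (b ∷ y) = cong₂ _∷_ (eq k a b) (⊙-⊖ k x y)
  where
  eq : ∀ k a b → k * (a - b) ≡ k * a - k * b
  eq = solve-∀

+-⊙ : ∀ {n} k l (x : Vec ℤ n) → (k + l) ⊙ x ≡ k ⊙ x ⊕ l ⊙ x
+-⊙ k l [] = refl
+-⊙ k l (a ∷ x) = cong₂ _∷_ (ℤₚ.*-distribʳ-+ a k l) (+-⊙ k l x)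

*-⊙ : ∀ {n} k l (x : Vec ℤ n) → (k * l) ⊙ x ≡ k ⊙ l ⊙ x
*-⊙ k l [] = refl
*-⊙ k l (a ∷ x) = cong₂ _∷_ (ℤₚ.*-assoc k l a) (*-⊙ k l x)

⊙-𝟎 : ∀ {n} k → k ⊙ 𝟎 {n} ≡ 𝟎
⊙-𝟎 {zero} k = refl
⊙-𝟎 {suc n} k = cong₂ _∷_ (ℤₚ.*-zeroʳ k) (⊙-𝟎 k)

0-⊙ : ∀ {n} (x : Vec ℤ n) → + 0 ⊙ x ≡ 𝟎
0-⊙ [] = refl
0-⊙ (a ∷ x) = cong₂ _∷_ refl (0-⊙ x)

1-⊙ : ∀ {n} (x : Vec ℤ n) → + 1 ⊙ x ≡ x
1-⊙ [] = refl
1-⊙ (a ∷ x) = cong₂ _∷_ (ℤₚ.*-identityˡ a) (1-⊙ x)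

⊙-cancel : ∀ {n} k .{{_ : ℤ.NonZero k}} {x y : Vec ℤ n} → k ⊙ x ≡ k ⊙ y → x ≡ y
⊙-cancel k {[]} {[]} _ = refl
⊙-cancel k {a ∷ x} {b ∷ y} e = cong₂ _∷_ (ℤₚ.*-cancelˡ-≡ k a b (cong Data.Vec.head e)) (⊙-cancel k (cong Data.Vec.tail e))

⊖-self : ∀ {n} (x : Vec ℤ n) → x ⊖ x ≡ 𝟎
⊖-self [] = refl
⊖-self (a ∷ x) = cong₂ _∷_ (ℤₚ.+-inverseʳ a) (⊖-self x)

⊖⇒≡⊕ : ∀ {n} {x y z : Vec ℤ n} → x ⊖ y ≡ z → x ≡ y ⊕ z
⊖⇒≡⊕ {x = []} {[]} {[]} _ = refl
⊖⇒≡⊕ {x = a ∷ x} {b ∷ y} {c ∷ z} refl = cong₂ _∷_ (eq a b) (⊖⇒≡⊕ refl)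
  where
  eq : ∀ a b → a ≡ b + (a - b)
  eq = solve-∀

⊕-⊖ : ∀ {n} (x y : Vec ℤ n) → (x ⊕ y) ⊖ x ≡ y
⊕-⊖ [] [] = refl
⊕-⊖ (a ∷ x) (b ∷ y) = cong₂ _∷_ (eq a b) (⊕-⊖ x y)
  where
  eq : ∀ a b → (a + b) - a ≡ b
  eq = solve-∀

comb-⊕ : ∀ {m n} (cs ds : Vec ℤ m) (vs : Vec (Vec ℤ n) m) → comb (cs ⊕ ds) vs ≡ comb cs vs ⊕ comb ds vs
comb-⊕ [] [] [] = sym (⊕-identityˡ 𝟎)
comb-⊕ (c ∷ cs) (d ∷ ds) (v ∷ vs) =
  trans (cong₂ _⊕_ (+-⊙ c d v) (comb-⊕ cs ds vs)) (⊕-interchange (c ⊙ v) (d ⊙ v) (comb cs vs) (comb ds vs))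

comb-⊙ : ∀ {m n} k (cs : Vec ℤ m) (vs : Vec (Vec ℤ n) m) → comb (k ⊙ cs) vs ≡ k ⊙ comb cs vs
comb-⊙ k [] [] = sym (⊙-𝟎 k)
comb-⊙ k (c ∷ cs) (v ∷ vs) =
  trans (cong₂ _⊕_ (*-⊙ k c v) (comb-⊙ k cs vs)) (sym (⊙-⊕ k (c ⊙ v) (comb cs vs)))

comb-𝟎 : ∀ {m n} (vs : Vec (Vec ℤ n) m) → comb 𝟎 vs ≡ 𝟎
comb-𝟎 [] = refl
comb-𝟎 (v ∷ vs) = trans (cong₂ _⊕_ (0-⊙ v) (comb-𝟎 vs)) (⊕-identityˡ 𝟎)

comb-comb : ∀ {l m n} (cs : Vec ℤ l) (us : Vec (Vec ℤ m) l) (vs : Vec (Vec ℤ n) m) →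
  comb (comb cs us) vs ≡ comb cs (map (λ u → comb u vs) us)
comb-comb [] [] vs = comb-𝟎 vs
comb-comb (c ∷ cs) (u ∷ us) vs =
  trans (comb-⊕ (c ⊙ u) (comb cs us) vs) (cong₂ _⊕_ (comb-⊙ c u vs) (comb-comb cs us vs))

scalar : ∀ n → ℤ → Vec (Vec ℤ n) n
scalar zero k = []
scalar (suc n) k = (k ∷ 𝟎) ∷ map (+ 0 ∷_) (scalar n k)

comb-pad : ∀ {m n} (cs : Vec ℤ m) (vs : Vec (Vec ℤ n) m) → comb cs (map (+ 0 ∷_) vs) ≡ + 0 ∷ comb cs vs
comb-pad [] [] = refl
comb-pad (c ∷ cs) (v ∷ vs) rewrite comb-pad cs vs | ℤₚ.*-zeroʳ c = refl

comb-scalar : ∀ {n} k (x : Vec ℤ n) → comb x (scalar n k) ≡ k ⊙ x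
comb-scalar k [] = refl
comb-scalar {suc n} k (a ∷ x) = trans (cong ((a ⊙ (k ∷ 𝟎)) ⊕_) (comb-pad x (scalar n k)))
  (cong₂ _∷_ (trans (ℤₚ.+-identityʳ (a * k)) (ℤₚ.*-comm a k))
    (trans (cong₂ _⊕_ (⊙-𝟎 a) (comb-scalar k x)) (⊕-identityˡ _)))

transpose : ∀ {m n} → Vec (Vec ℤ n) m → Vec (Vec ℤ m) n
transpose [] = replicate _ []
transpose (v ∷ vs) = zipWith _∷_ v (transpose vs)

map-⟪⟫-transpose : ∀ {m n} (x : Vec ℤ m) (vs : Vec (Vec ℤ n) m) → map ⟪ x ,_⟫ (transpose vs) ≡ comb x vs
map-⟪⟫-transpose {n = n} [] [] = nil n
  where
  nil : ∀ n → map ⟪ [] ,_⟫ (replicate n []) ≡ 𝟎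
  nil zero = refl
  nil (suc n) = cong (+ 0 ∷_) (nil n)
map-⟪⟫-transpose (a ∷ x) (v ∷ vs) = trans (row v (transpose vs)) (cong ((a ⊙ v) ⊕_) (map-⟪⟫-transpose x vs))
  where
  row : ∀ {n} (v : Vec ℤ n) ws → map ⟪ a ∷ x ,_⟫ (zipWith _∷_ v ws) ≡ a ⊙ v ⊕ map ⟪ x ,_⟫ ws
  row [] [] = refl
  row (b ∷ v) (w ∷ ws) = cong (_ ∷_) (row v ws)

import Data.Nat.Divisibility as ℕ∣
open import Data.Integer.DivMod using (_%ℕ_; _/ℕ_; a≡a%ℕn+[a/ℕn]*n; n%ℕd<d)
open import Data.Integer.Divisibility.Signed using (∣⇒∣ᵤ; ∣m∣n⇒∣m+n; ∣n⇒∣m*n)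
open import Data.List as List using (List; []; _∷_)
open import Data.List.Relation.Unary.All as All using (All; []; _∷_)
open import Data.Vec.Properties using (map-id; map-cong)

-- Membership in Λ as divisibility of inner products

bit : Bool → ℕ
bit true = 1
bit false = 0

bitℤ : Bool → ℤ
bitℤ b = + bit b

bits : ∀ {n} → Vec Bool n → Vec ℤ n
bits = map bitℤ

-- The difference of two residues is smaller than `d` in absolute value, and zero is the only
-- multiple of `d` that small.
residue-unique : ∀ d .{{_ : ℕ.NonZero d}} {a b} → a ℕ.< d → b ℕ.< d → ∀ q → + a ≡ + b + q * + d → a ≡ b
residue-unique d {a} {b} a<d b<d q eq = case ℤ.∣ + a - + b ∣ ℕ.≟ 0 of λ where
    (yes z) → ℤₚ.+-injective (ℤₚ.i-j≡0⇒i≡j (+ a) (+ b) (ℤₚ.∣i∣≡0⇒i≡0 z))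
    (no nz) → ⊥-elim (ℕ∣.>⇒∤ {{ℕ.≢-nonZero nz}} small (∣⇒∣ᵤ (divides q (trans (cong (_- + b) eq) (cancel (+ b) (q * + d))))))
  where
  cancel : ∀ x y → (x + y) - x ≡ y
  cancel = solve-∀
  small : ℤ.∣ + a - + b ∣ ℕ.< d
  small = ℕₚ.≤-<-trans (subst (λ z → ℤ.∣ z ∣ ℕ.≤ a ℕ.⊔ b) (sym (ℤₚ.m-n≡m⊖n a b)) (ℤₚ.∣m⊝n∣≤m⊔n a b)) (ℕₚ.⊔-lub a<d b<d)

%ℕ-unique : ∀ d .{{_ : ℕ.NonZero d}} {z a} → a ℕ.< d → ∀ q → z ≡ + a + q * + d → z %ℕ d ≡ a
%ℕ-unique d {z} {a} a<d q eq = residue-unique d (n%ℕd<d z d) a<d (q - z /ℕ d)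
  (shift (+ (z %ℕ d)) (z /ℕ d) (trans (sym (a≡a%ℕn+[a/ℕn]*n z d)) eq))
  where
  solve : ∀ x p d a q → x + p * d ≡ a + q * d → x ≡ (a + q * d) - p * d
  solve x p d a q e = trans (eq′ x (p * d)) (cong (_- p * d) e)
    where
    eq′ : ∀ x y → x ≡ (x + y) - y
    eq′ = solve-∀
  shift : ∀ x p → x + p * + d ≡ + a + q * + d → x ≡ + a + (q - p) * + d
  shift x p e = trans (solve x p (+ d) (+ a) q e) (regroup (+ a) q p (+ d))
    where
    regroup : ∀ a q p d → (a + q * d) - p * d ≡ a + (q - p) * d
    regroup = solve-∀

data Shaped (β : Bool) : ∀ {n} → Vec ℤ n → Vec Bool n → Set where
  []  : Shaped β [] []
  _∷_ : ∀ {n z b} {x : Vec ℤ n} {h} → (∃ λ q → z ≡ bitℤ β + + 2 * bitℤ b + + 4 * q) → Shaped β x h → Shaped β (z ∷ x) (b ∷ h)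

parity-bits : ∀ {n} (h r : Vec Bool n) → ∃ λ k → ⟪ bits h , bits r ⟫ ≡ bitℤ (parity (zipWith _∧_ h r)) + + 2 * k
parity-bits [] [] = + 0 , refl
parity-bits (b ∷ h) (c ∷ r) with parity-bits h r
... | k , e rewrite e = go b c (parity (zipWith _∧_ h r))
  where
  bump : ∀ k → + 1 + (+ 1 + + 2 * k) ≡ + 0 + + 2 * (+ 1 + k)
  bump = solve-∀
  skip : ∀ p k → + 0 + (p + + 2 * k) ≡ p + + 2 * k
  skip = solve-∀
  next : ∀ k → + 1 + (+ 0 + + 2 * k) ≡ + 1 + + 2 * k
  next = solve-∀
  go : ∀ b c p → ∃ λ j → bitℤ b * bitℤ c + (bitℤ p + + 2 * k) ≡ bitℤ ((b ∧ c) xor p) + + 2 * j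
  go false c p = k , trans (cong (_+ (bitℤ p + + 2 * k)) (ℤₚ.*-zeroˡ (bitℤ c))) (skip (bitℤ p) k)
  go true false p = k , skip (bitℤ p) k
  go true true false = k , next k
  go true true true = + 1 + k , bump k

even-bit : ∀ b k → bitℤ b ≡ + 2 * k → b ≡ false
even-bit false k _ = refl
even-bit true k e = case residue-unique 2 {1} {0} (s≤s (s≤s z≤n)) (s≤s z≤n) k (trans e (eq k)) of λ ()
  where
  eq : ∀ k → + 2 * k ≡ + 0 + k * + 2
  eq = solve-∀

shaped-row : ∀ {β n} {x : Vec ℤ n} {h} → Shaped β x h → ∀ r →
  ∃ λ k → ⟪ x , bits r ⟫ ≡ bitℤ β * sumℤ (bits r) + + 2 * ⟪ bits h , bits r ⟫ + + 4 * k
shaped-row {β} [] [] = + 0 , eq (bitℤ β)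
  where
  eq : ∀ b → + 0 ≡ b * + 0 + + 2 * + 0 + + 4 * + 0
  eq = solve-∀
shaped-row {β} (_∷_ {b = b} (q , refl) s) (c ∷ r) with shaped-row s r
... | k , e rewrite e = q * bitℤ c + k , eq (bitℤ β) (bitℤ b) q (bitℤ c) _ _ k
  where
  eq : ∀ β b q c S H k → (β + + 2 * b + + 4 * q) * c + (β * S + + 2 * H + + 4 * k)
     ≡ β * (c + S) + + 2 * (b * c + H) + + 4 * (q * c + k)
  eq = solve-∀

unit : ∀ {n} → Fin n → Vec ℤ n
unit zero = + 1 ∷ 𝟎
unit (suc i) = + 0 ∷ unit i

⟪⟫-unit : ∀ {n} (x : Vec ℤ n) i → ⟪ x , unit i ⟫ ≡ lookup x i
⟪⟫-unit (a ∷ x) zero rewrite ⟪⟫-𝟎ʳ x = trans (ℤₚ.+-identityʳ (a * + 1)) (ℤₚ.*-identityʳ a)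
⟪⟫-unit (a ∷ x) (suc i) rewrite ⟪⟫-unit x i | ℤₚ.*-zeroʳ a = ℤₚ.+-identityˡ _

-- Doubly even words, of weight divisible by 4. For them the parity term of `shaped-row` vanishes
-- modulo 4, so that only twice the overlap with `h` remains.
Even : Vec Bool 24 → Set
Even r = ∃ λ k → sumℤ (bits r) ≡ + 4 * k

edge : Fin 24 → Vec24
edge i = + 4 ⊙ (unit zero ⊖ unit i)

glue : Vec24
glue = -[1+ 2 ] ∷ replicate 23 (+ 1)

doubled : Vec Bool 24 → Vec24
doubled r = + 2 ⊙ bits r

-- Λ is unimodular for the form divided by 8, so that membership is integrality of the pairings with
-- generators. The three conditions on Λ reappear one by one: the edges give the common parity,
-- `glue` the coordinate sum modulo 8, and the doubled rows the orthogonality to the self-dual code.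
record Dual (x : Vec24) : Set where
  constructor dual
  field
    on-edges : ∀ i → + 8 ∣ ⟪ x , edge i ⟫
    on-glue  : + 8 ∣ ⟪ x , glue ⟫
    on-rows  : All (λ r → + 8 ∣ ⟪ x , doubled r ⟫) golayRows

⟪⟫-edge : ∀ x i → ⟪ x , edge i ⟫ ≡ + 4 * (lookup x zero - lookup x i)
⟪⟫-edge x i = trans (⟪⟫-⊙ʳ x (+ 4) (unit zero ⊖ unit i)) (cong (+ 4 *_)
  (trans (⟪⟫-⊖ʳ x (unit zero) (unit i)) (cong₂ _-_ (⟪⟫-unit x zero) (⟪⟫-unit x i))))

⟪⟫-ones : ∀ {n} (x : Vec ℤ n) → ⟪ x , replicate n (+ 1) ⟫ ≡ sumℤ x
⟪⟫-ones [] = refl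
⟪⟫-ones (a ∷ x) = cong₂ _+_ (ℤₚ.*-identityʳ a) (⟪⟫-ones x)

⟪⟫-glue : ∀ x → ⟪ x , glue ⟫ ≡ sumℤ x - + 4 * lookup x zero
⟪⟫-glue (a ∷ x) = trans (cong (_+_ (a * -[1+ 2 ])) (⟪⟫-ones x)) (eq a (sumℤ x))
  where
  eq : ∀ a s → a * -[1+ 2 ] + s ≡ (a + s) - + 4 * a
  eq = solve-∀

rows-even : All Even golayRows
rows-even = All.map (λ {r} e → sumℤ (bits r) /ℕ 4 , trans (a≡a%ℕn+[a/ℕn]*n (sumℤ (bits r)) 4)
    (trans (cong (λ z → + z + (sumℤ (bits r) /ℕ 4) * + 4) e) (eq _))) mod4
  where
  mod4 : All (λ r → sumℤ (bits r) %ℕ 4 ≡ 0) golayRows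
  mod4 = refl ∷ refl ∷ refl ∷ refl ∷ refl ∷ refl ∷ refl ∷ refl ∷ refl ∷ refl ∷ refl ∷ refl ∷ []
  eq : ∀ k → + 0 + k * + 4 ≡ + 4 * k
  eq = solve-∀

-- An element of Λ is congruent modulo 4 to β + 2h, with β its parity and h a codeword.
residue : ∀ β z → z %ℕ 2 ≡ bit β → ∃ λ q → z ≡ bitℤ β + + 2 * bitℤ ⌊ z %ℕ 4 ℕ.≟ 2 ℕ.+ bit β ⌋ + + 4 * q
residue β z e = go β (z %ℕ 4) (n%ℕd<d z 4) {z /ℕ 4} {z /ℕ 2} (a≡a%ℕn+[a/ℕn]*n z 4)
    (trans (a≡a%ℕn+[a/ℕn]*n z 2) (cong (λ b → + b + (z /ℕ 2) * + 2) e))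
  where
  m0 : ∀ p → + 0 + p * + 4 ≡ + 0 + + 0 + + 4 * p
  m0 = solve-∀
  m1 : ∀ p → + 1 + p * + 4 ≡ + 1 + + 0 + + 4 * p
  m1 = solve-∀
  m2 : ∀ p → + 2 + p * + 4 ≡ + 0 + + 2 + + 4 * p
  m2 = solve-∀
  m3 : ∀ p → + 3 + p * + 4 ≡ + 1 + + 2 + + 4 * p
  m3 = solve-∀
  clash : ∀ {β ρ p q} β′ j → bit β′ ≢ bit β → + ρ ≡ bitℤ β′ + j * + 2 → z ≡ + ρ + p * + 4 → z ≡ bitℤ β + q * + 2 → ⊥
  clash {β} {ρ} {p} {q} β′ j ne eρ e₁ e₂ = ne (residue-unique 2 (lt β′) (lt β) (q - j - + 2 * p)
      (trans (c₁ (bitℤ β′) j p) (trans (cong (λ t → t + p * + 4 - j * + 2 - + 2 * p * + 2) (sym eρ))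
        (trans (cong (λ t → t - j * + 2 - + 2 * p * + 2) (trans (sym e₁) e₂)) (c₂ (bitℤ β) q j p)))))
    where
    lt : ∀ b → bit b ℕ.< 2
    lt true = s≤s (s≤s z≤n)
    lt false = s≤s z≤n
    c₁ : ∀ b j p → b ≡ b + j * + 2 + p * + 4 - j * + 2 - + 2 * p * + 2
    c₁ = solve-∀
    c₂ : ∀ b q j p → b + q * + 2 - j * + 2 - + 2 * p * + 2 ≡ b + (q - j - + 2 * p) * + 2
    c₂ = solve-∀
  go : ∀ β ρ → ρ ℕ.< 4 → ∀ {p q} → z ≡ + ρ + p * + 4 → z ≡ bitℤ β + q * + 2 →
    ∃ λ q → z ≡ bitℤ β + + 2 * bitℤ ⌊ ρ ℕ.≟ 2 ℕ.+ bit β ⌋ + + 4 * q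
  go false 0 _ {p} e₁ _ = p , trans e₁ (m0 p)
  go false 1 _ {p} {q} e₁ e₂ = ⊥-elim (clash {false} {1} {p} {q} true (+ 0) (λ ()) refl e₁ e₂)
  go false 2 _ {p} e₁ _ = p , trans e₁ (m2 p)
  go false 3 _ {p} {q} e₁ e₂ = ⊥-elim (clash {false} {3} {p} {q} true (+ 1) (λ ()) refl e₁ e₂)
  go true 0 _ {p} {q} e₁ e₂ = ⊥-elim (clash {true} {0} {p} {q} false (+ 0) (λ ()) refl e₁ e₂)
  go true 1 _ {p} e₁ _ = p , trans e₁ (m1 p)
  go true 2 _ {p} {q} e₁ e₂ = ⊥-elim (clash {true} {2} {p} {q} false (+ 1) (λ ()) refl e₁ e₂)
  go true 3 _ {p} e₁ _ = p , trans e₁ (m3 p)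
  go _ (suc (suc (suc (suc _)))) (s≤s (s≤s (s≤s (s≤s ()))))

halves : Bool → ∀ {n} → Vec ℤ n → Vec Bool n
halves β = map (λ z → ⌊ z %ℕ 4 ℕ.≟ 2 ℕ.+ bit β ⌋)

shaped : ∀ β {n} (x : Vec ℤ n) → (∀ i → lookup x i %ℕ 2 ≡ bit β) → Shaped β x (halves β x)
shaped β [] _ = []
shaped β (z ∷ x) f = residue β z (f zero) ∷ shaped β x (f ∘ suc)

parity-bit : ∀ z → ∃ λ β → z %ℕ 2 ≡ bit β
parity-bit z = go (z %ℕ 2) (n%ℕd<d z 2)
  where
  go : ∀ ρ → ρ ℕ.< 2 → ∃ λ β → ρ ≡ bit β
  go 0 _ = false , refl
  go 1 _ = true , refl
  go (suc (suc _)) (s≤s (s≤s ()))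

record Coset (x : Vec24) : Set where
  constructor coset
  field
    β      : Bool
    h      : Vec Bool 24
    shape  : Shaped β x h
    golay  : IsGolay h
    total  : ∃ λ k → sumℤ x ≡ + 4 * bitℤ β + + 8 * k

InΛ⇒Coset : ∀ {x} → InΛ x → Coset x
InΛ⇒Coset {x} (par , tot , cls) = build (parity-bit (lookup x zero))
  where
  cl : ∀ β → IsGolay (halves β x)
  cl true = cls (suc (suc (suc zero)))
  cl false = cls (suc (suc zero))
  eq : ∀ β k → + (4 ℕ.* bit β) + k * + 8 ≡ + 4 * bitℤ β + + 8 * k
  eq β k = cong₂ _+_ (ℤₚ.pos-* 4 (bit β)) (ℤₚ.*-comm k (+ 8))
  build : (∃ λ β → lookup x zero %ℕ 2 ≡ bit β) → Coset x
  build (β , e) = coset β (halves β x) (shaped β x (λ i → trans (par i) e)) (cl β)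
    (sumℤ x /ℕ 8 , trans (a≡a%ℕn+[a/ℕn]*n (sumℤ x) 8)
      (trans (cong (λ z → + z + (sumℤ x /ℕ 8) * + 8) (trans tot (cong (4 ℕ.*_) e))) (eq β (sumℤ x /ℕ 8))))

entry-residue : ∀ β b {z} → (∃ λ q → z ≡ bitℤ β + + 2 * bitℤ b + + 4 * q) → z %ℕ 4 ≡ bit β ℕ.+ 2 ℕ.* bit b
entry-residue β b (q , e) = %ℕ-unique 4 (lt β b) q (trans e (eq β b))
  where
  lt : ∀ β b → bit β ℕ.+ 2 ℕ.* bit b ℕ.< 4
  lt true true = ℕₚ.≤-refl
  lt true false = s≤s (s≤s z≤n)
  lt false true = s≤s (s≤s (s≤s z≤n))
  lt false false = s≤s z≤n
  eq : ∀ β b → bitℤ β + + 2 * bitℤ b + + 4 * q ≡ + (bit β ℕ.+ 2 ℕ.* bit b) + q * + 4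
  eq β b = cong₂ _+_ (trans (cong (_+_ (bitℤ β)) (sym (ℤₚ.pos-* 2 (bit b)))) (sym (ℤₚ.pos-+ (bit β) (2 ℕ.* bit b)))) (ℤₚ.*-comm (+ 4) q)

shaped-mod4 : ∀ {β n} {x : Vec ℤ n} {h} (a : Fin 4) → Shaped β x h →
  map (λ z → ⌊ z %ℕ 4 ℕ.≟ toℕ a ⌋) x ≡ map (λ b → ⌊ bit β ℕ.+ 2 ℕ.* bit b ℕ.≟ toℕ a ⌋) h
shaped-mod4 a [] = refl
shaped-mod4 {β} a (_∷_ {b = b} e s) = cong₂ _∷_ (cong (λ n → ⌊ n ℕ.≟ toℕ a ⌋) (entry-residue β b e)) (shaped-mod4 a s)

shaped-mod2 : ∀ {β n} {x : Vec ℤ n} {h} → Shaped β x h → ∀ i → lookup x i %ℕ 2 ≡ bit β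
shaped-mod2 {β} (_∷_ {b = b} (q , e) s) zero = %ℕ-unique 2 (lt β) (bitℤ b + + 2 * q) (trans e (eq (bitℤ β) (bitℤ b) q))
  where
  lt : ∀ b → bit b ℕ.< 2
  lt true = s≤s (s≤s z≤n)
  lt false = s≤s z≤n
  eq : ∀ β b q → β + + 2 * b + + 4 * q ≡ β + (b + + 2 * q) * + 2
  eq = solve-∀
shaped-mod2 (_ ∷ s) (suc i) = shaped-mod2 s i

orthogonal-const : ∀ {n} (h r : Vec Bool n) → parity (zipWith _∧_ (map (λ _ → false) h) r) ≡ false
orthogonal-const [] [] = refl
orthogonal-const (b ∷ h) (c ∷ r) = orthogonal-const h r

parity-not : ∀ {n} (h r : Vec Bool n) → parity (zipWith _∧_ (map not h) r) ≡ parity r xor parity (zipWith _∧_ h r)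
parity-not [] [] = refl
parity-not (b ∷ h) (c ∷ r) rewrite parity-not h r = go b c (parity r) (parity (zipWith _∧_ h r))
  where
  go : ∀ b c p q → (not b ∧ c) xor (p xor q) ≡ (c xor p) xor ((b ∧ c) xor q)
  go true true true true = refl
  go true true true false = refl
  go true true false true = refl
  go true true false false = refl
  go true false p q = refl
  go false true true true = refl
  go false true true false = refl
  go false true false q = refl
  go false false p q = refl

rows-parity : All (λ r → parity r ≡ false) golayRows
rows-parity = refl ∷ refl ∷ refl ∷ refl ∷ refl ∷ refl ∷ refl ∷ refl ∷ refl ∷ refl ∷ refl ∷ refl ∷ []

-- The generator rows have even weight, so the all-ones word is orthogonal to them, and
-- complementing a word changes none of the parities.
golay-not : ∀ {h} → IsGolay h → IsGolay (map not h)
golay-not {h} = go rows-parity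
  where
  go : ∀ {rs} → All (λ r → parity r ≡ false) rs → AllRows h rs → AllRows (map not h) rs
  go [] [] = []
  go {r ∷ rs} (e ∷ es) (o ∷ os) = trans (parity-not h r) (cong₂ _xor_ e o) ∷ go es os

golay-false : ∀ (h : Vec Bool 24) → IsGolay (map (λ _ → false) h)
golay-false h = go golayRows
  where
  go : ∀ rs → AllRows (map (λ _ → false) h) rs
  go [] = []
  go (r ∷ rs) = orthogonal-const h r ∷ go rs

-- Of the four residues modulo 4, the two of parity `β` give the word `h` and its complement, and
-- the two of the other parity give the empty word.
Coset⇒InΛ : ∀ {x} → Coset x → InΛ x
Coset⇒InΛ {x} (coset β h sh go (k , tot)) =
    (λ i → trans (shaped-mod2 sh i) (sym (shaped-mod2 sh zero)))
  , trans (%ℕ-unique 8 (lt β) k (trans tot (eq β))) (cong (4 ℕ.*_) (sym (shaped-mod2 sh zero)))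
  , λ a → subst IsGolay (sym (shaped-mod4 a sh)) (cls β a)
  where
  lt : ∀ β → 4 ℕ.* bit β ℕ.< 8
  lt true = s≤s (s≤s (s≤s (s≤s (s≤s z≤n))))
  lt false = s≤s z≤n
  eq : ∀ β → + 4 * bitℤ β + + 8 * k ≡ + (4 ℕ.* bit β) + k * + 8
  eq β = cong₂ _+_ (sym (ℤₚ.pos-* 4 (bit β))) (ℤₚ.*-comm (+ 8) k)
  via : ∀ {f g : Bool → Bool} → (∀ b → g b ≡ f b) → IsGolay (map g h) → IsGolay (map f h)
  via p = subst IsGolay (map-cong p h)
  cls : ∀ β a → IsGolay (map (λ b → ⌊ bit β ℕ.+ 2 ℕ.* bit b ℕ.≟ toℕ a ⌋) h)
  cls false zero = via (λ { true → refl ; false → refl }) (golay-not go)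
  cls false (suc zero) = via (λ { true → refl ; false → refl }) (golay-false h)
  cls false (suc (suc zero)) = via {g = id} (λ { true → refl ; false → refl }) (subst IsGolay (sym (map-id h)) go)
  cls false (suc (suc (suc zero))) = via (λ { true → refl ; false → refl }) (golay-false h)
  cls true zero = via (λ { true → refl ; false → refl }) (golay-false h)
  cls true (suc zero) = via (λ { true → refl ; false → refl }) (golay-not go)
  cls true (suc (suc zero)) = via (λ { true → refl ; false → refl }) (golay-false h)
  cls true (suc (suc (suc zero))) = via {g = id} (λ { true → refl ; false → refl }) (subst IsGolay (sym (map-id h)) go)

shaped-lookup : ∀ {β n} {x : Vec ℤ n} {h} → Shaped β x h → ∀ i → ∃ λ k → lookup x i ≡ bitℤ β + + 2 * k
shaped-lookup {β} (_∷_ {b = b} (q , refl) s) zero = bitℤ b + + 2 * q , eq (bitℤ β) (bitℤ b) q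
  where
  eq : ∀ β b q → β + + 2 * b + + 4 * q ≡ β + + 2 * (b + + 2 * q)
  eq = solve-∀
shaped-lookup (_ ∷ s) (suc i) = shaped-lookup s i

edge-divides : ∀ b {a c} → (∃ λ k → a ≡ b + + 2 * k) → (∃ λ k → c ≡ b + + 2 * k) → + 8 ∣ + 4 * (a - c)
edge-divides b (k , refl) (l , refl) = divides (k - l) (eq b k l)
  where
  eq : ∀ b k l → + 4 * ((b + + 2 * k) - (b + + 2 * l)) ≡ (k - l) * + 8
  eq = solve-∀

glue-divides : ∀ b {s a} → (∃ λ k → s ≡ + 4 * b + + 8 * k) → (∃ λ k → a ≡ b + + 2 * k) → + 8 ∣ s - + 4 * a
glue-divides b (k , refl) (l , refl) = divides (k - l) (eq b k l)
  where
  eq : ∀ b k l → (+ 4 * b + + 8 * k) - + 4 * (b + + 2 * l) ≡ (k - l) * + 8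
  eq = solve-∀

row-divides : ∀ β {x h} → Shaped β x h → ∀ r → Even r → orthogonal h r → + 8 ∣ ⟪ x , doubled r ⟫
row-divides β {x} {h} sh r (j , ev) o = go (parity-bits h r) (shaped-row sh r)
  where
  eq : ∀ b j l i → + 2 * (b * (+ 4 * j) + + 2 * (+ 0 + + 2 * l) + + 4 * i) ≡ (b * j + l + i) * + 8
  eq = solve-∀
  go : (∃ λ l → ⟪ bits h , bits r ⟫ ≡ bitℤ (parity (zipWith _∧_ h r)) + + 2 * l) →
       (∃ λ i → ⟪ x , bits r ⟫ ≡ bitℤ β * sumℤ (bits r) + + 2 * ⟪ bits h , bits r ⟫ + + 4 * i) → + 8 ∣ ⟪ x , doubled r ⟫
  go (l , e₁) (i , e₂) = divides (bitℤ β * j + l + i) (trans (⟪⟫-⊙ʳ x (+ 2) (bits r)) (trans (cong (+ 2 *_)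
      (trans e₂ (cong₂ (λ a b → bitℤ β * a + + 2 * b + + 4 * i) ev (trans e₁ (cong (λ b → bitℤ b + + 2 * l) o)))))
      (eq (bitℤ β) j l i)))

Coset⇒Dual : ∀ {x} → Coset x → Dual x
Coset⇒Dual {x} (coset β h sh go tot) = dual
  (λ i → subst (+ 8 ∣_) (sym (⟪⟫-edge x i)) (edge-divides (bitℤ β) (shaped-lookup sh zero) (shaped-lookup sh i)))
  (subst (+ 8 ∣_) (sym (⟪⟫-glue x)) (glue-divides (bitℤ β) tot (shaped-lookup sh zero)))
  (rows rows-even go)
  where
  rows : ∀ {rs} → All Even rs → AllRows h rs → All (λ r → + 8 ∣ ⟪ x , doubled r ⟫) rs
  rows [] [] = []
  rows {r ∷ _} (ev ∷ evs) (o ∷ os) = row-divides β sh r ev o ∷ rows evs os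

*-cancel-∣ : ∀ k d .{{_ : ℤ.NonZero k}} {z} → k * d ∣ k * z → d ∣ z
*-cancel-∣ k d {z} (divides q e) = divides q (ℤₚ.*-cancelˡ-≡ k z (q * d) (trans e (eq q k d)))
  where
  eq : ∀ q k d → q * (k * d) ≡ k * (q * d)
  eq = solve-∀

row-orthogonal : ∀ {β x h} → Shaped β x h → ∀ r → Even r → + 8 ∣ ⟪ x , doubled r ⟫ → orthogonal h r
row-orthogonal {β} {x} {h} sh r (j , ev) d = go (parity-bits h r) (shaped-row sh r) (*-cancel-∣ (+ 2) (+ 4) (subst (+ 8 ∣_) (⟪⟫-⊙ʳ x (+ 2) (bits r)) d))
  where
  π : ℤ
  π = bitℤ (parity (zipWith _∧_ h r))
  c₁ : ∀ b j p l i → + 2 * p ≡ (b * (+ 4 * j) + + 2 * (p + + 2 * l) + + 4 * i) - + 4 * (b * j) - + 4 * l - + 4 * i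
  c₁ = solve-∀
  c₂ : ∀ b j l i q → q * + 4 - + 4 * (b * j) - + 4 * l - + 4 * i ≡ + 2 * (+ 2 * (q - b * j - i - l))
  c₂ = solve-∀
  go : (∃ λ l → ⟪ bits h , bits r ⟫ ≡ π + + 2 * l) →
       (∃ λ i → ⟪ x , bits r ⟫ ≡ bitℤ β * sumℤ (bits r) + + 2 * ⟪ bits h , bits r ⟫ + + 4 * i) →
       + 4 ∣ ⟪ x , bits r ⟫ → orthogonal h r
  go (l , e₁) (i , e₂) (divides q e₃) = even-bit (parity (zipWith _∧_ h r)) (q - bitℤ β * j - i - l)
      (ℤₚ.*-cancelˡ-≡ (+ 2) π (+ 2 * (q - bitℤ β * j - i - l)) (trans (c₁ (bitℤ β) j π l i) (trans (cong (λ t → t - + 4 * (bitℤ β * j) - + 4 * l - + 4 * i)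
        (trans (sym (trans e₂ (cong₂ (λ a b → bitℤ β * a + + 2 * b + + 4 * i) ev e₁))) e₃)) (c₂ (bitℤ β) j l i q))))

same-parity : ∀ β a b → a %ℕ 2 ≡ bit β → + 2 ∣ a - b → b %ℕ 2 ≡ bit β
same-parity β a b e₀ (divides q e) = %ℕ-unique 2 (subst (ℕ._< 2) e₀ (n%ℕd<d a 2)) (a /ℕ 2 - q)
    (trans (c₁ a b) (trans (cong₂ _-_ (trans (a≡a%ℕn+[a/ℕn]*n a 2)
      (cong (λ b → + b + (a /ℕ 2) * + 2) e₀)) e) (c₂ (bitℤ β) (a /ℕ 2) q)))
  where
  c₁ : ∀ a b → b ≡ a - (a - b)
  c₁ = solve-∀
  c₂ : ∀ b p q → (b + p * + 2) - q * + 2 ≡ b + (p - q) * + 2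
  c₂ = solve-∀

glue-total : ∀ b s a → (∃ λ p → a ≡ b + + 2 * p) → + 8 ∣ s - + 4 * a → ∃ λ k → s ≡ + 4 * b + + 8 * k
glue-total b s a (p , e) (divides q e′) = p + q , trans (c₁ s a) (trans (cong₂ (λ u v → u + + 4 * v) e′ e) (c₂ b p q))
  where
  c₁ : ∀ s a → s ≡ (s - + 4 * a) + + 4 * a
  c₁ = solve-∀
  c₂ : ∀ b p q → q * + 8 + + 4 * (b + + 2 * p) ≡ + 4 * b + + 8 * (p + q)
  c₂ = solve-∀

Dual⇒Coset : ∀ {x} → Dual x → Coset x
Dual⇒Coset {x} (dual edges gl rows) = build (parity-bit (lookup x zero))
  where
  build : (∃ λ β → lookup x zero %ℕ 2 ≡ bit β) → Coset x
  build (β , e₀) = coset β (halves β x) sh (go rows-even rows)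
      (glue-total (bitℤ β) (sumℤ x) (lookup x zero) (shaped-lookup sh zero) (subst (+ 8 ∣_) (⟪⟫-glue x) gl))
    where
    sh : Shaped β x (halves β x)
    sh = shaped β x (λ i → same-parity β (lookup x zero) (lookup x i) e₀
      (*-cancel-∣ (+ 4) (+ 2) (subst (+ 8 ∣_) (⟪⟫-edge x i) (edges i))))
    go : ∀ {rs} → All Even rs → All (λ r → + 8 ∣ ⟪ x , doubled r ⟫) rs → AllRows (halves β x) rs
    go [] [] = []
    go {r ∷ _} (ev ∷ evs) (d ∷ ds) = row-orthogonal sh r ev d ∷ go evs ds

InΛ⇒Dual : ∀ {x} → InΛ x → Dual x
InΛ⇒Dual = Coset⇒Dual ∘ InΛ⇒Coset

Dual⇒InΛ : ∀ {x} → Dual x → InΛ x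
Dual⇒InΛ = Coset⇒InΛ ∘ Dual⇒Coset

open import Data.Nat.DivMod using (_/_; _%_)
open import Data.Fin using (#_)
import Data.Fin.Properties as Finₚ
import Data.Vec as Vec
import Data.Vec.Properties as Vecₚ
open import Data.Vec.Relation.Unary.All as VAll using ([]; _∷_) renaming (All to VAll)
import Data.Vec.Relation.Unary.All.Properties as VAllₚ

-- A pair of dual bases of Λ

-- Matrices are stored row by row, lowest digit first, each entry being shifted to make it a digit.
unpackRow : (b off : ℕ) .{{_ : ℕ.NonZero b}} → ∀ n → ℕ → Vec ℤ n
unpackRow b off zero k = []
unpackRow b off (suc n) k = (+ (k % b) - + off) ∷ unpackRow b off n (k / b)

unpack : (b off : ℕ) .{{_ : ℕ.NonZero b}} → ∀ m → ℕ → Vec Vec24 m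
unpack b off zero k = []
unpack b off (suc m) k = unpackRow b off 24 k ∷ unpack b off m (k / (b ℕ.^ 24)) where instance _ = ℕₚ.m^n≢0 b 24

opaque
  -- Eleven doubled rows, eleven edges, 8e₀ and the glue vector; the remaining generators of Λ are
  -- integral combinations of these. The matrix `dual-columns` is 8 times the inverse of the matrix
  -- with rows `basis`.
  basis dual-columns : Vec Vec24 24
  basis =
    map doubled (Vec.tail (Vec.fromList golayRows)) Vec.++
    map edge (# 1 ∷ # 2 ∷ # 5 ∷ # 11 ∷ # 13 ∷ # 14 ∷ # 15 ∷ # 16 ∷ # 18 ∷ # 19 ∷ # 23 ∷ []) Vec.++
    (+ 8 ⊙ unit zero) ∷ glue ∷ []
  dual-columns = unpack 128 64 24
    0x8105f40810204081020408102040810204081020407135b4894e9c4074d9f4070c224489122408912234a086b2e5d428409d52142a581c3870e1c3c70e1e5c7135b4a90e1d4074da03e70c224489122448912034810603e8102040810204081020408102040810204081060407d0204081020408102040810204081020407135b4a94e1c4270da0406cc224489122448912230810604080fa040810204081020408102040810204081060408101f4081020408102040810204081020408106040810203e8102040810204081020408102040810604081020407d0204081020408102040810204090b66366d2a54095320409551e3c78f1e3c78f1e508106040810204080fa04081020408102040810204090d643a711234289221428d3203c78f1e4078f20486185454a8b974064a9f3e5c7244c91224449122224a0a692e613a63e994a142a171c3878e1c3c70e1e58715594c90d9c3e6cd203e6cb2244892224489120306185452acc17425ca9f40587244891226449122420810604081020408101f4081020408102040810204090b6638752a342912a0429141e3c78f1e3c80f204ca086b305d3a93ea152140a581c3870e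1c3c70f1c5c81060408102040810203e8102040810204081020408106040810204081020407d0204081020408102040810604081020408102040810204081020408102040

cobasis : Vec Vec24 24
cobasis = transpose dual-columns

div8 : Vec ℤ 24 → Vec ℤ 24
div8 = map (_/ℕ 8)

-- The division rounds down for vectors outside Λ; on Λ it is exact, by `coords-exact`.
coords : Vec24 → Vec ℤ 24
coords x = div8 (map ⟪ x ,_⟫ cobasis)

div-exact : ∀ d .{{_ : ℕ.NonZero d}} {z} → + d ∣ z → + d * (z /ℕ d) ≡ z
div-exact d {z} (divides q e) = sym (trans (a≡a%ℕn+[a/ℕn]*n z d)
  (trans (cong (λ r → + r + (z /ℕ d) * + d) (%ℕ-unique d (ℕ.>-nonZero⁻¹ d) q (trans e (sym (ℤₚ.+-identityˡ _)))))
    (trans (ℤₚ.+-identityˡ _) (ℤₚ.*-comm (z /ℕ d) (+ d)))))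

record Integral (x : Vec24) : Set where
  constructor integral
  field on-basis : VAll (λ q → + 8 ∣ ⟪ x , q ⟫) basis

open Integral

opaque
  unfolding basis

  Dual⇒Integral : ∀ {x} → Dual x → Integral x
  Dual⇒Integral {x} (dual e g (_ ∷ d₁ ∷ d₂ ∷ d₃ ∷ d₄ ∷ d₅ ∷ d₆ ∷ d₇ ∷ d₈ ∷ d₉ ∷ d₁₀ ∷ d₁₁ ∷ [])) = integral (
    d₁ ∷ d₂ ∷ d₃ ∷ d₄ ∷ d₅ ∷ d₆ ∷ d₇ ∷ d₈ ∷ d₉ ∷ d₁₀ ∷ d₁₁ ∷
    e (# 1) ∷ e (# 2) ∷ e (# 5) ∷ e (# 11) ∷ e (# 13) ∷ e (# 14) ∷ e (# 15) ∷ e (# 16) ∷ e (# 18) ∷ e (# 19) ∷ e (# 23) ∷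
    divides (⟪ x , unit zero ⟫) (trans (⟪⟫-⊙ʳ x (+ 8) (unit zero)) (ℤₚ.*-comm (+ 8) _)) ∷ g ∷ [])

∣-comb : ∀ {m n d} (x : Vec ℤ n) (c : Vec ℤ m) {vs} → VAll (λ v → d ∣ ⟪ x , v ⟫) vs → d ∣ ⟪ x , comb c vs ⟫
∣-comb {d = d} x [] [] = divides (+ 0) (trans (⟪⟫-𝟎ʳ x) (sym (ℤₚ.*-zeroˡ d)))
∣-comb {d = d} x (c ∷ cs) {v ∷ vs} (p ∷ ps) = subst (d ∣_) (sym (trans (⟪⟫-⊕ʳ x (c ⊙ v) (comb cs vs)) (cong (_+ ⟪ x , comb cs vs ⟫) (⟪⟫-⊙ʳ x c v))))
  (∣m∣n⇒∣m+n (∣n⇒∣m*n c p) (∣-comb x cs ps))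

spanned : ∀ {x} {v} → Integral x → comb (coords v) basis ≡ v → + 8 ∣ ⟪ x , v ⟫
spanned {x} {v} int e = subst (λ y → + 8 ∣ ⟪ x , y ⟫) e (∣-comb x (coords v) (on-basis int))

opaque
  unfolding basis dual-columns

  edges-spanned : ∀ i → comb (coords (edge i)) basis ≡ edge i
  edges-spanned = decided (Finₚ.all? (λ i → Vecₚ.≡-dec ℤ._≟_ (comb (coords (edge i)) basis) (edge i))) refl

  rows-spanned : All (λ r → comb (coords (doubled r)) basis ≡ doubled r) golayRows
  rows-spanned = decided (All.all? (λ r → Vecₚ.≡-dec ℤ._≟_ (comb (coords (doubled r)) basis) (doubled r)) golayRows) refl

  -- Unimodularity in computational form: the dual basis lies in the span of the basis. It makes the
  -- pairings with the dual basis exact multiples of 8.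
  cobasis-spanned : VAll (λ p → comb (coords p) basis ≡ p) cobasis
  cobasis-spanned = decided (VAll.all? (λ p → Vecₚ.≡-dec ℤ._≟_ (comb (coords p) basis) p) cobasis) refl

  dual-bases : map (λ u → comb u basis) dual-columns ≡ scalar 24 (+ 8)
  dual-bases = decided (Vecₚ.≡-dec (Vecₚ.≡-dec ℤ._≟_) (map (λ u → comb u basis) dual-columns) (scalar 24 (+ 8))) refl

  basis-even : VAll (λ q → + 16 ∣ ⟪ q , q ⟫) basis
  basis-even = decided (VAll.all? (λ q → + 16 ∣? ⟪ q , q ⟫) basis) refl

  basis-integral : VAll Integral basis
  basis-integral = decided (VAll.all? (λ q → map′ integral on-basis (VAll.all? (λ q′ → + 8 ∣? ⟪ q , q′ ⟫) basis)) basis) refl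

opaque
  unfolding basis

  integral-glue : ∀ {x} → Integral x → + 8 ∣ ⟪ x , glue ⟫
  integral-glue int = VAllₚ.lookup⁺ (on-basis int) (# 23)

Integral⇒Dual : ∀ {x} → Integral x → Dual x
Integral⇒Dual int = dual (λ i → spanned {v = edge i} int (edges-spanned i)) (integral-glue int)
  (All.map (λ {r} → spanned {v = doubled r} int) rows-spanned)

InΛ⇒Integral : ∀ {x} → InΛ x → Integral x
InΛ⇒Integral = Dual⇒Integral ∘ InΛ⇒Dual

Integral⇒InΛ : ∀ {x} → Integral x → InΛ x
Integral⇒InΛ = Dual⇒InΛ ∘ Integral⇒Dual

Integral? : ∀ x → Dec (Integral x)
Integral? x = map′ integral on-basis (VAll.all? (λ q → + 8 ∣? ⟪ x , q ⟫) basis)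

InΛ? : ∀ x → Dec (InΛ x)
InΛ? x = map′ Integral⇒InΛ InΛ⇒Integral (Integral? x)

coords-exact : ∀ {x} → Integral x → + 8 ⊙ coords x ≡ map ⟪ x ,_⟫ cobasis
coords-exact {x} int = go cobasis cobasis-spanned
  where
  go : ∀ {m} (ps : Vec Vec24 m) → VAll (λ p → comb (coords p) basis ≡ p) ps → + 8 ⊙ map (_/ℕ 8) (map ⟪ x ,_⟫ ps) ≡ map ⟪ x ,_⟫ ps
  go [] [] = refl
  go (p ∷ ps) (e ∷ es) = cong₂ _∷_ (div-exact 8 (spanned {v = p} int e)) (go ps es)

-- The coefficients with respect to a basis are the pairings with the dual basis; in matrix terms,
-- `dual-columns` times `basis` is 8 times the identity.
expand : ∀ {x} → Integral x → x ≡ comb (coords x) basis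
expand {x} int = ⊙-cancel (+ 8) (sym (begin
  + 8 ⊙ comb (coords x) basis                       ≡⟨ comb-⊙ (+ 8) (coords x) basis ⟨
  comb (+ 8 ⊙ coords x) basis                       ≡⟨ cong (λ c → comb c basis) (coords-exact int) ⟩
  comb (map ⟪ x ,_⟫ (transpose dual-columns)) basis ≡⟨ cong (λ c → comb c basis) (map-⟪⟫-transpose x dual-columns) ⟩
  comb (comb x dual-columns) basis                  ≡⟨ comb-comb x dual-columns basis ⟩
  comb x (map (λ u → comb u basis) dual-columns)    ≡⟨ cong (comb x) dual-bases ⟩
  comb x (scalar 24 (+ 8))                          ≡⟨ comb-scalar (+ 8) x ⟩
  + 8 ⊙ x                                           ∎))
  where open ≡-Reasoning

pairing : ∀ {x y} → Integral x → Integral y → + 8 ∣ ⟪ x , y ⟫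
pairing {x} {y} ix iy = subst (λ v → + 8 ∣ ⟪ x , v ⟫) (sym (expand iy)) (∣-comb x (coords y) (on-basis ix))

opaque
  unfolding basis

  Λ-𝟎 : Integral 𝟎
  Λ-𝟎 = decided (Integral? 𝟎) refl

Λ-⊕ : ∀ {x y} → Integral x → Integral y → Integral (x ⊕ y)
Λ-⊕ {x} {y} p q = integral (go basis (on-basis p) (on-basis q))
  where
  go : ∀ {m} (vs : Vec Vec24 m) → VAll (λ v → + 8 ∣ ⟪ x , v ⟫) vs → VAll (λ v → + 8 ∣ ⟪ y , v ⟫) vs → VAll (λ v → + 8 ∣ ⟪ x ⊕ y , v ⟫) vs
  go [] [] [] = []
  go (v ∷ vs) (p ∷ ps) (q ∷ qs) = subst (+ 8 ∣_) (sym (⟪⟫-⊕ˡ x y v)) (∣m∣n⇒∣m+n p q) ∷ go vs ps qs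

Λ-⊙ : ∀ k {x} → Integral x → Integral (k ⊙ x)
Λ-⊙ k {x} int = integral (VAll.map (λ {v} p → subst (+ 8 ∣_) (sym (⟪⟫-⊙ˡ k x v)) (∣n⇒∣m*n k p)) (on-basis int))

Λ-⊖ : ∀ {x y} → Integral x → Integral y → Integral (x ⊖ y)
Λ-⊖ {x} {y} p q = subst Integral (sym (⊖-as-⊕ x y)) (Λ-⊕ p (Λ-⊙ ℤ.-1ℤ q))

Λ-comb : ∀ {m} (c : Vec ℤ m) {vs} → VAll Integral vs → Integral (comb c vs)
Λ-comb [] [] = Λ-𝟎
Λ-comb (c ∷ cs) (p ∷ ps) = Λ-⊕ (Λ-⊙ c p) (Λ-comb cs ps)

-- The cross terms carry the factor 2 · 8, so that evenness need only be checked on the basis.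
even-norm : ∀ {x} → Integral x → + 16 ∣ ⟪ x , x ⟫
even-norm {x} int = subst (λ y → + 16 ∣ ⟪ y , y ⟫) (sym (expand int)) (go (coords x) basis-integral basis-even)
  where
  go : ∀ {m} (c : Vec ℤ m) {vs} → VAll Integral vs → VAll (λ q → + 16 ∣ ⟪ q , q ⟫) vs → + 16 ∣ ⟪ comb c vs , comb c vs ⟫
  go [] [] [] = divides (+ 0) refl
  go (c ∷ cs) {v ∷ vs} (i ∷ is) (e ∷ es) = subst (λ w → + 16 ∣ ⟪ c ⊙ v ⊕ w , c ⊙ v ⊕ w ⟫) (1-⊙ w) (subst (+ 16 ∣_) (sym (norm-comb c (+ 1) v w))
      (∣m∣n⇒∣m+n (∣m∣n⇒∣m+n (∣n⇒∣m*n (c * c) e) cross) (subst (+ 16 ∣_) (sym (ℤₚ.*-identityˡ _)) (go cs is es))))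
    where
    w : Vec24
    w = comb cs vs
    cross : + 16 ∣ + 2 * (c * + 1) * ⟪ v , w ⟫
    cross with pairing i (Λ-comb cs is)
    ... | divides k e = divides (c * k) (trans (cong (+ 2 * (c * + 1) *_) e) (eq c k))
      where
      eq : ∀ c k → + 2 * (c * + 1) * (k * + 8) ≡ c * k * + 16
      eq = solve-∀

-- Congruence modulo 4Λ

infix 4 _≈_

_≈_ : Vec24 → Vec24 → Set
x ≈ y = In4Λ (x -ᵥ y)

≈-refl : ∀ {x} → x ≈ x
≈-refl {x} = 𝟎 , Integral⇒InΛ Λ-𝟎 , trans (⊖-self x) (sym (⊙-𝟎 (+ 4)))

≈-sym : ∀ {x y} → x ≈ y → y ≈ x
≈-sym {x} {y} (w , iw , e) = ℤ.-1ℤ ⊙ w , Integral⇒InΛ (Λ-⊙ ℤ.-1ℤ (InΛ⇒Integral iw)) , flip x y w e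
  where
  eq₁ : ∀ b a → b - a ≡ ℤ.-1ℤ * (a - b)
  eq₁ = solve-∀
  eq₂ : ∀ c → ℤ.-1ℤ * (+ 4 * c) ≡ + 4 * (ℤ.-1ℤ * c)
  eq₂ = solve-∀
  flip : ∀ {n} (x y w : Vec ℤ n) → x ⊖ y ≡ + 4 ⊙ w → y ⊖ x ≡ + 4 ⊙ ℤ.-1ℤ ⊙ w
  flip [] [] [] _ = refl
  flip (a ∷ x) (b ∷ y) (c ∷ w) e = cong₂ _∷_ (trans (eq₁ b a) (trans (cong (ℤ.-1ℤ *_) (Vecₚ.∷-injectiveˡ e)) (eq₂ c)))
    (flip x y w (Vecₚ.∷-injectiveʳ e))

≈-trans : ∀ {x y z} → x ≈ y → y ≈ z → x ≈ z
≈-trans {x} {y} {z} (v , iv , e) (w , iw , e′) = v ⊕ w , Integral⇒InΛ (Λ-⊕ (InΛ⇒Integral iv) (InΛ⇒Integral iw)) ,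
  trans (split x y z) (trans (cong₂ _⊕_ e e′) (sym (⊙-⊕ (+ 4) v w)))
  where
  eq : ∀ a b c → a - c ≡ (a - b) + (b - c)
  eq = solve-∀
  split : ∀ {n} (x y z : Vec ℤ n) → x ⊖ z ≡ (x ⊖ y) ⊕ (y ⊖ z)
  split [] [] [] = refl
  split (a ∷ x) (b ∷ y) (c ∷ z) = cong₂ _∷_ (eq a b c) (split x y z)

≈⇒Λ : ∀ {x y} → InΛ y → x ≈ y → InΛ x
≈⇒Λ iy (w , iw , e) = subst InΛ (sym (⊖⇒≡⊕ e)) (Integral⇒InΛ (Λ-⊕ (InΛ⇒Integral iy) (Λ-⊙ (+ 4) (InΛ⇒Integral iw))))

-- The quotient by 4, rounded down, is the only possible witness.
In4Λ? : ∀ x → Dec (In4Λ x)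
In4Λ? x = go (Vecₚ.≡-dec ℤ._≟_ x (+ 4 ⊙ map (_/ℕ 4) x)) (InΛ? (map (_/ℕ 4) x))
  where
  exact : ∀ {n} (w x : Vec ℤ n) → x ≡ + 4 ⊙ w → w ≡ map (_/ℕ 4) x
  exact [] [] _ = refl
  exact (c ∷ w) (a ∷ x) refl = cong₂ _∷_ (ℤₚ.*-cancelˡ-≡ (+ 4) c _ (sym (div-exact 4 (divides c (ℤₚ.*-comm (+ 4) c))))) (exact w x refl)
  go : Dec (x ≡ + 4 ⊙ map (_/ℕ 4) x) → Dec (InΛ (map (_/ℕ 4) x)) → Dec (In4Λ x)
  go (yes e) (yes i) = yes (_ , i , e)
  go (yes _) (no ni) = no λ { (w , iw , e′) → ni (subst InΛ (exact w x e′) iw) }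
  go (no ne) _ = no λ { (w , iw , e′) → ne (trans e′ (cong (+ 4 ⊙_) (exact w x e′))) }

coord-residue : Vec24 → Fin 24 → Fin 4
coord-residue x k = Fin.fromℕ< (n%ℕd<d (lookup (coords x) k) 4)

-- The coordinates in `basis` modulo 4. That the values lie in a set of 4²⁴ elements is the upper
-- bound which the census will meet.
class : Vec24 → Fin (4 ℕ.^ 24)
class x = Fin.funToFin (coord-residue x)

class-injective : ∀ {x y} → InΛ x → InΛ y → class x ≡ class y → x ≈ y
class-injective {x} {y} ix iy e = comb d basis , Integral⇒InΛ (Λ-comb d basis-integral) , (begin
    x ⊖ y                                            ≡⟨ cong₂ _⊖_ (expand (InΛ⇒Integral ix)) (expand (InΛ⇒Integral iy)) ⟩
    comb (coords x) basis ⊖ comb (coords y) basis    ≡⟨ cong (_⊖ comb (coords y) basis) (cong (λ c → comb c basis) (⊖⇒≡⊕ split)) ⟩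
    comb (coords y ⊕ + 4 ⊙ d) basis ⊖ comb (coords y) basis ≡⟨ cong (_⊖ comb (coords y) basis) (comb-⊕ (coords y) (+ 4 ⊙ d) basis) ⟩
    (comb (coords y) basis ⊕ comb (+ 4 ⊙ d) basis) ⊖ comb (coords y) basis ≡⟨ ⊕-⊖ (comb (coords y) basis) (comb (+ 4 ⊙ d) basis) ⟩
    comb (+ 4 ⊙ d) basis                             ≡⟨ comb-⊙ (+ 4) d basis ⟩
    + 4 ⊙ comb d basis                               ∎)
  where
  open ≡-Reasoning
  same : ∀ k → lookup (coords x) k %ℕ 4 ≡ lookup (coords y) k %ℕ 4
  same k = begin
    lookup (coords x) k %ℕ 4 ≡⟨ Finₚ.toℕ-fromℕ< (n%ℕd<d (lookup (coords x) k) 4) ⟨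
    toℕ (coord-residue x k)  ≡⟨ cong toℕ (trans (sym (Finₚ.finToFun-funToFin (coord-residue x) k))
                                  (trans (cong (λ z → Fin.finToFun z k) e) (Finₚ.finToFun-funToFin (coord-residue y) k))) ⟩
    toℕ (coord-residue y k)  ≡⟨ Finₚ.toℕ-fromℕ< (n%ℕd<d (lookup (coords y) k) 4) ⟩
    lookup (coords y) k %ℕ 4 ∎
  d : Vec ℤ 24
  d = map (_/ℕ 4) (coords x) ⊖ map (_/ℕ 4) (coords y)
  eq : ∀ r p q → (r + p * + 4) - (r + q * + 4) ≡ + 4 * (p - q)
  eq = solve-∀
  go : ∀ {n} (a b : Vec ℤ n) → (∀ k → lookup a k %ℕ 4 ≡ lookup b k %ℕ 4) → a ⊖ b ≡ + 4 ⊙ (map (_/ℕ 4) a ⊖ map (_/ℕ 4) b)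
  go [] [] _ = refl
  go (a ∷ as) (b ∷ bs) f = cong₂ _∷_ (trans (cong₂ _-_ (trans (a≡a%ℕn+[a/ℕn]*n a 4) (cong (λ r → + r + (a /ℕ 4) * + 4) (f zero)))
    (a≡a%ℕn+[a/ℕn]*n b 4)) (eq (+ (b %ℕ 4)) (a /ℕ 4) (b /ℕ 4))) (go as bs (f ∘ suc))
  split : coords x ⊖ coords y ≡ + 4 ⊙ d
  split = go (coords x) (coords y) same

-- The group Co₀ and its orbits

open Co₀

Co₀-id : Co₀ id
Co₀-id = record
  { maps = λ _ i → i ; additive = λ _ _ _ _ → refl ; isometry = λ _ _ _ _ → refl ; inverse = id
  ; inv-maps = λ _ i → i ; inv-left = λ _ _ → refl ; inv-right = λ _ _ → refl }

Co₀-∘ : ∀ {σ τ} → Co₀ σ → Co₀ τ → Co₀ (σ ∘ τ)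
Co₀-∘ {σ} {τ} s t = record
  { maps = λ u i → maps s (τ u) (maps t u i)
  ; additive = λ u v i j → trans (cong σ (additive t u v i j)) (additive s (τ u) (τ v) (maps t u i) (maps t v j))
  ; isometry = λ u v i j → trans (isometry s (τ u) (τ v) (maps t u i) (maps t v j)) (isometry t u v i j)
  ; inverse = inverse t ∘ inverse s
  ; inv-maps = λ u i → inv-maps t (inverse s u) (inv-maps s u i)
  ; inv-left = λ u i → trans (cong (inverse t) (inv-left s (τ u) (maps t u i))) (inv-left t u i)
  ; inv-right = λ u i → trans (cong σ (inv-right t (inverse s u) (inv-maps s u i))) (inv-right s u i) }

Λ-closed-⊕ : ∀ {x y} → InΛ x → InΛ y → InΛ (x ⊕ y)
Λ-closed-⊕ i j = Integral⇒InΛ (Λ-⊕ (InΛ⇒Integral i) (InΛ⇒Integral j))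

Λ-closed-⊖ : ∀ {x y} → InΛ x → InΛ y → InΛ (x ⊖ y)
Λ-closed-⊖ i j = Integral⇒InΛ (Λ-⊖ (InΛ⇒Integral i) (InΛ⇒Integral j))

Λ-closed-⊙ : ∀ k {x} → InΛ x → InΛ (k ⊙ x)
Λ-closed-⊙ k i = Integral⇒InΛ (Λ-⊙ k (InΛ⇒Integral i))

Co₀-inverse : ∀ {σ} (s : Co₀ σ) → Co₀ (inverse s)
Co₀-inverse {σ} s = record
  { maps = inv-maps s
  ; additive = λ u v i j → begin
      inverse s (u +ᵥ v)                           ≡⟨ cong (inverse s) (cong₂ _+ᵥ_ (inv-right s u i) (inv-right s v j)) ⟨
      inverse s (σ (inverse s u) +ᵥ σ (inverse s v)) ≡⟨ cong (inverse s) (additive s _ _ (inv-maps s u i) (inv-maps s v j)) ⟨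
      inverse s (σ (inverse s u +ᵥ inverse s v))   ≡⟨ inv-left s _ (Λ-closed-⊕ (inv-maps s u i) (inv-maps s v j)) ⟩
      inverse s u +ᵥ inverse s v                   ∎
  ; isometry = λ u v i j → trans (sym (isometry s _ _ (inv-maps s u i) (inv-maps s v j))) (cong₂ form8 (inv-right s u i) (inv-right s v j))
  ; inverse = σ ; inv-maps = maps s ; inv-left = inv-right s ; inv-right = inv-left s }
  where open ≡-Reasoning

orbit-refl : ∀ {v} → InOrbit v v
orbit-refl = id , Co₀-id , refl

orbit-trans : ∀ {u v w} → InOrbit u v → InOrbit v w → InOrbit u w
orbit-trans (σ , s , refl) (τ , t , refl) = τ ∘ σ , Co₀-∘ t s , refl

orbit-sym : ∀ {u v} → InΛ u → InOrbit u v → InOrbit v u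
orbit-sym i (σ , s , refl) = inverse s , Co₀-inverse s , inv-left s _ i

orbit-Λ : ∀ {u v} → InΛ u → InOrbit u v → InΛ v
orbit-Λ i (σ , s , refl) = maps s _ i

orbit-norm : ∀ {u v} → InΛ u → InOrbit u v → form8 v v ≡ form8 u u
orbit-norm i (σ , s , refl) = isometry s _ _ i i

module _ {σ} (s : Co₀ σ) where

  σ-injective : ∀ {u v} → InΛ u → InΛ v → σ u ≡ σ v → u ≡ v
  σ-injective i j e = trans (sym (inv-left s _ i)) (trans (cong (inverse s) e) (inv-left s _ j))

  σ-⊖ : ∀ {x y} → InΛ x → InΛ y → σ (x ⊖ y) ≡ σ x ⊖ σ y
  σ-⊖ {x} {y} i j = sym (trans (cong (_⊖ σ y) (trans (cong σ (⊖⇒≡⊕ {x = x} {y} refl)) (additive s y (x ⊖ y) j (Λ-closed-⊖ i j))))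
    (⊕-⊖ (σ y) (σ (x ⊖ y))))

  σ-𝟎 : σ 𝟎 ≡ 𝟎
  σ-𝟎 = trans (cong σ (sym (⊖-self 𝟎))) (trans (σ-⊖ {𝟎} {𝟎} i₀ i₀) (⊖-self (σ 𝟎)))
    where
    i₀ : InΛ 𝟎
    i₀ = Integral⇒InΛ Λ-𝟎

  σ-⊙ : ∀ k {x} → InΛ x → σ (+ k ⊙ x) ≡ + k ⊙ σ x
  σ-⊙ zero {x} i = trans (cong σ (0-⊙ x)) (trans σ-𝟎 (sym (0-⊙ (σ x))))
  σ-⊙ (suc k) {x} i = begin
    σ (+ suc k ⊙ x)          ≡⟨ cong σ (unroll k x) ⟩
    σ (x ⊕ + k ⊙ x)          ≡⟨ additive s x (+ k ⊙ x) i (Λ-closed-⊙ (+ k) i) ⟩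
    σ x ⊕ σ (+ k ⊙ x)        ≡⟨ cong (σ x ⊕_) (σ-⊙ k i) ⟩
    σ x ⊕ + k ⊙ σ x          ≡⟨ unroll k (σ x) ⟨
    + suc k ⊙ σ x            ∎
    where
    open ≡-Reasoning
    unroll : ∀ k (x : Vec24) → + suc k ⊙ x ≡ x ⊕ + k ⊙ x
    unroll k x = trans (+-⊙ (+ 1) (+ k) x) (cong (_⊕ + k ⊙ x) (1-⊙ x))

  σ-≈ : ∀ {x y} → InΛ x → InΛ y → x ≈ y → σ x ≈ σ y
  σ-≈ i j (w , iw , e) = σ w , maps s w iw , trans (sym (σ-⊖ i j)) (trans (cong σ e) (σ-⊙ 4 iw))

-- Automorphisms given by a matrix 8σ: both σ and its transpose have to map Λ to itself.

act : Vec Vec24 24 → Vec24 → Vec24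
act M x = div8 (map ⟪ x ,_⟫ M)

record Adjoint (M N : Vec Vec24 24) : Set where
  constructor adjoint
  field
    rows       : VAll Integral M
    integrals  : VAll (λ q → Integral (act M q)) basis
    transposed : transpose N ≡ M
    product    : map (λ u → comb u M) N ≡ scalar 24 (+ 64)

open Adjoint

IsAut : Vec Vec24 24 → Set
IsAut M = Adjoint M (transpose M) × Adjoint (transpose M) M

Adjoint? : ∀ M N → Dec (Adjoint M N)
Adjoint? M N = map′ (λ { (a , b , c , d) → adjoint a b c d }) (λ { (adjoint a b c d) → a , b , c , d })
  (VAll.all? Integral? M ×-dec VAll.all? (λ q → Integral? (act M q)) basis
   ×-dec Vecₚ.≡-dec (Vecₚ.≡-dec ℤ._≟_) (transpose N) M
   ×-dec Vecₚ.≡-dec (Vecₚ.≡-dec ℤ._≟_) (map (λ u → comb u M) N) (scalar 24 (+ 64)))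

IsAut? : ∀ M → Dec (IsAut M)
IsAut? M = Adjoint? M (transpose M) ×-dec Adjoint? (transpose M) M

act-exact : ∀ {M N x} → Adjoint M N → Integral x → + 8 ⊙ act M x ≡ comb x N
act-exact {M} {N} {x} m i = trans (go (rows m)) (trans (cong (map ⟪ x ,_⟫) (sym (transposed m))) (map-⟪⟫-transpose x N))
  where
  go : ∀ {k} {vs : Vec Vec24 k} → VAll Integral vs → + 8 ⊙ map (_/ℕ 8) (map ⟪ x ,_⟫ vs) ≡ map ⟪ x ,_⟫ vs
  go [] = refl
  go (p ∷ ps) = cong₂ _∷_ (div-exact 8 (pairing i p)) (go ps)

module _ {M N} (m : Adjoint M N) (n : Adjoint N M) where

  act-adjoint : ∀ {x y} → Integral x → Integral y → ⟪ act M x , y ⟫ ≡ ⟪ x , act N y ⟫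
  act-adjoint {x} {y} i j = ℤₚ.*-cancelˡ-≡ (+ 8) _ _ (begin
    + 8 * ⟪ act M x , y ⟫     ≡⟨ ⟪⟫-⊙ˡ (+ 8) (act M x) y ⟨
    ⟪ + 8 ⊙ act M x , y ⟫     ≡⟨ cong ⟪_, y ⟫ (act-exact m i) ⟩
    ⟪ comb x N , y ⟫          ≡⟨ ⟪⟫-comm (comb x N) y ⟩
    ⟪ y , comb x N ⟫          ≡⟨ ⟪⟫-comb y x N ⟩
    ⟪ x , map ⟪ y ,_⟫ N ⟫     ≡⟨ cong (λ v → ⟪ x , map ⟪ y ,_⟫ v ⟫) (transposed n) ⟨
    ⟪ x , map ⟪ y ,_⟫ (transpose M) ⟫ ≡⟨ cong ⟪ x ,_⟫ (map-⟪⟫-transpose y M) ⟩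
    ⟪ x , comb y M ⟫          ≡⟨ cong ⟪ x ,_⟫ (act-exact n j) ⟨
    ⟪ x , + 8 ⊙ act N y ⟫     ≡⟨ ⟪⟫-⊙ʳ x (+ 8) (act N y) ⟩
    + 8 * ⟪ x , act N y ⟫     ∎)
    where open ≡-Reasoning

  -- Tested against a basis vector `q`, the image of `x` pairs like `x` with the transpose applied
  -- to `q`, and the transpose maps the basis into Λ by the field `integrals` of the opposite
  -- record.
  act-integral : ∀ {x} → Integral x → Integral (act M x)
  act-integral {x} i = integral (go basis basis-integral (integrals n))
    where
    go : ∀ {k} (vs : Vec Vec24 k) → VAll Integral vs → VAll (λ q → Integral (act N q)) vs → VAll (λ q → + 8 ∣ ⟪ act M x , q ⟫) vs
    go [] [] [] = []
    go (v ∷ vs) (p ∷ ps) (q ∷ qs) = subst (+ 8 ∣_) (sym (act-adjoint i p)) (pairing i q) ∷ go vs ps qs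

  act-inverse : ∀ {x} → Integral x → act N (act M x) ≡ x
  act-inverse {x} i = ⊙-cancel (+ 64) (begin
    + 64 ⊙ act N (act M x)               ≡⟨ *-⊙ (+ 8) (+ 8) (act N (act M x)) ⟩
    + 8 ⊙ + 8 ⊙ act N (act M x)          ≡⟨ cong (+ 8 ⊙_) (act-exact n (act-integral i)) ⟩
    + 8 ⊙ comb (act M x) M               ≡⟨ comb-⊙ (+ 8) (act M x) M ⟨
    comb (+ 8 ⊙ act M x) M               ≡⟨ cong (λ c → comb c M) (act-exact m i) ⟩
    comb (comb x N) M                    ≡⟨ comb-comb x N M ⟩
    comb x (map (λ u → comb u M) N)      ≡⟨ cong (comb x) (product m) ⟩
    comb x (scalar 24 (+ 64))            ≡⟨ comb-scalar (+ 64) x ⟩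
    + 64 ⊙ x                             ∎)
    where open ≡-Reasoning

act-⊕ : ∀ {M N x y} → Adjoint M N → Adjoint N M → Integral x → Integral y → act M (x ⊕ y) ≡ act M x ⊕ act M y
act-⊕ {M} {N} {x} {y} m n i j = ⊙-cancel (+ 8) (begin
  + 8 ⊙ act M (x ⊕ y)               ≡⟨ act-exact m (Λ-⊕ i j) ⟩
  comb (x ⊕ y) N                    ≡⟨ comb-⊕ x y N ⟩
  comb x N ⊕ comb y N               ≡⟨ cong₂ _⊕_ (act-exact m i) (act-exact m j) ⟨
  + 8 ⊙ act M x ⊕ + 8 ⊙ act M y     ≡⟨ ⊙-⊕ (+ 8) (act M x) (act M y) ⟨
  + 8 ⊙ (act M x ⊕ act M y)         ∎)
  where open ≡-Reasoning

act-Co₀ : ∀ {M} → IsAut M → Co₀ (act M)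
act-Co₀ {M} (m , n) = record
  { maps = λ u i → Integral⇒InΛ (act-integral m n (InΛ⇒Integral i))
  ; additive = λ u v i j → act-⊕ m n (InΛ⇒Integral i) (InΛ⇒Integral j)
  ; isometry = λ u v i j → trans (act-adjoint m n (InΛ⇒Integral i) (act-integral m n (InΛ⇒Integral j)))
      (cong ⟪ u ,_⟫ (act-inverse m n (InΛ⇒Integral j)))
  ; inverse = act (transpose M)
  ; inv-maps = λ u i → Integral⇒InΛ (act-integral n m (InΛ⇒Integral i))
  ; inv-left = λ u i → act-inverse m n (InΛ⇒Integral i)
  ; inv-right = λ u i → act-inverse n m (InΛ⇒Integral i) }

open import Data.List using (length; filter; _++_)
import Data.List.Properties as Listₚ
open import Data.List.Membership.Propositional using (_∈_; _∉_)
import Data.List.Membership.DecPropositional as DecMem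
open import Data.List.Membership.Propositional.Properties using (∈-filter⁺; ∈-filter⁻; ∈-map⁺; ∈-map⁻)
import Data.List.Relation.Unary.All.Properties as Allₚ
open import Data.List.Relation.Unary.Any as Any using (Any; here; there)
open import Data.List.Relation.Unary.AllPairs using ([]; _∷_)
open import Data.List.Relation.Unary.Unique.Propositional using (Unique)
import Data.List.Relation.Unary.Unique.Propositional.Properties as Uniqueₚ
open import Function.Bundles using (mk⇔; Equivalence)
open import Relation.Binary.Definitions using (DecidableEquality)
open import Relation.Nullary using (¬?)

-- Finite counting

-- Cardinality bounds phrased with repetition-free lists, so that they make sense for a predicate
-- such as membership in an orbit, for which no decision procedure is available.
AtMost AtLeast : {A : Set} → (A → Set) → ℕ → Set
AtMost P n = ∀ l → Unique l → All P l → length l ℕ.≤ n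
AtLeast P n = ∃ λ l → Unique l × All P l × n ℕ.≤ length l

∉⇒All≢ : ∀ {A : Set} {x : A} {l} → x ∉ l → All (x ≢_) l
∉⇒All≢ x∉ = Allₚ.¬Any⇒All¬ _ x∉

All≢⇒∉ : ∀ {A : Set} {x : A} {l} → All (x ≢_) l → x ∉ l
All≢⇒∉ = Allₚ.All¬⇒¬Any

AtMost-⊆ : ∀ {A : Set} {P Q : A → Set} {n} → (∀ {x} → P x → Q x) → AtMost Q n → AtMost P n
AtMost-⊆ f b l u ps = b l u (All.map f ps)

AtMost-≤ : ∀ {A : Set} {P : A → Set} {m n} → m ℕ.≤ n → AtMost P m → AtMost P n
AtMost-≤ m≤n b l u ps = ℕₚ.≤-trans (b l u ps) m≤n

AtMost-∅ : ∀ {A : Set} {P : A → Set} → (∀ {x} → ¬ P x) → AtMost P 0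
AtMost-∅ ¬P [] _ _ = z≤n
AtMost-∅ ¬P (x ∷ l) _ (p ∷ _) = ⊥-elim (¬P p)

AtMost-singleton : ∀ {A : Set} (a : A) → AtMost (_≡ a) 1
AtMost-singleton a [] _ _ = z≤n
AtMost-singleton a (x ∷ []) _ _ = s≤s z≤n
AtMost-singleton a (x ∷ y ∷ l) ((x≢y ∷ _) ∷ _) (refl ∷ refl ∷ _) = ⊥-elim (x≢y refl)

AtMost-remove : ∀ {A : Set} {P Q : A → Set} {n} x → (∀ {y} → P y → Q y) → Q x → ¬ P x → AtMost Q (suc n) → AtMost P n
AtMost-remove {P = P} x f q ¬p b l u ps =
  ℕ.s≤s⁻¹ (b (x ∷ l) (All.map (λ { p refl → ¬p p }) ps ∷ u) (q ∷ All.map f ps))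

unique-map : ∀ {A B : Set} {P : A → Set} (f : A → B) → (∀ {x y} → P x → P y → f x ≡ f y → x ≡ y) →
  ∀ {l} → All P l → Unique l → Unique (List.map f l)
unique-map f inj [] [] = []
unique-map f inj (p ∷ ps) (x∉ ∷ u) =
  Allₚ.map⁺ (All.zipWith (λ { (q , x≢y) e → x≢y (inj p q e) }) (ps , x∉)) ∷ unique-map f inj ps u

AtMost-map : ∀ {A B : Set} {P : A → Set} {Q : B → Set} {n} (f : A → B) → (∀ {x y} → P x → P y → f x ≡ f y → x ≡ y) →
  (∀ {x} → P x → Q (f x)) → AtMost Q n → AtMost P n
AtMost-map f inj g b l u ps = subst (ℕ._≤ _) (Listₚ.length-map f l) (b (List.map f l) (unique-map f inj ps u) (Allₚ.map⁺ (All.map g ps)))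

AtLeast-map : ∀ {A B : Set} {P : A → Set} {Q : B → Set} {n} (f : A → B) → (∀ {x y} → P x → P y → f x ≡ f y → x ≡ y) →
  (∀ {x} → P x → Q (f x)) → AtLeast P n → AtLeast Q n
AtLeast-map f inj g (l , u , ps , n≤) = List.map f l , unique-map f inj ps u , Allₚ.map⁺ (All.map g ps) ,
  subst (_ ℕ.≤_) (sym (Listₚ.length-map f l)) n≤

AtLeast-⊆ : ∀ {A : Set} {P Q : A → Set} {n} → (∀ {x} → P x → Q x) → AtLeast P n → AtLeast Q n
AtLeast-⊆ f (l , u , ps , n≤) = l , u , All.map f ps , n≤

AtMost-⊎ : ∀ {A : Set} {P Q R : A → Set} {m n} → (∀ {x} → P x → Q x ⊎ R x) → AtMost Q m → AtMost R n → AtMost P (m ℕ.+ n)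
AtMost-⊎ {A} {P} {Q} {R} {m} {n} f bq br l u ps = bound (split l u ps)
  where
  Split : List A → Set
  Split l = ∃ λ l₁ → ∃ λ l₂ → Unique l₁ × Unique l₂ × All Q l₁ × All R l₂
    × (∀ {x} → All (x ≢_) l → All (x ≢_) l₁ × All (x ≢_) l₂) × length l₁ ℕ.+ length l₂ ≡ length l
  split : ∀ l → Unique l → All P l → Split l
  split [] [] [] = [] , [] , [] , [] , [] , [] , (λ _ → [] , []) , refl
  split (x ∷ l) (x∉ ∷ u) (p ∷ ps) with split l u ps | f p
  ... | l₁ , l₂ , u₁ , u₂ , q , r , s , e | inj₁ qx =
    x ∷ l₁ , l₂ , proj₁ (s x∉) ∷ u₁ , u₂ , qx ∷ q , r , (λ { (n ∷ ns) → n ∷ proj₁ (s ns) , proj₂ (s ns) }) , cong suc e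
  ... | l₁ , l₂ , u₁ , u₂ , q , r , s , e | inj₂ rx =
    l₁ , x ∷ l₂ , u₁ , proj₂ (s x∉) ∷ u₂ , q , rx ∷ r , (λ { (n ∷ ns) → proj₁ (s ns) , n ∷ proj₂ (s ns) }) ,
    trans (ℕₚ.+-suc (length l₁) (length l₂)) (cong suc e)
  bound : Split l → length l ℕ.≤ m ℕ.+ n
  bound (l₁ , l₂ , u₁ , u₂ , q , r , _ , e) = subst (ℕ._≤ _) e (ℕₚ.+-mono-≤ (bq l₁ u₁ q) (br l₂ u₂ r))

length-filter-¬ : ∀ {A : Set} {P : A → Set} (P? : ∀ x → Dec (P x)) l → length l ≡ length (filter P? l) ℕ.+ length (filter (¬? ∘ P?) l)
length-filter-¬ P? [] = refl
length-filter-¬ P? (x ∷ l) with P? x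
... | yes _ = cong suc (length-filter-¬ P? l)
... | no _ = trans (cong suc (length-filter-¬ P? l)) (sym (ℕₚ.+-suc _ _))

AtLeast-disjoint : ∀ {A : Set} {P Q R : A → Set} {m n} → (∀ {x} → P x → R x) → (∀ {x} → Q x → R x) → (∀ {x} → P x → ¬ Q x) →
  AtLeast P m → AtLeast Q n → AtLeast R (m ℕ.+ n)
AtLeast-disjoint f g d (l , u , ps , m≤) (k , v , qs , n≤) = l ++ k ,
  Uniqueₚ.++⁺ u v (λ { (x∈l , x∈k) → d (All.lookup ps x∈l) (All.lookup qs x∈k) }) , Allₚ.++⁺ (All.map f ps) (All.map g qs) ,
  subst (_ ℕ.≤_) (sym (Listₚ.length-++ l)) (ℕₚ.+-mono-≤ m≤ n≤)

module Fibres {A B : Set} (_≟_ : DecidableEquality B) (f : A → B) {Q : A → Set} {m : ℕ} where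

  private
    at : ∀ y (x : A) → Dec (f x ≡ y)
    at y x = f x ≟ y

  fibres : ∀ ys {xs} → Unique xs → All Q xs → All (λ x → f x ∈ ys) xs →
    (∀ {y} → y ∈ ys → AtMost (λ x → Q x × f x ≡ y) m) → length xs ℕ.≤ length ys ℕ.* m
  fibres [] {[]} _ _ _ _ = z≤n
  fibres [] {_ ∷ _} _ _ (() ∷ _) _
  fibres (y ∷ ys) {xs} u qs ms b = subst (ℕ._≤ _) (sym (length-filter-¬ (at y) xs)) (ℕₚ.+-mono-≤
    (b (here refl) (filter (at y) xs) (Uniqueₚ.filter⁺ (at y) u)
      (All.zip (Allₚ.filter⁺ (at y) qs , Allₚ.all-filter (at y) xs)))
    (fibres ys (Uniqueₚ.filter⁺ (¬? ∘ at y) u) (Allₚ.filter⁺ (¬? ∘ at y) qs)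
      (All.zipWith (λ { (here e , ne) → ⊥-elim (ne e) ; (there i , _) → i }) (Allₚ.filter⁺ (¬? ∘ at y) ms , Allₚ.all-filter (¬? ∘ at y) xs))
      (b ∘ there)))

  -- If xs is as long as the fibre bounds allow, every fibre attains its bound.
  tight : ∀ ys {xs} → Unique xs → All Q xs → All (λ x → f x ∈ ys) xs →
    (∀ {y} → y ∈ ys → AtMost (λ x → Q x × f x ≡ y) m) → length ys ℕ.* m ℕ.≤ length xs →
    ∀ {y} → y ∈ ys → AtLeast (λ x → Q x × f x ≡ y) m
  tight ys {xs} u qs ms b long {y} y∈ = filter (at y) xs , Uniqueₚ.filter⁺ (at y) u ,
    All.zip (Allₚ.filter⁺ (at y) qs , Allₚ.all-filter (at y) xs) , ℕₚ.+-cancelʳ-≤ (length rest ℕ.* m) m (length (filter (at y) xs)) (begin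
      m ℕ.+ length rest ℕ.* m                              ≤⟨ ℕₚ.*-monoˡ-≤ m (Listₚ.filter-notAll (λ z → ¬? (z ≟ y)) ys (Any.map (λ e ne → ne (sym e)) y∈)) ⟩
      length ys ℕ.* m                                      ≤⟨ long ⟩
      length xs                                            ≡⟨ length-filter-¬ (at y) xs ⟩
      length (filter (at y) xs) ℕ.+ length (filter (¬? ∘ at y) xs) ≤⟨ ℕₚ.+-monoʳ-≤ (length (filter (at y) xs)) others ⟩
      length (filter (at y) xs) ℕ.+ length rest ℕ.* m      ∎)
    where
    open ℕₚ.≤-Reasoning
    rest : List B
    rest = filter (λ z → ¬? (z ≟ y)) ys
    others : length (filter (¬? ∘ at y) xs) ℕ.≤ length rest ℕ.* m
    others = fibres rest (Uniqueₚ.filter⁺ (¬? ∘ at y) u) (Allₚ.filter⁺ (¬? ∘ at y) qs)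
      (All.zipWith (λ { (i , ne) → ∈-filter⁺ (λ z → ¬? (z ≟ y)) i ne }) (Allₚ.filter⁺ (¬? ∘ at y) ms , Allₚ.all-filter (¬? ∘ at y) xs))
      (λ i → b (proj₁ (∈-filter⁻ (λ z → ¬? (z ≟ y)) {xs = ys} i)))

module _ {A : Set} (_≟_ : DecidableEquality A) where

  open DecMem _≟_ using (_∈?_)

  AtMost-list : ∀ ys → AtMost (_∈ ys) (length ys)
  AtMost-list ys l u ms = subst (length l ℕ.≤_) (ℕₚ.*-identityʳ (length ys))
    (Fibres.fibres _≟_ id ys u ms ms (λ {y} _ → AtMost-⊆ proj₂ (AtMost-singleton y)))

  -- An element missing from the list would extend it beyond the bound. In this way an equality of
  -- counts becomes a description of the set counted.
  saturated : ∀ {P : A → Set} {n l} → AtMost P n → Unique l → All P l → n ℕ.≤ length l → ∀ {x} → P x → x ∈ l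
  saturated {n = n} {l} b u ps n≤ {x} p with x ∈? l
  ... | yes i = i
  ... | no x∉ = ⊥-elim (ℕₚ.<-irrefl refl (ℕₚ.<-≤-trans (b (x ∷ l) (∉⇒All≢ x∉ ∷ u) (p ∷ ps)) n≤))

pair-list : ∀ {A B : Set} {Q : A → Set} {S : A → B → Set} {n} xs → Unique xs → All Q xs → (∀ {x} → Q x → AtLeast (S x) n) →
  ∃ λ (ps : List (A × B)) → Unique ps × All (λ { (x , y) → Q x × S x y }) ps × length xs ℕ.* n ℕ.≤ length ps
pair-list {A} {B} {Q} {S} {n} xs u qs f = let ps , ups , aps , len = go xs u qs in ps , ups , All.map proj₂ aps , len
  where
  go : ∀ xs → Unique xs → All Q xs →
    ∃ λ (ps : List (A × B)) → Unique ps × All (λ { (x , y) → x ∈ xs × Q x × S x y }) ps × length xs ℕ.* n ℕ.≤ length ps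
  go [] _ _ = [] , [] , [] , z≤n
  go (x ∷ xs) (x∉ ∷ u) (q ∷ qs) with go xs u qs | f q
  ... | ps , ups , aps , len | l , ul , al , n≤ = List.map (x ,_) l ++ ps ,
      Uniqueₚ.++⁺ (Uniqueₚ.map⁺ (cong proj₂) ul) ups clash ,
      Allₚ.++⁺ (Allₚ.map⁺ (All.map (λ r → here refl , q , r) al)) (All.map (λ { (i , r) → there i , r }) aps) ,
      subst (_ ℕ.≤_) (sym (trans (Listₚ.length-++ (List.map (x ,_) l)) (cong (ℕ._+ length ps) (Listₚ.length-map (x ,_) l)))) (ℕₚ.+-mono-≤ n≤ len)
    where
    clash : ∀ {p} → ¬ (p ∈ List.map (x ,_) l × p ∈ ps)
    clash (i , j) with ∈-map⁻ (x ,_) i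
    ... | _ , _ , refl = All≢⇒∉ x∉ (proj₁ (All.lookup aps j))

-- The related pairs are listed row by row, and the length of this list is then bounded column by
-- column.
double-count : ∀ {A B : Set} (_≟_ : DecidableEquality B) {Q : A → Set} {R : A → B → Set} {n m xs ys} →
  Unique xs → All Q xs → (∀ {x} → Q x → AtLeast (λ y → y ∈ ys × R x y) n) →
  (∀ {y} → y ∈ ys → AtMost (λ x → Q x × R x y) m) → length xs ℕ.* n ℕ.≤ length ys ℕ.* m
double-count _≟_ {xs = xs} {ys} u qs f b with pair-list xs u qs f
... | ps , ups , aps , len = ℕₚ.≤-trans len (Fibres.fibres _≟_ proj₂ ys ups (All.map (λ { (q , _ , r) → q , r }) aps) (All.map (λ { (_ , i , _) → i }) aps)
    (λ i → AtMost-map proj₁ (λ { (_ , refl) (_ , refl) refl → refl }) (λ { (q , refl) → q }) (b i)))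

infix 4 _≟ᵥ_

_≟ᵥ_ : DecidableEquality Vec24
_≟ᵥ_ = Vecₚ.≡-dec ℤ._≟_

HasSize⇒AtMost : ∀ {P n} → HasSize P n → AtMost P n
HasSize⇒AtMost (l , u , refl , iff) k v ps = AtMost-list _≟ᵥ_ l k v (All.map (λ {x} p → Equivalence.to (iff x) p) ps)

HasSize⇒AtLeast : ∀ {P n} → HasSize P n → AtLeast P n
HasSize⇒AtLeast (l , u , refl , iff) = l , u , All.tabulate (λ {x} i → Equivalence.from (iff x) i) , ℕₚ.≤-refl

hasSize : ∀ {P n} → AtMost P n → AtLeast P n → HasSize P n
hasSize b (l , u , ps , n≤) = l , u , ℕₚ.≤-antisym (b l u ps) n≤ ,
  λ x → mk⇔ (λ p → saturated _≟ᵥ_ b u ps n≤ p) (All.lookup ps)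

import Data.Bool
open import Data.Nat.DivMod using (m<n⇒m%n≡m; m<n⇒m/n≡0; [m+kn]%n≡m%n; +-distrib-/-∣ʳ; m*n/n≡m)
import Data.Nat.Tactic.RingSolver as ℕ-Solver
open import Data.List.Membership.Propositional using (find)
open import Data.List.Membership.Propositional.Properties using (∈-++⁺ˡ; ∈-++⁺ʳ)
open import Data.Unit using (tt)
open import Relation.Nullary.Decidable using (_→-dec_)

-- Minimal vectors as numbers

-- The entries of a vector are shifted by 8 and then read as digits in this base.
radix : ℕ
radix = 1048576

pack : ∀ {n} → Vec ℕ n → ℕ
pack [] = 0
pack (d ∷ ds) = d ℕ.+ pack ds ℕ.* radix

digit : ℤ → ℕ
digit z = ℤ.∣ z + + 8 ∣

code : ∀ {n} → Vec ℤ n → ℕ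
code x = pack (map digit x)

pack-% : ∀ {n d} (ds : Vec ℕ n) → d ℕ.< radix → pack (d ∷ ds) % radix ≡ d
pack-% {d = d} ds d< = begin
  (d ℕ.+ pack ds ℕ.* radix) % radix ≡⟨ [m+kn]%n≡m%n d (pack ds) radix ⟩
  d % radix                         ≡⟨ m<n⇒m%n≡m d< ⟩
  d                                 ∎
  where open ≡-Reasoning

pack-/ : ∀ {n d} (ds : Vec ℕ n) → d ℕ.< radix → pack (d ∷ ds) / radix ≡ pack ds
pack-/ {d = d} ds d< = begin
  (d ℕ.+ pack ds ℕ.* radix) / radix           ≡⟨ +-distrib-/-∣ʳ d (ℕ∣.n∣m*n (pack ds)) ⟩
  d / radix ℕ.+ pack ds ℕ.* radix / radix     ≡⟨ cong₂ ℕ._+_ (m<n⇒m/n≡0 d<) (m*n/n≡m (pack ds) radix) ⟩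
  pack ds                                     ∎
  where open ≡-Reasoning

pack-injective : ∀ {n} {ds es : Vec ℕ n} → VAll (ℕ._< radix) ds → VAll (ℕ._< radix) es → pack ds ≡ pack es → ds ≡ es
pack-injective {ds = []} {[]} _ _ _ = refl
pack-injective {ds = d ∷ ds} {e ∷ es} (p ∷ ps) (q ∷ qs) eq = cong₂ _∷_
  (trans (sym (pack-% ds p)) (trans (cong (_% radix) eq) (pack-% es q)))
  (pack-injective ps qs (trans (sym (pack-/ ds p)) (trans (cong (_/ radix) eq) (pack-/ es q))))

-- Entries of vectors of norm at most 48, the largest norm that is enumerated: 7² is 49.
Small : ℤ → Set
Small z = ℤ.∣ z ∣ ℕ.≤ 6

digit-+ : ∀ {z} → Small z → + digit z ≡ z + + 8
digit-+ {+ n} _ = refl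
digit-+ { -[1+ 0 ]} _ = refl
digit-+ { -[1+ 1 ]} _ = refl
digit-+ { -[1+ 2 ]} _ = refl
digit-+ { -[1+ 3 ]} _ = refl
digit-+ { -[1+ 4 ]} _ = refl
digit-+ { -[1+ 5 ]} _ = refl
digit-+ { -[1+ suc (suc (suc (suc (suc (suc _))))) ]} (s≤s (s≤s (s≤s (s≤s (s≤s (s≤s ()))))))

digit-< : ∀ {z} → Small z → digit z ℕ.< 16
digit-< {z} s = ℕₚ.≤-<-trans (ℤₚ.∣i+j∣≤∣i∣+∣j∣ z (+ 8)) (s≤s (ℕₚ.≤-trans (ℕₚ.+-monoˡ-≤ 8 s) (ℕₚ.n≤1+n 14)))

16<radix : 16 ℕ.< radix
16<radix = ℕₚ.<ᵇ⇒< 16 radix tt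

digits-small : ∀ {n} {x : Vec ℤ n} → VAll Small x → VAll (ℕ._< radix) (map digit x)
digits-small [] = []
digits-small {x = z ∷ _} (s ∷ ss) = ℕₚ.<-trans (digit-< {z} s) 16<radix ∷ digits-small ss

code-injective : ∀ {n} {x y : Vec ℤ n} → VAll Small x → VAll Small y → code x ≡ code y → x ≡ y
code-injective {x = x} {y} sx sy e = go sx sy (pack-injective (digits-small {x = x} sx) (digits-small {x = y} sy) e)
  where
  cancel : ∀ a b → a + + 8 ≡ b + + 8 → a ≡ b
  cancel a b e = trans (unshift a) (trans (cong (_- + 8) e) (sym (unshift b)))
    where
    unshift : ∀ a → a ≡ (a + + 8) - + 8
    unshift = solve-∀
  go : ∀ {n} {x y : Vec ℤ n} → VAll Small x → VAll Small y → map digit x ≡ map digit y → x ≡ y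
  go [] [] _ = refl
  go {x = a ∷ _} {b ∷ _} (s ∷ ss) (t ∷ ts) e = cong₂ _∷_ (cancel a b (trans (sym (digit-+ {a} s)) (trans (cong +_ (Vecₚ.∷-injectiveˡ e)) (digit-+ {b} t)))) (go ss ts (Vecₚ.∷-injectiveʳ e))

sq : ℤ → ℕ
sq z = ℤ.∣ z ∣ ℕ.* ℤ.∣ z ∣

sq-+ : ∀ z → + sq z ≡ z * z
sq-+ (+ n) = ℤₚ.pos-* n n
sq-+ -[1+ n ] = refl

norm : ∀ {n} → Vec ℤ n → ℕ
norm [] = 0
norm (z ∷ x) = sq z ℕ.+ norm x

norm-+ : ∀ {n} (x : Vec ℤ n) → + norm x ≡ ⟪ x , x ⟫
norm-+ [] = refl
norm-+ (z ∷ x) = trans (ℤₚ.pos-+ (sq z) (norm x)) (cong₂ _+_ (sq-+ z) (norm-+ x))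

norm-small : ∀ {n} (x : Vec ℤ n) → norm x ℕ.≤ 48 → VAll Small x
norm-small [] _ = []
norm-small (z ∷ x) h = small (ℤ.∣ z ∣) (ℕₚ.≤-trans (ℕₚ.m≤m+n (sq z) (norm x)) h) ∷ norm-small x (ℕₚ.≤-trans (ℕₚ.m≤n+m (norm x) (sq z)) h)
  where
  small : ∀ n → n ℕ.* n ℕ.≤ 48 → n ℕ.≤ 6
  small n h with n ℕ.≤? 6
  ... | yes p = p
  ... | no ¬p = ⊥-elim (ℕₚ.<⇒≱ (ℕₚ.≤-refl {49}) (ℕₚ.≤-trans (ℕₚ.*-mono-≤ (ℕₚ.≰⇒> ¬p) (ℕₚ.≰⇒> ¬p)) h))

least : Bool → Bool → ℕ
least true _ = 1
least false b = 4 ℕ.* bit b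

-- The shifted entries of absolute value at most 6 in a class modulo 4, grouped by their excess (z² − least)/8.
options : Bool → Bool → List (ℕ × List ℕ)
options true false = (0 , 9 ∷ []) ∷ (1 , 5 ∷ []) ∷ (3 , 13 ∷ []) ∷ []
options true true = (0 , 7 ∷ []) ∷ (1 , 11 ∷ []) ∷ (3 , 3 ∷ []) ∷ []
options false false = (0 , 8 ∷ []) ∷ (2 , 12 ∷ 4 ∷ []) ∷ []
options false true = (0 , 10 ∷ 6 ∷ []) ∷ (4 , 14 ∷ 2 ∷ []) ∷ []

Option : Bool → Bool → ℤ → Set
Option β b z = Any (λ { (e , ds) → Any (digit z ≡_) ds × sq z ≡ least β b ℕ.+ 8 ℕ.* e }) (options β b)

-- There are only 13 integers of absolute value at most 6; the table of options is compared with
-- each of them.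
option : ∀ β b z → Small z → z %ℕ 4 ≡ bit β ℕ.+ 2 ℕ.* bit b → Option β b z
option β b z s e = subst (λ z → z %ℕ 4 ≡ bit β ℕ.+ 2 ℕ.* bit b → Option β b z) (recover z s) (table β b (index z s)) e
  where
  entry : Fin 13 → ℤ
  entry i = + toℕ i - + 6
  index< : ∀ z → Small z → ℤ.∣ z + + 6 ∣ ℕ.< 13
  index< z s = s≤s (ℕₚ.≤-trans (ℤₚ.∣i+j∣≤∣i∣+∣j∣ z (+ 6)) (ℕₚ.+-monoˡ-≤ 6 s))
  index : ∀ z → Small z → Fin 13
  index z s = Fin.fromℕ< {ℤ.∣ z + + 6 ∣} (index< z s)
  recover : ∀ z s → entry (index z s) ≡ z
  recover z s = trans (cong (λ n → + n - + 6) (Finₚ.toℕ-fromℕ< {m = ℤ.∣ z + + 6 ∣} (index< z s))) (shift z s)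
    where
    shift : ∀ z → Small z → + ℤ.∣ z + + 6 ∣ - + 6 ≡ z
    shift (+ n) _ = eq (+ n)
      where
      eq : ∀ a → (a + + 6) - + 6 ≡ a
      eq = solve-∀
    shift -[1+ 0 ] _ = refl
    shift -[1+ 1 ] _ = refl
    shift -[1+ 2 ] _ = refl
    shift -[1+ 3 ] _ = refl
    shift -[1+ 4 ] _ = refl
    shift -[1+ 5 ] _ = refl
    shift -[1+ suc (suc (suc (suc (suc (suc _))))) ] (s≤s (s≤s (s≤s (s≤s (s≤s (s≤s ()))))))
  dec : ∀ β b i → Dec (entry i %ℕ 4 ≡ bit β ℕ.+ 2 ℕ.* bit b → Option β b (entry i))
  dec β b i = (entry i %ℕ 4 ℕ.≟ bit β ℕ.+ 2 ℕ.* bit b) →-dec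
    Any.any? (λ { (e , ds) → Any.any? (digit (entry i) ℕ.≟_) ds ×-dec sq (entry i) ℕ.≟ least β b ℕ.+ 8 ℕ.* e }) (options β b)
  table : ∀ β b i → entry i %ℕ 4 ≡ bit β ℕ.+ 2 ℕ.* bit b → Option β b (entry i)
  table true true = decided (Finₚ.all? (dec true true)) refl
  table true false = decided (Finₚ.all? (dec true false)) refl
  table false true = decided (Finₚ.all? (dec false true)) refl
  table false false = decided (Finₚ.all? (dec false false)) refl

-- The last index is the total excess over the least norm that the parity and the codeword allow, in
-- units of 8. Prescribing the norm thus prescribes it, and the enumeration becomes a search for
-- digits with a given total excess.
data Chosen (β : Bool) : ∀ {n} → Vec Bool n → Vec ℕ n → ℕ → Set where
  []  : Chosen β [] [] 0
  _∷_ : ∀ {n b d e es} {h : Vec Bool n} {ds s} → (e , es) ∈ options β b × d ∈ es → Chosen β h ds s → Chosen β (b ∷ h) (d ∷ ds) (e ℕ.+ s)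

leasts : ∀ {n} → Bool → Vec Bool n → ℕ
leasts β [] = 0
leasts β (b ∷ h) = least β b ℕ.+ leasts β h

chosen : ∀ {β n} {x : Vec ℤ n} {h} → Shaped β x h → VAll Small x →
  ∃ λ s → Chosen β h (map digit x) s × norm x ≡ leasts β h ℕ.+ 8 ℕ.* s
chosen [] [] = 0 , [] , refl
chosen {β} (_∷_ {z = z} {b = b} e sh) (s ∷ ss) with find (option β b z s (entry-residue β b e)) | chosen sh ss
... | (c , _) , o , i , eq | t , ch , eqs = c ℕ.+ t , (o , i) ∷ ch , trans (cong₂ ℕ._+_ eq eqs) (regroup (least β b) c _ t)
  where
  regroup : ∀ a b c d → (a ℕ.+ 8 ℕ.* b) ℕ.+ (c ℕ.+ 8 ℕ.* d) ≡ (a ℕ.+ c) ℕ.+ 8 ℕ.* (b ℕ.+ d)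
  regroup = ℕ-Solver.solve-∀

-- The last list is the output that follows; the enumeration is written with such tails throughout,
-- so that no lists are concatenated.
prepend : ℕ → List ℕ → List ℕ → List ℕ
prepend d [] k = k
prepend d (c ∷ cs) k = (d ℕ.+ c ℕ.* radix) ∷ prepend d cs k

prependAll : List ℕ → List ℕ → List ℕ → List ℕ
prependAll [] cs k = k
prependAll (d ∷ ds) cs k = prepend d cs (prependAll ds cs k)

choices : Bool → ∀ {n} → Vec Bool n → ℕ → List ℕ
choicesFrom : Bool → ∀ {n} → Vec Bool n → List (ℕ × List ℕ) → ℕ → List ℕ
choices β [] zero = 0 ∷ []
choices β [] (suc _) = []
choices β (b ∷ h) s = choicesFrom β h (options β b) s
choicesFrom β h [] s = []
choicesFrom β h ((e , ds) ∷ gs) s = if e ℕ.≤ᵇ s then prependAll ds (choices β h (s ℕ.∸ e)) (choicesFrom β h gs s) else choicesFrom β h gs s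

prepend-keeps : ∀ d cs {k z} → z ∈ k → z ∈ prepend d cs k
prepend-keeps d [] i = i
prepend-keeps d (c ∷ cs) i = there (prepend-keeps d cs i)

prepend-∈ : ∀ d {c cs k} → c ∈ cs → d ℕ.+ c ℕ.* radix ∈ prepend d cs k
prepend-∈ d (here refl) = here refl
prepend-∈ d (there i) = there (prepend-∈ d i)

prependAll-keeps : ∀ ds cs {k z} → z ∈ k → z ∈ prependAll ds cs k
prependAll-keeps [] cs i = i
prependAll-keeps (d ∷ ds) cs i = prepend-keeps d cs (prependAll-keeps ds cs i)

prependAll-∈ : ∀ {d ds c cs k} → d ∈ ds → c ∈ cs → d ℕ.+ c ℕ.* radix ∈ prependAll ds cs k
prependAll-∈ {d} (here refl) i = prepend-∈ d i
prependAll-∈ {cs = cs} (there {x = d′} j) i = prepend-keeps d′ cs (prependAll-∈ j i)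

T⇒true : ∀ {b} → T b → b ≡ true
T⇒true {true} _ = refl

choices-complete : ∀ {β n} {h : Vec Bool n} {ds s} → Chosen β h ds s → pack ds ∈ choices β h s
choicesFrom-complete : ∀ {β n d e es} {h : Vec Bool n} {ds s gs} → (e , es) ∈ gs → d ∈ es → Chosen β h ds s →
  d ℕ.+ pack ds ℕ.* radix ∈ choicesFrom β h gs (e ℕ.+ s)
choices-complete [] = here refl
choices-complete ((o , i) ∷ ch) = choicesFrom-complete o i ch
choicesFrom-complete {e = e} {s = s} (here refl) i ch
  rewrite T⇒true (ℕₚ.≤⇒≤ᵇ (ℕₚ.m≤m+n e s)) | ℕₚ.m+n∸m≡n e s = prependAll-∈ i (choices-complete ch)
choicesFrom-complete {β} {e = e} {h = h} {s = s} {gs = (e′ , es′) ∷ _} (there o) i ch with e′ ℕ.≤ᵇ (e ℕ.+ s)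
... | true = prependAll-keeps es′ (choices β h (e ℕ.+ s ℕ.∸ e′)) (choicesFrom-complete o i ch)
... | false = choicesFrom-complete o i ch

-- The sum of the digits is read off modulo radix − 1.
digitSum : ℕ → ℕ
digitSum c = c % 1048575

digitSum-pack : ∀ {n} (ds : Vec ℕ n) → Vec.sum ds ℕ.< 1048575 → digitSum (pack ds) ≡ Vec.sum ds
digitSum-pack ds lt with casting ds
  where
  casting : ∀ {n} (ds : Vec ℕ n) → ∃ λ k → pack ds ≡ Vec.sum ds ℕ.+ k ℕ.* 1048575
  casting [] = 0 , refl
  casting (d ∷ ds) with casting ds
  ... | k , e = k ℕ.+ pack ds , trans (cong (d ℕ.+_) (trans (ℕₚ.*-suc (pack ds) 1048575) (cong (ℕ._+ pack ds ℕ.* 1048575) e))) (regroup d (Vec.sum ds) k (pack ds) 1048575)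
    where
    regroup : ∀ d s k p m → d ℕ.+ (s ℕ.+ k ℕ.* m ℕ.+ p ℕ.* m) ≡ d ℕ.+ s ℕ.+ (k ℕ.+ p) ℕ.* m
    regroup = ℕ-Solver.solve-∀
... | k , e = trans (cong (_% 1048575) e) (trans ([m+kn]%n≡m%n (Vec.sum ds) k 1048575) (m<n⇒m%n≡m lt))

-- Imposes the condition on the coordinate sum modulo 8, which the shift of every entry by 8 leaves
-- unchanged.
keep : ℕ → List ℕ → List ℕ → List ℕ
keep t [] k = k
keep t (c ∷ cs) k = if digitSum c % 8 ℕ.≡ᵇ t then c ∷ keep t cs k else keep t cs k

keep-keeps : ∀ t cs {k z} → z ∈ k → z ∈ keep t cs k
keep-keeps t [] i = i
keep-keeps t (c ∷ cs) i with digitSum c % 8 ℕ.≡ᵇ t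
... | true = there (keep-keeps t cs i)
... | false = keep-keeps t cs i

keep-∈ : ∀ {t z cs k} → z ∈ cs → digitSum z % 8 ≡ t → z ∈ keep t cs k
keep-∈ {t} {z} (here refl) e rewrite T⇒true (ℕₚ.≡⇒≡ᵇ (digitSum z % 8) t e) = here refl
keep-∈ {t} {cs = c ∷ cs} (there i) e with digitSum c % 8 ℕ.≡ᵇ t
... | true = there (keep-∈ i e)
... | false = keep-∈ i e

-- The codewords of the Golay code

bitVectors : ∀ n → List (Vec Bool n)
bitVectors zero = [] ∷ []
bitVectors (suc n) = List.map (true ∷_) (bitVectors n) ++ List.map (false ∷_) (bitVectors n)

bitVectors-complete : ∀ {n} (v : Vec Bool n) → v ∈ bitVectors n
bitVectors-complete [] = here refl
bitVectors-complete (true ∷ v) = ∈-++⁺ˡ (∈-map⁺ (true ∷_) (bitVectors-complete v))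
bitVectors-complete {suc n} (false ∷ v) = ∈-++⁺ʳ (List.map (true ∷_) (bitVectors n)) (∈-map⁺ (false ∷_) (bitVectors-complete v))

-- The generator matrix is [I | A] and the code is self-dual, so a codeword is determined by its last 12 bits.
checks : Vec (Vec Bool 12) 12
checks = map (Vec.drop 12) (Vec.fromList golayRows)

dotParity : ∀ {n} → Vec Bool n → Vec Bool n → Bool
dotParity [] [] = false
dotParity (a ∷ v) (true ∷ t) = a xor dotParity v t
dotParity (a ∷ v) (false ∷ t) = dotParity v t

dotParity-parity : ∀ {n} (v t : Vec Bool n) → dotParity v t ≡ parity (zipWith _∧_ v t)
dotParity-parity [] [] = refl
dotParity-parity (true ∷ v) (true ∷ t) = cong not (dotParity-parity v t)
dotParity-parity (false ∷ v) (true ∷ t) = dotParity-parity v t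
dotParity-parity (true ∷ v) (false ∷ t) = dotParity-parity v t
dotParity-parity (false ∷ v) (false ∷ t) = dotParity-parity v t

encode : Vec Bool 12 → Vec Bool 24
encode v = map (dotParity v) checks Vec.++ v

unitB : ∀ {n} → Fin n → Vec Bool n
unitB zero = true ∷ replicate _ false
unitB (suc i) = false ∷ unitB i

parity-++ : ∀ {m n} (p u : Vec Bool m) (v t : Vec Bool n) →
  parity (zipWith _∧_ (p Vec.++ v) (u Vec.++ t)) ≡ parity (zipWith _∧_ p u) xor parity (zipWith _∧_ v t)
parity-++ [] [] v t = refl
parity-++ (a ∷ p) (b ∷ u) v t rewrite parity-++ p u v t = assoc (a ∧ b) (parity (zipWith _∧_ p u)) _
  where
  assoc : ∀ x y z → x xor (y xor z) ≡ (x xor y) xor z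
  assoc true true true = refl
  assoc true true false = refl
  assoc true false z = refl
  assoc false y z = refl

parity-zeros : ∀ {n} (p : Vec Bool n) → parity (zipWith _∧_ p (replicate n false)) ≡ false
parity-zeros [] = refl
parity-zeros (true ∷ p) = parity-zeros p
parity-zeros (false ∷ p) = parity-zeros p

parity-unitB : ∀ {n} (p : Vec Bool n) i → parity (zipWith _∧_ p (unitB i)) ≡ lookup p i
parity-unitB (true ∷ p) zero = cong not (parity-zeros p)
parity-unitB (false ∷ p) zero = parity-zeros p
parity-unitB (true ∷ p) (suc i) = parity-unitB p i
parity-unitB (false ∷ p) (suc i) = parity-unitB p i

AllRows-lookup : ∀ {c rs} → AllRows c rs → ∀ i → orthogonal c (List.lookup rs i)
AllRows-lookup (o ∷ os) zero = o
AllRows-lookup (o ∷ os) (suc i) = AllRows-lookup os i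

systematic : ∀ i → List.lookup golayRows i ≡ unitB i Vec.++ lookup checks i
systematic = decided (Finₚ.all? (λ i → Vecₚ.≡-dec Data.Bool._≟_ (List.lookup golayRows i) (unitB i Vec.++ lookup checks i))) refl

xor≡false : ∀ a b → a xor b ≡ false → a ≡ b
xor≡false true true _ = refl
xor≡false false b e = sym e

golay-encode : ∀ (p v : Vec Bool 12) → IsGolay (p Vec.++ v) → p Vec.++ v ≡ encode v
golay-encode p v go = cong (Vec._++ v) (ext p checks bits≡)
  where
  bits≡ : ∀ i → lookup p i ≡ parity (zipWith _∧_ v (lookup checks i))
  bits≡ i = xor≡false (lookup p i) (parity (zipWith _∧_ v (lookup checks i)))
    (trans (sym (trans (parity-++ p (unitB i) v (lookup checks i)) (cong (_xor parity (zipWith _∧_ v (lookup checks i))) (parity-unitB p i))))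
      (subst (orthogonal (p Vec.++ v)) (systematic i) (AllRows-lookup go i)))
  ext : ∀ {n} (p : Vec Bool n) (ts : Vec (Vec Bool 12) n) → (∀ i → lookup p i ≡ parity (zipWith _∧_ v (lookup ts i))) →
    p ≡ map (dotParity v) ts
  ext [] [] _ = refl
  ext (a ∷ p) (t ∷ ts) f = cong₂ _∷_ (trans (f zero) (sym (dotParity-parity v t))) (ext p ts (f ∘ suc))

opaque
  codewords : List (Vec Bool 24)
  codewords = List.map encode (bitVectors 12)

  codewords-complete : ∀ {c} → IsGolay c → c ∈ codewords
  codewords-complete {c} go = build (Vec.splitAt 12 c)
    where
    build : (∃ λ (p : Vec Bool 12) → ∃ λ (v : Vec Bool 12) → c ≡ p Vec.++ v) → c ∈ List.map encode (bitVectors 12)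
    build (p , v , e) = subst (_∈ List.map encode (bitVectors 12)) (sym (trans e (golay-encode p v (subst IsGolay e go)))) (∈-map⁺ encode (bitVectors-complete v))

-- Enumeration of the lattice vectors of a given small norm

shortIn : ℕ → Bool → Vec Bool 24 → List ℕ → List ℕ
shortIn N β h k = if leasts β h ℕ.≤ᵇ N then keep (4 ℕ.* bit β) (choices β h ((N ℕ.∸ leasts β h) / 8)) k else k

shorts : ℕ → List (Vec Bool 24) → List ℕ
shorts N [] = []
shorts N (h ∷ hs) = shortIn N true h (shortIn N false h (shorts N hs))

shortIn-keeps : ∀ N β h {k z} → z ∈ k → z ∈ shortIn N β h k
shortIn-keeps N β h i with leasts β h ℕ.≤ᵇ N
... | true = keep-keeps (4 ℕ.* bit β) (choices β h ((N ℕ.∸ leasts β h) / 8)) i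
... | false = i

*8/8 : ∀ s → s ℕ.* 8 / 8 ≡ s
*8/8 s = m*n/n≡m s 8

shortIn-complete : ∀ {β h ds s} k → Chosen β h ds s → digitSum (pack ds) % 8 ≡ 4 ℕ.* bit β → pack ds ∈ shortIn (leasts β h ℕ.+ 8 ℕ.* s) β h k
shortIn-complete {β} {h} {ds} {s} k ch e
  rewrite T⇒true (ℕₚ.≤⇒≤ᵇ (ℕₚ.m≤m+n (leasts β h) (8 ℕ.* s))) | ℕₚ.m+n∸m≡n (leasts β h) (8 ℕ.* s) | ℕₚ.*-comm 8 s | *8/8 s =
  keep-∈ (choices-complete ch) e

shorts-complete : ∀ {x} → InΛ x → norm x ℕ.≤ 48 → code x ∈ shorts (norm x) codewords
shorts-complete {x} ix n≤ = build (InΛ⇒Coset ix)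
  where
  sum-digits : ∀ {n} {x : Vec ℤ n} → VAll Small x → + Vec.sum (map digit x) ≡ sumℤ x + + (n ℕ.* 8)
  sum-digits [] = refl
  sum-digits {suc n} {z ∷ x} (s ∷ ss) = trans (ℤₚ.pos-+ (digit z) _) (trans (cong₂ _+_ (digit-+ {z} s) (sum-digits ss)) (eq z (sumℤ x) (+ (n ℕ.* 8))))
    where
    eq : ∀ a b c → (a + + 8) + (b + c) ≡ (a + b) + (+ 8 + c)
    eq = solve-∀
  sum-≤ : ∀ {n} {x : Vec ℤ n} → VAll Small x → Vec.sum (map digit x) ℕ.≤ n ℕ.* 16
  sum-≤ [] = z≤n
  sum-≤ {x = z ∷ _} (s ∷ ss) = ℕₚ.+-mono-≤ (ℕₚ.<⇒≤ (digit-< {z} s)) (sum-≤ ss)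
  sum-< : ∀ {x : Vec24} → VAll Small x → Vec.sum (map digit x) ℕ.< 1048575
  sum-< {x} ss = ℕₚ.≤-<-trans (sum-≤ {x = x} ss) (ℕₚ.<ᵇ⇒< 384 1048575 tt)
  sm : VAll Small x
  sm = norm-small x n≤
  into : ∀ β {h} hs N → h ∈ hs → (∀ k → code x ∈ shortIn N β h k) → code x ∈ shorts N hs
  into true (h ∷ hs) N (here refl) f = f _
  into false (h ∷ hs) N (here refl) f = shortIn-keeps N true h (f _)
  into β (h ∷ hs) N (there i) f = shortIn-keeps N true h (shortIn-keeps N false h (into β hs N i f))
  build : Coset x → code x ∈ shorts (norm x) codewords
  build (coset β h sh go (k , tot)) with chosen sh sm
  ... | s , ch , eq = into β codewords (norm x) (codewords-complete go) (λ k′ → subst (λ N → code x ∈ shortIn N β h k′) (sym eq)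
      (shortIn-complete k′ ch (trans (cong (_% 8) (digitSum-pack (map digit x) (sum-< sm))) (%ℕ-unique 8 (lt β) (k + + 24) (trans (sum-digits sm) (trans (cong (_+ + 192) tot) (total β)))))))
    where
    lt : ∀ β → 4 ℕ.* bit β ℕ.< 8
    lt true = s≤s (s≤s (s≤s (s≤s (s≤s z≤n))))
    lt false = s≤s z≤n
    -- The 24 entries are shifted by 8 each, whence 192 = 24 · 8.
    total : ∀ β → + 4 * bitℤ β + + 8 * k + + 192 ≡ + (4 ℕ.* bit β) + (k + + 24) * + 8
    total β = trans (eq′ (+ 4 * bitℤ β) k) (cong (_+ (k + + 24) * + 8) (sym (ℤₚ.pos-* 4 (bit β))))
      where
      eq′ : ∀ a k → a + + 8 * k + + 192 ≡ a + (k + + 24) * + 8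
      eq′ = solve-∀

minCodes : List ℕ
minCodes = shorts 32 codewords

opaque
  unfolding codewords

  -- Norms in Λ are multiples of 16, so this evaluation is what makes 32 the minimal norm.
  no-norm-16 : shorts 16 codewords ≡ []
  no-norm-16 = refl

open import Agda.Builtin.Strict using (primForce)
open import Agda.Builtin.Nat using (mod-helper)

-- Inner products of a fixed vector with all minimal vectors

Min : Vec24 → Set
Min a = InΛ a × form8 a a ≡ + 32

-- The base is a variable in order to keep the algebra symbolic. One factor is read from the lowest
-- digit and the other from the highest, so that the middle coefficient of the product of the two
-- numbers is an inner product.
packIn packRev : ℕ → ∀ {n} → Vec ℕ n → ℕ
packIn X [] = 0
packIn X (d ∷ ds) = d ℕ.+ packIn X ds ℕ.* X
packRev X [] = 0
packRev X {suc n} (e ∷ es) = e ℕ.* X ℕ.^ n ℕ.+ packRev X es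

pack≡packIn : ∀ {n} (ds : Vec ℕ n) → pack ds ≡ packIn radix ds
pack≡packIn [] = refl
pack≡packIn (d ∷ ds) = cong (λ p → d ℕ.+ p ℕ.* radix) (pack≡packIn ds)

dot : ∀ {n} → Vec ℕ n → Vec ℕ n → ℕ
dot [] [] = 0
dot (d ∷ ds) (e ∷ es) = d ℕ.* e ℕ.+ dot ds es

packRev-bound : ∀ X E → E ℕ.+ E ℕ.≤ E ℕ.* X → ∀ {n} (es : Vec ℕ n) → VAll (ℕ._< E) es → packRev X es ℕ.* X ℕ.≤ (E ℕ.+ E) ℕ.* X ℕ.^ n
packRev-bound X E E≤ [] [] = z≤n
packRev-bound X E E≤ {suc n} (e ∷ es) (e< ∷ es<) = begin
  (e ℕ.* Y ℕ.+ packRev X es) ℕ.* X           ≡⟨ ℕₚ.*-distribʳ-+ X (e ℕ.* Y) (packRev X es) ⟩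
  e ℕ.* Y ℕ.* X ℕ.+ packRev X es ℕ.* X       ≤⟨ ℕₚ.+-mono-≤ (ℕₚ.*-monoˡ-≤ X (ℕₚ.*-monoˡ-≤ Y (ℕₚ.<⇒≤ e<))) (packRev-bound X E E≤ es es<) ⟩
  E ℕ.* Y ℕ.* X ℕ.+ (E ℕ.+ E) ℕ.* Y          ≤⟨ ℕₚ.+-monoʳ-≤ (E ℕ.* Y ℕ.* X) (ℕₚ.*-monoˡ-≤ Y E≤) ⟩
  E ℕ.* Y ℕ.* X ℕ.+ E ℕ.* X ℕ.* Y            ≡⟨ regroup E Y X ⟩
  (E ℕ.+ E) ℕ.* (X ℕ.* Y)                    ∎
  where
  open ℕₚ.≤-Reasoning
  Y : ℕ
  Y = X ℕ.^ n
  regroup : ∀ a x r → a ℕ.* x ℕ.* r ℕ.+ a ℕ.* r ℕ.* x ≡ (a ℕ.+ a) ℕ.* (r ℕ.* x)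
  regroup = ℕ-Solver.solve-∀

-- The inner product is the digit in the middle of a product of two numbers.
convolution : ∀ D E X → E ℕ.+ E ℕ.≤ E ℕ.* X → ∀ {n} (ds es : Vec ℕ (suc n)) → VAll (ℕ._< D) ds → VAll (ℕ._< E) es → ∃ λ low → ∃ λ high →
  packIn X ds ℕ.* packRev X es ≡ low ℕ.+ (dot ds es ℕ.+ high ℕ.* X) ℕ.* X ℕ.^ n × low ℕ.* X ℕ.≤ D ℕ.* (E ℕ.+ E) ℕ.* n ℕ.* X ℕ.^ n
convolution D E X E≤ {zero} (d ∷ []) (e ∷ []) _ _ = 0 , 0 , eq d e X , z≤n
  where
  eq : ∀ d e x → (d ℕ.+ 0 ℕ.* x) ℕ.* (e ℕ.* 1 ℕ.+ 0) ≡ 0 ℕ.+ (d ℕ.* e ℕ.+ 0 ℕ.+ 0 ℕ.* x) ℕ.* 1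
  eq = ℕ-Solver.solve-∀
convolution D E X E≤ {suc n} (d ∷ ds) (e ∷ es) (d< ∷ ds<) (e< ∷ es<) with convolution D E X E≤ ds es ds< es<
... | low , high , eq , bound = d ℕ.* packRev X es ℕ.+ low ℕ.* X , packIn X ds ℕ.* e ℕ.+ high ,
    trans (expand₁ d (packIn X ds) X e Y (packRev X es))
      (trans (cong (λ p → d ℕ.* e ℕ.* (X ℕ.* Y) ℕ.+ d ℕ.* packRev X es ℕ.+ packIn X ds ℕ.* e ℕ.* X ℕ.* (X ℕ.* Y) ℕ.+ p ℕ.* X) eq)
        (expand₂ d e X Y (packRev X es) (packIn X ds) low (dot ds es) high)) ,
    (begin
      (d ℕ.* packRev X es ℕ.+ low ℕ.* X) ℕ.* X                  ≡⟨ split d (packRev X es) low X ⟩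
      d ℕ.* (packRev X es ℕ.* X) ℕ.+ low ℕ.* X ℕ.* X            ≤⟨ ℕₚ.+-mono-≤ (ℕₚ.*-mono-≤ (ℕₚ.<⇒≤ d<) (packRev-bound X E E≤ es es<)) (ℕₚ.*-monoˡ-≤ X bound) ⟩
      D ℕ.* ((E ℕ.+ E) ℕ.* (X ℕ.* Y)) ℕ.+ D ℕ.* (E ℕ.+ E) ℕ.* n ℕ.* Y ℕ.* X ≡⟨ join D (E ℕ.+ E) n Y X ⟩
      D ℕ.* (E ℕ.+ E) ℕ.* suc n ℕ.* (X ℕ.* Y)                   ∎)
  where
  open ℕₚ.≤-Reasoning
  Y : ℕ
  Y = X ℕ.^ n
  expand₁ : ∀ d p r e x q → (d ℕ.+ p ℕ.* r) ℕ.* (e ℕ.* (r ℕ.* x) ℕ.+ q) ≡ d ℕ.* e ℕ.* (r ℕ.* x) ℕ.+ d ℕ.* q ℕ.+ p ℕ.* e ℕ.* r ℕ.* (r ℕ.* x) ℕ.+ p ℕ.* q ℕ.* r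
  expand₁ = ℕ-Solver.solve-∀
  expand₂ : ∀ d e r x q p l t h → d ℕ.* e ℕ.* (r ℕ.* x) ℕ.+ d ℕ.* q ℕ.+ p ℕ.* e ℕ.* r ℕ.* (r ℕ.* x) ℕ.+ (l ℕ.+ (t ℕ.+ h ℕ.* r) ℕ.* x) ℕ.* r
    ≡ (d ℕ.* q ℕ.+ l ℕ.* r) ℕ.+ (d ℕ.* e ℕ.+ t ℕ.+ (p ℕ.* e ℕ.+ h) ℕ.* r) ℕ.* (r ℕ.* x)
  expand₂ = ℕ-Solver.solve-∀
  split : ∀ d q l r → (d ℕ.* q ℕ.+ l ℕ.* r) ℕ.* r ≡ d ℕ.* (q ℕ.* r) ℕ.+ l ℕ.* r ℕ.* r
  split = ℕ-Solver.solve-∀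
  join : ∀ a b n x r → a ℕ.* (b ℕ.* (r ℕ.* x)) ℕ.+ a ℕ.* b ℕ.* n ℕ.* x ℕ.* r ≡ a ℕ.* b ℕ.* suc n ℕ.* (r ℕ.* x)
  join = ℕ-Solver.solve-∀

top : ℕ
top = 0x10000000000000000000000000000000000000000000000000000000000000000000000000000000000000000000000000000000000000000000

top-power : radix ℕ.^ 23 ≡ top
top-power = ℕₚ.≡ᵇ⇒≡ (radix ℕ.^ 23) top tt

-- The shift by 256 makes all entries positive and disappears from inner products read modulo 256.
raised : Vec24 → Vec ℕ 24
raised = map (λ z → ℤ.∣ z + + 256 ∣)

-- The shift of the other vector by 8 contributes 8 times the coordinate sum of `r`. The offset
-- cancels this contribution and adds 128.
weights offset : Vec24 → ℕ
weights r = packRev radix (raised r)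
offset r = (+ 128 - + 8 * sumℤ r) %ℕ 256

-- `mod-helper 0 255 n 255` is `n % 256`. The digits above the middle one contribute multiples of
-- `radix`, hence of 256, and drop out.
conv : ℕ → ℕ → ℕ → ℕ
conv w k c = mod-helper 0 255 (c ℕ.* w / top ℕ.+ k) 255

-- Inner products are at most 96 in absolute value here, so adding 128 places them between 0 and
-- 255. The value 64 is the inner product -64, at which `r + 4a` is exactly as long as `r`; a
-- smaller value would make it shorter.
value : Vec24 → Vec24 → ℕ
value r a = ℤ.∣ ⟪ r , a ⟫ + + 128 ∣

Moderate : ℤ → Set
Moderate z = ℤ.∣ z ∣ ℕ.≤ 16

norm-moderate : ∀ {n} (x : Vec ℤ n) → norm x ℕ.≤ 256 → VAll Moderate x
norm-moderate [] _ = []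
norm-moderate (z ∷ x) h = small (ℤ.∣ z ∣) (ℕₚ.≤-trans (ℕₚ.m≤m+n (sq z) (norm x)) h) ∷ norm-moderate x (ℕₚ.≤-trans (ℕₚ.m≤n+m (norm x) (sq z)) h)
  where
  small : ∀ n → n ℕ.* n ℕ.≤ 256 → n ℕ.≤ 16
  small n h with n ℕ.≤? 16
  ... | yes p = p
  ... | no ¬p = ⊥-elim (ℕₚ.<⇒≱ (ℕₚ.<ᵇ⇒< 256 289 tt) (ℕₚ.≤-trans (ℕₚ.*-mono-≤ (ℕₚ.≰⇒> ¬p) (ℕₚ.≰⇒> ¬p)) h))

nonneg-abs : ∀ {z} → + 0 ℤ.≤ z → + ℤ.∣ z ∣ ≡ z
nonneg-abs = ℤₚ.0≤i⇒+∣i∣≡i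

-∣∣≤ : ∀ {z n} → ℤ.∣ z ∣ ℕ.≤ n → + 0 ℤ.≤ z + + n
-∣∣≤ {+ m} _ = +≤+ z≤n
-∣∣≤ { -[1+ m ]} {n} h = subst (+ 0 ℤ.≤_) (sym (ℤₚ.⊖-≥ h)) (+≤+ z≤n)

raised-+ : ∀ {z} → Moderate z → + ℤ.∣ z + + 256 ∣ ≡ z + + 256
raised-+ {z} m = nonneg-abs (-∣∣≤ {z} (ℕₚ.≤-trans m (ℕₚ.≤ᵇ⇒≤ 16 256 tt)))

raised-< : ∀ {n} {r : Vec ℤ n} → VAll Moderate r → VAll (ℕ._< 512) (map (λ z → ℤ.∣ z + + 256 ∣) r)
raised-< [] = []
raised-< {r = z ∷ r} (m ∷ ms) = ℕₚ.≤-<-trans (ℕₚ.≤-trans (ℤₚ.∣i+j∣≤∣i∣+∣j∣ z (+ 256)) (ℕₚ.+-monoˡ-≤ 256 m)) (ℕₚ.<ᵇ⇒< 272 512 tt) ∷ raised-< ms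

digits-16 : ∀ {n} {x : Vec ℤ n} → VAll Small x → VAll (ℕ._< 16) (map digit x)
digits-16 [] = []
digits-16 {x = z ∷ _} (s ∷ ss) = digit-< {z} s ∷ digits-16 ss

dot-+ : ∀ {n} {a r : Vec ℤ n} → VAll Small a → VAll Moderate r →
  ∃ λ k → + dot (map digit a) (map (λ z → ℤ.∣ z + + 256 ∣) r) ≡ ⟪ r , a ⟫ + + 8 * sumℤ r + k * + 256
dot-+ {a = []} {[]} [] [] = + 0 , refl
dot-+ {a = x ∷ a} {y ∷ r} (s ∷ ss) (m ∷ ms) with dot-+ ss ms
... | k , e = x + + 8 + k , trans (ℤₚ.pos-+ (digit x ℕ.* ℤ.∣ y + + 256 ∣) _) (trans (cong₂ _+_ (trans (ℤₚ.pos-* (digit x) _) (cong₂ _*_ (digit-+ {x} s) (raised-+ {y} m))) e)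
    (eq x y ⟪ r , a ⟫ (sumℤ r) k))
  where
  eq : ∀ x y p q k → (x + + 8) * (y + + 256) + (p + + 8 * q + k * + 256) ≡ (y * x + p) + + 8 * (y + q) + (x + + 8 + k) * + 256
  eq = solve-∀

norm≡ : ∀ {x : Vec24} {n} → form8 x x ≡ + n → norm x ≡ n
norm≡ {x} e = ℤₚ.+-injective (trans (norm-+ x) e)

Min-small : ∀ {a} → Min a → VAll Small a
Min-small {a} (_ , e) = norm-small a (subst (ℕ._≤ 48) (sym (norm≡ {a} e)) (ℕₚ.≤ᵇ⇒≤ 32 48 tt))

Min-code : ∀ {a} → Min a → code a ∈ minCodes
Min-code {a} (i , e) = subst (λ N → code a ∈ shorts N codewords) (norm≡ {a} e) (shorts-complete i (subst (ℕ._≤ 48) (sym (norm≡ {a} e)) (ℕₚ.≤ᵇ⇒≤ 32 48 tt)))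

-- |⟪r,a⟫| ≤ 96 since r ± 2a have non-negative norm.
pairing-bound : ∀ {r a} → norm r ℕ.≤ 256 → form8 a a ≡ + 32 → ℤ.∣ ⟪ r , a ⟫ ∣ ℕ.≤ 96
pairing-bound {r} {a} h e = go ⟪ r , a ⟫ (side (+ 2)) (side -[1+ 1 ])
  where
  side : ∀ k → + 0 ℤ.≤ ⟪ r , r ⟫ + + 2 * (+ 1 * k) * ⟪ r , a ⟫ + k * k * + 32
  side k = subst (λ n → + 0 ℤ.≤ n) (trans (norm-comb (+ 1) k r a) (cong₂ (λ p q → p + + 2 * (+ 1 * k) * ⟪ r , a ⟫ + k * k * q) (ℤₚ.*-identityˡ ⟪ r , r ⟫) e))
    (norm-nonneg (+ 1 ⊙ r ⊕ k ⊙ a))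
  rr : ⟪ r , r ⟫ ℤ.≤ + 256
  rr = subst (ℤ._≤ + 256) (norm-+ r) (+≤+ h)
  cancel : ∀ n → 4 ℕ.* n ℕ.≤ 384 → n ℕ.≤ 96
  cancel n h = ℕₚ.*-cancelˡ-≤ 4 h
  drop : ∀ {q m} → q ℤ.≤ + 256 → + 0 ℤ.≤ q - + m + + 128 → m ℕ.≤ 384
  drop {q} {m} q≤ p = ℤₚ.drop‿+≤+ (subst₂ ℤ._≤_ (l q (+ m)) (r′ (+ 256)) (ℤₚ.+-mono-≤ (ℤₚ.+-monoʳ-≤ (+ m) p) q≤′))
    where
    q≤′ : - q + q ℤ.≤ - q + + 256
    q≤′ = ℤₚ.+-monoʳ-≤ (- q) q≤
    l : ∀ q m → (m + + 0) + (- q + q) ≡ m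
    l = solve-∀
    r′ : ∀ c → (+ m + (q - + m + + 128)) + (- q + c) ≡ c + + 128
    r′ c = eq q (+ m) c
      where
      eq : ∀ q m c → (m + (q - m + + 128)) + (- q + c) ≡ c + + 128
      eq = solve-∀
  go : ∀ z → + 0 ℤ.≤ ⟪ r , r ⟫ + + 2 * (+ 1 * + 2) * z + + 2 * + 2 * + 32 → + 0 ℤ.≤ ⟪ r , r ⟫ + + 2 * (+ 1 * -[1+ 1 ]) * z + -[1+ 1 ] * -[1+ 1 ] * + 32 → ℤ.∣ z ∣ ℕ.≤ 96
  go (+ n) _ p = cancel n (drop rr (subst (+ 0 ℤ.≤_) (trans (eq ⟪ r , r ⟫ (+ n)) (cong (λ m → ⟪ r , r ⟫ - m + + 128) (sym (ℤₚ.pos-* 4 n)))) p))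
    where
    eq : ∀ q n → q + + 2 * (+ 1 * -[1+ 1 ]) * n + + 128 ≡ q - + 4 * n + + 128
    eq = solve-∀
  go -[1+ n ] p _ = cancel (suc n) (drop rr (subst (+ 0 ℤ.≤_) (trans (eq ⟪ r , r ⟫ (+ suc n)) (cong (λ m → ⟪ r , r ⟫ - m + + 128) (sym (ℤₚ.pos-* 4 (suc n))))) p))
    where
    eq : ∀ q n → q + + 2 * (+ 1 * + 2) * (- n) + + 128 ≡ q - + 4 * n + + 128
    eq = solve-∀

value-+ : ∀ {r a} → norm r ℕ.≤ 256 → Min a → + value r a ≡ ⟪ r , a ⟫ + + 128
value-+ {r} {a} h (_ , e) = nonneg-abs (-∣∣≤ {⟪ r , a ⟫} (ℕₚ.≤-trans (pairing-bound {r} {a} h e) (ℕₚ.≤ᵇ⇒≤ 96 128 tt)))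

value-< : ∀ {r a} → norm r ℕ.≤ 256 → Min a → value r a ℕ.< 256
value-< {r} {a} h (_ , e) = ℕₚ.≤-<-trans (ℕₚ.≤-trans (ℤₚ.∣i+j∣≤∣i∣+∣j∣ ⟪ r , a ⟫ (+ 128)) (ℕₚ.+-monoˡ-≤ 128 (pairing-bound {r} {a} h e))) (ℕₚ.<ᵇ⇒< 224 256 tt)

div-top : ∀ X .{{_ : ℕ.NonZero X}} {low q} → low ℕ.< X → (low ℕ.+ q ℕ.* X) / X ≡ q
div-top X {low} {q} l< = trans (+-distrib-/-∣ʳ low (ℕ∣.n∣m*n q)) (cong₂ ℕ._+_ (m<n⇒m/n≡0 l<) (m*n/n≡m q X))

conv-value : ∀ {r a} → norm r ℕ.≤ 256 → Min a → conv (weights r) (offset r) (code a) ≡ value r a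
conv-value {r} {a} h m = go (convolution 16 512 radix (ℕₚ.≤ᵇ⇒≤ (512 ℕ.+ 512) (512 ℕ.* radix) tt) (map digit a) (raised r) (digits-16 sa) (raised-< mr)) (dot-+ sa mr)
  where
  sa : VAll Small a
  sa = Min-small m
  mr : VAll Moderate r
  mr = norm-moderate r h
  D : ℕ
  D = dot (map digit a) (raised r)
  t : ℤ
  t = + 128 - + 8 * sumℤ r
  go : (∃ λ low → ∃ λ high → packIn radix (map digit a) ℕ.* packRev radix (raised r) ≡ low ℕ.+ (D ℕ.+ high ℕ.* radix) ℕ.* radix ℕ.^ 23 × low ℕ.* radix ℕ.≤ 16 ℕ.* (512 ℕ.+ 512) ℕ.* 23 ℕ.* radix ℕ.^ 23) →
    (∃ λ k → + D ≡ ⟪ r , a ⟫ + + 8 * sumℤ r + k * + 256) → conv (weights r) (offset r) (code a) ≡ value r a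
  go (low , high , eq , bound) (k , eqD) = trans (cong (λ q → (q ℕ.+ offset r) % 256) quotient)
      (%ℕ-unique 256 (value-< {r} {a} h m) (k + + high * + 4096 - t /ℕ 256) residue-eq)
    where
    -- The digits below the middle carry nothing into it, because 16 · 1024 · 23 is less than
    -- `radix`.
    low< : low ℕ.< top
    low< = ℕₚ.*-cancelʳ-< radix low top (ℕₚ.≤-<-trans (subst (λ X → low ℕ.* radix ℕ.≤ 16 ℕ.* (512 ℕ.+ 512) ℕ.* 23 ℕ.* X) top-power bound)
      (subst (16384 ℕ.* 23 ℕ.* top ℕ.<_) (ℕₚ.*-comm radix top) (ℕₚ.<ᵇ⇒< (16384 ℕ.* 23 ℕ.* top) (radix ℕ.* top) tt)))
    quotient : code a ℕ.* weights r / top ≡ D ℕ.+ high ℕ.* radix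
    quotient = trans (cong (_/ top) (trans (cong (ℕ._* weights r) (pack≡packIn (map digit a))) (trans eq (cong (λ X → low ℕ.+ (D ℕ.+ high ℕ.* radix) ℕ.* X) top-power)))) (div-top top {low} {D ℕ.+ high ℕ.* radix} low<)
    residue-eq : + (D ℕ.+ high ℕ.* radix ℕ.+ offset r) ≡ + value r a + (k + + high * + 4096 - t /ℕ 256) * + 256
    residue-eq = begin
      + (D ℕ.+ high ℕ.* radix ℕ.+ offset r)                ≡⟨ trans (ℤₚ.pos-+ (D ℕ.+ high ℕ.* radix) (offset r)) (cong (_+ + offset r) (trans (ℤₚ.pos-+ D (high ℕ.* radix)) (cong (_+_ (+ D)) (ℤₚ.pos-* high radix)))) ⟩
      + D + + high * + radix + + offset r                  ≡⟨ cong₂ (λ p q → p + + high * + radix + q) eqD (rest t) ⟩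
      (⟪ r , a ⟫ + + 8 * sumℤ r + k * + 256) + + high * + radix + (t - t /ℕ 256 * + 256) ≡⟨ collect ⟪ r , a ⟫ (sumℤ r) k (+ high) (t /ℕ 256) ⟩
      (⟪ r , a ⟫ + + 128) + (k + + high * + 4096 - t /ℕ 256) * + 256 ≡⟨ cong (_+ (k + + high * + 4096 - t /ℕ 256) * + 256) (value-+ {r} {a} h m) ⟨
      + value r a + (k + + high * + 4096 - t /ℕ 256) * + 256 ∎
      where
      open ≡-Reasoning
      rest : ∀ t → + (t %ℕ 256) ≡ t - t /ℕ 256 * + 256
      rest t = trans (sub (+ (t %ℕ 256)) (t /ℕ 256 * + 256)) (cong (_- t /ℕ 256 * + 256) (sym (a≡a%ℕn+[a/ℕn]*n t 256)))
        where
        sub : ∀ a b → a ≡ (a + b) - b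
        sub = solve-∀
      collect : ∀ p s k h q → (p + + 8 * s + k * + 256) + h * + 1048576 + ((+ 128 - + 8 * s) - q * + 256) ≡ (p + + 128) + (k + h * + 4096 - q) * + 256
      collect = solve-∀

-- What one pass over the minimal vectors reveals about a vector

open import Agda.Builtin.Strict using (primForceLemma)
open import Data.Nat.ListAction using (sum)
open import Data.Nat.ListAction.Properties using (sum-↭)
open import Data.List.Membership.Propositional.Properties using (∈-∃++)
open import Data.List.Relation.Binary.Permutation.Propositional using (_↭_; ↭-sym)
open import Data.List.Relation.Binary.Permutation.Propositional.Properties using (shift; map⁺; ∈-resp-↭; ↭-length)

-- A repetition-free list inside `ys` that is at least as long as `ys` is a permutation of it. Sums
-- over all minimal vectors can thus be computed from their codes, once enough minimal vectors are
-- known.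
sublist-sum : ∀ (f : ℕ → ℕ) {xs ys} → Unique xs → All (_∈ ys) xs → length ys ℕ.≤ length xs → sum (List.map f xs) ≡ sum (List.map f ys)
sublist-sum f {[]} {[]} _ _ _ = refl
sublist-sum f {x ∷ xs} (x∉ ∷ u) (i ∷ is) len with ∈-∃++ i
... | as , bs , refl = trans (cong (f x ℕ.+_) (sublist-sum f u rest (ℕ.s≤s⁻¹ (subst (ℕ._≤ _) (↭-length (shift x as bs)) len))))
    (sum-↭ (↭-sym (map⁺ f (shift x as bs))))
  where
  rest : All (_∈ as ++ bs) xs
  rest = All.zipWith (λ { (n , j) → drop n (∈-resp-↭ (shift x as bs) j) }) (x∉ , is)
    where
    drop : ∀ {y} → x ≢ y → y ∈ x ∷ as ++ bs → y ∈ as ++ bs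
    drop n (here e) = ⊥-elim (n (sym e))
    drop n (there j) = j

∧-true : ∀ {p q} → p ∧ q ≡ true → p ≡ true × q ≡ true
∧-true {true} e = refl , e

-- All numbers compared here are inner products plus 128, as returned by conv;
-- the target is tested against its negative, so that both tests only concern rare small values.
module Scan (w k target nears ats total : ℕ) where

  scan : List ℕ → (a b s : ℕ) → Bool
  look : ℕ → List ℕ → (a b s : ℕ) → Bool
  rare : ℕ → List ℕ → (a b s : ℕ) → Bool
  scan [] a b s = (a ℕ.≤ᵇ nears) ∧ (b ℕ.≤ᵇ ats) ∧ (s ℕ.≡ᵇ total)
  scan (x ∷ xs) a b s = look (conv w k x) xs a b s
  look v xs a b s = primForce (s ℕ.+ v % 32) λ s → if target ℕ.<ᵇ v then scan xs a b s else rare v xs a b s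
  rare v xs a b s = if v ℕ.<ᵇ 64 then false else scan xs (if v ℕ.≡ᵇ 64 then suc a else a) (if v ℕ.≡ᵇ target then suc b else b) s

  hits : ℕ → List ℕ → List ℕ
  hits t = filter (λ x → conv w k x ℕ.≟ t)

  Scanned : List ℕ → (a b s : ℕ) → Set
  Scanned xs a b s = All (λ x → 64 ℕ.≤ conv w k x) xs × length (hits 64 xs) ℕ.+ a ℕ.≤ nears
    × length (hits target xs) ℕ.+ b ℕ.≤ ats × sum (List.map (λ x → conv w k x % 32) xs) ℕ.+ s ≡ total

  hits-step : ∀ t x xs n → length (hits t (x ∷ xs)) ℕ.+ n ≡ length (hits t xs) ℕ.+ (if conv w k x ℕ.≡ᵇ t then suc n else n)
  hits-step t x xs n with conv w k x ℕ.≟ t | conv w k x ℕ.≡ᵇ t in eq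
  ... | yes e | true = sym (ℕₚ.+-suc (length (hits t xs)) n)
  ... | yes e | false = ⊥-elim (subst T eq (ℕₚ.≡⇒≡ᵇ (conv w k x) t e))
  ... | no ne | true = ⊥-elim (ne (ℕₚ.≡ᵇ⇒≡ (conv w k x) t (subst T (sym eq) tt)))
  ... | no ne | false = refl

  scan-sound : 64 ℕ.≤ target → ∀ xs {a b s} → scan xs a b s ≡ true → Scanned xs a b s
  scan-sound 64≤ [] {a} {b} {s} e with ∧-true e
  ... | p , e′ with ∧-true e′
  ... | q , r = [] , ℕₚ.≤ᵇ⇒≤ a nears (subst T (sym p) tt) , ℕₚ.≤ᵇ⇒≤ b ats (subst T (sym q) tt) , ℕₚ.≡ᵇ⇒≡ s total (subst T (sym r) tt)
  scan-sound 64≤ (x ∷ xs) {a} {b} {s} e = go (target ℕ.<ᵇ v) refl (trans (sym (primForceLemma (s ℕ.+ v % 32) _)) e)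
    where
    v : ℕ
    v = conv w k x
    combine : 64 ℕ.≤ v → Scanned xs (if v ℕ.≡ᵇ 64 then suc a else a) (if v ℕ.≡ᵇ target then suc b else b) (s ℕ.+ v % 32) → Scanned (x ∷ xs) a b s
    combine h (l , p , q , t) = h ∷ l , subst (ℕ._≤ nears) (sym (hits-step 64 x xs a)) p , subst (ℕ._≤ ats) (sym (hits-step target x xs b)) q ,
      trans (regroup (v % 32) (sum (List.map (λ x → conv w k x % 32) xs)) s) t
      where
      regroup : ∀ a b c → a ℕ.+ b ℕ.+ c ≡ b ℕ.+ (c ℕ.+ a)
      regroup = ℕ-Solver.solve-∀
    differs : ∀ t {n} → t ℕ.< v → (if v ℕ.≡ᵇ t then suc n else n) ≡ n
    differs t h with v ℕ.≡ᵇ t in eq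
    ... | true = ⊥-elim (ℕₚ.<-irrefl (sym (ℕₚ.≡ᵇ⇒≡ v t (subst T (sym eq) tt))) h)
    ... | false = refl
    go : ∀ q → (target ℕ.<ᵇ v) ≡ q → (if q then scan xs a b (s ℕ.+ v % 32) else rare v xs a b (s ℕ.+ v % 32)) ≡ true → Scanned (x ∷ xs) a b s
    go true eq e = combine (ℕₚ.≤-trans 64≤ (ℕₚ.<⇒≤ lt))
        (subst₂ (λ m n → Scanned xs m n (s ℕ.+ v % 32)) (sym (differs 64 (ℕₚ.≤-<-trans 64≤ lt))) (sym (differs target lt)) (scan-sound 64≤ xs e))
      where
      lt : target ℕ.< v
      lt = ℕₚ.<ᵇ⇒< target v (subst T (sym eq) tt)
    go false eq e = low (v ℕ.<ᵇ 64) refl e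
      where
      low : ∀ q → (v ℕ.<ᵇ 64) ≡ q → (if q then false else scan xs (if v ℕ.≡ᵇ 64 then suc a else a) (if v ℕ.≡ᵇ target then suc b else b) (s ℕ.+ v % 32)) ≡ true → Scanned (x ∷ xs) a b s
      low false eq e = combine (ℕₚ.≮⇒≥ (λ h → subst T eq (ℕₚ.<⇒<ᵇ h))) (scan-sound 64≤ xs e)

-- `near-≥` says that no `r + 4a` with minimal `a` is shorter than `r`, and `near` bounds those
-- equally long. The bound `at` is the multiplicity with which `r` is reached in the double count
-- for the size of its orbit.
record Profile (r : Vec24) (target nears ats total : ℕ) : Set where
  field
    near-≥ : ∀ {a} → Min a → 64 ℕ.≤ value r a
    near   : AtMost (λ a → Min a × value r a ≡ 64) nears
    at     : AtMost (λ a → Min a × value r a ≡ target) ats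
    -- the sum over all minimal vectors, provided that minCodes has no superfluous entries
    sums   : ∀ {l} → Unique l → All Min l → length minCodes ℕ.≤ length l → sum (List.map (λ a → value r a % 32) l) ≡ total

profile : ∀ {r target nears ats total} → norm r ℕ.≤ 256 → 64 ℕ.≤ target →
  Scan.scan (weights r) (offset r) target nears ats total minCodes 0 0 0 ≡ true → Profile r target nears ats total
profile {r} {target} {nears} {ats} {total} h 64≤ e = record
  { near-≥ = λ {a} m → subst (64 ℕ.≤_) (conv-value {r} {a} h m) (All.lookup (proj₁ sc) (Min-code m))
  ; near = bounded 64 (subst (ℕ._≤ nears) (ℕₚ.+-identityʳ _) (proj₁ (proj₂ sc)))
  ; at = bounded target (subst (ℕ._≤ ats) (ℕₚ.+-identityʳ _) (proj₁ (proj₂ (proj₂ sc))))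
  ; sums = λ {l} u ms len → begin
      sum (List.map (λ a → value r a % 32) l)                ≡⟨ cong sum (values ms) ⟩
      sum (List.map res (List.map code l))                   ≡⟨ sublist-sum res (unique-map code (λ p q → code-injective (Min-small p) (Min-small q)) ms u)
                                                                  (Allₚ.map⁺ (All.map Min-code ms)) (subst (length minCodes ℕ.≤_) (sym (Listₚ.length-map code l)) len) ⟩
      sum (List.map res minCodes)                            ≡⟨ ℕₚ.+-identityʳ _ ⟨
      sum (List.map res minCodes) ℕ.+ 0                      ≡⟨ proj₂ (proj₂ (proj₂ sc)) ⟩
      total                                                  ∎ }
  where
  open Scan (weights r) (offset r) target nears ats total
  open ≡-Reasoning
  res : ℕ → ℕ
  res x = conv (weights r) (offset r) x % 32
  sc : Scanned minCodes 0 0 0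
  sc = scan-sound 64≤ minCodes e
  values : ∀ {l} → All Min l → List.map (λ a → value r a % 32) l ≡ List.map res (List.map code l)
  values [] = refl
  values {a ∷ _} (m ∷ ms) = cong₂ _∷_ (cong (_% 32) (sym (conv-value {r} {a} h m))) (values ms)
  bounded : ∀ t {n} → length (hits t minCodes) ℕ.≤ n → AtMost (λ a → Min a × value r a ≡ t) n
  bounded t le = AtMost-≤ le (AtMost-map code (λ p q → code-injective (Min-small (proj₁ p)) (Min-small (proj₁ q)))
    (λ { {a} (m , eq) → ∈-filter⁺ (λ x → conv (weights r) (offset r) x ℕ.≟ t) (Min-code m) (trans (conv-value {r} {a} h m) eq) }) (AtMost-list ℕₚ._≟_ (hits t minCodes)))

open import Agda.Builtin.Nat using (div-helper)
open import Data.List.Relation.Binary.Permutation.Propositional using (prep; ↭-trans; ↭⇒↭ₛ)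
open import Data.List.Relation.Binary.Permutation.Propositional.Properties using (++⁺ˡ)
import Data.List.Relation.Binary.Permutation.Setoid.Properties as Permₛ
open import Relation.Binary.PropositionalEquality using (setoid)

-- Acting with a matrix on codes

full : ℕ
full = 0x1000000000000000000000000000000000000000000000000000000000000000000000000000000000000000000000000000000000000000000000000

full-power : radix ℕ.^ 24 ≡ full
full-power = refl

-- Evaluation at `radix` for entries of any size and sign. Unlike `code` it is linear, and it
-- differs from it only by the shift, see `code-ev`.
ev : ∀ {n} → Vec ℤ n → ℤ
ev [] = + 0
ev (z ∷ x) = z + ev x * + radix

ev-⊕ : ∀ {n} (x y : Vec ℤ n) → ev (x ⊕ y) ≡ ev x + ev y
ev-⊕ [] [] = refl
ev-⊕ (a ∷ x) (b ∷ y) rewrite ev-⊕ x y = eq a b (ev x) (ev y) (+ radix)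
  where
  eq : ∀ a b p q r → (a + b) + (p + q) * r ≡ (a + p * r) + (b + q * r)
  eq = solve-∀

ev-⊙ : ∀ {n} k (x : Vec ℤ n) → ev (k ⊙ x) ≡ k * ev x
ev-⊙ k [] = sym (ℤₚ.*-zeroʳ k)
ev-⊙ k (a ∷ x) rewrite ev-⊙ k x = eq k a (ev x) (+ radix)
  where
  eq : ∀ k a p r → k * a + k * p * r ≡ k * (a + p * r)
  eq = solve-∀

ev-𝟎 : ∀ n → ev (𝟎 {n}) ≡ + 0
ev-𝟎 zero = refl
ev-𝟎 (suc n) rewrite ev-𝟎 n = refl

𝟏 : ∀ {n} → Vec ℤ n
𝟏 = replicate _ (+ 1)

code-ev : ∀ {n} {x : Vec ℤ n} → VAll Small x → + code x ≡ ev x + + 8 * ev (𝟏 {n})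
code-ev [] = refl
code-ev {suc n} {z ∷ x} (s ∷ ss) = trans (ℤₚ.pos-+ (digit z) (code x ℕ.* radix)) (trans (cong₂ _+_ (digit-+ {z} s)
  (trans (ℤₚ.pos-* (code x) radix) (cong (_* + radix) (code-ev ss)))) (eq z (ev x) (ev (𝟏 {n})) (+ radix)))
  where
  eq : ∀ z p q r → (z + + 8) + (p + + 8 * q) * r ≡ (z + p * r) + + 8 * (+ 1 + q * r)
  eq = solve-∀

columnCode : Vec24 → ℕ
columnCode c = ev c %ℕ full

evs : ∀ {n} → Vec Vec24 n → ℤ
evs N = sumℤ (map ev N)

-- Balances the shifts by 8: those in the argument contribute 8 · `evs N` too much, whereas eight
-- times the code of the image needs 64 · `ev 𝟏`.
constant : Vec Vec24 24 → ℕ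
constant N = (+ 64 * ev (𝟏 {24}) - + 8 * evs N) %ℕ full

peel : List ℕ → ℕ → ℕ → ℕ
peel [] n acc = acc % full / 8
-- n / radix and n % radix, written out for speed
peel (c ∷ cs) n acc = peel cs (div-helper 0 1048575 n 1048575) (acc ℕ.+ mod-helper 0 1048575 n 1048575 ℕ.* c)

record Gen : Set where
  constructor _,_
  field
    columns : List ℕ
    shiftBy : ℕ

step : Gen → ℕ → ℕ
step (cs , k) n = peel cs n k

gen : Vec Vec24 24 → Gen
gen M = Vec.toList (map columnCode (transpose M)) , constant (transpose M)

peel-dot : ∀ {n} (ds cs : Vec ℕ n) acc → VAll (ℕ._< radix) ds → peel (Vec.toList cs) (pack ds) acc ≡ (acc ℕ.+ dot ds cs) % full / 8
peel-dot [] [] acc _ = cong (λ n → n % full / 8) (sym (ℕₚ.+-identityʳ acc))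
peel-dot (d ∷ ds) (c ∷ cs) acc (p ∷ ps) = trans (cong₂ (λ q r → peel (Vec.toList cs) q (acc ℕ.+ r ℕ.* c)) (pack-/ ds p) (pack-% ds p))
  (trans (peel-dot ds cs (acc ℕ.+ d ℕ.* c) ps) (cong (λ n → n % full / 8) (ℕₚ.+-assoc acc (d ℕ.* c) (dot ds cs))))

mod-split : ∀ d .{{_ : ℕ.NonZero d}} z → + (z %ℕ d) ≡ z - z /ℕ d * + d
mod-split d z = trans (sub (+ (z %ℕ d)) (z /ℕ d * + d)) (cong (_- z /ℕ d * + d) (sym (a≡a%ℕn+[a/ℕn]*n z d)))
  where
  sub : ∀ a b → a ≡ (a + b) - b
  sub = solve-∀

dot-columns : ∀ {n} {a : Vec ℤ n} (N : Vec Vec24 n) → VAll Small a →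
  ∃ λ q → + dot (map digit a) (map columnCode N) ≡ ev (comb a N) + + 8 * evs N + q * + full
dot-columns [] [] = + 0 , cong (λ e → e + + 0 + + 0) (sym (ev-𝟎 24))
dot-columns {a = z ∷ a} (c ∷ N) (s ∷ ss) = combine (dot-columns N ss)
  where
  combine : (∃ λ q → + dot (map digit a) (map columnCode N) ≡ ev (comb a N) + + 8 * evs N + q * + full) →
    ∃ λ q → + dot (map digit (z ∷ a)) (map columnCode (c ∷ N)) ≡ ev (comb (z ∷ a) (c ∷ N)) + + 8 * evs (c ∷ N) + q * + full
  combine (q , e) = q - (z + + 8) * (ev c /ℕ full) , (begin
    + (digit z ℕ.* columnCode c ℕ.+ dot (map digit a) (map columnCode N))
      ≡⟨ trans (ℤₚ.pos-+ (digit z ℕ.* columnCode c) _) (cong₂ _+_ (ℤₚ.pos-* (digit z) (columnCode c)) e) ⟩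
    + digit z * + columnCode c + (ev (comb a N) + + 8 * evs N + q * + full)
      ≡⟨ cong₂ (λ u v → u * v + (ev (comb a N) + + 8 * evs N + q * + full)) (digit-+ {z} s) (mod-split full (ev c)) ⟩
    (z + + 8) * (ev c - ev c /ℕ full * + full) + (ev (comb a N) + + 8 * evs N + q * + full)
      ≡⟨ eq z (ev c) (ev c /ℕ full) (ev (comb a N)) (evs N) q (+ full) ⟩
    (z * ev c + ev (comb a N)) + + 8 * (ev c + evs N) + (q - (z + + 8) * (ev c /ℕ full)) * + full
      ≡⟨ cong (λ t → t + + 8 * (ev c + evs N) + (q - (z + + 8) * (ev c /ℕ full)) * + full)
           (trans (cong (_+ ev (comb a N)) (sym (ev-⊙ z c))) (sym (ev-⊕ (z ⊙ c) (comb a N)))) ⟩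
    ev (comb (z ∷ a) (c ∷ N)) + + 8 * evs (c ∷ N) + (q - (z + + 8) * (ev c /ℕ full)) * + full ∎)
    where
    open ≡-Reasoning
    eq : ∀ z e k p s q f → (z + + 8) * (e - k * f) + (p + + 8 * s + q * f) ≡ (z * e + p) + + 8 * (e + s) + (q - (z + + 8) * k) * f
    eq = solve-∀

packIn-bound : ∀ X D → D ℕ.* 8 ℕ.< X → ∀ {n} (ds : Vec ℕ n) → VAll (ℕ._< D) ds → packIn X ds ℕ.* 8 ℕ.< X ℕ.^ n
packIn-bound X D D< [] [] = s≤s z≤n
packIn-bound X D D< {suc n} (d ∷ ds) (p ∷ ps) = begin-strict
  (d ℕ.+ packIn X ds ℕ.* X) ℕ.* 8       ≡⟨ regroup d (packIn X ds) X ⟩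
  d ℕ.* 8 ℕ.+ packIn X ds ℕ.* 8 ℕ.* X   <⟨ ℕₚ.+-monoˡ-< (packIn X ds ℕ.* 8 ℕ.* X) (ℕₚ.≤-<-trans (ℕₚ.*-monoˡ-≤ 8 (ℕₚ.<⇒≤ p)) D<) ⟩
  suc (packIn X ds ℕ.* 8) ℕ.* X         ≤⟨ ℕₚ.*-monoˡ-≤ X (packIn-bound X D D< ds ps) ⟩
  X ℕ.^ n ℕ.* X                         ≡⟨ ℕₚ.*-comm (X ℕ.^ n) X ⟩
  X ℕ.^ suc n                           ∎
  where
  open ℕₚ.≤-Reasoning
  regroup : ∀ d p r → (d ℕ.+ p ℕ.* r) ℕ.* 8 ≡ d ℕ.* 8 ℕ.+ p ℕ.* 8 ℕ.* r
  regroup = ℕ-Solver.solve-∀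

pack-bound : ∀ (ds : Vec ℕ 24) → VAll (ℕ._< 16) ds → pack ds ℕ.* 8 ℕ.< full
pack-bound ds ps = subst₂ (λ p q → p ℕ.* 8 ℕ.< q) (sym (pack≡packIn ds)) full-power (packIn-bound radix 16 (ℕₚ.<ᵇ⇒< 128 radix tt) ds ps)

Min-act : ∀ {σ a} → Co₀ σ → Min a → Min (σ a)
Min-act {σ} {a} s (i , e) = Co₀.maps s a i , trans (Co₀.isometry s a a i i) e

-- Modulo `full` the accumulated number is eight times the code of the image, by linearity of `ev`.
-- Since the image is minimal again, its digits are below 16 and eight times its code is below
-- `full`, so the residue is this number itself.
step-code : ∀ {M a} → IsAut M → Min a → step (gen M) (code a) ≡ code (act M a)
step-code {M} {a} aut m = begin
  peel (Vec.toList (map columnCode N)) (code a) (constant N)            ≡⟨ peel-dot (map digit a) (map columnCode N) (constant N) (digits-small sa) ⟩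
  (constant N ℕ.+ dot (map digit a) (map columnCode N)) % full / 8      ≡⟨ cong (_/ 8) (residue′ (dot-columns N sa)) ⟩
  code (act M a) ℕ.* 8 / 8                                              ≡⟨ *8/8 (code (act M a)) ⟩
  code (act M a)                                                        ∎
  where
  open ≡-Reasoning
  N : Vec Vec24 24
  N = transpose M
  sa : VAll Small a
  sa = Min-small m
  sb : VAll Small (act M a)
  sb = Min-small (Min-act (act-Co₀ aut) m)
  bound : code (act M a) ℕ.* 8 ℕ.< full
  bound = pack-bound (map digit (act M a)) (digits-16 sb)
  t : ℤ
  t = + 64 * ev (𝟏 {24}) - + 8 * evs N
  D : ℕ
  D = dot (map digit a) (map columnCode N)
  residue′ : (∃ λ q → + D ≡ ev (comb a N) + + 8 * evs N + q * + full) → (constant N ℕ.+ D) % full ≡ code (act M a) ℕ.* 8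
  residue′ (q , e) = %ℕ-unique full bound (q - t /ℕ full) (begin
    + (constant N ℕ.+ D)                                             ≡⟨ trans (ℤₚ.pos-+ (constant N) D) (cong₂ _+_ (mod-split full t) e) ⟩
    (t - t /ℕ full * + full) + (ev (comb a N) + + 8 * evs N + q * + full) ≡⟨ cong (λ v → (t - t /ℕ full * + full) + (v + + 8 * evs N + q * + full))
                                                                           (trans (cong ev (sym (act-exact (proj₁ aut) (InΛ⇒Integral (proj₁ m))))) (ev-⊙ (+ 8) (act M a))) ⟩
    (t - t /ℕ full * + full) + (+ 8 * ev (act M a) + + 8 * evs N + q * + full) ≡⟨ eq (ev (𝟏 {24})) (evs N) (t /ℕ full) (+ full) (ev (act M a)) q ⟩
    (ev (act M a) + + 8 * ev (𝟏 {24})) * + 8 + (q - t /ℕ full) * + full ≡⟨ cong (λ v → v * + 8 + (q - t /ℕ full) * + full) (code-ev sb) ⟨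
    + code (act M a) * + 8 + (q - t /ℕ full) * + full                 ≡⟨ cong (_+ (q - t /ℕ full) * + full) (ℤₚ.pos-* (code (act M a)) 8) ⟨
    + (code (act M a) ℕ.* 8) + (q - t /ℕ full) * + full               ∎)
    where
    eq : ∀ o s k f x q → ((+ 64 * o - + 8 * s) - k * f) + (+ 8 * x + + 8 * s + q * f) ≡ (x + + 8 * o) * + 8 + (q - k) * f
    eq = solve-∀

-- Orbits of minimal vectors

-- Follows the cycles of the first generator; the tokens tell at which of the elements found so far
-- the second generator leads to a new cycle (63 only skips).
module Search (f g : Gen) where

  cycle : ℕ → ℕ → ℕ → List ℕ → List ℕ
  close : ℕ → ℕ → ℕ → List ℕ → List ℕ
  cycle k s x pending = x ∷ close k s (step f x) pending
  close zero s y pending = pending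
  close (suc k) s y pending = if y ℕ.≡ᵇ s then pending else cycle k s y pending

  readToken : ℕ → ℕ → List ℕ → List ℕ
  skip : ℕ → ℕ → Bool → ℕ → List ℕ → List ℕ
  readToken zero tokens pending = pending
  readToken (suc n) tokens pending = skip n (tokens / 64) (tokens % 64 ℕ.<ᵇ 63) (tokens % 64) pending
  skip n tokens b t [] = []
  skip n tokens b (suc t) (y ∷ pending) = y ∷ skip n tokens b t pending
  skip n tokens true zero (y ∷ pending) = y ∷ readToken n tokens (cycle 99 (step g y) (step g y) pending)
  skip n tokens false zero (y ∷ pending) = readToken n tokens (y ∷ pending)

  search : ℕ × ℕ × ℕ → List ℕ
  search (start , n , tokens) = readToken n tokens (cycle 99 start start [])

  module _ {Q : ℕ → Set} (Q-f : ∀ {x} → Q x → Q (step f x)) (Q-g : ∀ {x} → Q x → Q (step g x)) where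

    cycle-sound : ∀ k s {x pending} → Q x → All Q pending → All Q (cycle k s x pending)
    close-sound : ∀ k s {y pending} → Q y → All Q pending → All Q (close k s y pending)
    cycle-sound k s q qs = q ∷ close-sound k s (Q-f q) qs
    close-sound zero s q qs = qs
    close-sound (suc k) s {y} q qs with y ℕ.≡ᵇ s
    ... | true = qs
    ... | false = cycle-sound k s q qs

    readToken-sound : ∀ n tokens {pending} → All Q pending → All Q (readToken n tokens pending)
    skip-sound : ∀ n tokens b t {pending} → All Q pending → All Q (skip n tokens b t pending)
    readToken-sound zero tokens qs = qs
    readToken-sound (suc n) tokens qs = skip-sound n (tokens / 64) (tokens % 64 ℕ.<ᵇ 63) (tokens % 64) qs
    skip-sound n tokens b t [] = []
    skip-sound n tokens b (suc t) (q ∷ qs) = q ∷ skip-sound n tokens b t qs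
    skip-sound n tokens true zero (q ∷ qs) = q ∷ readToken-sound n tokens (cycle-sound 99 _ (Q-g q) qs)
    skip-sound n tokens false zero (q ∷ qs) = readToken-sound n tokens (q ∷ qs)

    -- Whatever the tokens say, everything listed arises from the start by the two generators. A
    -- wrong certificate could only produce too few elements or repetitions, and both are detected
    -- by `verdict`.
    search-sound : ∀ run → Q (proj₁ run) → All Q (search run)
    search-sound (start , n , tokens) q = readToken-sound n tokens (cycle-sound 99 start q [])

-- Quicksort without output: the list is split at its first element, and an element equal to the
-- pivot makes the test fail. The first argument bounds the depth of the recursion.
distinct : ℕ → List ℕ → Bool
split : ℕ → ℕ → List ℕ → List ℕ → List ℕ → Bool
distinct zero xs = false
distinct (suc k) [] = true
distinct (suc k) (x ∷ xs) = split k x xs [] []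
split k x [] ls gs = distinct k ls ∧ distinct k gs
split k x (y ∷ ys) ls gs = if y ℕ.<ᵇ x then split k x ys (y ∷ ls) gs else (if x ℕ.<ᵇ y then split k x ys ls (y ∷ gs) else false)

Unique-resp-↭ : ∀ {xs ys : List ℕ} → xs ↭ ys → Unique xs → Unique ys
Unique-resp-↭ p = Permₛ.Unique-resp-↭ (setoid ℕ) (↭⇒↭ₛ p)

distinct-sound : ∀ k xs → distinct k xs ≡ true → Unique xs
split-sound : ∀ k x ys {ls gs} → All (ℕ._< x) ls → All (x ℕ.<_) gs → split k x ys ls gs ≡ true → Unique (x ∷ ys ++ ls ++ gs)
distinct-sound (suc k) [] e = []
distinct-sound (suc k) (x ∷ xs) e = subst (λ l → Unique (x ∷ l)) (Listₚ.++-identityʳ xs) (split-sound k x xs [] [] e)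
split-sound k x [] {ls} {gs} l g e with distinct k ls in p | distinct k gs in q
... | true | true = Allₚ.++⁺ (All.map (λ y<x e → ℕₚ.<-irrefl (sym e) y<x) l) (All.map (λ x<y e → ℕₚ.<-irrefl e x<y) g)
  ∷ Uniqueₚ.++⁺ (distinct-sound k ls p) (distinct-sound k gs q) (λ { (i , j) → ℕₚ.<-asym (All.lookup l i) (All.lookup g j) })
split-sound k x (y ∷ ys) {ls} {gs} l g e with y ℕ.<ᵇ x in p | x ℕ.<ᵇ y in q
... | true | _ = Unique-resp-↭ (prep x (shift y ys (ls ++ gs))) (split-sound k x ys (ℕₚ.<ᵇ⇒< y x (subst T (sym p) tt) ∷ l) g e)
... | false | true = Unique-resp-↭ (prep x (↭-trans (++⁺ˡ ys (shift y ls gs)) (shift y ys (ls ++ gs)))) (split-sound k x ys l (ℕₚ.<ᵇ⇒< x y (subst T (sym q) tt) ∷ g) e)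

decode-list : ∀ {P : Vec24 → Set} {cs} → All (λ c → ∃ λ x → P x × code x ≡ c) cs → Unique cs →
  ∃ λ xs → Unique xs × All P xs × List.map code xs ≡ cs
decode-list [] [] = [] , [] , [] , refl
decode-list ((x , p , refl) ∷ ps) (c∉ ∷ u) with decode-list ps u
... | xs , uxs , axs , refl = x ∷ xs , All.map (λ n e → n (cong code e)) (Allₚ.map⁻ c∉) ∷ uxs , p ∷ axs , refl

verdict : ℕ → List ℕ → Bool
verdict n l = (n ℕ.≤ᵇ length l) ∧ distinct 199 l

module _ {M₁ M₂} (aut₁ : IsAut M₁) (aut₂ : IsAut M₂) {P : Vec24 → Set} (minimal : ∀ {x} → P x → Min x)
    (P-f : ∀ {x} → P x → P (act M₁ x)) (P-g : ∀ {x} → P x → P (act M₂ x)) where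

  private
    Coded : ℕ → Set
    Coded c = ∃ λ x → P x × code x ≡ c

    found : List (ℕ × ℕ × ℕ) → List ℕ
    found = List.concatMap (Search.search (gen M₁) (gen M₂))

  -- Each code found comes with a vector that satisfies `P`, and vectors with different codes are
  -- different.
  reached : ∀ {n} runs → All (Coded ∘ proj₁) runs → verdict n (found runs) ≡ true → AtLeast P n
  reached {n} runs starts ok = finish (decode-list (all-found starts) (distinct-sound 199 (found runs) (proj₂ (∧-true ok))))
    where
    long : (n ℕ.≤ᵇ length (found runs)) ≡ true
    long = proj₁ (∧-true ok)
    all-found : ∀ {runs} → All (Coded ∘ proj₁) runs → All Coded (found runs)
    all-found [] = []
    all-found {run ∷ _} (q ∷ qs) = Allₚ.++⁺ (Search.search-sound (gen M₁) (gen M₂)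
      (λ { (x , p , refl) → act M₁ x , P-f p , sym (step-code aut₁ (minimal p)) })
      (λ { (x , p , refl) → act M₂ x , P-g p , sym (step-code aut₂ (minimal p)) }) run q) (all-found qs)
    finish : (∃ λ xs → Unique xs × All P xs × List.map code xs ≡ found runs) → AtLeast P n
    finish (xs , u , ps , e) = xs , u , ps , ℕₚ.≤-trans (ℕₚ.≤ᵇ⇒≤ n (length (found runs)) (subst T (sym long) tt))
      (ℕₚ.≤-reflexive (trans (cong length (sym e)) (Listₚ.length-map code xs)))

open import Data.List.Membership.Propositional.Properties using (∈-deduplicate⁺; ∈-deduplicate⁻)
open import Data.List.Relation.Unary.Unique.DecPropositional.Properties using (deduplicate-!)

-- Short vectors in a class modulo 4Λ

diff : ∀ {a b} → a ℤ.≤ b → + 0 ℤ.≤ b - a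
diff = ℤₚ.i≤j⇒0≤j-i

undiff : ∀ {a b} → + 0 ℤ.≤ b - a → a ℤ.≤ b
undiff = ℤₚ.0≤i-j⇒j≤i

shrink : ∀ k .{{_ : ℤ.Positive (+ k)}} {z} → + 0 ℤ.≤ + k * z → + 0 ℤ.≤ z
shrink k {z} h = ℤₚ.*-cancelˡ-≤-pos (+ 0) z (+ k) (subst (ℤ._≤ + k * z) (sym (ℤₚ.*-zeroʳ (+ k))) h)

grow : ∀ k {z} → + 0 ℤ.≤ z → + 0 ℤ.≤ + k * z
grow k {z} h = subst (ℤ._≤ + k * z) (ℤₚ.*-zeroʳ (+ k)) (ℤₚ.*-monoˡ-≤-nonNeg (+ k) h)

_⊞_ : ∀ {a b} → + 0 ℤ.≤ a → + 0 ℤ.≤ b → + 0 ℤ.≤ a + b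
p ⊞ q = ℤₚ.+-mono-≤ p q

norm-type : ∀ {x} → InΛ x → ∃ λ s → norm x ≡ 16 ℕ.* s
norm-type {x} i = go (∣⇒∣ᵤ (subst (+ 16 ∣_) (sym (norm-+ x)) (even-norm (InΛ⇒Integral i))))
  where
  go : 16 ℕ∣.∣ norm x → ∃ λ s → norm x ≡ 16 ℕ.* s
  go (ℕ∣.divides s e) = s , trans e (ℕₚ.*-comm s 16)

no-type-1 : ∀ {x} → InΛ x → norm x ≢ 16
no-type-1 {x} i e = none (listed (norm x) e (shorts-complete i (subst (ℕ._≤ 48) (sym e) (ℕₚ.≤ᵇ⇒≤ 16 48 tt))))
  where
  listed : ∀ N → N ≡ 16 → code x ∈ shorts N codewords → code x ∈ shorts 16 codewords
  listed _ refl c = c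
  none : code x ∈ shorts 16 codewords → ⊥
  none c = empty (subst (λ l → code x ∈ l) no-norm-16 c)
    where
    empty : code x ∈ [] → ⊥
    empty ()

data Size (x : Vec24) : Set where
  null    : x ≡ 𝟎 → Size x
  minimal : Min x → Size x
  large   : 48 ℕ.≤ norm x → Size x

size : ∀ {x} → InΛ x → Size x
size {x} i = go (norm-type i)
  where
  go : (∃ λ s → norm x ≡ 16 ℕ.* s) → Size x
  go (0 , e) = null (norm-zero x (subst (ℤ._≤ + 0) (trans (cong +_ (sym e)) (norm-+ x)) (+≤+ z≤n)))
  go (1 , e) = ⊥-elim (no-type-1 i e)
  go (2 , e) = minimal (i , trans (sym (norm-+ x)) (cong +_ e))
  go (suc (suc (suc s)) , e) = large (subst (48 ℕ.≤_) (sym e) (ℕₚ.*-monoʳ-≤ 16 {3} {3 ℕ.+ s} (s≤s (s≤s (s≤s z≤n)))))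

size-≥32 : ∀ {x} → InΛ x → x ≢ 𝟎 → 32 ℕ.≤ norm x
size-≥32 {x} i ne = go (size i)
  where
  go : Size x → 32 ℕ.≤ norm x
  go (null e) = ⊥-elim (ne e)
  go (minimal (_ , e)) = ℕₚ.≤-reflexive (sym (norm≡ {x} e))
  go (large l) = ℕₚ.≤-trans (ℕₚ.≤ᵇ⇒≤ 32 48 tt) l

norm-shift : ∀ k (r w : Vec24) → + norm (r ⊕ k ⊙ w) ≡ + norm r + + 2 * k * ⟪ r , w ⟫ + k * k * + norm w
norm-shift k r w = begin
  + norm (r ⊕ k ⊙ w)                      ≡⟨ norm-+ (r ⊕ k ⊙ w) ⟩
  ⟪ r ⊕ k ⊙ w , r ⊕ k ⊙ w ⟫               ≡⟨ cong (λ v → ⟪ v ⊕ k ⊙ w , v ⊕ k ⊙ w ⟫) (1-⊙ r) ⟨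
  ⟪ + 1 ⊙ r ⊕ k ⊙ w , + 1 ⊙ r ⊕ k ⊙ w ⟫   ≡⟨ norm-comb (+ 1) k r w ⟩
  + 1 * + 1 * ⟪ r , r ⟫ + + 2 * (+ 1 * k) * ⟪ r , w ⟫ + k * k * ⟪ w , w ⟫ ≡⟨ eq ⟪ r , r ⟫ k ⟪ r , w ⟫ ⟪ w , w ⟫ ⟩
  ⟪ r , r ⟫ + + 2 * k * ⟪ r , w ⟫ + k * k * ⟪ w , w ⟫ ≡⟨ cong₂ (λ a b → a + + 2 * k * ⟪ r , w ⟫ + k * k * b) (norm-+ r) (norm-+ w) ⟨
  + norm r + + 2 * k * ⟪ r , w ⟫ + k * k * + norm w ∎
  where
  open ≡-Reasoning
  eq : ∀ a k b c → + 1 * + 1 * a + + 2 * (+ 1 * k) * b + k * k * c ≡ a + + 2 * k * b + k * k * c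
  eq = solve-∀

norm-⊙ : ∀ k (w : Vec24) → + norm (k ⊙ w) ≡ k * k * + norm w
norm-⊙ k w = trans (norm-+ (k ⊙ w)) (trans (⟪⟫-⊙ˡ k w (k ⊙ w)) (trans (cong (k *_) (⟪⟫-⊙ʳ w k w)) (trans (sym (ℤₚ.*-assoc k k _)) (cong (k * k *_) (sym (norm-+ w))))))

-- 768 is 16 · 48: a far vector is `r + 4w` with `w` neither zero nor minimal, that is of type at
-- least 3.
Near Far : Vec24 → Vec24 → Set
Near r u = u ≈ r × norm u ℕ.≤ norm r
Far r u = Near r u × 768 ℕ.≤ norm (u ⊖ r)

-- Write `u = r + 4w`. Adding |r + 2w|² ≥ 0, (|r|² - |u|²)/2 ≥ 0 and 4|w|² - 192 ≥ 0 leaves |r|² ≥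
-- 192. Below type 12 a class is thus controlled by the minimal vectors alone.
Far-type : ∀ {r u} → Far r u → 192 ℕ.≤ norm r
Far-type {r} {u} (((w , iw , e) , u≤) , far) = ℤₚ.drop‿+≤+ (undiff (subst (+ 0 ℤ.≤_) (eq (+ norm r) ⟪ r , w ⟫ (+ norm w))
    (subst (+ 0 ℤ.≤_) (norm-shift (+ 2) r w) (+≤+ z≤n) ⊞ (shrink 2 (subst (+ 0 ℤ.≤_) (eq₁ (+ norm r) ⟪ r , w ⟫ (+ norm w)) (diff (subst (ℤ._≤ + norm r) u≡ (+≤+ u≤))))
      ⊞ shrink 4 (subst (+ 0 ℤ.≤_) (eq₂ (+ norm w)) (diff (subst (+ 768 ℤ.≤_) w≡ (+≤+ far))))))))
  where
  u≡ : + norm u ≡ + norm r + + 2 * + 4 * ⟪ r , w ⟫ + + 4 * + 4 * + norm w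
  u≡ = trans (cong (+_ ∘ norm) (⊖⇒≡⊕ e)) (norm-shift (+ 4) r w)
  w≡ : + norm (u ⊖ r) ≡ + 4 * + 4 * + norm w
  w≡ = trans (cong (+_ ∘ norm) e) (norm-⊙ (+ 4) w)
  eq₁ : ∀ R p N → R - (R + + 2 * + 4 * p + + 4 * + 4 * N) ≡ + 2 * (- (+ 4 * p) - + 8 * N)
  eq₁ = solve-∀
  eq₂ : ∀ N → + 4 * + 4 * N - + 768 ≡ + 4 * (+ 4 * N - + 192)
  eq₂ = solve-∀
  eq : ∀ R p N → (R + + 2 * + 2 * p + + 2 * + 2 * N) + ((- (+ 4 * p) - + 8 * N) + (+ 4 * N - + 192)) ≡ R - + 192
  eq = solve-∀

value⁻ : ∀ {r a n} → norm r ℕ.≤ 256 → Min a → value r a ≡ n → ⟪ r , a ⟫ ≡ + n - + 128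
value⁻ {r} {a} h m refl = trans (eq ⟪ r , a ⟫) (cong (_- + 128) (sym (value-+ {r} {a} h m)))
  where
  eq : ∀ z → z ≡ (z + + 128) - + 128
  eq = solve-∀

value⁺ : ∀ {r a n} → norm r ℕ.≤ 256 → Min a → ⟪ r , a ⟫ ≡ + n - + 128 → value r a ≡ n
value⁺ {r} {a} {n} h m e = ℤₚ.+-injective (trans (value-+ {r} {a} h m) (trans (cong (_+ + 128) e) (eq (+ n))))
  where
  eq : ∀ z → (z - + 128) + + 128 ≡ z
  eq = solve-∀

Step : Vec24 → Vec24 → Set
Step r u = ∃ λ w → u ≡ r ⊕ + 4 ⊙ w × Min w × value r w ≡ 64

-- u = r + 4w is not longer than r; the minimal vectors w are controlled by the profile of r.
near-cases : ∀ {r u} → norm r ℕ.≤ 256 → (∀ {a} → Min a → 64 ℕ.≤ value r a) → Near r u →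
  (u ≡ r) ⊎ Step r u ⊎ Far r u
near-cases {r} {u} h no-low n@((w , iw , e) , u≤) = go (size iw)
  where
  eq : ∀ R p → R - (R + + 2 * + 4 * p + + 4 * + 4 * + 32) ≡ + 8 * (+ 64 - (p + + 128))
  eq = solve-∀
  u≡ : ∀ {N} → norm w ≡ N → + norm u ≡ + norm r + + 2 * + 4 * ⟪ r , w ⟫ + + 4 * + 4 * + N
  u≡ refl = trans (cong (+_ ∘ norm) (⊖⇒≡⊕ e)) (norm-shift (+ 4) r w)
  small : Min w → value r w ℕ.≤ 64
  small m = ℤₚ.drop‿+≤+ (subst (ℤ._≤ + 64) (sym (value-+ {r} {w} h m)) (undiff (shrink 8 (subst (+ 0 ℤ.≤_) (eq (+ norm r) ⟪ r , w ⟫)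
    (diff (subst (ℤ._≤ + norm r) (u≡ (norm≡ {w} (proj₂ m))) (+≤+ u≤)))))))
  far : 48 ℕ.≤ norm w → 768 ℕ.≤ norm (u ⊖ r)
  far l = ℤₚ.drop‿+≤+ (subst (+ 768 ℤ.≤_) (trans (ℤₚ.pos-* 16 (norm w)) (sym (trans (cong (+_ ∘ norm) e) (norm-⊙ (+ 4) w)))) (+≤+ (ℕₚ.*-monoʳ-≤ 16 l)))
  go : Size w → (u ≡ r) ⊎ Step r u ⊎ Far r u
  go (null w≡𝟎) = inj₁ (trans (⊖⇒≡⊕ e) (trans (cong (λ v → r ⊕ + 4 ⊙ v) w≡𝟎) (trans (cong (r ⊕_) (⊙-𝟎 (+ 4))) (⊕-identityʳ r))))
  go (large l) = inj₂ (inj₂ (n , far l))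
  go (minimal m) = inj₂ (inj₁ (w , ⊖⇒≡⊕ e , m , ℕₚ.≤-antisym (small m) (no-low m)))

step-norm : ∀ {r u} → norm r ℕ.≤ 256 → Step r u → norm u ≡ norm r
step-norm {r} {u} h (w , refl , m , v) = ℤₚ.+-injective (trans (norm-shift (+ 4) r w)
  (trans (cong₂ (λ p N → + norm r + + 2 * + 4 * p + + 4 * + 4 * + N) (value⁻ {r} {w} h m v) (norm≡ {w} (proj₂ m))) (eq (+ norm r))))
  where
  eq : ∀ R → R + + 2 * + 4 * (+ 64 - + 128) + + 4 * + 4 * + 32 ≡ R
  eq = solve-∀

step-unique : ∀ {r n} → AtMost (λ a → Min a × value r a ≡ 64) n → AtMost (Step r) n
step-unique {r} b = AtMost-map (λ u → map (_/ℕ 4) (u ⊖ r)) (λ { (w , refl , _) (w′ , refl , _) e → cong (λ v → r ⊕ + 4 ⊙ v) (trans (sym (back w)) (trans e (back w′))) })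
  (λ { (w , refl , m , v) → subst (λ x → Min x × value r x ≡ 64) (sym (back w)) (m , v) }) b
  where
  quarter : ∀ {n} (w : Vec ℤ n) → map (_/ℕ 4) (+ 4 ⊙ w) ≡ w
  quarter [] = refl
  quarter (z ∷ w) = cong₂ _∷_ (ℤₚ.*-cancelˡ-≡ (+ 4) _ z (div-exact 4 (divides z (ℤₚ.*-comm (+ 4) z)))) (quarter w)
  back : ∀ w → map (_/ℕ 4) ((r ⊕ + 4 ⊙ w) ⊖ r) ≡ w
  back w = trans (cong (map (_/ℕ 4)) (⊕-⊖ r (+ 4 ⊙ w))) (quarter w)

AtMost-if : ∀ {A : Set} {P : A → Set} {c : A} {b : Bool} → (∀ {x} → P x → x ≡ c × b ≡ true) → AtMost P (if b then 1 else 0)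
AtMost-if {b = true} f = AtMost-⊆ (proj₁ ∘ f) (AtMost-singleton _)
AtMost-if {b = false} f = AtMost-∅ (λ p → case proj₂ (f p) of λ ())

-- The value 96 is the inner product -32, so that `y₀ + 2z` is orthogonal to `y₀`: these are two
-- different members of a frame, up to sign.
data Third (r y₀ u : Vec24) : Set where
  third : norm r ≡ 256 → norm y₀ ≡ 64 → norm u ≡ 256 → ∀ z → u ≡ (+ 2 ⊙ y₀ ⊖ r) ⊕ + 4 ⊙ z → Min z → value y₀ z ≡ 96 → Third r y₀ u

-- For far u = r + 4w the vector y = r + 2w has type at most 4; as y ≡ r modulo 2Λ, it is then ±y₀,
-- or y and y₀ are orthogonal vectors of type 4.
module _ {r y₀ z₀ : Vec24} (r≤ : norm r ℕ.≤ 256) (iy : InΛ y₀) (iz : InΛ z₀) (e₀ : r ⊖ y₀ ≡ + 2 ⊙ z₀) (y₀≤ : norm y₀ ℕ.≤ 64) where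

  c₁ c₂ : Vec24
  c₁ = + 2 ⊙ y₀ ⊖ r
  c₂ = -[1+ 1 ] ⊙ y₀ ⊖ r

  far-cases : ∀ {u} → Far r u → (u ≡ c₁) ⊎ (u ≡ c₂) ⊎ Third r y₀ u
  far-cases {u} (((w , iw , e) , u≤) , far) = decide (z ≟ᵥ 𝟎) (z′ ≟ᵥ 𝟎)
    where
    z z′ y : Vec24
    z = z₀ ⊕ w
    z′ = y₀ ⊕ + 1 ⊙ z
    y = y₀ ⊕ + 2 ⊙ z
    R N Y₀ Z g q : ℤ
    R = + norm r
    N = + norm w
    Y₀ = + norm y₀
    Z = + norm z
    g = ⟪ r , w ⟫
    q = ⟪ y₀ , z ⟫
    pt₁ : ∀ r y w k → r - y ≡ + 2 * k → r + + 2 * w ≡ y + + 2 * (k + w)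
    pt₁ r y w k e = trans (s₁ r y w) (trans (cong (λ d → y + d + + 2 * w) e) (s₂ y k w))
      where
      s₁ : ∀ r y w → r + + 2 * w ≡ y + (r - y) + + 2 * w
      s₁ = solve-∀
      s₂ : ∀ y k w → y + + 2 * k + + 2 * w ≡ y + + 2 * (k + w)
      s₂ = solve-∀
    y≡go : ∀ {n} (r y w k : Vec ℤ n) → r ⊖ y ≡ + 2 ⊙ k → r ⊕ + 2 ⊙ w ≡ y ⊕ + 2 ⊙ (k ⊕ w)
    y≡go [] [] [] [] _ = refl
    y≡go (a ∷ r) (b ∷ y) (c ∷ w) (d ∷ k) e = cong₂ _∷_ (pt₁ a b c d (cong Vec.head e)) (y≡go r y w k (cong Vec.tail e))
    y≡ : r ⊕ + 2 ⊙ w ≡ y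
    y≡ = y≡go r y₀ w z₀ e₀
    twice : ∀ {n} (r w : Vec ℤ n) → r ⊕ + 4 ⊙ w ≡ + 2 ⊙ (r ⊕ + 2 ⊙ w) ⊖ r
    twice [] [] = refl
    twice (a ∷ r) (b ∷ w) = cong₂ _∷_ (s a b) (twice r w)
      where
      s : ∀ a b → a + + 4 * b ≡ + 2 * (a + + 2 * b) - a
      s = solve-∀
    u≡y : u ≡ + 2 ⊙ y ⊖ r
    u≡y = trans (⊖⇒≡⊕ e) (trans (twice r w) (cong (λ v → + 2 ⊙ v ⊖ r) y≡))
    u≡z : u ≡ c₁ ⊕ + 4 ⊙ z
    u≡z = trans u≡y (go y₀ z r)
      where
      go : ∀ {n} (y z r : Vec ℤ n) → + 2 ⊙ (y ⊕ + 2 ⊙ z) ⊖ r ≡ (+ 2 ⊙ y ⊖ r) ⊕ + 4 ⊙ z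
      go [] [] [] = refl
      go (a ∷ y) (b ∷ z) (c ∷ r) = cong₂ _∷_ (s a b c) (go y z r)
        where
        s : ∀ a b c → + 2 * (a + + 2 * b) - c ≡ (+ 2 * a - c) + + 4 * b
        s = solve-∀
    norm-u : + norm u ≡ R + + 2 * + 4 * g + + 4 * + 4 * N
    norm-u = trans (cong (+_ ∘ norm) (⊖⇒≡⊕ e)) (norm-shift (+ 4) r w)
    norm-y : + norm y ≡ R + + 2 * + 2 * g + + 2 * + 2 * N
    norm-y = trans (cong (+_ ∘ norm) (sym y≡)) (norm-shift (+ 2) r w)
    norm-z′ : + norm z′ ≡ Y₀ + + 2 * + 1 * q + + 1 * + 1 * Z
    norm-z′ = norm-shift (+ 1) y₀ z
    norm-y′ : + norm y ≡ Y₀ + + 2 * + 2 * q + + 2 * + 2 * Z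
    norm-y′ = norm-shift (+ 2) y₀ z
    -- the four non-negative slacks of the argument
    s₁ : + 0 ℤ.≤ - g - + 2 * N
    s₁ = shrink 8 (subst (+ 0 ℤ.≤_) (trans (cong (λ t → R - t) norm-u) (eq R g N)) (diff (+≤+ u≤)))
      where
      eq : ∀ R g N → R - (R + + 2 * + 4 * g + + 4 * + 4 * N) ≡ + 8 * (- g - + 2 * N)
      eq = solve-∀
    s₂ : + 0 ℤ.≤ N - + 48
    s₂ = shrink 16 (subst (+ 0 ℤ.≤_) (trans (cong (_- + 768) (trans (cong (+_ ∘ norm) e) (norm-⊙ (+ 4) w))) (eq N)) (diff (+≤+ far)))
      where
      eq : ∀ N → + 4 * + 4 * N - + 768 ≡ + 16 * (N - + 48)
      eq = solve-∀
    s₃ : + 0 ℤ.≤ + 256 - R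
    s₃ = diff (+≤+ r≤)
    s₄ : + 0 ℤ.≤ + 64 - Y₀
    s₄ = diff (+≤+ y₀≤)
    -- 2 (norm z + norm z′) = norm y + norm y₀
    balance : + 2 * (Z + + norm z′) + (+ 4 * (- g - + 2 * N) + (+ 4 * (N - + 48) + ((+ 256 - R) + (+ 64 - Y₀)))) ≡ + 128
    balance = trans (cong (λ t → + 2 * (Z + t) + slack) norm-z′) (trans (eq₁ Y₀ q Z slack) (trans (cong (λ t → t + Y₀ + slack) (trans (sym norm-y′) norm-y)) (eq₂ R g N Y₀)))
      where
      slack : ℤ
      slack = + 4 * (- g - + 2 * N) + (+ 4 * (N - + 48) + ((+ 256 - R) + (+ 64 - Y₀)))
      eq₁ : ∀ Y q Z s → + 2 * (Z + (Y + + 2 * + 1 * q + + 1 * + 1 * Z)) + s ≡ (Y + + 2 * + 2 * q + + 2 * + 2 * Z) + Y + s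
      eq₁ = solve-∀
      eq₂ : ∀ R g N Y → (R + + 2 * + 2 * g + + 2 * + 2 * N) + Y + (+ 4 * (- g - + 2 * N) + (+ 4 * (N - + 48) + ((+ 256 - R) + (+ 64 - Y)))) ≡ + 128
      eq₂ = solve-∀
    -- If both z and z′ are non-zero then all slacks vanish.
    pinch : ∀ {Z Z′ a b c d} → + 0 ℤ.≤ Z - + 32 → + 0 ℤ.≤ Z′ - + 32 → + 0 ℤ.≤ a → + 0 ℤ.≤ b → + 0 ℤ.≤ c → + 0 ℤ.≤ d →
      + 2 * (Z + Z′) + (+ 4 * a + (+ 4 * b + (c + d))) ≡ + 128 → Z ≡ + 32 × Z′ ≡ + 32 × a ≡ + 0 × b ≡ + 0 × c ≡ + 0 × d ≡ + 0
    pinch {Z} {Z′} {a} {b} {c} {d} hz hz′ ha hb hc hd bal =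
        un Z (flat hz (slim (grow 1 hz ⊞ (grow 2 hz′ ⊞ (grow 4 ha ⊞ (grow 4 hb ⊞ (hc ⊞ hd))))) (e₁ Z Z′ a b c d)))
      , un Z′ (flat hz′ (slim (grow 2 hz ⊞ (grow 1 hz′ ⊞ (grow 4 ha ⊞ (grow 4 hb ⊞ (hc ⊞ hd))))) (e₂ Z Z′ a b c d)))
      , flat ha (slim (grow 2 hz ⊞ (grow 2 hz′ ⊞ (grow 3 ha ⊞ (grow 4 hb ⊞ (hc ⊞ hd))))) (e₃ Z Z′ a b c d))
      , flat hb (slim (grow 2 hz ⊞ (grow 2 hz′ ⊞ (grow 4 ha ⊞ (grow 3 hb ⊞ (hc ⊞ hd))))) (e₄ Z Z′ a b c d))
      , flat hc (slim (grow 2 hz ⊞ (grow 2 hz′ ⊞ (grow 4 ha ⊞ (grow 4 hb ⊞ hd)))) (e₅ Z Z′ a b c d))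
      , flat hd (slim (grow 2 hz ⊞ (grow 2 hz′ ⊞ (grow 4 ha ⊞ (grow 4 hb ⊞ hc)))) (e₆ Z Z′ a b c d))
      where
      flat : ∀ {x} → + 0 ℤ.≤ x → x ℤ.≤ + 0 → x ≡ + 0
      flat p q = ℤₚ.≤-antisym q p
      un : ∀ x → x - + 32 ≡ + 0 → x ≡ + 32
      un x e = ℤₚ.i-j≡0⇒i≡j x (+ 32) e
      slim : ∀ {x rest} → + 0 ℤ.≤ rest → rest ≡ (+ 2 * (Z + Z′) + (+ 4 * a + (+ 4 * b + (c + d)))) - + 128 - x → x ℤ.≤ + 0
      slim {x} {rest} h e = undiff (subst (+ 0 ℤ.≤_) (trans e (cong (λ t → t - + 128 - x) bal)) h)
      e₁ : ∀ Z Z′ a b c d → + 1 * (Z - + 32) + (+ 2 * (Z′ - + 32) + (+ 4 * a + (+ 4 * b + (c + d)))) ≡ (+ 2 * (Z + Z′) + (+ 4 * a + (+ 4 * b + (c + d)))) - + 128 - (Z - + 32)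
      e₁ = solve-∀
      e₂ : ∀ Z Z′ a b c d → + 2 * (Z - + 32) + (+ 1 * (Z′ - + 32) + (+ 4 * a + (+ 4 * b + (c + d)))) ≡ (+ 2 * (Z + Z′) + (+ 4 * a + (+ 4 * b + (c + d)))) - + 128 - (Z′ - + 32)
      e₂ = solve-∀
      e₃ : ∀ Z Z′ a b c d → + 2 * (Z - + 32) + (+ 2 * (Z′ - + 32) + (+ 3 * a + (+ 4 * b + (c + d)))) ≡ (+ 2 * (Z + Z′) + (+ 4 * a + (+ 4 * b + (c + d)))) - + 128 - a
      e₃ = solve-∀
      e₄ : ∀ Z Z′ a b c d → + 2 * (Z - + 32) + (+ 2 * (Z′ - + 32) + (+ 4 * a + (+ 3 * b + (c + d)))) ≡ (+ 2 * (Z + Z′) + (+ 4 * a + (+ 4 * b + (c + d)))) - + 128 - b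
      e₄ = solve-∀
      e₅ : ∀ Z Z′ a b c d → + 2 * (Z - + 32) + (+ 2 * (Z′ - + 32) + (+ 4 * a + (+ 4 * b + d))) ≡ (+ 2 * (Z + Z′) + (+ 4 * a + (+ 4 * b + (c + d)))) - + 128 - c
      e₅ = solve-∀
      e₆ : ∀ Z Z′ a b c d → + 2 * (Z - + 32) + (+ 2 * (Z′ - + 32) + (+ 4 * a + (+ 4 * b + c))) ≡ (+ 2 * (Z + Z′) + (+ 4 * a + (+ 4 * b + (c + d)))) - + 128 - d
      e₆ = solve-∀
    iz′ : InΛ z
    iz′ = Λ-closed-⊕ iz iw
    last : z ≢ 𝟎 → z′ ≢ 𝟎 → Third r y₀ u
    last z≢ z′≢ = finish (pinch (diff (+≤+ (size-≥32 iz′ z≢))) (diff (+≤+ (size-≥32 (Λ-closed-⊕ iy (Λ-closed-⊙ (+ 1) iz′)) z′≢))) s₁ s₂ s₃ s₄ balance)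
      where
      finish : Z ≡ + 32 × + norm z′ ≡ + 32 × (- g - + 2 * N) ≡ + 0 × N - + 48 ≡ + 0 × + 256 - R ≡ + 0 × + 64 - Y₀ ≡ + 0 → Third r y₀ u
      finish (eZ , eZ′ , ep , eN , eR , eY) = third R≡ Y≡ U≡ z u≡z mz (value⁺ {y₀} {z} (subst (ℕ._≤ 256) (sym Y≡) (ℕₚ.≤ᵇ⇒≤ 64 256 tt)) mz q≡)
        where
        mz : Min z
        mz = iz′ , trans (sym (norm-+ z)) eZ
        R≡ : norm r ≡ 256
        R≡ = ℤₚ.+-injective (sym (ℤₚ.i-j≡0⇒i≡j (+ 256) R eR))
        Y≡ : norm y₀ ≡ 64
        Y≡ = ℤₚ.+-injective (sym (ℤₚ.i-j≡0⇒i≡j (+ 64) Y₀ eY))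
        U≡ : norm u ≡ 256
        U≡ = ℤₚ.+-injective (trans norm-u (trans (eq R g N) (trans (cong (λ t → R - + 8 * t) ep) (trans (ℤₚ.+-identityʳ R) (cong +_ R≡)))))
          where
          eq : ∀ R g N → R + + 2 * + 4 * g + + 4 * + 4 * N ≡ R - + 8 * (- g - + 2 * N)
          eq = solve-∀
        q≡ : q ≡ + 96 - + 128
        q≡ = ℤₚ.*-cancelˡ-≡ (+ 2) q (+ 96 - + 128) (trans (eq Y₀ q Z) (trans (cong (λ t → t - Y₀ - Z) (trans (sym norm-z′) eZ′)) (cong₂ (λ a b → + 32 - a - b) (cong +_ Y≡) eZ)))
          where
          eq : ∀ Y q Z → + 2 * q ≡ (Y + + 2 * + 1 * q + + 1 * + 1 * Z) - Y - Z
          eq = solve-∀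
    decide : Dec (z ≡ 𝟎) → Dec (z′ ≡ 𝟎) → (u ≡ c₁) ⊎ (u ≡ c₂) ⊎ Third r y₀ u
    decide (yes e) _ = inj₁ (trans u≡z (trans (cong (λ v → c₁ ⊕ + 4 ⊙ v) e) (trans (cong (c₁ ⊕_) (⊙-𝟎 (+ 4))) (⊕-identityʳ c₁))))
    decide (no _) (yes e′) = inj₂ (inj₁ (trans u≡z (go y₀ z r e′)))
      where
      pt : ∀ y z r → y + + 1 * z ≡ + 0 → (+ 2 * y - r) + + 4 * z ≡ -[1+ 1 ] * y - r
      pt y z r e = trans (s y z r) (trans (cong (λ t → -[1+ 1 ] * y - r + + 4 * t) e) (ℤₚ.+-identityʳ (-[1+ 1 ] * y - r)))
        where
        s : ∀ y z r → (+ 2 * y - r) + + 4 * z ≡ -[1+ 1 ] * y - r + + 4 * (y + + 1 * z)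
        s = solve-∀
      go : ∀ {n} (y z r : Vec ℤ n) → y ⊕ + 1 ⊙ z ≡ 𝟎 → (+ 2 ⊙ y ⊖ r) ⊕ + 4 ⊙ z ≡ -[1+ 1 ] ⊙ y ⊖ r
      go [] [] [] _ = refl
      go (a ∷ y) (b ∷ z) (c ∷ r) e = cong₂ _∷_ (pt a b c (cong Vec.head e)) (go y z r (cong Vec.tail e))
    decide (no z≢) (no z′≢) = inj₂ (inj₂ (last z≢ z′≢))

-- Bounds for the number of shortest vectors in a class

record Class (r : Vec24) (n : ℕ) : Set where
  field
    bounded : AtMost (Near r) n
    exact   : ∀ {u} → Near r u → norm u ≡ norm r

class-of : ∀ {r t nears ats total f} → norm r ℕ.≤ 256 → Profile r t nears ats total →
  AtMost (Far r) f → (∀ {u} → Far r u → norm u ≡ norm r) → Class r (1 ℕ.+ (nears ℕ.+ f))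
class-of {r} h pr bf ef = record
  { bounded = AtMost-⊎ (near-cases h (Profile.near-≥ pr)) (AtMost-singleton r) (AtMost-⊎ id (step-unique (Profile.near pr)) bf)
  ; exact = λ n → [ cong norm , [ step-norm h , ef ]′ ]′ (near-cases h (Profile.near-≥ pr) n) }

class-short : ∀ {r t nears ats total} → norm r ℕ.< 192 → Profile r t nears ats total → Class r (1 ℕ.+ (nears ℕ.+ 0))
class-short h pr = class-of (ℕₚ.≤-trans (ℕₚ.<⇒≤ h) (ℕₚ.≤ᵇ⇒≤ 192 256 tt)) pr (AtMost-∅ (λ f → ℕₚ.<⇒≱ h (Far-type f))) (λ f → ⊥-elim (ℕₚ.<⇒≱ h (Far-type f)))

viable : Vec24 → Vec24 → Bool
viable r c = (norm c ℕ.≤ᵇ norm r) ∧ (768 ℕ.≤ᵇ norm (c ⊖ r))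

Far-viable : ∀ {r u} → Far r u → viable r u ≡ true
Far-viable ((_ , u≤) , far) = cong₂ _∧_ (T⇒true (ℕₚ.≤⇒≤ᵇ u≤)) (T⇒true (ℕₚ.≤⇒≤ᵇ far))

one : Bool → ℕ
one b = if b then 1 else 0

-- The bits `b₁` and `b₂` record whether the two candidates for far vectors are short enough and far
-- enough. The second one is counted only where it differs from the first; they coincide when `y₀`
-- is zero.
class-long : ∀ {r t nears ats total y₀ z₀ j b₁ b₂} → norm r ℕ.≤ 256 → Profile r t nears ats total →
  InΛ y₀ → InΛ z₀ → r ⊖ y₀ ≡ + 2 ⊙ z₀ → norm y₀ ℕ.≤ 64 → AtMost (Third r y₀) j →
  (∀ {u} → Far r u → u ≡ + 2 ⊙ y₀ ⊖ r → b₁ ≡ true × norm u ≡ norm r) →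
  (∀ {u} → Far r u → u ≡ -[1+ 1 ] ⊙ y₀ ⊖ r → u ≢ + 2 ⊙ y₀ ⊖ r → b₂ ≡ true × norm u ≡ norm r) →
  Class r (1 ℕ.+ (nears ℕ.+ (one b₁ ℕ.+ (one b₂ ℕ.+ j))))
class-long {r} {y₀ = y₀} {b₁ = b₁} {b₂} h pr iy iz e₀ y≤ bj f₁ f₂ = class-of h pr
    (AtMost-⊎ cases (AtMost-if {b = b₁} (λ { (f , e) → e , proj₁ (f₁ f e) })) (AtMost-⊎ id (AtMost-if {b = b₂} (λ { (f , e , n) → e , proj₁ (f₂ f e n) })) bj))
    (λ f → [ (λ { (f , e) → proj₂ (f₁ f e) }) , [ (λ { (f , e , n) → proj₂ (f₂ f e n) }) , (λ { (third R _ U _ _ _ _) → trans U (sym R) }) ]′ ]′ (cases f))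
  where
  cases : ∀ {u} → Far r u → (Far r u × u ≡ + 2 ⊙ y₀ ⊖ r) ⊎ (Far r u × u ≡ -[1+ 1 ] ⊙ y₀ ⊖ r × u ≢ + 2 ⊙ y₀ ⊖ r) ⊎ Third r y₀ u
  cases {u} f = go (u ≟ᵥ + 2 ⊙ y₀ ⊖ r) (far-cases h iy iz e₀ y≤ f)
    where
    go : Dec (u ≡ + 2 ⊙ y₀ ⊖ r) → (u ≡ + 2 ⊙ y₀ ⊖ r) ⊎ (u ≡ -[1+ 1 ] ⊙ y₀ ⊖ r) ⊎ Third r y₀ u →
      (Far r u × u ≡ + 2 ⊙ y₀ ⊖ r) ⊎ (Far r u × u ≡ -[1+ 1 ] ⊙ y₀ ⊖ r × u ≢ + 2 ⊙ y₀ ⊖ r) ⊎ Third r y₀ u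
    go (yes e) _ = inj₁ (f , e)
    go (no ne) (inj₁ e) = ⊥-elim (ne e)
    go (no ne) (inj₂ (inj₁ e)) = inj₂ (inj₁ (f , e , ne))
    go (no ne) (inj₂ (inj₂ t)) = inj₂ (inj₂ t)

-- Lower bounds for the size of orbits

Min-neg : ∀ {a} → Min a → Min (ℤ.-1ℤ ⊙ a)
Min-neg {a} (i , e) = Λ-closed-⊙ ℤ.-1ℤ i , trans (⟪⟫-⊙ˡ ℤ.-1ℤ a (ℤ.-1ℤ ⊙ a)) (trans (cong (ℤ.-1ℤ *_) (⟪⟫-⊙ʳ a ℤ.-1ℤ a)) (cong (λ n → ℤ.-1ℤ * (ℤ.-1ℤ * n)) e))

-- Double counting of the pairs (u , a) with u in the orbit of rᵢ and u + βa in the orbit of rⱼ.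
edge-bound : ∀ {rᵢ rⱼ β t cᵢ cⱼ n m} .{{_ : ℕ.NonZero m}} .{{_ : ℕ.NonZero β}} → InΛ rᵢ → InΛ rⱼ → norm rⱼ ℕ.≤ 256 →
  AtLeast (InOrbit rᵢ) cᵢ → AtLeast (λ a → Min a × InOrbit rⱼ (rᵢ ⊕ + β ⊙ a)) n → AtMost (λ a → Min a × value rⱼ a ≡ t) m →
  + 2 * + β * (+ 128 - + t) ≡ + norm rⱼ - + norm rᵢ + + 32 * + β * + β → cᵢ ℕ.* n ≡ cⱼ ℕ.* m → AtLeast (InOrbit rⱼ) cⱼ
edge-bound {rᵢ} {rⱼ} {β} {t} {cᵢ} {cⱼ} {n} {m} iᵢ iⱼ h (L , uL , oL , cᵢ≤) F M rel card = finish (pair-list L uL oL partners)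
  where
  S : Vec24 → Vec24 → Set
  S u a = Min a × InOrbit rⱼ (u ⊕ + β ⊙ a)
  partners : ∀ {u} → InOrbit rᵢ u → AtLeast (S u) n
  partners (σ , s , refl) = AtLeast-map σ (λ { (m , _) (m′ , _) → σ-injective s (proj₁ m) (proj₁ m′) })
    (λ { {a} (m , o) → Min-act s m , orbit-trans o (σ , s , trans (Co₀.additive s rᵢ (+ β ⊙ a) iᵢ (Λ-closed-⊙ (+ β) (proj₁ m))) (cong (σ rᵢ ⊕_) (σ-⊙ s β (proj₁ m)))) }) F
  target : Vec24 × Vec24 → Vec24
  target (u , a) = u ⊕ + β ⊙ a
  Q : Vec24 × Vec24 → Set
  Q (u , a) = InOrbit rᵢ u × S u a
  -- The norms at both ends of an edge determine its inner product with the end `v = u + βa`, by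
  -- |u|² = |v - βa|²; `rel` is this relation in terms of values.
  pairing-value : ∀ {u a} → Q (u , a) → ⟪ u ⊕ + β ⊙ a , a ⟫ ≡ + 128 - + t
  pairing-value {u} {a} (o , (ia , ea) , o′) = ℤₚ.*-cancelˡ-≡ (+ 2 * + β) ⟪ u ⊕ + β ⊙ a , a ⟫ (+ 128 - + t) {{ℤₚ.i*j≢0 (+ 2) (+ β) {{_}} {{ℤ.≢-nonZero (λ e → ℕ.≢-nonZero⁻¹ β (ℤₚ.+-injective e))}}}} (begin
    + 2 * + β * ⟪ u ⊕ + β ⊙ a , a ⟫                        ≡⟨ cong (+ 2 * + β *_) (trans (⟪⟫-⊕ˡ u (+ β ⊙ a) a) (cong (_+_ ⟪ u , a ⟫) (trans (⟪⟫-⊙ˡ (+ β) a a) (cong (+ β *_) ea)))) ⟩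
    + 2 * + β * (⟪ u , a ⟫ + + β * + 32)                   ≡⟨ eq (+ norm u) (+ β) ⟪ u , a ⟫ ⟩
    (+ norm u + + 2 * + β * ⟪ u , a ⟫ + + β * + β * + 32) - + norm u + + 32 * + β * + β ≡⟨ cong (λ N → (+ norm u + + 2 * + β * ⟪ u , a ⟫ + + β * + β * + N) - + norm u + + 32 * + β * + β) (norm≡ {a} ea) ⟨
    (+ norm u + + 2 * + β * ⟪ u , a ⟫ + + β * + β * + norm a) - + norm u + + 32 * + β * + β ≡⟨ cong (λ N → N - + norm u + + 32 * + β * + β) (norm-shift (+ β) u a) ⟨
    + norm (u ⊕ + β ⊙ a) - + norm u + + 32 * + β * + β      ≡⟨ cong₂ (λ M N → M - N + + 32 * + β * + β) (same iⱼ o′) (same iᵢ o) ⟩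
    + norm rⱼ - + norm rᵢ + + 32 * + β * + β                ≡⟨ rel ⟨
    + 2 * + β * (+ 128 - + t)                              ∎)
    where
    open ≡-Reasoning
    same : ∀ {v w} → InΛ v → InOrbit v w → + norm w ≡ + norm v
    same {v} {w} i o = trans (norm-+ w) (trans (orbit-norm i o) (sym (norm-+ v)))
    eq : ∀ N b p → + 2 * b * (p + b * + 32) ≡ (N + + 2 * b * p + b * b * + 32) - N + + 32 * b * b
    eq = solve-∀
  neg-injective : ∀ {n} (x y : Vec ℤ n) → ℤ.-1ℤ ⊙ x ≡ ℤ.-1ℤ ⊙ y → x ≡ y
  neg-injective x y = ⊙-cancel ℤ.-1ℤ
  ⊕-cancelʳ : ∀ {n} (x y z : Vec ℤ n) → x ⊕ z ≡ y ⊕ z → x ≡ y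
  ⊕-cancelʳ [] [] [] _ = refl
  ⊕-cancelʳ (a ∷ x) (b ∷ y) (c ∷ z) e = cong₂ _∷_ (trans (s a c) (trans (cong (_- c) (cong Vec.head e)) (sym (s b c)))) (⊕-cancelʳ x y z (cong Vec.tail e))
    where
    s : ∀ a c → a ≡ (a + c) - c
    s = solve-∀
  fibre : ∀ {v} → InOrbit rⱼ v → AtMost (λ p → Q p × target p ≡ v) m
  -- An edge into `v` is recorded by `-a`, whose inner product with `v` is `t - 128`, so that the
  -- edges are counted at the target value of the profile.
  fibre {v} (τ , s , refl) = AtMost-map (λ { (u , a) → Co₀.inverse s (ℤ.-1ℤ ⊙ a) }) injective into M
    where
    s⁻ : Co₀ (Co₀.inverse s)
    s⁻ = Co₀-inverse s
    injective : ∀ {p q} → Q p × target p ≡ τ rⱼ → Q q × target q ≡ τ rⱼ → Co₀.inverse s (ℤ.-1ℤ ⊙ proj₂ p) ≡ Co₀.inverse s (ℤ.-1ℤ ⊙ proj₂ q) → p ≡ q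
    injective {u , a} {u′ , a′} ((_ , m , _) , e) ((_ , m′ , _) , e′) eq = pair
      (neg-injective a a′ (σ-injective s⁻ (proj₁ (Min-neg m)) (proj₁ (Min-neg m′)) eq))
      where
      pair : a ≡ a′ → (u , a) ≡ (u′ , a′)
      pair refl = cong (_, a) (⊕-cancelʳ u u′ (+ β ⊙ a) (trans e (sym e′)))
    into : ∀ {p} → Q p × target p ≡ τ rⱼ → Min (Co₀.inverse s (ℤ.-1ℤ ⊙ proj₂ p)) × value rⱼ (Co₀.inverse s (ℤ.-1ℤ ⊙ proj₂ p)) ≡ t
    into {u , a} (q@(_ , m , _) , e) = mb , value⁺ {rⱼ} {b} h mb (begin
        ⟪ rⱼ , b ⟫                      ≡⟨ Co₀.isometry s rⱼ b iⱼ (proj₁ mb) ⟨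
        ⟪ τ rⱼ , τ b ⟫                  ≡⟨ cong₂ ⟪_,_⟫ (sym e) (Co₀.inv-right s _ (proj₁ (Min-neg m))) ⟩
        ⟪ u ⊕ + β ⊙ a , ℤ.-1ℤ ⊙ a ⟫     ≡⟨ ⟪⟫-⊙ʳ (u ⊕ + β ⊙ a) ℤ.-1ℤ a ⟩
        ℤ.-1ℤ * ⟪ u ⊕ + β ⊙ a , a ⟫     ≡⟨ cong (ℤ.-1ℤ *_) (pairing-value q) ⟩
        ℤ.-1ℤ * (+ 128 - + t)           ≡⟨ eq (+ t) ⟩
        + t - + 128                     ∎)
      where
      open ≡-Reasoning
      b : Vec24
      b = Co₀.inverse s (ℤ.-1ℤ ⊙ a)
      mb : Min b
      mb = Min-act s⁻ (Min-neg m)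
      eq : ∀ t → ℤ.-1ℤ * (+ 128 - t) ≡ t - + 128
      eq = solve-∀
  finish : (∃ λ ps → Unique ps × All (λ { (x , y) → InOrbit rᵢ x × S x y }) ps × length L ℕ.* n ℕ.≤ length ps) → AtLeast (InOrbit rⱼ) cⱼ
  finish (ps , ups , aps , len) = ys , deduplicate-! _≟ᵥ_ (List.map target ps) , oys ,
      ℕₚ.*-cancelʳ-≤ cⱼ (length ys) m (begin
        cⱼ ℕ.* m          ≡⟨ card ⟨
        cᵢ ℕ.* n          ≤⟨ ℕₚ.*-monoˡ-≤ n cᵢ≤ ⟩
        length L ℕ.* n    ≤⟨ len ⟩
        length ps         ≤⟨ Fibres.fibres _≟ᵥ_ target ys ups aps (All.tabulate (λ i → ∈-deduplicate⁺ _≟ᵥ_ (∈-map⁺ target i))) (λ i → fibre (All.lookup oys i)) ⟩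
        length ys ℕ.* m   ∎)
    where
    open ℕₚ.≤-Reasoning
    ys : List Vec24
    ys = List.deduplicate _≟ᵥ_ (List.map target ps)
    oys : All (InOrbit rⱼ) ys
    oys = All.tabulate (λ i → All.lookup (Allₚ.map⁺ (All.map (λ { (_ , _ , o) → o }) aps)) (∈-deduplicate⁻ _≟ᵥ_ (List.map target ps) i))

open import Data.Unit using (⊤)

open import Data.Bool using (_∨_)
open import Data.List.Relation.Unary.AllPairs using (AllPairs)
open import Data.List.Membership.Propositional.Properties using (∈-allFin)

-- The weighted count of Λ/4Λ

total : ℕ
total = 4 ℕ.^ 24

-- `bound` bounds all the shortest vectors in a class, `weight` those from the orbit itself; they
-- differ for type 15 alone, where a class also contains vectors of O₁₅ᵦ. `classes` is the number of
-- classes that the orbit contributes to the count.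
record Spec : Set where
  constructor spec
  field
    type card weight classes bound checksum : ℕ

open Spec

record Frame (s : Spec) : Set where
  field
    rep      : Vec24
    rep∈Λ    : InΛ rep
    rep-norm : norm rep ≡ 16 ℕ.* type s
    type≤    : type s ℕ.≤ 16
    many     : AtLeast (InOrbit rep) (card s)
    card≡    : card s ≡ classes s ℕ.* weight s
    weight≢0 : ℕ.NonZero (weight s)
    near-class : Class rep (bound s)
    few      : AtMost (λ u → InOrbit rep u × u ≈ rep) (weight s)
    sums     : ∀ {l} → Unique l → All Min l → length minCodes ℕ.≤ length l → sum (List.map (λ a → value rep a % 32) l) ≡ checksum s

-- A difference `4w` changes an inner product with a lattice vector by a multiple of 4 · 8. In the
-- unscaled form, inner products modulo 4 are invariants of the class.
≈-norm : ∀ {x y} → x ≈ y → InΛ y → ∀ {a} → InΛ a → ⟪ x , a ⟫ %ℕ 32 ≡ ⟪ y , a ⟫ %ℕ 32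
≈-norm {x} {y} (w , iw , e) iy {a} ia = go (pairing (InΛ⇒Integral iw) (InΛ⇒Integral ia))
  where
  go : + 8 ∣ ⟪ w , a ⟫ → ⟪ x , a ⟫ %ℕ 32 ≡ ⟪ y , a ⟫ %ℕ 32
  go (divides k e′) = %ℕ-unique 32 (n%ℕd<d ⟪ y , a ⟫ 32) (⟪ y , a ⟫ /ℕ 32 + k) (begin
    ⟪ x , a ⟫                          ≡⟨ cong ⟪_, a ⟫ (⊖⇒≡⊕ e) ⟩
    ⟪ y ⊕ + 4 ⊙ w , a ⟫                ≡⟨ trans (⟪⟫-⊕ˡ y (+ 4 ⊙ w) a) (cong (_+_ ⟪ y , a ⟫) (trans (⟪⟫-⊙ˡ (+ 4) w a) (cong (+ 4 *_) e′))) ⟩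
    ⟪ y , a ⟫ + + 4 * (k * + 8)        ≡⟨ cong (_+ + 4 * (k * + 8)) (a≡a%ℕn+[a/ℕn]*n ⟪ y , a ⟫ 32) ⟩
    + (⟪ y , a ⟫ %ℕ 32) + ⟪ y , a ⟫ /ℕ 32 * + 32 + + 4 * (k * + 8) ≡⟨ eq (+ (⟪ y , a ⟫ %ℕ 32)) (⟪ y , a ⟫ /ℕ 32) k ⟩
    + (⟪ y , a ⟫ %ℕ 32) + (⟪ y , a ⟫ /ℕ 32 + k) * + 32 ∎)
    where
    open ≡-Reasoning
    eq : ∀ r q k → r + q * + 32 + + 4 * (k * + 8) ≡ r + (q + k) * + 32
    eq = solve-∀

value-residue : ∀ {r a} → norm r ℕ.≤ 256 → Min a → value r a % 32 ≡ ⟪ r , a ⟫ %ℕ 32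
value-residue {r} {a} h m = %ℕ-unique 32 (n%ℕd<d ⟪ r , a ⟫ 32) (⟪ r , a ⟫ /ℕ 32 + + 4)
  (trans (value-+ {r} {a} h m) (trans (cong (_+ + 128) (a≡a%ℕn+[a/ℕn]*n ⟪ r , a ⟫ 32)) (eq (+ (⟪ r , a ⟫ %ℕ 32)) (⟪ r , a ⟫ /ℕ 32))))
  where
  eq : ∀ r q → r + q * + 32 + + 128 ≡ r + (q + + 4) * + 32
  eq = solve-∀

norm-orbit : ∀ {u v} → InΛ u → InOrbit u v → norm v ≡ norm u
norm-orbit {u} {v} i o = ℤₚ.+-injective (trans (norm-+ v) (trans (orbit-norm i o) (sym (norm-+ u))))

≈-orbit : ∀ {σ x y} (s : Co₀ σ) → InΛ x → InΛ y → σ x ≈ y → x ≈ Co₀.inverse s y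
≈-orbit {σ} {x} {y} s ix iy e = subst (_≈ Co₀.inverse s y) (Co₀.inv-left s x ix) (σ-≈ (Co₀-inverse s) (Co₀.maps s x ix) iy e)

class-conj : ∀ {r b v u} → InΛ r → Class r b → InOrbit r v → u ≈ v → norm u ℕ.≤ norm v → norm u ≡ norm v
class-conj {r} {v = v} {u} ir cl (σ , s , refl) e u≤ = trans (sym (norm-orbit iu (Co₀.inverse s , s⁻ , refl)))
    (trans (Class.exact cl (≈-sym (≈-orbit s ir iu (≈-sym e)) , subst₂ ℕ._≤_ (sym (norm-orbit iu (Co₀.inverse s , s⁻ , refl))) (norm-orbit ir (σ , s , refl)) u≤))
      (sym (norm-orbit ir (σ , s , refl))))
  where
  s⁻ : Co₀ (Co₀.inverse s)
  s⁻ = Co₀-inverse s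
  iu : InΛ u
  iu = ≈⇒Λ (Co₀.maps s r ir) e

orbit-AtMost : ∀ {r v n} {P : Vec24 → Set} → InΛ r → InOrbit r v → (∀ {u} → P u → InΛ u) → (∀ {σ u} → Co₀ σ → P u → P (σ u)) →
  AtMost (λ u → P u × u ≈ r) n → AtMost (λ u → P u × u ≈ v) n
orbit-AtMost {r} ir (σ , s , refl) inΛ closed = AtMost-map (Co₀.inverse s)
  (λ { (p , _) (q , _) → σ-injective (Co₀-inverse s) (inΛ p) (inΛ q) })
  (λ { (p , e) → closed (Co₀-inverse s) p , ≈-sym (≈-orbit s ir (inΛ p) (≈-sym e)) })

orbit-AtLeast : ∀ {r v n} {P : Vec24 → Set} → InΛ r → InOrbit r v → (∀ {u} → P u → InΛ u) → (∀ {σ u} → Co₀ σ → P u → P (σ u)) →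
  AtLeast (λ u → P u × u ≈ r) n → AtLeast (λ u → P u × u ≈ v) n
orbit-AtLeast ir (σ , s , refl) inΛ closed = AtLeast-map σ
  (λ { (p , _) (q , _) → σ-injective s (inΛ p) (inΛ q) })
  (λ { (p , e) → closed s p , σ-≈ s (inΛ p) ir e })

orbit-closed : ∀ {r σ u} → Co₀ σ → InOrbit r u → InOrbit r (σ u)
orbit-closed s o = orbit-trans o (_ , s , refl)

Separated : Spec → Spec → Set
Separated s s′ = type s ≢ type s′ ⊎ checksum s ≢ checksum s′

module _ (minimals : AtLeast Min (length minCodes)) where

  -- An automorphism permutes the minimal vectors, so the sum over all of them is constant along an
  -- orbit. The length condition in `sums` guarantees that the transported list is again all of
  -- them.
  residue-sum : ∀ {s u} (F : Frame s) → InOrbit (Frame.rep F) u → sum (List.map (λ a → ⟪ u , a ⟫ %ℕ 32) (proj₁ minimals)) ≡ checksum s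
  residue-sum {s} F (σ , g , refl) = trans (cong sum (go (proj₁ (proj₂ (proj₂ minimals)))))
      (Frame.sums F (unique-map (Co₀.inverse g) (λ p q → σ-injective g⁻ (proj₁ p) (proj₁ q)) (proj₁ (proj₂ (proj₂ minimals))) (proj₁ (proj₂ minimals)))
        (Allₚ.map⁺ (All.map (Min-act g⁻) (proj₁ (proj₂ (proj₂ minimals))))) (subst (length minCodes ℕ.≤_) (sym (Listₚ.length-map (Co₀.inverse g) (proj₁ minimals))) (proj₂ (proj₂ (proj₂ minimals)))))
    where
    r : Vec24
    r = Frame.rep F
    g⁻ : Co₀ (Co₀.inverse g)
    g⁻ = Co₀-inverse g
    r≤ : norm r ℕ.≤ 256
    r≤ = subst (ℕ._≤ 256) (sym (Frame.rep-norm F)) (ℕₚ.*-monoʳ-≤ 16 (Frame.type≤ F))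
    go : ∀ {l} → All Min l → List.map (λ a → ⟪ σ r , a ⟫ %ℕ 32) l ≡ List.map (λ a → value r a % 32) (List.map (Co₀.inverse g) l)
    go [] = refl
    go {a ∷ _} (m ∷ ms) = cong₂ _∷_ (trans (cong (_%ℕ 32) (trans (cong ⟪ σ r ,_⟫ (sym (Co₀.inv-right g a (proj₁ m)))) (Co₀.isometry g r (Co₀.inverse g a) (Frame.rep∈Λ F) (Co₀.inv-maps g a (proj₁ m)))))
      (sym (value-residue {r} {Co₀.inverse g a} r≤ (Min-act g⁻ m)))) (go ms)

  -- If the types differ, the shorter of two congruent vectors would contradict `exact` for the
  -- class of the longer one. If the checksums differ, then so would the residue sums of congruent
  -- vectors.
  separated : ∀ {s s′ u v} (F : Frame s) (G : Frame s′) → Separated s s′ → InOrbit (Frame.rep F) u → InOrbit (Frame.rep G) v → ¬ u ≈ v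
  separated {s} {s′} {u} {v} F G (inj₁ t≢) o o′ e = t≢ (ℕₚ.*-cancelˡ-≡ (type s) (type s′) 16 (trans (sym (norm-of F o)) (trans same (norm-of G o′))))
    where
    norm-of : ∀ {s u} (F : Frame s) → InOrbit (Frame.rep F) u → norm u ≡ 16 ℕ.* type s
    norm-of F o = trans (norm-orbit (Frame.rep∈Λ F) o) (Frame.rep-norm F)
    same : norm u ≡ norm v
    same = [ class-conj (Frame.rep∈Λ G) (Frame.near-class G) o′ e , (λ v≤ → sym (class-conj (Frame.rep∈Λ F) (Frame.near-class F) o (≈-sym e) v≤)) ]′ (ℕₚ.≤-total (norm u) (norm v))
  separated {s} {s′} {u} {v} F G (inj₂ S≢) o o′ e = S≢ (trans (sym (residue-sum F o)) (trans (cong sum (go (proj₁ (proj₂ (proj₂ minimals))))) (residue-sum G o′)))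
    where
    go : ∀ {l} → All Min l → List.map (λ a → ⟪ u , a ⟫ %ℕ 32) l ≡ List.map (λ a → ⟪ v , a ⟫ %ℕ 32) l
    go [] = refl
    go (m ∷ ms) = cong₂ _∷_ (≈-norm e (orbit-Λ (Frame.rep∈Λ G) o′) (proj₁ m)) (go ms)

  classesOf : ∀ {s} → Frame s → List (Fin total)
  classesOf F = List.deduplicate Finₚ._≟_ (List.map class (proj₁ (Frame.many F)))

  classOf⁻ : ∀ {s} (F : Frame s) {y} → y ∈ classesOf F → ∃ λ u → InOrbit (Frame.rep F) u × y ≡ class u
  classOf⁻ F i with ∈-map⁻ class (∈-deduplicate⁻ Finₚ._≟_ (List.map class (proj₁ (Frame.many F))) i)
  ... | u , j , e = u , All.lookup (proj₁ (proj₂ (proj₂ (Frame.many F)))) j , e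

  fibre-few : ∀ {s} (F : Frame s) {y} → y ∈ classesOf F → AtMost (λ u → InOrbit (Frame.rep F) u × class u ≡ y) (weight s)
  fibre-few F i with classOf⁻ F i
  ... | v , o , refl = AtMost-⊆ (λ { (p , e) → p , class-injective (orbit-Λ (Frame.rep∈Λ F) p) (orbit-Λ (Frame.rep∈Λ F) o) e })
    (orbit-AtMost (Frame.rep∈Λ F) o (orbit-Λ (Frame.rep∈Λ F)) orbit-closed (Frame.few F))

  listed : ∀ {s} (F : Frame s) → All (λ u → class u ∈ classesOf F) (proj₁ (Frame.many F))
  listed F = All.tabulate (λ i → ∈-deduplicate⁺ Finₚ._≟_ (∈-map⁺ class i))

  -- The orbit has at least `card` elements and no class contains more than `weight` of them.
  classes-≥ : ∀ {s} (F : Frame s) → classes s ℕ.≤ length (classesOf F)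
  classes-≥ {s} F = ℕₚ.*-cancelʳ-≤ (classes s) (length (classesOf F)) (weight s) {{Frame.weight≢0 F}} (subst (ℕ._≤ _) (Frame.card≡ F)
    (ℕₚ.≤-trans (proj₂ (proj₂ (proj₂ (Frame.many F)))) (Fibres.fibres Finₚ._≟_ class (classesOf F) (proj₁ (proj₂ (Frame.many F))) (proj₁ (proj₂ (proj₂ (Frame.many F)))) (listed F) (fibre-few F))))

  allClasses : ∀ {ss} → All Frame ss → List (Fin total)
  allClasses [] = []
  allClasses (F ∷ Fs) = classesOf F ++ allClasses Fs

  allClasses⁻ : ∀ {ss} (Fs : All Frame ss) {y} → y ∈ allClasses Fs → ∃ λ s → ∃ λ (i : s ∈ ss) → y ∈ classesOf (All.lookup Fs i)
  allClasses⁻ (F ∷ Fs) j with Data.List.Membership.Propositional.Properties.∈-++⁻ (classesOf F) j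
  ... | inj₁ k = _ , here refl , k
  ... | inj₂ k with allClasses⁻ Fs k
  ...   | s , i , k′ = s , there i , k′

  unique-classes : ∀ {ss} (Fs : All Frame ss) → AllPairs Separated ss → Unique (allClasses Fs)
  unique-classes [] [] = []
  unique-classes (F ∷ Fs) (sep ∷ seps) = Uniqueₚ.++⁺ (deduplicate-! Finₚ._≟_ _) (unique-classes Fs seps) clash
    where
    clash : ∀ {y} → ¬ (y ∈ classesOf F × y ∈ allClasses Fs)
    clash (j , k) with classOf⁻ F j | allClasses⁻ Fs k
    ... | u , o , refl | s , i , k′ with classOf⁻ (All.lookup Fs i) k′
    ...   | v , o′ , e = separated F (All.lookup Fs i) (All.lookup sep i) o o′
      (class-injective (orbit-Λ (Frame.rep∈Λ F) o) (orbit-Λ (Frame.rep∈Λ (All.lookup Fs i)) o′) e)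

  length-classes : ∀ {ss} (Fs : All Frame ss) → sum (List.map classes ss) ℕ.≤ length (allClasses Fs)
  length-classes [] = z≤n
  length-classes (F ∷ Fs) = subst (_ ℕ.≤_) (sym (Listₚ.length-++ (classesOf F))) (ℕₚ.+-mono-≤ (classes-≥ F) (length-classes Fs))

  -- Each orbit contributes at least its share to the total; if the total is not exceeded, none
  -- contributes more.
  classes-≤ : ∀ {ss} (Fs : All Frame ss) → length (allClasses Fs) ℕ.≤ sum (List.map classes ss) → ∀ {s} (i : s ∈ ss) → length (classesOf (All.lookup Fs i)) ℕ.≤ classes s
  classes-≤ {s ∷ ss} (F ∷ Fs) le (here refl) = ℕₚ.+-cancelʳ-≤ (length (allClasses Fs)) (length (classesOf F)) (classes s)
    (ℕₚ.≤-trans (subst (ℕ._≤ _) (Listₚ.length-++ (classesOf F)) le) (ℕₚ.+-monoʳ-≤ (classes s) (length-classes Fs)))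
  classes-≤ {s ∷ ss} (F ∷ Fs) le (there i) = classes-≤ Fs (ℕₚ.+-cancelˡ-≤ (classes s) _ _
    (ℕₚ.≤-trans (ℕₚ.+-monoˡ-≤ _ (classes-≥ F)) (subst (ℕ._≤ _) (Listₚ.length-++ (classesOf F)) le))) i

-- Positions in the list are compared together with the entries, since a frame is attached to a
-- position.
AllPairs-cases : ∀ {A : Set} {R : A → A → Set} {l} → AllPairs R l → ∀ {x y} (i : x ∈ l) (j : y ∈ l) → (_≡_ {A = ∃ (_∈ l)} (x , i) (y , j)) ⊎ R x y ⊎ R y x
AllPairs-cases (r ∷ rs) (here refl) (here refl) = inj₁ refl
AllPairs-cases (r ∷ rs) (here refl) (there j) = inj₂ (inj₁ (All.lookup r j))
AllPairs-cases (r ∷ rs) (there i) (here refl) = inj₂ (inj₂ (All.lookup r i))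
AllPairs-cases (r ∷ rs) (there i) (there j) with AllPairs-cases rs i j
... | inj₁ refl = inj₁ refl
... | inj₂ c = inj₂ c

Fin-unique : ∀ {N} {l : List (Fin N)} → Unique l → length l ℕ.≤ N
Fin-unique {N} {l} u = subst (length l ℕ.≤_) (Listₚ.length-tabulate id) (AtMost-list Finₚ._≟_ (List.allFin N) l u (All.tabulate (λ {y} _ → ∈-allFin y)))

Fin-saturated : ∀ {N} {l : List (Fin N)} → Unique l → N ℕ.≤ length l → ∀ y → y ∈ l
Fin-saturated u le y = saturated Finₚ._≟_ {P = λ _ → ⊤} (λ l u _ → Fin-unique u) u (All.tabulate (λ _ → tt)) le tt

-- Consequences of the count reaching 4²⁴

module Census {specs : List Spec} (frames : All Frame specs) (minimals : AtLeast Min (length minCodes))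
    (seps : AllPairs Separated specs) (sum≡ : sum (List.map classes specs) ≡ total) where

  frame : ∀ {s} → s ∈ specs → Frame s
  frame = All.lookup frames

  private
    found : List (Fin total)
    found = allClasses minimals frames

    found-unique : Unique found
    found-unique = unique-classes minimals frames seps

    hit : ∀ y → y ∈ found
    hit = Fin-saturated found-unique (subst (ℕ._≤ length found) sum≡ (length-classes minimals frames))

  cover : ∀ {x} → InΛ x → ∃ λ s → ∃ λ (i : s ∈ specs) → ∃ λ u → InOrbit (Frame.rep (frame i)) u × x ≈ u × class x ∈ classesOf minimals (frame i)
  cover {x} ix = go (allClasses⁻ minimals frames (hit (class x)))
    where
    go : (∃ λ s → ∃ λ (i : s ∈ specs) → class x ∈ classesOf minimals (frame i)) →
      ∃ λ s → ∃ λ (i : s ∈ specs) → ∃ λ u → InOrbit (Frame.rep (frame i)) u × x ≈ u × class x ∈ classesOf minimals (frame i)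
    go (s , i , j) = back (classOf⁻ minimals (frame i) j)
      where
      back : (∃ λ u → InOrbit (Frame.rep (frame i)) u × class x ≡ class u) → _
      back (u , o , e) = s , i , u , o , class-injective ix (orbit-Λ (Frame.rep∈Λ (frame i)) o) e , j

  same-frame : ∀ {s s′ u v} (i : s ∈ specs) (j : s′ ∈ specs) → InOrbit (Frame.rep (frame i)) u → InOrbit (Frame.rep (frame j)) v → u ≈ v →
    _≡_ {A = ∃ (_∈ specs)} (s , i) (s′ , j)
  same-frame i j o o′ e = [ id , [ (λ r → ⊥-elim (separated minimals (frame i) (frame j) r o o′ e)) , (λ r → ⊥-elim (separated minimals (frame j) (frame i) r o′ o (≈-sym e))) ]′ ]′
    (AllPairs-cases seps i j)

  module _ {s} (i : s ∈ specs) where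

    private
      F : Frame s
      F = frame i
    open Frame F

    in-classes : ∀ {x u} → InΛ x → InOrbit rep u → x ≈ u → class x ∈ classesOf minimals F
    in-classes {x} ix o e = go (cover ix)
      where
      go : (∃ λ s′ → ∃ λ (j : s′ ∈ specs) → ∃ λ v → InOrbit (Frame.rep (frame j)) v × x ≈ v × class x ∈ classesOf minimals (frame j)) → class x ∈ classesOf minimals F
      go (s′ , j , v , o′ , e′ , c) = subst (λ { (_ , k) → class x ∈ classesOf minimals (frame k) }) (sym (same-frame i j o o′ (≈-trans (≈-sym e) e′))) c

    classes-count : length (classesOf minimals F) ≡ classes s
    classes-count = ℕₚ.≤-antisym (classes-≤ minimals frames (subst (length found ℕ.≤_) (sym sum≡) (Fin-unique found-unique)) i) (classes-≥ minimals F)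

    -- The orbit lies in `classes s` classes with at most `weight s` elements in each; their product
    -- is the lower bound already known.
    orbit-size : HasSize (InOrbit rep) (card s)
    orbit-size = hasSize (λ l u os → subst (length l ℕ.≤_) (sym card≡) (subst (λ n → length l ℕ.≤ n ℕ.* weight s) classes-count
      (Fibres.fibres Finₚ._≟_ class (classesOf minimals F) u os (All.map (λ o → in-classes (orbit-Λ rep∈Λ o) o ≈-refl) os) (fibre-few minimals F)))) many

    -- The count of `orbit-size` leaves no room: each class met by the orbit contains the full
    -- number `weight s` of its elements.
    attained : AtLeast (λ u → InOrbit rep u × u ≈ rep) (weight s)
    attained = AtLeast-⊆ (λ { (o , e) → o , class-injective (orbit-Λ rep∈Λ o) rep∈Λ e })
      (Fibres.tight Finₚ._≟_ class (classesOf minimals F) (proj₁ (proj₂ many)) (proj₁ (proj₂ (proj₂ many))) (listed minimals F) (fibre-few minimals F)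
        (subst₂ ℕ._≤_ (trans card≡ (cong (ℕ._* weight s) (sym classes-count))) refl (proj₂ (proj₂ (proj₂ many)))) (in-classes rep∈Λ orbit-refl ≈-refl))

open import Data.List.Membership.Propositional.Properties using (∈-++⁻)
import Function.Bundles

-- Congruent vectors have small inner products

-- The difference is four times a non-zero lattice vector, so |x - y|² is at least 16 · 32 = 512.
congruent-pairing : ∀ {x y} → InΛ y → x ≈ y → x ≢ y → + 2 * ⟪ x , y ⟫ ℤ.≤ + norm x + + norm y - + 512
congruent-pairing {x} {y} iy (w , iw , e) x≢y = undiff (subst (+ 0 ℤ.≤_) final (grow 16 (diff (+≤+ (size-≥32 iw w≢)))))
  where
  x≡ : x ≡ y ⊕ + 4 ⊙ w
  x≡ = ⊖⇒≡⊕ e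
  w≢ : w ≢ 𝟎
  w≢ w≡ = x≢y (trans x≡ (trans (cong (λ v → y ⊕ + 4 ⊙ v) w≡) (trans (cong (y ⊕_) (⊙-𝟎 (+ 4))) (⊕-identityʳ y))))
  eq : ∀ Y g N → + 16 * (N - + 32) ≡ (Y + + 2 * + 4 * g + + 4 * + 4 * N) + Y - + 512 - + 2 * (Y + + 4 * g)
  eq = solve-∀
  final : + 16 * (+ norm w - + 32) ≡ + norm x + + norm y - + 512 - + 2 * ⟪ x , y ⟫
  final = trans (eq (+ norm y) ⟪ y , w ⟫ (+ norm w)) (cong₂ (λ X P → X + + norm y - + 512 - + 2 * P)
    (sym (trans (cong (+_ ∘ norm) x≡) (norm-shift (+ 4) y w)))
    (sym (trans (cong ⟪_, y ⟫ x≡) (trans (⟪⟫-⊕ˡ y (+ 4 ⊙ w) y) (cong₂ _+_ (sym (norm-+ y)) (trans (⟪⟫-⊙ˡ (+ 4) w y) (cong (+ 4 *_) (⟪⟫-comm w y))))))))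

vsum : List Vec24 → Vec24
vsum [] = 𝟎
vsum (x ∷ l) = x ⊕ vsum l

Around : Vec24 → ℤ → Vec24 → Set
Around v T u = InΛ u × u ≈ v × + norm u ≡ T

len : ∀ {A : Set} → List A → ℤ
len l = + length l

len-∷ : ∀ {A : Set} (x : A) l → len (x ∷ l) ≡ + 1 + len l
len-∷ x l = ℤₚ.pos-+ 1 (length l)

around-≈ : ∀ {v T T′ x y} → Around v T x → Around v T′ y → x ≈ y
around-≈ (_ , e , _) (_ , e′ , _) = ≈-trans e (≈-sym e′)

cross-sum : ∀ {v T T′ x l} → Around v T x → All (Around v T′) l → All (x ≢_) l → + 2 * ⟪ x , vsum l ⟫ ℤ.≤ len l * (T + T′ - + 512)
cross-sum {x = x} ax [] [] = ℤₚ.≤-reflexive (cong (+ 2 *_) (⟪⟫-𝟎ʳ x))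
cross-sum {T = T} {T′} {x} {y ∷ l} ax (ay ∷ al) (n ∷ ns) = subst₂ ℤ._≤_
  (trans (sym (ℤₚ.*-distribˡ-+ (+ 2) ⟪ x , y ⟫ ⟪ x , vsum l ⟫)) (cong (+ 2 *_) (sym (⟪⟫-⊕ʳ x y (vsum l)))))
  (trans (sym (eq (T + T′ - + 512) (len l))) (cong (_* (T + T′ - + 512)) (sym (len-∷ y l))))
  (ℤₚ.+-mono-≤ (subst (+ 2 * ⟪ x , y ⟫ ℤ.≤_) (cong₂ (λ a b → a + b - + 512) (proj₂ (proj₂ ax)) (proj₂ (proj₂ ay))) (congruent-pairing (proj₁ ay) (around-≈ ax ay) n)) (cross-sum ax al ns))
  where
  eq : ∀ c k → (+ 1 + k) * c ≡ c + k * c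
  eq = solve-∀

-- In the square of a sum of k vectors the diagonal terms are `T`, and the k(k - 1) others are at
-- most `T - 256` by `congruent-pairing`. Below type 16 this becomes negative for large k.
gram : ∀ {v T l} → Unique l → All (Around v T) l → ⟪ vsum l , vsum l ⟫ ℤ.≤ len l * len l * (T - + 256) + + 256 * len l
gram [] [] = ℤₚ.≤-reflexive (⟪⟫-𝟎ʳ (𝟎 {24}))
gram {T = T} {x ∷ l} (n ∷ u) (ax ∷ al) = subst₂ ℤ._≤_ (sym square) (trans (eq T (len l)) (cong (λ k → k * k * (T - + 256) + + 256 * k) (sym (len-∷ x l))))
  (ℤₚ.+-mono-≤ (ℤₚ.≤-reflexive (proj₂ (proj₂ ax))) (ℤₚ.+-mono-≤ (cross-sum ax al n) (gram u al)))
  where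
  S : Vec24
  S = vsum l
  rearr : ∀ a b c → a + b + (b + c) ≡ a + (+ 2 * b + c)
  rearr = solve-∀
  square : ⟪ x ⊕ S , x ⊕ S ⟫ ≡ + norm x + (+ 2 * ⟪ x , S ⟫ + ⟪ S , S ⟫)
  square = trans (⟪⟫-⊕ˡ x S (x ⊕ S)) (trans (cong₂ _+_ (⟪⟫-⊕ʳ x x S) (trans (⟪⟫-⊕ʳ S x S) (cong (_+ ⟪ S , S ⟫) (⟪⟫-comm S x))))
    (trans (rearr ⟪ x , x ⟫ ⟪ x , S ⟫ ⟪ S , S ⟫) (cong (_+ (+ 2 * ⟪ x , S ⟫ + ⟪ S , S ⟫)) (sym (norm-+ x)))))
  eq : ∀ T k → T + (k * (T + T - + 512) + (k * k * (T - + 256) + + 256 * k)) ≡ (+ 1 + k) * (+ 1 + k) * (T - + 256) + + 256 * (+ 1 + k)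
  eq = solve-∀

cross : ∀ {v T T′ l l′} → All (Around v T) l → All (Around v T′) l′ → T ≢ T′ → + 2 * ⟪ vsum l , vsum l′ ⟫ ℤ.≤ len l * len l′ * (T + T′ - + 512)
cross {l = []} {l′} [] _ _ = ℤₚ.≤-reflexive (cong (+ 2 *_) (trans (⟪⟫-comm 𝟎 (vsum l′)) (⟪⟫-𝟎ʳ (vsum l′))))
cross {T = T} {T′} {x ∷ l} {l′} (ax ∷ al) al′ T≢ = subst₂ ℤ._≤_
  (trans (sym (ℤₚ.*-distribˡ-+ (+ 2) ⟪ x , vsum l′ ⟫ ⟪ vsum l , vsum l′ ⟫)) (cong (+ 2 *_) (sym (⟪⟫-⊕ˡ x (vsum l) (vsum l′)))))
  (trans (sym (eq (len l) (len l′) (T + T′ - + 512))) (cong (λ k → k * len l′ * (T + T′ - + 512)) (sym (len-∷ x l))))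
  -- Vectors of different norms are different, so `congruent-pairing` applies to every pair from the
  -- two lists.
  (ℤₚ.+-mono-≤ (cross-sum ax al′ (All.map (λ { ay refl → T≢ (trans (sym (proj₂ (proj₂ ax))) (proj₂ (proj₂ ay))) }) al′)) (cross al al′ T≢))
  where
  eq : ∀ k k′ c → (+ 1 + k) * k′ * c ≡ k′ * c + k * k′ * c
  eq = solve-∀

-- The upper bound for |αS + βS′|² when `S` is a sum of `k` vectors of norm `T` and `S′` a sum of
-- `k′` vectors of norm `T′`, all different and in one class.
gramForm : (T T′ k k′ α β : ℤ) → ℤ
gramForm T T′ k k′ α β = α * α * (k * k * (T - + 256) + + 256 * k) + (α * β * (k * k′ * (T + T′ - + 512)) + β * β * (k′ * k′ * (T′ - + 256) + + 256 * k′))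

-- A norm is not negative. The coefficients are natural numbers because the upper bounds are
-- multiplied by α², αβ and β².
gramForm-nonneg : ∀ {v T T′ l l′} → Unique l → Unique l′ → All (Around v T) l → All (Around v T′) l′ → T ≢ T′ → ∀ α β →
  + 0 ℤ.≤ gramForm T T′ (len l) (len l′) (+ α) (+ β)
gramForm-nonneg {T = T} {T′} {l} {l′} u u′ al al′ T≢ α β = ℤₚ.≤-trans (norm-nonneg (+ α ⊙ vsum l ⊕ + β ⊙ vsum l′)) (subst (ℤ._≤ gramForm T T′ (len l) (len l′) (+ α) (+ β))
    (sym (trans (norm-comb (+ α) (+ β) (vsum l) (vsum l′)) (eq (+ α) (+ β) ⟪ vsum l , vsum l ⟫ ⟪ vsum l , vsum l′ ⟫ ⟪ vsum l′ , vsum l′ ⟫)))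
    (ℤₚ.+-mono-≤ (times (α ℕ.* α) (ℤₚ.pos-* α α) (gram u al)) (ℤₚ.+-mono-≤ (times (α ℕ.* β) (ℤₚ.pos-* α β) (cross al al′ T≢)) (times (β ℕ.* β) (ℤₚ.pos-* β β) (gram u′ al′)))))
  where
  times : ∀ n {z a b} → + n ≡ z → a ℤ.≤ b → z * a ℤ.≤ z * b
  times n refl h = ℤₚ.*-monoˡ-≤-nonNeg (+ n) h
  eq : ∀ a b p q r → a * a * p + + 2 * (a * b) * q + b * b * r ≡ a * a * p + (a * b * (+ 2 * q) + b * b * r)
  eq = solve-∀

hasSize-⇔ : ∀ {P Q n} → (∀ {u} → P u → Q u) → (∀ {u} → Q u → P u) → HasSize P n → HasSize Q n
hasSize-⇔ f g h = hasSize (AtMost-⊆ g (HasSize⇒AtMost h)) (AtLeast-⊆ f (HasSize⇒AtLeast h))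

-- Vectors of type t in orbits of size c are not congruent to shorter ones

negative : ℤ → Bool
negative -[1+ _ ] = true
negative (+ _) = false

quot : ℕ → ℕ → ℕ
quot m zero = 0
quot m n@(suc _) = m / n

quot-exact : ∀ n k → ℕ.NonZero n → quot (n ℕ.* k) n ≡ k
quot-exact n@(suc _) k _ = trans (cong (_/ n) (ℕₚ.*-comm n k)) (m*n/n≡m k n)

-- `k` is the number of vectors of the orbit in one class of `s`, as forced by counting congruent
-- pairs. The alternatives are: nothing shorter to exclude, types incongruent modulo 4, a `k` that
-- is not integral, types 16 and 4, or a negative value of the Gram form. Types 16 and 4 stand apart
-- because for O₁₆ₐ against O₄, with one vector on either side, the form 256α² - 192αβ + 64β² is
-- positive definite.
excludedFor : ℕ → ℕ → Spec → ℕ → Bool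
excludedFor t c s k = (t ℕ.≤ᵇ type s) ∨ not (t % 4 ℕ.≡ᵇ type s % 4) ∨ not (c ℕ.* weight s ℕ.≡ᵇ card s ℕ.* k) ∨ ((t ℕ.≡ᵇ 16) ∧ (type s ℕ.≡ᵇ 4))
    ∨ negative (gramForm Tℤ T′ (+ k) (+ weight s) (+ 1) (+ 0)) ∨ negative (gramForm Tℤ T′ (+ k) (+ weight s) (+ ℤ.∣ Y ∣) (+ ℤ.∣ A ∣))
  where
  Tℤ T′ Y A : ℤ
  Tℤ = + (16 ℕ.* t)
  T′ = + (16 ℕ.* type s)
  -- gramForm is minimal in the direction (−Y , A)
  Y = + k * + weight s * (Tℤ + T′ - + 512)
  A = + 2 * (+ k * + k * (Tℤ - + 256) + + 256 * + k)

excluded : ℕ → ℕ → Spec → Bool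
excluded t c s = excludedFor t c s (quot (c ℕ.* weight s) (card s))

∨-case : ∀ {p q} {A : Set} → p ∨ q ≡ true → (p ≡ true → A) → (q ≡ true → A) → A
∨-case {true} _ f _ = f refl
∨-case {false} e _ g = g e

not-true : ∀ {p} → not p ≡ true → ¬ T p
not-true {false} _ ()

-- With `x = y + 4w`, the norms differ by 8⟨y , w⟩ + 16|w|², a multiple of 64 since ⟨y , w⟩ is
-- divisible by 8 and |w|² by 16.
≈-type : ∀ {x y t t′} → InΛ y → x ≈ y → norm x ≡ 16 ℕ.* t → norm y ≡ 16 ℕ.* t′ → t % 4 ≡ t′ % 4
≈-type {x} {y} {t} {t′} iy (w , iw , e) ex ey = go (pairing (InΛ⇒Integral iy) (InΛ⇒Integral iw)) (norm-type iw)
  where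
  go : + 8 ∣ ⟪ y , w ⟫ → (∃ λ s → norm w ≡ 16 ℕ.* s) → t % 4 ≡ t′ % 4
  go (divides m em) (s , es) = %ℕ-unique 4 {+ t} {t′ % 4} (n%ℕd<d (+ t′) 4) ((+ t′) /ℕ 4 + m + + 4 * + s) (ℤₚ.*-cancelˡ-≡ (+ 16) (+ t) (+ (t′ % 4) + ((+ t′) /ℕ 4 + m + + 4 * + s) * + 4) (begin
    + 16 * + t                                     ≡⟨ trans (sym (ℤₚ.pos-* 16 t)) (cong +_ (sym ex)) ⟩
    + norm x                                       ≡⟨ trans (cong (+_ ∘ norm) (⊖⇒≡⊕ e)) (norm-shift (+ 4) y w) ⟩
    + norm y + + 2 * + 4 * ⟪ y , w ⟫ + + 4 * + 4 * + norm w ≡⟨ cong₂ (λ a b → a + + 2 * + 4 * ⟪ y , w ⟫ + + 4 * + 4 * b) (trans (cong +_ ey) (ℤₚ.pos-* 16 t′)) (trans (cong +_ es) (ℤₚ.pos-* 16 s)) ⟩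
    + 16 * + t′ + + 2 * + 4 * ⟪ y , w ⟫ + + 4 * + 4 * (+ 16 * + s) ≡⟨ cong (λ a → + 16 * + t′ + + 2 * + 4 * a + + 4 * + 4 * (+ 16 * + s)) em ⟩
    + 16 * + t′ + + 2 * + 4 * (m * + 8) + + 4 * + 4 * (+ 16 * + s) ≡⟨ cong (λ a → + 16 * a + + 2 * + 4 * (m * + 8) + + 4 * + 4 * (+ 16 * + s)) (a≡a%ℕn+[a/ℕn]*n (+ t′) 4) ⟩
    + 16 * (+ (t′ % 4) + (+ t′) /ℕ 4 * + 4) + + 2 * + 4 * (m * + 8) + + 4 * + 4 * (+ 16 * + s) ≡⟨ eq (+ (t′ % 4)) ((+ t′) /ℕ 4) m (+ s) ⟩
    + 16 * (+ (t′ % 4) + ((+ t′) /ℕ 4 + m + + 4 * + s) * + 4) ∎))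
    where
    open ≡-Reasoning
    eq : ∀ r q m s → + 16 * (r + q * + 4) + + 2 * + 4 * (m * + 8) + + 4 * + 4 * (+ 16 * s) ≡ + 16 * (r + (q + m + + 4 * s) * + 4)
    eq = solve-∀

-- If v = v′ + 4w has type 16 and v′ type 4, then v′ + w would have type 7 − 3s for w of type s.
no-16-4 : ∀ {x y} → InΛ y → x ≈ y → norm x ≡ 256 → norm y ≡ 64 → ⊥
no-16-4 {x} {y} iy (w , iw , e) ex ey = go (size iw)
  where
  g : ℤ
  g = ⟪ y , w ⟫
  rel : + 256 ≡ + 64 + + 2 * + 4 * g + + 4 * + 4 * + norm w
  rel = trans (cong +_ (sym ex)) (trans (cong (+_ ∘ norm) (⊖⇒≡⊕ e)) (trans (norm-shift (+ 4) y w) (cong (λ a → + a + + 2 * + 4 * g + + 4 * + 4 * + norm w) ey)))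
  sum-norm : + 4 * + norm (y ⊕ + 1 ⊙ w) ≡ + 448 - + 12 * + norm w
  sum-norm = trans (cong (+ 4 *_) (trans (norm-shift (+ 1) y w) (cong (λ a → + a + + 2 * + 1 * g + + 1 * + 1 * + norm w) ey)))
    (trans (eq g (+ norm w)) (cong (λ t → t + + 192 - + 12 * + norm w) (sym rel)))
    where
    eq : ∀ g N → + 4 * (+ 64 + + 2 * + 1 * g + + 1 * + 1 * N) ≡ (+ 64 + + 2 * + 4 * g + + 4 * + 4 * N) + + 192 - + 12 * N
    eq = solve-∀
  four : ∀ n → + 4 * + n ≡ + 64 → n ≡ 16
  four n e = ℤₚ.+-injective (ℤₚ.*-cancelˡ-≡ (+ 4) (+ n) (+ 16) e)
  go : Size w → ⊥
  go (null refl) = case trans (sym ex) (trans (cong norm (trans (⊖⇒≡⊕ e) (trans (cong (y ⊕_) (⊙-𝟎 (+ 4))) (⊕-identityʳ y)))) ey) of λ ()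
  go (minimal m) = no-type-1 (Λ-closed-⊕ iy (Λ-closed-⊙ (+ 1) iw)) (four (norm (y ⊕ + 1 ⊙ w)) (trans sum-norm (cong (λ N → + 448 - + 12 * + N) (norm≡ {w} (proj₂ m)))))
  go (large l) = ℤₚ.≤⇒≯ (subst (+ 0 ℤ.≤_) (trans (cong (_+ + 12 * (+ norm w - + 48)) sum-norm) (eq (+ norm w))) (grow 4 {+ norm (y ⊕ + 1 ⊙ w)} (+≤+ z≤n) ⊞ grow 12 (diff (+≤+ l)))) ℤ.-<+
    where
    eq : ∀ N → (+ 448 - + 12 * N) + + 12 * (N - + 48) ≡ -[1+ 127 ]
    eq = solve-∀

module Excluding {specs : List Spec} (frames : All Frame specs) (minimals : AtLeast Min (length minCodes))
    (seps : AllPairs Separated specs) (sum≡ : sum (List.map classes specs) ≡ total) where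

  open Census frames minimals seps sum≡ public

  -- Counting the congruent pairs between the orbit of `v` and that of the representative from both
  -- sides yields `c · weight s = card s · k`. The number of congruent vectors therefore depends on
  -- the table only, and every alternative in `excluded` becomes a contradiction.
  shorter-excluded : ∀ {s v v′ t c} (i : s ∈ specs) → InΛ v → norm v ≡ 16 ℕ.* t → HasSize (InOrbit v) c →
    InOrbit (Frame.rep (frame i)) v′ → v ≈ v′ → type s ℕ.< t → excluded t c s ≡ true → ⊥
  shorter-excluded {s} {v} {v′} {t} {c} i iv ev hs@(ℓ , uℓ , ℓ≡ , iff) o e lt ex = decide
    where
    open Frame (frame i)
    iv′ : InΛ v′
    iv′ = orbit-Λ rep∈Λ o
    L′ : List Vec24
    L′ = proj₁ (orbit-size i)
    near? : ∀ u → Dec (u ≈ v′)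
    near? u = In4Λ? (u ⊖ v′)
    X : List Vec24
    X = filter near? ℓ
    k : ℕ
    k = length X
    ℓ-all : All (InOrbit v) ℓ
    ℓ-all = All.tabulate (λ {u} j → Function.Bundles.Equivalence.from (iff u) j)
    X-unique : Unique X
    X-unique = Uniqueₚ.filter⁺ near? uℓ
    X-all : All (λ u → InOrbit v u × u ≈ v′) X
    X-all = All.zip (Allₚ.filter⁺ near? ℓ-all , Allₚ.all-filter near? ℓ)
    at-most-k : AtMost (λ u → InOrbit v u × u ≈ v′) k
    at-most-k = AtMost-⊆ (λ {u} (p , q) → ∈-filter⁺ near? (Function.Bundles.Equivalence.to (iff u) p) q) (AtMost-list _≟ᵥ_ X)
    at-least-k : AtLeast (λ u → InOrbit v u × u ≈ v′) k
    at-least-k = X , X-unique , X-all , ℕₚ.≤-refl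
    v′-orbit : ∀ {u} → InOrbit rep u → InOrbit v′ u
    v′-orbit p = orbit-trans (orbit-sym rep∈Λ o) p
    forth : c ℕ.* weight s ℕ.≤ card s ℕ.* k
    forth = subst₂ (λ a b → a ℕ.* weight s ℕ.≤ b ℕ.* k) ℓ≡ (proj₁ (proj₂ (proj₂ (orbit-size i))))
      (double-count _≟ᵥ_ {Q = InOrbit v} {R = _≈_} {ys = L′} uℓ ℓ-all
        (λ { (σ , g , refl) → AtLeast-⊆ (λ {u′} (p , q) → Function.Bundles.Equivalence.to (proj₂ (proj₂ (proj₂ (orbit-size i))) u′) p , ≈-trans (σ-≈ g iv iv′ e) (≈-sym q))
            (orbit-AtLeast rep∈Λ (orbit-closed g o) (orbit-Λ rep∈Λ) orbit-closed (attained i)) })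
        (λ {u′} j → orbit-AtMost iv′ (v′-orbit (Function.Bundles.Equivalence.from (proj₂ (proj₂ (proj₂ (orbit-size i))) u′) j)) (orbit-Λ iv) orbit-closed at-most-k))
    back : card s ℕ.* k ℕ.≤ c ℕ.* weight s
    back = subst₂ (λ a b → a ℕ.* k ℕ.≤ b ℕ.* weight s) (proj₁ (proj₂ (proj₂ (orbit-size i)))) ℓ≡
      (double-count _≟ᵥ_ {Q = InOrbit rep} {R = _≈_} {ys = ℓ} (proj₁ (proj₂ (orbit-size i))) (All.tabulate (λ {u} j → Function.Bundles.Equivalence.from (proj₂ (proj₂ (proj₂ (orbit-size i))) u) j))
        (λ p → AtLeast-⊆ (λ {u} (q , q′) → Function.Bundles.Equivalence.to (iff u) q , ≈-sym q′) (orbit-AtLeast iv′ (v′-orbit p) (orbit-Λ iv) orbit-closed at-least-k))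
        (λ {u} j → column (Function.Bundles.Equivalence.from (iff u) j)))
      where
      column : ∀ {u} → InOrbit v u → AtMost (λ u′ → InOrbit rep u′ × u′ ≈ u) (weight s)
      column (σ , g , refl) = AtMost-⊆ (λ (p , q) → p , ≈-trans q (σ-≈ g iv iv′ e)) (orbit-AtMost rep∈Λ (orbit-closed g o) (orbit-Λ rep∈Λ) orbit-closed few)
    count : c ℕ.* weight s ≡ card s ℕ.* k
    count = ℕₚ.≤-antisym forth back
    Tℤ T′ : ℤ
    Tℤ = + (16 ℕ.* t)
    T′ = + (16 ℕ.* type s)
    ev′ : norm v′ ≡ 16 ℕ.* type s
    ev′ = trans (norm-orbit rep∈Λ o) rep-norm
    T≢ : Tℤ ≢ T′
    T≢ eq = ℕₚ.<-irrefl (sym (ℕₚ.*-cancelˡ-≡ t (type s) 16 (ℤₚ.+-injective eq))) lt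
    l′ : AtLeast (λ u → InOrbit rep u × u ≈ v′) (weight s)
    l′ = orbit-AtLeast rep∈Λ o (orbit-Λ rep∈Λ) orbit-closed (attained i)
    l′-length : length (proj₁ l′) ≡ weight s
    l′-length = ℕₚ.≤-antisym (orbit-AtMost rep∈Λ o (orbit-Λ rep∈Λ) orbit-closed few (proj₁ l′) (proj₁ (proj₂ l′)) (proj₁ (proj₂ (proj₂ l′)))) (proj₂ (proj₂ (proj₂ l′)))
    nonneg : ∀ α β → + 0 ℤ.≤ gramForm Tℤ T′ (+ k) (+ weight s) (+ α) (+ β)
    nonneg α β = subst (λ w → + 0 ℤ.≤ gramForm Tℤ T′ (+ k) (+ w) (+ α) (+ β)) l′-length (gramForm-nonneg X-unique (proj₁ (proj₂ l′))
      (All.map (λ (p , q) → orbit-Λ iv p , q , cong +_ (trans (norm-orbit iv p) ev)) X-all)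
      (All.map (λ (p , q) → orbit-Λ rep∈Λ p , q , cong +_ (trans (norm-orbit rep∈Λ p) rep-norm)) (proj₁ (proj₂ (proj₂ l′)))) T≢ α β)
    not-negative : ∀ {z} → + 0 ℤ.≤ z → negative z ≡ true → ⊥
    not-negative {+ _} _ ()
    quot-k : quot (c ℕ.* weight s) (card s) ≡ k
    quot-k = trans (cong (λ m → quot m (card s)) count) (quot-exact (card s) k card≢0)
      where
      card≢0 : ℕ.NonZero (card s)
      card≢0 = ℕ.≢-nonZero (λ z → ℕₚ.<⇒≱ {0} {1} (s≤s z≤n) (subst (1 ℕ.≤_) z (HasSize⇒AtMost (orbit-size i) (rep ∷ []) ([] ∷ []) (orbit-refl ∷ []))))
    sixteen : (t ℕ.≡ᵇ 16) ∧ (type s ℕ.≡ᵇ 4) ≡ true → ⊥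
    sixteen h = no-16-4 iv′ e (trans ev (cong (16 ℕ.*_) (ℕₚ.≡ᵇ⇒≡ t 16 (proj₁ (both h))))) (trans ev′ (cong (16 ℕ.*_) (ℕₚ.≡ᵇ⇒≡ (type s) 4 (proj₂ (both h)))))
      where
      both : ∀ {p q} → p ∧ q ≡ true → T p × T q
      both {true} {true} _ = tt , tt
    decide : ⊥
    decide = ∨-case {t ℕ.≤ᵇ type s} (subst (λ q → excludedFor t c s q ≡ true) quot-k ex) (λ h → ℕₚ.<⇒≱ lt (ℕₚ.≤ᵇ⇒≤ t (type s) (subst T (sym h) tt)))
      λ ex → ∨-case {not (t % 4 ℕ.≡ᵇ type s % 4)} ex (λ h → not-true h (ℕₚ.≡⇒≡ᵇ (t % 4) (type s % 4) (≈-type {v} {v′} {t} {type s} iv′ e ev ev′)))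
      λ ex → ∨-case {not (c ℕ.* weight s ℕ.≡ᵇ card s ℕ.* k)} ex (λ h → not-true h (ℕₚ.≡⇒≡ᵇ (c ℕ.* weight s) (card s ℕ.* k) count))
      λ ex → ∨-case {(t ℕ.≡ᵇ 16) ∧ (type s ℕ.≡ᵇ 4)} ex sixteen
      λ ex → ∨-case {negative (gramForm Tℤ T′ (+ k) (+ weight s) (+ 1) (+ 0))} ex (not-negative (nonneg 1 0)) (not-negative (nonneg ℤ.∣ + k * + weight s * (Tℤ + T′ - + 512) ∣ ℤ.∣ + 2 * (+ k * + k * (Tℤ - + 256) + + 256 * + k) ∣))

  norm-≤ : ∀ {s v v′} (i : s ∈ specs) → InΛ v → InOrbit (Frame.rep (frame i)) v′ → v ≈ v′ → norm v′ ℕ.≤ norm v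
  norm-≤ {v = v} {v′} i iv o e = [ (λ h → ℕₚ.≤-reflexive (sym (class-conj (Frame.rep∈Λ (frame i)) (Frame.near-class (frame i)) o e h))) , id ]′ (ℕₚ.≤-total (norm v) (norm v′))

  -- By the census `v` is congruent to some element of a constructed orbit, which is not longer than
  -- `v`; the table rules out that it is strictly shorter.
  locate : ∀ {v t c} → InΛ v → norm v ≡ 16 ℕ.* t → HasSize (InOrbit v) c → (∀ {s} → s ∈ specs → excluded t c s ≡ true) →
    ∃ λ s → ∃ λ (i : s ∈ specs) → type s ≡ t × ∃ λ v′ → InOrbit (Frame.rep (frame i)) v′ × v ≈ v′
  locate {v} {t} {c} iv ev hs ex = go (cover iv)
    where
    go : (∃ λ s → ∃ λ (i : s ∈ specs) → ∃ λ u → InOrbit (Frame.rep (frame i)) u × v ≈ u × class v ∈ classesOf minimals (frame i)) → _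
    go (s , i , v′ , o , e , _) = [ (λ lt → ⊥-elim (shorter-excluded i iv ev hs o e lt (ex i))) , (λ eq → s , i , eq , v′ , o , e) ]′
      (ℕₚ.m≤n⇒m<n∨m≡n (ℕₚ.*-cancelˡ-≤ 16 (subst₂ ℕ._≤_ (trans (norm-orbit (Frame.rep∈Λ (frame i)) o) (Frame.rep-norm (frame i))) ev (norm-≤ i iv o e))))

  minimal-in-class : ∀ {s v} (i : s ∈ specs) → InOrbit (Frame.rep (frame i)) v → MinimalInClass v
  minimal-in-class {v = v} i o u iu e = subst₂ ℤ._≤_ (norm-+ v) (norm-+ u) (+≤+ (norm-≤ i iu o e))

  attained-near : ∀ {s} (i : s ∈ specs) {u} → InOrbit (Frame.rep (frame i)) u × u ≈ Frame.rep (frame i) → Near (Frame.rep (frame i)) u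
  attained-near i (o , e) = e , ℕₚ.≤-reflexive (norm-orbit (Frame.rep∈Λ (frame i)) o)

  conjugate-near : ∀ {r v} {P : Vec24 → Set} → InΛ r → InOrbit r v → (∀ {σ u} → Co₀ σ → P u → P (σ u)) → (∀ {u} → Near r u → P u) → ∀ {u} → u ≈ v → norm u ℕ.≤ norm v → P u
  conjugate-near {r} {P = P} ir (σ , g , refl) closed f {u} e u≤ = subst P (Co₀.inv-right g u iu)
      (closed g (f (≈-sym (≈-orbit g ir iu (≈-sym e)) , subst₂ ℕ._≤_ (sym (norm-orbit iu (Co₀.inverse g , Co₀-inverse g , refl))) (norm-orbit ir (σ , g , refl)) u≤)))
    where
    iu : InΛ u
    iu = ≈⇒Λ (Co₀.maps g r ir) e

  module Plain {s} (i : s ∈ specs) (plain : bound s ≡ weight s) where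

    private
      r : Vec24
      r = Frame.rep (frame i)
      ir : InΛ r
      ir = Frame.rep∈Λ (frame i)

    -- A class has at most `bound s` vectors of this length or less, and the orbit already supplies
    -- `weight s` of them, the same number.
    shortest : ∀ {v u} → InOrbit r v → u ≈ v → norm u ℕ.≤ norm v → InOrbit r u
    shortest o = conjugate-near ir o orbit-closed (λ n → proj₁ (All.lookup (proj₁ (proj₂ (proj₂ (attained i))))
      (saturated _≟ᵥ_ (Class.bounded (Frame.near-class (frame i))) (proj₁ (proj₂ (attained i))) (All.map (attained-near i) (proj₁ (proj₂ (proj₂ (attained i)))))
        (subst (ℕ._≤ length (proj₁ (attained i))) (sym plain) (proj₂ (proj₂ (proj₂ (attained i))))) n)))

    weights≡ : ∀ {v} → InOrbit r v → HasSize (λ u → InOrbit r u × u ≈ v) (weight s)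
    weights≡ o = hasSize (orbit-AtMost ir o (orbit-Λ ir) orbit-closed (Frame.few (frame i))) (orbit-AtLeast ir o (orbit-Λ ir) orbit-closed (attained i))

    orbit-weight : ∀ {v} → InOrbit r v → HasSize (OrbitWeight4 v) (weight s)
    orbit-weight o = hasSize-⇔ (λ (p , e) → orbit-trans (orbit-sym ir o) p , e) (λ (p , e) → orbit-trans o p , e) (weights≡ o)

    vector-weight : ∀ {v} → InOrbit r v → HasSize (Weight4 v) (weight s)
    vector-weight {v} o = hasSize-⇔ (λ {u} (p , e) → orbit-Λ ir p , e , trans (orbit-norm ir p) (sym (orbit-norm ir o)))
      (λ {u} (iu , e , n) → shortest o e (ℕₚ.≤-reflexive (ℤₚ.+-injective (trans (norm-+ u) (trans n (sym (norm-+ v)))))) , e) (weights≡ o)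

HasSize-unique : ∀ {P m n} → HasSize P m → HasSize P n → m ≡ n
HasSize-unique h k = ℕₚ.≤-antisym (below h k) (below k h)
  where
  below : ∀ {P m n} → HasSize P m → HasSize P n → m ℕ.≤ n
  below h k = let l , u , ps , m≤ = HasSize⇒AtLeast h in ℕₚ.≤-trans m≤ (HasSize⇒AtMost k l u ps)

orbit-size-conj : ∀ {r v n} → InΛ r → InOrbit r v → HasSize (InOrbit r) n → HasSize (InOrbit v) n
orbit-size-conj ir o = hasSize-⇔ (orbit-trans (orbit-sym ir o)) (orbit-trans o)

form8⇒norm : ∀ {u v} → form8 u u ≡ form8 v v → norm u ≡ norm v
form8⇒norm {u} {v} e = ℤₚ.+-injective (trans (norm-+ u) (trans e (sym (norm-+ v))))

norm⇒form8 : ∀ {u v} → norm u ≡ norm v → form8 u u ≡ form8 v v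
norm⇒form8 {u} {v} e = trans (sym (norm-+ u)) (trans (cong +_ e) (norm-+ v))

-- Classes whose shortest vectors form two orbits

module Mixed {specs : List Spec} (frames : All Frame specs) (minimals : AtLeast Min (length minCodes))
    (seps : AllPairs Separated specs) (sum≡ : sum (List.map classes specs) ≡ total)
    {s : Spec} (i : s ∈ specs) {q : Vec24} {w c : ℕ} (iq : InΛ q) (q≈ : q ≈ Frame.rep (All.lookup frames i)) (q-norm : norm q ≡ norm (Frame.rep (All.lookup frames i)))
    (q-many : AtLeast (InOrbit q) c) (c≡ : c ≡ classes s ℕ.* w) (bound≡ : bound s ≡ weight s ℕ.+ w)
    (q∉ : ¬ InOrbit (Frame.rep (All.lookup frames i)) q) where

  open Excluding frames minimals seps sum≡

  r : Vec24
  r = Frame.rep (frame i)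

  ir : InΛ r
  ir = Frame.rep∈Λ (frame i)

  Either : Vec24 → Set
  Either u = InOrbit r u ⊎ InOrbit q u

  either-closed : ∀ {σ u} → Co₀ σ → Either u → Either (σ u)
  either-closed g = [ inj₁ ∘ orbit-closed g , inj₂ ∘ orbit-closed g ]′

  either-Λ : ∀ {u} → Either u → InΛ u
  either-Λ = [ orbit-Λ ir , orbit-Λ iq ]′

  either-norm : ∀ {u} → Either u → norm u ≡ norm r
  either-norm = [ norm-orbit ir , (λ o → trans (norm-orbit iq o) q-norm) ]′

  disjoint : ∀ {u} → InOrbit r u → ¬ InOrbit q u
  disjoint o o′ = q∉ (orbit-trans o (orbit-sym iq o′))

  either-near : ∀ {u} → Either u × u ≈ r → Near r u
  either-near (o , e) = e , ℕₚ.≤-reflexive (either-norm o)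

  -- The orbit of `r` occupies `weight s` of the at most `weight s + w` places in the class.
  q-few : AtMost (λ u → InOrbit q u × u ≈ r) w
  q-few l u os = ℕₚ.+-cancelˡ-≤ (weight s) (length l) w (ℕₚ.≤-trans (ℕₚ.+-monoˡ-≤ (length l) (proj₂ (proj₂ (proj₂ (attained i)))))
    (subst₂ ℕ._≤_ (Listₚ.length-++ (proj₁ (attained i))) bound≡ (Class.bounded (Frame.near-class (frame i)) (proj₁ (attained i) ++ l)
      (Uniqueₚ.++⁺ (proj₁ (proj₂ (attained i))) u (λ (j , k) → disjoint (proj₁ (All.lookup (proj₁ (proj₂ (proj₂ (attained i)))) j)) (proj₁ (All.lookup os k))))
      (Allₚ.++⁺ (All.map (λ (o , e) → either-near (inj₁ o , e)) (proj₁ (proj₂ (proj₂ (attained i))))) (All.map (λ (o , e) → either-near (inj₂ o , e)) os)))))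

  partner : ∀ {v} → InOrbit q v → ∃ λ v′ → InOrbit r v′ × v ≈ v′
  partner (σ , g , refl) = σ r , (σ , g , refl) , σ-≈ g iq ir q≈

  q-class : ∀ {v} → InOrbit q v → class v ∈ classesOf minimals (frame i)
  q-class o = let v′ , o′ , e = partner o in in-classes i (orbit-Λ iq o) o′ e

  q-fibre : ∀ {y} → y ∈ classesOf minimals (frame i) → AtMost (λ u → InOrbit q u × class u ≡ y) w
  q-fibre j = go (classOf⁻ minimals (frame i) j)
    where
    go : ∀ {y} → (∃ λ v → InOrbit r v × y ≡ class v) → AtMost (λ u → InOrbit q u × class u ≡ y) w
    go (v , o , e) = AtMost-⊆ (λ (p , e′) → p , class-injective (orbit-Λ iq p) (orbit-Λ ir o) (trans e′ e)) (orbit-AtMost ir o (orbit-Λ iq) orbit-closed q-few)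

  -- The orbit of `q` meets only classes met by the orbit of `r`, each in at most `w` vectors. Their
  -- number times `w` is the lower bound `c`.
  q-size : HasSize (InOrbit q) c
  q-size = hasSize (λ l u os → subst (length l ℕ.≤_) (trans (cong (ℕ._* w) (classes-count i)) (sym c≡))
    (Fibres.fibres Finₚ._≟_ class (classesOf minimals (frame i)) u os (All.map q-class os) q-fibre)) q-many

  q-attained : AtLeast (λ u → InOrbit q u × u ≈ r) w
  q-attained = AtLeast-⊆ (λ (o , e) → o , class-injective (orbit-Λ iq o) ir e)
    (Fibres.tight Finₚ._≟_ class (classesOf minimals (frame i)) (proj₁ (proj₂ q-many)) (proj₁ (proj₂ (proj₂ q-many))) (All.map q-class (proj₁ (proj₂ (proj₂ q-many)))) q-fibre
      (subst (ℕ._≤ length (proj₁ q-many)) (trans c≡ (cong (ℕ._* w) (sym (classes-count i)))) (proj₂ (proj₂ (proj₂ q-many)))) (in-classes i ir orbit-refl ≈-refl))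

  both-attained : AtLeast (λ u → Either u × u ≈ r) (bound s)
  both-attained = subst (AtLeast (λ u → Either u × u ≈ r)) (sym bound≡)
    (AtLeast-disjoint (λ (o , e) → inj₁ o , e) (λ (o , e) → inj₂ o , e) (λ (o , _) (o′ , _) → disjoint o o′) (attained i) q-attained)

  shortest : ∀ {v u} → InOrbit r v → u ≈ v → norm u ℕ.≤ norm v → Either u
  shortest o = conjugate-near ir o either-closed (λ n → proj₁ (All.lookup (proj₁ (proj₂ (proj₂ both-attained)))
    (saturated _≟ᵥ_ (Class.bounded (Frame.near-class (frame i))) (proj₁ (proj₂ both-attained)) (All.map either-near (proj₁ (proj₂ (proj₂ both-attained)))) (proj₂ (proj₂ (proj₂ both-attained))) n)))

  -- Everything about v is read off a congruent element v′ of the orbit of r.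
  beside : ∀ {v} → Either v → ∃ λ v′ → InOrbit r v′ × v ≈ v′
  beside {v} = [ (λ o → v , o , ≈-refl) , partner ]′

  near-either : ∀ {v u} → Either v → u ≈ v → norm u ℕ.≤ norm v → Either u
  near-either o e u≤ = let v′ , o′ , e′ = beside o in
    shortest o′ (≈-trans e e′) (subst (_ ℕ.≤_) (trans (either-norm o) (sym (norm-orbit ir o′))) u≤)

  vector-weight : ∀ {v} → Either v → HasSize (Weight4 v) (bound s)
  vector-weight {v} o = let v′ , o′ , e′ = beside o in hasSize-⇔
    (λ {u} (p , e) → either-Λ p , ≈-trans e (≈-sym e′) , norm⇒form8 {u} {v} (trans (either-norm p) (sym (either-norm o))))
    (λ {u} (iu , e , n) → near-either o e (ℕₚ.≤-reflexive (form8⇒norm {u} {v} n)) , ≈-trans e e′)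
    (hasSize (orbit-AtMost ir o′ either-Λ either-closed (AtMost-⊆ either-near (Class.bounded (Frame.near-class (frame i))))) (orbit-AtLeast ir o′ either-Λ either-closed both-attained))

  r-weight : ∀ {v} → InOrbit r v → HasSize (OrbitWeight4 v) (weight s)
  r-weight o = hasSize-⇔ (λ (p , e) → orbit-trans (orbit-sym ir o) p , e) (λ (p , e) → orbit-trans o p , e)
    (hasSize (orbit-AtMost ir o (orbit-Λ ir) orbit-closed (Frame.few (frame i))) (orbit-AtLeast ir o (orbit-Λ ir) orbit-closed (attained i)))

  q-weight : ∀ {v} → InOrbit q v → HasSize (OrbitWeight4 v) w
  q-weight o = let v′ , o′ , e′ = partner o in hasSize-⇔
    (λ (p , e) → orbit-trans (orbit-sym iq o) p , ≈-trans e (≈-sym e′)) (λ (p , e) → orbit-trans o p , ≈-trans e e′)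
    (hasSize (orbit-AtMost ir o′ (orbit-Λ iq) orbit-closed q-few) (orbit-AtLeast ir o′ (orbit-Λ iq) orbit-closed q-attained))

  conjugate : ∀ {v u} → InOrbit q v → InOrbit r u → Conj4 v u
  conjugate (σ , g , refl) (τ , h , refl) = σ ∘ Co₀.inverse h , Co₀-∘ g (Co₀-inverse h) ,
    subst (λ x → σ q ≈ σ x) (sym (Co₀.inv-left h r ir)) (σ-≈ g iq ir q≈)

  minimal-either : ∀ {v} → Either v → MinimalInClass v
  minimal-either {v} o u iu e = let v′ , o′ , e′ = beside o in
    subst₂ ℤ._≤_ (norm⇒form8 {v′} {v} (trans (norm-orbit ir o′) (sym (either-norm o)))) refl (minimal-in-class i o′ u iu (≈-trans e e′))

-- Vectors known only by type and size of orbit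

module Conclusion {specs : List Spec} (frames : All Frame specs) (minimals : AtLeast Min (length minCodes))
    (seps : AllPairs Separated specs) (sum≡ : sum (List.map classes specs) ≡ total)
    {s₁ : Spec} (i₁ : s₁ ∈ specs) (q : Vec24) {w c : ℕ} (iq : InΛ q) (q≈ : q ≈ Frame.rep (All.lookup frames i₁)) (q-norm : norm q ≡ norm (Frame.rep (All.lookup frames i₁)))
    (q-many : AtLeast (InOrbit q) c) (c≡ : c ≡ classes s₁ ℕ.* w) (bound≡ : bound s₁ ≡ weight s₁ ℕ.+ w)
    (q∉ : ¬ InOrbit (Frame.rep (All.lookup frames i₁)) q)
    (type₁ : type s₁ ≡ 15) (c≢ : c ≢ card s₁)
    (plain : ∀ {s} → s ∈ specs → type s ≢ 15 → bound s ≡ weight s)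
    (only : ∀ {s} (i : s ∈ specs) → type s ≡ 15 → _≡_ {A = ∃ (_∈ specs)} (s , i) (s₁ , i₁))
    (rules : ∀ {e} → e ∈ appearing → ∀ {s} → s ∈ specs → excluded (Entry.type e) (Entry.card e) s ≡ true)
    (matches : ∀ {e} → e ∈ appearing → ∀ {s} → s ∈ specs → type s ≡ Entry.type e → card s ≡ Entry.card e → Entry.type e ≢ 15 → weight s ≡ Entry.weight e)
    (weight-15 : ∀ {e} → e ∈ appearing → Entry.type e ≡ 15 → Entry.weight e ≡ bound s₁)
    (appears : ∀ {s} → s ∈ specs → Any (λ e → type s ≡ Entry.type e × card s ≡ Entry.card e) appearing)
    where

  open Excluding frames minimals seps sum≡
  module M = Mixed frames minimals seps sum≡ i₁ iq q≈ q-norm q-many c≡ bound≡ q∉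

  type-norm : ∀ {v t} → HasType v t → norm v ≡ 16 ℕ.* t
  type-norm {v} {t} e = norm≡ {v} {16 ℕ.* t} e

  -- The class of `v` has a representative of the same type, so `v` is one of its shortest vectors
  -- and thereby in the constructed orbit. The size of the orbit then identifies the entry of the
  -- table, and with it the weight.
  plain-orbit : ∀ {e v} → e ∈ appearing → Entry.type e ≢ 15 → IsOrbit (Entry.type e) (Entry.card e) v →
    ∃ λ s → ∃ λ (i : s ∈ specs) → InOrbit (Frame.rep (frame i)) v × bound s ≡ weight s × weight s ≡ Entry.weight e
  plain-orbit {e} {v} j t≢ (iv , ty , hs) = go (locate iv (type-norm {v} {Entry.type e} ty) hs (rules j))
    where
    go : (∃ λ s → ∃ λ (i : s ∈ specs) → type s ≡ Entry.type e × ∃ λ v′ → InOrbit (Frame.rep (frame i)) v′ × v ≈ v′) → _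
    go (s , i , t≡ , v′ , o , e≈) = s , i , ov , pl , matches j i t≡ (HasSize-unique (orbit-size-conj (Frame.rep∈Λ (frame i)) ov (orbit-size i)) hs) t≢
      where
      pl : bound s ≡ weight s
      pl = plain i (λ z → t≢ (trans (sym t≡) z))
      ov : InOrbit (Frame.rep (frame i)) v
      ov = Plain.shortest i pl o e≈ (ℕₚ.≤-reflexive (trans (type-norm {v} {Entry.type e} ty) (trans (cong (16 ℕ.*_) (sym t≡)) (sym (trans (norm-orbit (Frame.rep∈Λ (frame i)) o) (Frame.rep-norm (frame i)))))))

  -- The only entry of type 15 is that of O₁₅d, so `v` is a shortest vector in one of its classes;
  -- which of the two orbits it belongs to is left to the sizes.
  mixed-orbit : ∀ {e v} → e ∈ appearing → Entry.type e ≡ 15 → IsOrbit (Entry.type e) (Entry.card e) v → M.Either v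
  mixed-orbit {e} {v} j t≡15 (iv , ty , hs) = go (locate iv (type-norm {v} {Entry.type e} ty) hs (rules j))
    where
    go : (∃ λ s → ∃ λ (i : s ∈ specs) → type s ≡ Entry.type e × ∃ λ v′ → InOrbit (Frame.rep (frame i)) v′ × v ≈ v′) → M.Either v
    go (s , i , t≡ , v′ , o , e≈) = M.shortest o₁ e≈ (ℕₚ.≤-reflexive (trans (type-norm {v} {Entry.type e} ty) (trans (cong (16 ℕ.*_) (trans t≡15 (sym type₁))) (sym (trans (norm-orbit M.ir o₁) (Frame.rep-norm (frame i₁)))))))
      where
      o₁ : InOrbit M.r v′
      o₁ = subst (λ { (_ , k) → InOrbit (Frame.rep (frame k)) v′ }) (only i (trans t≡ t≡15)) o

  minimal-and-weight : ∀ e → e ∈ appearing → ∀ v → IsOrbit (Entry.type e) (Entry.card e) v → MinimalInClass v × HasSize (Weight4 v) (Entry.weight e)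
  minimal-and-weight e j v io = go (Entry.type e ℕ.≟ 15)
    where
    go : Dec (Entry.type e ≡ 15) → MinimalInClass v × HasSize (Weight4 v) (Entry.weight e)
    go (yes t≡) = let o = mixed-orbit j t≡ io in M.minimal-either o , subst (HasSize (Weight4 v)) (sym (weight-15 j t≡)) (M.vector-weight o)
    go (no t≢) = let s , i , o , pl , w≡ = plain-orbit j t≢ io in minimal-in-class i o , subst (HasSize (Weight4 v)) w≡ (Plain.vector-weight i pl o)

  represented : ∀ x → InΛ x → ∃ λ v → In4Λ (x -ᵥ v) × Any (λ e → IsOrbit (Entry.type e) (Entry.card e) v) appearing
  represented x ix = go (cover ix)
    where
    go : (∃ λ s → ∃ λ (i : s ∈ specs) → ∃ λ u → InOrbit (Frame.rep (frame i)) u × x ≈ u × class x ∈ classesOf minimals (frame i)) → _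
    go (s , i , u , o , e , _) = u , e , Any.map (λ (t≡ , c≡) → orbit-Λ ir o , subst (HasType u) t≡ ty , subst (HasSize (InOrbit u)) c≡ (orbit-size-conj ir o (orbit-size i))) (appears i)
      where
      ir : InΛ (Frame.rep (frame i))
      ir = Frame.rep∈Λ (frame i)
      ty : HasType u (type s)
      ty = trans (sym (norm-+ u)) (cong +_ (trans (norm-orbit ir o) (Frame.rep-norm (frame i))))

  -- Both orbits have known and different sizes, which is how the vectors of type 15 are told apart.
  is-q : ∀ {v} → M.Either v → HasSize (InOrbit v) c → InOrbit q v
  is-q (inj₂ o) _ = o
  is-q (inj₁ o) hs = ⊥-elim (c≢ (HasSize-unique hs (orbit-size-conj M.ir o (orbit-size i₁))))

  is-r : ∀ {v} → M.Either v → HasSize (InOrbit v) (card s₁) → InOrbit M.r v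
  is-r (inj₁ o) _ = o
  is-r (inj₂ o) hs = ⊥-elim (c≢ (HasSize-unique (orbit-size-conj iq o M.q-size) hs))

  back : ∀ {σ u} {P : Vec24 → Set} (g : Co₀ σ) → InΛ u → (∀ {τ x} → Co₀ τ → P x → P (τ x)) → P (σ u) → P u
  back {u = u} {P} g iu closed p = subst P (Co₀.inv-left g u iu) (closed (Co₀-inverse g) p)

  σ-norm : ∀ {σ u} → Co₀ σ → InΛ u → norm (σ u) ≡ norm u
  σ-norm g iu = norm-orbit iu (_ , g , refl)

  isolated-mixed : ∀ {v u} → M.Either v → norm u ≡ norm v → InΛ u → Conj4 v u → M.Either u
  isolated-mixed o n iu (σ , g , e) = back {P = M.Either} g iu M.either-closed (M.near-either o (≈-sym e) (ℕₚ.≤-reflexive (trans (σ-norm g iu) n)))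

  -- If `σ u` is congruent to `v` and `u` is not longer, then `σ u` is a shortest vector of the
  -- class and hence in the orbit; so is `u`.
  isolated-plain : ∀ e → e ∈ appearing → Entry.type e ≢ 15 → ∀ v → IsOrbit (Entry.type e) (Entry.card e) v →
    (∀ u → InΛ u → TypeAtMost u (Entry.type e) → ¬ InOrbit v u → ¬ Conj4 v u) × HasSize (OrbitWeight4 v) (Entry.weight e)
  isolated-plain e j t≢ v io@(iv , ty , _) = let s , i , o , pl , w≡ = plain-orbit j t≢ io in
    (λ u iu (s′ , s≤ , tu) no (σ , g , e≈) → no (orbit-trans (orbit-sym (Frame.rep∈Λ (frame i)) o) (back {P = InOrbit (Frame.rep (frame i))} g iu orbit-closed
      (Plain.shortest i pl o (≈-sym e≈) (subst₂ ℕ._≤_ (sym (trans (σ-norm g iu) (type-norm {u} {s′} tu))) (sym (type-norm {v} {Entry.type e} ty)) (ℕₚ.*-monoʳ-≤ 16 s≤)))))) ,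
    subst (HasSize (OrbitWeight4 v)) w≡ (Plain.orbit-weight i pl o)

-- Certificates

Run : Set
Run = Vec24 × ℕ × ℕ

coded : Run → ℕ × ℕ × ℕ
coded (a , n , tokens) = code a , n , tokens

found : (M₁ M₂ : Vec Vec24 24) → List Run → List ℕ
found M₁ M₂ runs = List.concatMap (Search.search (gen M₁) (gen M₂)) (List.map coded runs)

-- A record, so that the evaluation is not repeated when two of these types are compared.
record Reach (n : ℕ) (M₁ M₂ : Vec Vec24 24) (runs : List Run) : Set where
  constructor reach
  field ok : verdict n (found M₁ M₂ runs) ≡ true

record Site : Set where
  field
    centre  : Vec24
    M₁ M₂   : Vec Vec24 24
    centre∈ : InΛ centre
    aut₁    : IsAut M₁
    aut₂    : IsAut M₂
    fix₁    : act M₁ centre ≡ centre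
    fix₂    : act M₂ centre ≡ centre

module _ (S : Site) where

  open Site S

  Leads : Vec24 → ℕ → Vec24 → Set
  Leads r β a = Min a × InOrbit r (centre ⊕ + β ⊙ a)

  -- An automorphism that fixes the centre takes `centre + βa` to the vector built from the image of
  -- `a`. All minimal vectors in one orbit of the two generators thus lead to the same orbit of
  -- `Co₀`.
  leads-closed : ∀ {r β M} → IsAut M → act M centre ≡ centre → ∀ {a} → Leads r β a → Leads r β (act M a)
  leads-closed {r} {β} {M} aut fix {a} (m , o) = Min-act g m , orbit-trans o (act M , g ,
      trans (Co₀.additive g centre (+ β ⊙ a) centre∈ (Λ-closed-⊙ (+ β) (proj₁ m))) (cong₂ _⊕_ fix (σ-⊙ g β (proj₁ m))))
    where
    g : Co₀ (act M)
    g = act-Co₀ aut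

  leads-many : ∀ {r β n} runs → All (Leads r β ∘ proj₁) runs → Reach n M₁ M₂ runs → AtLeast (Leads r β) n
  leads-many {r} {β} runs ls (reach ok) = reached aut₁ aut₂ {P = Leads r β} proj₁ (leads-closed {r} {β} aut₁ fix₁) (leads-closed {r} {β} aut₂ fix₂) (List.map coded runs)
    (Allₚ.map⁺ (All.map (λ {run} l → proj₁ run , l , refl) ls)) ok

  leap : ∀ {r β t nears ats S c c′ n N N′} runs .{{_ : ℕ.NonZero ats}} .{{_ : ℕ.NonZero β}} → InΛ r → AtLeast (InOrbit centre) c → Profile r t nears ats S →
    All (Leads r β ∘ proj₁) runs → Reach n M₁ M₂ runs → norm centre ≡ N → norm r ≡ N′ → N′ ℕ.≤ 256 →
    + 2 * + β * (+ 128 - + t) ≡ + N′ - + N + + 32 * + β * + β → c ℕ.* n ≡ c′ ℕ.* ats → AtLeast (InOrbit r) c′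
  leap {r} {β} runs ir many pr ls ok refl refl le rel card = edge-bound {rᵢ = centre} {rⱼ = r} {β = β} centre∈ ir le many (leads-many {r} {β} runs ls ok) (Profile.at pr) rel card

-- Doubling is injective and commutes with automorphisms. It provides O₈ₐ, O₁₂ₐ and O₁₆ₐ from the
-- types 2, 3 and 4.
doubled-orbit : ∀ {r c} → InΛ r → AtLeast (InOrbit r) c → AtLeast (InOrbit (+ 2 ⊙ r)) c
doubled-orbit ir = AtLeast-map (+ 2 ⊙_) (λ _ _ → ⊙-cancel (+ 2)) (λ { (σ , g , refl) → σ , g , σ-⊙ g 2 ir })

-- `target` is the value belonging to the edge by which `vector` is reached, and 64 where the size
-- of the orbit does not come from an edge; `ats` is its multiplicity.
record Job : Set where
  constructor job
  field
    vector : Vec24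
    target nears ats checksum : ℕ

scanJob : List ℕ → Job → Bool
scanJob cs (job r t n a S) = Scan.scan (weights r) (offset r) t n a S cs 0 0 0

scanJobs : List ℕ → List Job → Bool
scanJobs cs [] = true
scanJobs cs (j ∷ js) = scanJob cs j ∧ scanJobs cs js

JobProfile : Job → Set
JobProfile (job r t n a S) = Profile r t n a S

Fit : Job → Set
Fit (job r t n a S) = norm r ℕ.≤ 256 × 64 ℕ.≤ t

Fit? : ∀ j → Dec (Fit j)
Fit? (job r t n a S) = (norm r ℕ.≤? 256) ×-dec (64 ℕ.≤? t)

profiles : ∀ {js} → All Fit js → scanJobs minCodes js ≡ true → All JobProfile js
profiles [] _ = []
profiles {js = j ∷ js} ((h , t) ∷ hs) e = profile h t (proj₁ (∧-true e)) ∷ profiles hs (proj₂ (∧-true {scanJob minCodes j} e))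

-- Codes with prescribed values against two vectors at once; needed to bound the exceptional vectors
-- in the class of `rep-16e`.
jointly : (w k w′ k′ m n : ℕ) → List ℕ → List ℕ
jointly w k w′ k′ m n [] = []
jointly w k w′ k′ m n (c ∷ cs) = if conv w k c ℕ.≡ᵇ m then
  (if conv w′ k′ c ℕ.≡ᵇ n then c ∷ jointly w k w′ k′ m n cs else jointly w k w′ k′ m n cs) else jointly w k w′ k′ m n cs

jointly-∈ : ∀ w k w′ k′ {m n c cs} → c ∈ cs → conv w k c ≡ m → conv w′ k′ c ≡ n → c ∈ jointly w k w′ k′ m n cs
jointly-∈ w k w′ k′ {m} {n} {c} (here refl) e e′
  rewrite T⇒true (ℕₚ.≡⇒≡ᵇ (conv w k c) m e) | T⇒true (ℕₚ.≡⇒≡ᵇ (conv w′ k′ c) n e′) = here refl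
jointly-∈ w k w′ k′ {m} {n} {c} {d ∷ cs} (there i) e e′ = keep₂ (conv w k d ℕ.≡ᵇ m) (conv w′ k′ d ℕ.≡ᵇ n) (jointly-∈ w k w′ k′ i e e′)
  where
  keep₂ : ∀ p q {l} → c ∈ l → c ∈ (if p then (if q then d ∷ l else l) else l)
  keep₂ true true j = there j
  keep₂ true false j = j
  keep₂ false _ j = j

joint : (x y : Vec24) (m n : ℕ) → List ℕ → List ℕ
joint x y = jointly (weights x) (offset x) (weights y) (offset y)

joint-bound : ∀ {x y m n k} → norm x ℕ.≤ 256 → norm y ℕ.≤ 256 → (length (joint x y m n minCodes) ℕ.≤ᵇ k) ≡ true →
  AtMost (λ z → Min z × value x z ≡ m × value y z ≡ n) k
joint-bound {x} {y} {m} {n} {k} hx hy e = AtMost-≤ (ℕₚ.≤ᵇ⇒≤ (length (joint x y m n minCodes)) k (subst T (sym e) tt))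
  (AtMost-map code (λ (p , _) (q , _) → code-injective (Min-small p) (Min-small q))
    (λ {z} (p , e₁ , e₂) → jointly-∈ (weights x) (offset x) (weights y) (offset y) (Min-code p) (trans (conv-value {x} {z} hx p) e₁) (trans (conv-value {y} {z} hy p) e₂))
    (AtMost-list ℕₚ._≟_ (joint x y m n minCodes)))

third-none : ∀ {r y₀} → norm r ≢ 256 ⊎ norm y₀ ≢ 64 → AtMost (Third r y₀) 0
third-none h = AtMost-∅ (λ { (third R Y _ _ _ _ _) → [ (λ n → n R) , (λ n → n Y) ]′ h })

-- An exceptional vector `c₁ + 4z`, where `c₁ = 2y₀ - r`, has norm 256 just as `c₁` has. So ⟨c₁ , z⟩
-- is -64 besides ⟨y₀ , z⟩ = -32, and these two conditions leave few `z`.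
third-some : ∀ {r y₀ k} → norm (+ 2 ⊙ y₀ ⊖ r) ≡ 256 → AtMost (λ z → Min z × value y₀ z ≡ 96 × value (+ 2 ⊙ y₀ ⊖ r) z ≡ 64) k → AtMost (Third r y₀) k
third-some {r} {y₀} c≡ b = AtMost-map (λ u → map (_/ℕ 4) (u ⊖ c₀))
    (λ { (third _ _ _ z refl _ _) (third _ _ _ z′ refl _ _) e → cong (λ v → c₀ ⊕ + 4 ⊙ v) (trans (sym (back z)) (trans e (back z′))) })
    (λ { (third _ _ U z refl m v) → subst (λ x → Min x × value y₀ x ≡ 96 × value c₀ x ≡ 64) (sym (back z)) (m , v , at z m U) }) b
  where
  c₀ : Vec24
  c₀ = + 2 ⊙ y₀ ⊖ r
  quarter : ∀ {n} (w : Vec ℤ n) → map (_/ℕ 4) (+ 4 ⊙ w) ≡ w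
  quarter [] = refl
  quarter (z ∷ w) = cong₂ _∷_ (ℤₚ.*-cancelˡ-≡ (+ 4) _ z (div-exact 4 (divides z (ℤₚ.*-comm (+ 4) z)))) (quarter w)
  back : ∀ w → map (_/ℕ 4) ((c₀ ⊕ + 4 ⊙ w) ⊖ c₀) ≡ w
  back w = trans (cong (map (_/ℕ 4)) (⊕-⊖ c₀ (+ 4 ⊙ w))) (quarter w)
  at : ∀ z → Min z → norm (c₀ ⊕ + 4 ⊙ z) ≡ 256 → value c₀ z ≡ 64
  at z m U = value⁺ {c₀} {z} (ℕₚ.≤-reflexive c≡) m (ℤₚ.*-cancelˡ-≡ (+ 8) ⟪ c₀ , z ⟫ (+ 64 - + 128)
    (trans (eq (+ norm c₀) ⟪ c₀ , z ⟫ (+ norm z)) (trans (cong (λ t → t - + norm c₀ - + 16 * + norm z) (trans (sym (norm-shift (+ 4) c₀ z)) (cong +_ U)))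
      (cong₂ (λ a b → + 256 - + a - + 16 * + b) c≡ (norm≡ {z} (proj₂ m))))))
    where
    eq : ∀ C g N → + 8 * g ≡ (C + + 2 * + 4 * g + + 4 * + 4 * N) - C - + 16 * N
    eq = solve-∀

candidate : ∀ {r c b} → viable r c ≡ b → (b ≡ true → norm c ≡ norm r) → ∀ {u} → Far r u → u ≡ c → b ≡ true × norm u ≡ norm r
candidate v n f refl = trans (sym v) (Far-viable f) , n (trans (sym v) (Far-viable f))

plainFrame : ∀ (s : Spec) {r t nears ats} → InΛ r → norm r ≡ 16 ℕ.* type s → type s ℕ.≤ 16 → AtLeast (InOrbit r) (card s) → card s ≡ classes s ℕ.* weight s →
  ℕ.NonZero (weight s) → Profile r t nears ats (checksum s) → Class r (bound s) → bound s ≡ weight s → Frame s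
plainFrame s {r} ir n t≤ many c≡ nz pr cl b≡ = record
  { rep = r ; rep∈Λ = ir ; rep-norm = n ; type≤ = t≤ ; many = many ; card≡ = c≡ ; weight≢0 = nz ; near-class = cl
  ; few = subst (AtMost _) b≡ (AtMost-⊆ (λ (o , e) → e , ℕₚ.≤-reflexive (norm-orbit ir o)) (Class.bounded cl)) ; sums = Profile.sums pr }

-- The number of minimal vectors at inner product -64 is an invariant of the orbit.
other-orbit : ∀ {x y m n} → norm x ℕ.≤ 256 → norm y ℕ.≤ 256 → InΛ x → AtLeast (λ a → Min a × value x a ≡ 64) m → AtMost (λ a → Min a × value y a ≡ 64) n → n ℕ.< m → ¬ InOrbit x y
other-orbit {x} hx hy ix (l , u , ps , m≤) b lt (σ , g , refl) = ℕₚ.<⇒≱ lt (ℕₚ.≤-trans m≤ (AtMost-map σ (λ (p , _) (q , _) → σ-injective g (proj₁ p) (proj₁ q))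
  (λ {a} (p , v) → Min-act g p , value⁺ {σ x} {σ a} hy (Min-act g p) (trans (Co₀.isometry g x a ix (proj₁ p)) (value⁻ {x} {a} hx p v))) b l u ps))

open import Relation.Nullary.Decidable using (_⊎-dec_; ¬?)
import Data.List.Relation.Unary.AllPairs as AllPairs

-- Generators of the stabilisers of the centres, and the connecting matrices

vec : ℕ → Vec24
vec = unpackRow 32 16 24

matrix : ℕ → Vec Vec24 24
matrix = unpack 32 16 24

-- The matrices in `f` and `g` fix the representative after which they are named. `mat-15d` and
-- `mat-16e` join the ends of two runs into one orbit, and `mat-15b` carries `rep-15b` to `q₁`.
mat-0f mat-0g mat-2f mat-2g mat-3f mat-3g mat-4f mat-4g mat-5f mat-5g mat-6af mat-6ag mat-6bf mat-6bg mat-7f mat-7g mat-8bf mat-8bg mat-8cf mat-8cg mat-15d mat-16e mat-15b : Vec Vec24 24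
mat-0f = matrix 0x8420e849ce73a127418e842107424e74a5074214841d0839d073a4e83a10749d094190841d084a50739ce84a1093a50942108425483a5073a4e84a10a420e839d274a0e74212842107425284212839d293a127421284214741ce8421283a4e73a0e7420e83210741d2749d0942108425083a5093a5283a9094a5094210841d084a4c74a5283a1074a50742108425084a5094a4e64a1084212639ce94a127420e8421094252949d494210841d0839d094a4e84a108421284a4e94a0e74212642107424e739d074210641d083a5074a5284a1074a509421084250839d0749d284a148520e83a4e74a127421284210941ce949d0742108325083a50749ce83a1084212849ce74a129421284210731d28420e83a4e93992942128421074252739d09321084250849d074a4e83a108421284a5273a127521284210942528420e849ce93a0e7421284290941d2949d07421084250a49d073a5284a1084292839ce73a0e94212842109424e
mat-0g = matrix 0x8bdf18c62d8bdf16be718c5b18be718bdf16c5b18bded8bded8c5b18bdf16be718c5b18bdf18be716c6318bdf17c5b37bdef7c62f7b62f7ce6f7c62f7c62f7cdef7c62f7c62f9be6f9c6336bdf18c6318bded8cdf18c6316be718bded8c62d8bded8bdf16c62d8bdf17c62f9cdef7c62f7b5af7bdf37c62f8be716c62d8cdf18bdf18c6316bdf18cded8c6318bdf18be6d8c6316bdf17c62f7bdef9c5af7c62f7bdef7d62f6bded6c6318bdf16bdf18c6318bded8bdf18c5b18bdf16bdf18b62d6bdf17c5af7bdef7c62f7c6337bdf37c5b38bdf18c6318cded8be718b6318bded9b62f7bdef7b62f7c62f7be737c62f8bdf18c6318cdf16cded6c6318bdf18bdf18c6316bd718bdf18c6318cdf18bdf18c631abe718bdf18c6318cdf18bded8b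5b18cdf18bdf18c6318be718cdf16c6318bdf18bdf16b6318be717b5af7cdef7c6339c62f7bdef7c62f7b62f7be737c62f7b62f7bdef7c6336bdf18b62d8bdf18bded8b6318bdf1
mat-2f = matrix 0x94a5084a529425074a0e742106421074a50839ce9425094a1274214842108420e7421483a0e841d0849d294a4e939d083a4e7425074a12742108420c74a5083a527425073a92942108421084212742108499284250849d2749ce749d084a52741d094a1274290842108420e9421083a12841d0a4a52739ce73a5084a4e7425094a0e9421085210949d0839d27525094a0e9421084210842927421084a0e841d084a4e939cea42129421083a0e8425084a52949d2842129421084a0e831d083a5274a4e949d064a4e9425093a12942108421093a5083a52941d094a129321084210739d4849d29425074a1294210842108420e9521084a0e84250839d2939ce94a50849ce741d074a129421084290852129421083a12841d0839ce949ce842127421083a128424c83a5293a4e93a50849d27425493a127421084210842129421083a0ea4250849ce73a4e842129429084a12841d0849d293a52842127421063a0e841d0839d2739d2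
mat-2g = matrix 0x84210942506421074a0e8521283a0e94a5284a0e749ce8425093a507425084290932508421093a128420e83a0e84210742548420c93a0e8421284a0e949d283a0e94a4e841d094a50941d08420c742508521074a128420e84a0e949ce83a12939d28425094a507425084210941d08421073a92842128498e64210741d08421094a12a421283a0e842107424c8421493a0e8421284a0e74a5284a12949d2841d074a50741d0749d283a1274a528425073a509425074a4e84a0e93a4e8425074a5094250a4210741d08421094a126421283a0e8421094250a421074a0e8321283a0e84210941d08429094a0e8420e64a0e84214742508321074a128420e84a0e94a4e84a1273a52841d093a50941d083210942508421094a128429284a1285210942508421094a128419284a1284210941d08419094a0e8420ea4a0e84210941d084210739928421284a8e84190952508421093a128420e83a0e749ce83a0e739ce841d073a50741d0
mat-3f = matrix 0x9420e8425293a1264250839d09420e64a5093a108425074a129421283a50742126425294a0e841d0849d09420e84a5073a108425093a9274212849d09420e841d294a0e841d0839d474212849d0749908425073a127420e83a509428e841d273a0e841d084a509420e84a5073a10841d074a0e7420e64a50952128424e73a0e841d0839d09421284a5074a10841d493a0e9421283a50849d094a108425094a0e7421284a4c83a5093a108425093a0e7418e83a5094212841ce93a0e84250a49d07420e83a5074a108425094a129320e84a509420e8424e94a0e8425084a509429294212831ce94a12841d083a509420e849d093a14841d093a129420e84a5083a5494a10841d073a127421284a5094212841d274a1285250849d09421284a5094a108525073a0e9420e849d084a5094a10a41d094a127420e839d0942128425274a0e8425083a507320e74212841d293a0e8424c83a50942127420e841ce7498e84250839d09420e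
mat-3g = matrix 0x8420e93a509399284a5083a5083a108521273a5074a0e83a5083a5083a108421274a5093a0e84a5084a50a4a1074a5084212841d094212941929424e749d085212841d09420e7420e741ce8419293a5073a1283a50849d084a10749d08420e842509521294212741d2949d084212a42507420e942127424e94a508420e841d09420e752127425284212939d094a0e84a50849cc83a1084212739d473a12849d084a5083a10939d084212851d09420e94212941d284212949d074a1284a5083a5084a908421294a5094a12839d484a5083a1093a5084212842509429274212741ce84212939d093a0ea39d083a5084a1094a5084212841d0742129420e751d28420e93a5074a0e849d084a5084a0c6420e739d094a1283a5084a5084a1073a5084292842509420e9420e7425274a50a4212842507420e74212941d28421273a5094a12849d0639d084a1094a508420e842549420e9420e941ce949cc8421284250942127420e94252
mat-4f = matrix 0x7b5ef8b5ef7bdef7cdef7c5b38be316ce317be318c5b18c6318cdf19c5ef7c5ef6c5ef7be737cdef9c62f8be317c56f8c5ef7bdef7bdef7c62f8ce2d7c5ef8c5f37cdef7cdf37b62f8be318be319cdb16c6318c6318cdf17c5ef7c5ef8c6737bdef7bdef9c6336be317c66f8c5ef7bdef7bdef7c62f8ae2d8be317be318c6318c5b16ce717c66f6be317be2d6c62d8c6318be717c5ef6be319be318b6318c5b18bded7c5ef7c5f38b5f37be6f7be6f7c62f8be316be317ce318c6316c62d6bdf17c5ef7c5ef8c66f7ce6f9bdef7c5af8be318be2d9be318c6318c62d8be719c5ef8ce2d7be316b6318c6316bdf17c5ef7c5ef8c5ef9bdef9ce6f7c62f6be316be2d7bdb18c6318b6318bdf17c66f7c5f38c5ef7bdf39b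def7b6338be318ce317bdb18c62d8c5ad8bdf17c5ef7c5ef8c5ef9be6f7bdf37c6338bdb18bdb17be318c6318c6318bdf17b5eb8be317ce318b62d8c6318bdf19c66f7b5ef6c5f37bdef9bdef7c62f8bdb1
mat-4g = matrix 0x93a4c741d2939d0839d0842128421074a507425294a5083a50842128420c8421284a10842127419274a50939ce8420e83a10642129421293a50949ce8520e83a10842127420e949d0939d28421283a14842129421294a5073a52949d0941ce949d083a5484212842108421284990842129420e949d0749ce949d09425293a50839d08420e85210739d0941d293a5084a5084212a42108420e84a108420e94212949cc93a4e94a50941d274a4c849d08421284210749d0741ce73a50839d084212842908420ea4a10842127420e93a5073a4e74a50941d2739d083a506420e84210749d0741d2949d0849d08320e842108429284a108421274212939d094a52949d075252739d084a5084212842108421283a108418e7420e94a5094a4e8420e84a10852129420e74a5094a526420e84a108420e7421294a50749d28420e83a108421275212749d074a4e94a50741ce93a5084a508428e84210939d0741d274a5063a508420e84210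
mat-5f = matrix 0x9c6337b62f8c5f17be2f6c5ef7b62f8bded8bded7be2f8c6717bdad8bdf18adf18bdf17bdaf8b5f17be318bdf17c5af7c62f8b5f17bdaf8c5ef7b5af7c5b37c62f8c5f19be338c5ef7c6336bdf18bdf19be2f6c6717ce318bdf17b62f7c62f8c5717ce2f8c5ef7c62f7c62f7c5b36c5f17be2f8c5ef7b6337c62f9c5af8c5f17bdb36c5ef7c62f8bdf18ce717ce2f6c5f17be2d8bdf18bdf18bded7be336c5f19be318be717c62f9c62f8c5f19be2f8c66f9b62f7c5af9b6338c5f17be2f8b5ef7c62f8bdf18cdf17be338c6717be316bded7b62f7c62f8c6717ae2f8c5ef7c62f8bdf18cdf19be2f8c5ed7bdb18be717c5af7c62f6c5f17be2f6c5f39c62f8bded6bdf19ce338c5f17be318bdf19c62f9c62f8c5f17be2f8c5f37c5b38bdf18bdf17be338c5ed7ce2d8cdf16bdf18bded7ce2f8c5ed7be316bdf17c62f7c62f8b5f17be2f6b66f7c6338bded8be717be2f8c5f17ce316be716be718be717be338c5f17bdb18bdf1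
mat-5g = matrix 0x8c5f16bdad8be2d7bdef7be2d7bdf18c6718be318ce2d9bdef7ce317bdf17ce337c66f7c5ef8c6318b5ef8c5af7be337b5f39c5ef6c6318c5ef8c62f7bdaf7c5f37c5ef8c6318c66f8c5b37be2f9c5ef9c5ef8c62d8b5ef8c6338c5f16ce318ce317bdef9be317be717be2f7c66f9b5ef8c5b18c66f8c62f8c6718cdb18be317bdf37be317cdf17be2f7c5ef7c66f8b6318c5efac62f7ce2f9c5ef7c5ef6c6318c66f8b62f6c5f18ce318be317bdef7cdad7bdf17be337c5ef7b5ef8c6318c5f38b6338c5f18be2d8be317be6f9ce317cdf17ce2f7b5ef7c5f38c5b18c5ef8c6338c5f18be318beb17cdef7be319bdf17be2f7c5ef7c66f8d6318c5ef6c62f7be337c5ef7c5f38c62d6c66f8c62f6c66d6be318be317be6f7be317bdf16c5f18bdb18be319bdef9be317bded7cdaf7c5ef9c5ef8c6316c5f38c62f6c5f18be316be2d7bdef7be317ce718c5f18be318be319be737be2d7be716b5f18be2d8ce317bdf37be317bdf1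
mat-6af = matrix 0x7cded6b5f18be2f8be2f8ce317bdf17ce718c5f18be2f8bdaf8bdad7bdf18c6337be2f9c5ed7c66d7c5ef8c62f7be716c5f18be2f8be338be317ce719bded8c5f18be2f6be2f8be2d7cdf17bded8c5f18be2f8be2f8bdb19be6d8c62f9be2f7c5ed9b5f17c66f8c62f9bdf16c5ed8be2f8bdaf8be319bdf18b62f7be337c5f19c5ed7c5ef8c6338b62f7be2f7c66d7c5f17c5ef6b62f8c62f7bdaf7d5f17c5f19c5ef8c62f8c5af7ce2f9c5f19c5f17c5ef6c62f8c62f7ce337c5ed7c5f17c5f38c5af7bdf18c5f18be2f8ce338ce2d9bdf18c62f7be339c5f17c5f17b66f8b62f8c62f7be2f7c6719c6717b5ef8c5af7bdf18b5f18be2f8cdaf8be317cded9bdf18b5f18bdaf8be338bdb17bdf17bdf18c6718ce2f8be2fabe317bdf19cdf18c5f16be2f8ce2f8be317be718c62f9be2f9c6717c5f17c5f38c6338c62f7beaf7b5f17c5f19c5ef8c62f8c5b37be337c6717b5f17c5ef8c62f9be718c5f18be338be2f8ce317bded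
mat-6ag = matrix 0x73210942508420e9425094a50941d294210741d08420e94250749d0931ce94290741d08420e941d093a509425284a5283a12939d084a128521284a107420c741d084212941d0949d0741d294210951d084212741d074a50941d2849d283a0e949d083a0e8421283a149421074250842129525073a50741d2839d28399274a5084a0e8421284a1083a5284a0e949d084a0e8418e84a1083a4e83a0e94a5064a128421283a10839ce84a12939d084a0e8421283a9084a4e84a1294a5083a8e8421284a10839d264a0e93a5083a128421284a1094210742506421274250949d09425294210942508428e941d0749d07425264a5284a0e73a5084a0e8421283a10742107425085212941d074a509424e74210742548420e741d0739d0941d283a5283a1293a5483a0e8420e83a1083a5284a12749d083a128421263a1074210741d08420e7425074a4c74252849d284a1294a5084a12a420e83a1094210742508420e741cc94a50741ce
mat-6bf = matrix 0x6bdf17c5ef7c5ef7bdef9c62f7c5f57c5b38be318bdb18c6318be6d8be2f7c62f8be316ce316c5b18be718be2f7c6336be318ce318b62d8bdf18be2f7c62f6ce318bdb18c5b18cdf18be2f7c62f8be316be318b6318cded8ce2f7c6338be318be2d8c5b18bdf16ce2f8bdf17c66f7c5ef7be737c6337c6718be719c5ef9c5ef7bdef7c62f9c6717c6338cdad6be318c6318bdf18be2f9c62f8be318be318c631abdf18be337c5af8ce318be316c62d8bdf18ce2f8bdf19c5f37c5f39bdef7c6337c5f18cdf17c5ef9c6737bdf37c62f7c5f17b6338be318be316c6318cdf18bdaf8ce717c5f37c5ef7ce6f7c62f7c5f17c5af8bdb18ce2d8c6318cdf18be2f7c62f8be2d8be318c62d8ce716be2f7b62f8ce318ce318c6318bd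ed6be2f7c62f8be2d8cdb18c6318bdf18cdaf7c62f8ce318be2d8b6318be718bdaf7b62f6bdb18be318c6318be718ce2f8bdf17c66f7c66f9cdef7c62f9c5f1abdf17c5ef7c5ef7bdef9c62f7c5ed
mat-6bg = matrix 0x6be318bdf16c6317be2f8bdef7bdf57c5ef7c62f7cdef6c6719c5b18c62f8be318be718c5b17be2f8ce6f7be718cdb18be718c6319be2f8bdf37bdf17b5ef7c62f7be738c5ed9c6318c62f7c6737c62f7bdef8c66d7b6318c62f8ce2d8bdf18c6317ce2f8be6f9bdf18be318cdf18c62d9be2f8cdef9bdf18be316cdf18c6317be338be737bdf17c5ef7c6337be6f8c6717c62d6c62f7c5f37b5b37bdef8c5f19c6318c62f7c5f37c62f7cdf38c5f17c62d8c5af7c66f7c6337bdf38c5f17c5b18b62f7c66f9c62f7bdef8c5f19c6316c5af7c66f7b62f7ce6f8b5f17c6318c62f8be318bded8c6319ce338bdef7be717c5ef9c5af7bdf38b6717c6318c62f7b5ef9c6337cdef8c5f17b6318c62f8be318be718b6317be338bdef9cdf16be318bdf1ac6317be2f8bdef7bded8ce318cdf18c6317bdaf8bdef7ce717c5f39c62f7be6f6c5f17c6318b62f8be318bdf18c6317ce2f6cdf37cdf1abe318bdf16c6317be2f8bdef7bded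
mat-7f = matrix 0x93a0e74252839d28425094250749ce8425083a909420c94a1284a0e8421074a1294252849d2842509425093a4e8425464a107421074a1284a12842108424ca4a107421074a1284a1284210841d084a149421073a1284a0e8421474a0e741ce839ce842509425094a528425083a147421094a0e83a1284214841d083a107521093a1284a128521074a0e7425283a52841d0741d094a4e94a0e741d284a4e8425074250939ce841d083a10742107499283a8e842108525083a107421073a0e84a0e642106425083a109421073a1283a1284190a425083a109421073a1283a1284290851d084a109421094a1283a12642108425084a10942109398e84a9284210841d083a109429074a0ea4a12842108425084a109521074a0e83a0e8521094a129424e83a528425074250949d273a12941d283a4e842507425074a4e84250839909421494a1284a0e8421094a12941d2839ce841d0941d0949ce841d083a109419074a0e64a1284210
mat-7g = matrix 0x741d0842107420c84a50841ce831d084a12939d283a4e9421274a1094a0e95250842107421084a50a41d284250742546421094210849d0841ce842507424ca421094210849d0841ce84250941d0842109419083a50841cea4250741d0852109421084a508525284250742508421074210a3a4c8424e8425083a0e74a5284a4e9421293a1094a0e84a0e73a4e84a529421274a1093a1284a0e73a52849ce7420e74a1074a0e941d08429073210849d08424e8425084a1294a5284a527420e73a1093a0e74250842909321083a50841d2841d0742508421074190849d084252a41d0741d0832109421084a50832528425074250842107421063a548424e84250751d08421094210839d0a424e841d094250842149421084a508424e841d4942508420c9421084a508424e841cc84a1294a4e849ce9421273a1074a1294250842109420c839d0842528325083a1293a4e84a4e7420e94a1094a1284a0e749ce83a4e7420e73a1094a12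
mat-8bf = matrix 0x9ae338c5ef7bdef7c6317bdef7be318c5f17be318c62d8ce738c6318c66f7bdaf8c66f7bdef7c62d9bdef9be317be2f8b5f37bdef7c5b17cdef9be318c5f17be318c6316bdef6b6318c6737be2f6c6737bdef9b6317bdef7be317be2f8b5ef9cdef9c62d7bdef7be318c5f17be316c6318cdef8c5b16c5f37be2f6c5ef7be6f7c62d7ce6f7be318c5f17be318c5ad6bdef8c62d6c5ef7bdaf8c5ef7cdef7b6317cdf37be317bdaf6b5ef7bdf37c6317bdef7be2d9ce2b8c5ef7bdef7c6317bdef7be318c5f17be2d8b62d8bdef6c5b18c5ef7bdaf8c5f39be6f7c6317bdef7bdb17be2f8b66f7bdef7c6317be737bdb18c5f17bdb18b5b18be6f8c6318c5f37be2f6c5ef9bdef7c5b19bdf37be317be2f8b5ef7be6f7b6319bdef7ce318c5f17be2d8c6318bdf38c62d8b5f37be2f6c5ef7cdef7c6317bdef9cdb18c5f17bdb16c62d8bdef8b6318b5ef7bdaf8c5ef7bdef9c5b17be6f7ce315ce338c5ef7bdef7c6317bdef7be31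
mat-8bg = matrix 0x8be318cdef7ce339c62f7bdef8cdef9c5ef7c6318c66d8be718c6319c6316bdb18bdef7be2f7c62f7be738cdef7c5ef7c5b18c5f18bded8d6317c6317c66f7b62d8c5f18be716c6317c6317c5ef7c6316c5f18ce718c6317b5b18bdb18bdef7be2f9c62f7bdef6be738be2d8bdef7bdaf7c62f9bdef8cdf37c5ef7c62d8c6716cdf18c5b17c6317c5f37b6316c5f18bdf18c5b19c6316be316bdef9be2f9c62f9bdef8bdef8bdad6bdef7be337b62f7bdef8bdef6be2d8bdf37ce2f7c62f7bdef8be6f7c5ef7c6b18c5f18bded8b6317c6317c5ef7c62d6c5ed8bdf18c62d7c62d7c5ef7c5b18c5f18bdf58b6317c6317c5ef9b6318c6718bdf18c62d7c5b18cdb18bdef9cdaf7c62f7bdef8bdef8ce316bdf37be2f7c62f7bdef6cdef8ce2d8bdef7be2f9c5af7bdf38bdef8be316bdef7ce2f7c5af7be6f8bdf37c5ef7c6318b5f18cdf16c62d9c6317b5ef7c6318c5ed8bdf16c5b17c5b16ce318cdef7be2f7b62f7bdef8bdf3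
mat-8cf = matrix 0x94a0e83a108420c741ce74212739d08425074252949ce83a1084a508428e94a9284a10842109425274212939d074a1283a10842107424e94212949cc73a0e84a90842109424e94212739d0841d0941d2949d283a10849d484212842509425294a5284990839d08420e74a1284a1084210741d29520e739d0851d074252749d284a1083a508421284250741d293a5284a0c84a508421274a0e83a10a4210942527420e749d074a0ea4a10842107424e7420e93a50842509324e74a5283a1084a5084212841d49425293a4e83a1083a5084212841d07424e94a4e84a10849d0a4212841d0941d274a4ea4a1084a508420e64250741d274a4e83a10839d08421284250941ce949ce84a10a3a50842128425094252739ce84a10849d08521274a1284a0c84210941ce7421274a5094a0e84a1084290742529421274a5074a0e83a1083210941d29421293a5073a1283a1084210752527421273a5073a0e84a1084210741d274292949d0
mat-8cg = matrix 0x94a0e741d08424e83a0e8420c73a0e74a1274250a41ce84a128421073a0e94a12742508425283a128421094a8e8525083a1274a107425074a52841d07498e741d08425284a128421093a12841d0a4a1293a107425074a4e8425094a0e942508424ea4a128421074a128425083a0e94a1074250949ce8425474a12941d08425284a0e8419074a0e74a12942508424e83a0e8321093a1274a0e941d0841ce83a12a421094a0e74a0e75250841d283a0e8421074a12842508498e94a109425073a52842506425083a0e73a10941d074a4e842508425083a1293a149425093a4e841d08425084a1274a10751d093a4e84250841d484a0e74a109425094a4e841d08425084a1294a10941d0749cea41d08425084a0e93a90741d094a52841d0841d083a1294a10941cc94a52842508425084a1273a1094250949d28325073a0e742508424e84a8e8421094a0e73a12741d48424e83a128421074a1273a0e942508525283a128421073a0e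
mat-15d = matrix 0x8c5f17c6717c6337ce2d7ce2f7c62f8c56d9c5f17c62f7be317be2f7c62f7bdab6be2f8bdf18c5ef8c5f18bdf18b5f17c5ed7b62f7bdad7be2f7c62f9ce2f8ce2f8bded8c5ef8c5f18bded6c5f17c6719b62f7be317bdaf7c62f9be2f8be338bdf18c5ef6b5f18cdf18c5f17c5ed7c5b39be317bdaf7c62f7be2f8bdaf8bdf16c66f6c5f18bded7be2f8ce2f8cdf16b5ef8c5f18cdf18c5f17c5f17b5af7be317ce2f7c5b38c5f17b5f17c62f7bdb17cdb37c62f9be2f8be2f8bdf16c5f38c5ed8be717ce2f8be2f6bdf16c5ef8b5f16bdf18c5f17c5f17c62f7be2d7bdaf9b6339be2f8be2f8be718b66f8c5f16bdf18b5f17c6717c5af7be317be337b62f7be2f8cdb38bdf18c5ef8c5f16be717bdb3abe2f8bdf18c5ef8c5f18bdf18c5f17c5f19c6337bdb17be2f7b5af7be2f8be2f8cded8c5ef6c5ed6bdf17be2f8ce2f6be718c5f36c5f18bdf18b5f17c5f17c62f7ce319bdaf7c5af8c5f17c5ed9c62f7ce317be337c633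
mat-16e = matrix 0x9bdf18c5f39c62f9bdf18c6318bded7cdf16c5ef7b62f9bdf18b6318bdf17be716b5ef7c62f7be718c6318bded7bdf18c66f7b5b37bdf18c6318bded9cded8c5ef7c6337be718c6318bdf18c6337be318bdf18c62f7ce737c6338c62f7be318bdf18b6337bdef7c6af7bdf18c66f9c62f7be718b6318cdf19be718c5ef7c5af7bdf16b6318bdf18c62f7be318be716c5af7bdf39c62f8b62f7be318bdf18c62f9bdef9b6338b5af7bdad8bdf18c62f7bdf37c62f7bdf18c5ef7c62f7cdf58c6318be718c6339be2d8be718c62f7bdef7b62f8c5b37be316cdf18c62f7bdef9c62f9bdf18b5ef7b62f7bdf18c62d8cdf19bdf16c66f7c62f7bdf18c5b16bdf18c62f7be318bdf18d6337bdef7c5af7be718c5ef7c6339bdf18c5b18cdf18c62f7be2d8cdf18c5af9be6f7c62f8c6337cdb18bdf16c62f9bdef7c62f8c62f9be316bded8c62f9bdf37c62f8c62f7ce2d8bded8c62f7cdef9c62f7cdf18b5ef9c5af7bdf18c5b18bdf1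
mat-15b = matrix 0x8424e84210a3a4e942128424e74252a41ce84210839ce7420e841ce94252841ce84210849d294212641ce741d273990939ce94210839d093a1083a10841d284290839d2942128424e9424e74a10749d294190849d094a1083a10841d28521083a4e74212841ce741ce73a10949d274210849d073a1084a9093a1093a5274210849d094a1063a1093a10749d274210a3a5093a1083a10841ce6421084a527420e8424e7424e842528421084a5274212841ce9325273a1094a529421083a4c74a1083a1093a10949ce9421484a5094a1084a10841ce8421483a527421284252941d294a10949ce74210839d074a9083a108425284210839d27420e8324e741d274a0c94a4e7421084a5093a1083a1073a10739ce7321084a5074a1083a108424e84210839d273212841d27424e8324e84210849ce742128424e941ce93a1074a4e94210849d073a1483a1073a1074a4e74210839d094a1084a14841d284210849ce742928425274252

-- A chain of representatives joined by minimal vectors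

start-2 start-3 start-4 start-5 start-6a start-6b start-7 start-8b start-8c start-9a start-9b start-10a start-10b start-10c start-11a start-11b start-12c start-12d start-12e start-12f start-13b start-13c start-14b start-14d start-14e start-15b start-15d start-16e start-15d′ start-16e′ : Vec24
start-2 = vec 0x8c6318c6318c6318c6318c6318c62d
start-3 = vec 0x74a5273a108420e842108421084212
start-4 = vec 0x749ce94a108421284210842108420e
start-5 = vec 0x739ce94a1084212842108421084212
start-6a = vec 0x93a5273a108420e842108421084212
start-6b = vec 0x8b6318c6318c6318c6318c6318c631
start-7 = vec 0x94a4e93a108420e84210842108420e
start-8b = vec 0x749ce94a108420e842108421084212
start-8c = vec 0x94a5273a108420e84210842108420e
start-9a = vec 0x749ce94a108421284210842108420e
start-9b = vec 0x939d284212941d08421084210841d0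
start-10a = vec 0x739d274a1084212842108421084212
start-10b = vec 0x8c6318c6318c6318c6318c6318c62d
start-10c = vec 0x8c6318c6318c6318c6318c6318c62d
start-11a = vec 0x74a4e94a1084212842108421084212
start-11b = vec 0x74a5293a108420e84210842108420e
start-12c = vec 0x8c6318c6318c6318c6318c6318c62d
start-12d = vec 0x8c6318c6318c6318c6318c6318c5b1
start-12e = vec 0x8c6318c6318c62d8c6318c6318c631
start-12f = vec 0x94a4e84212942508421084210841d0
start-13b = vec 0x74a4e8421294250842108421084250
start-13c = vec 0x74a4e94a1084212842108421084212
start-14b = vec 0x8c62d8c6318c6318c6318c6318c631
start-14d = vec 0x8c6318c6318c6318c6318c6318c62d
start-14e = vec 0x949ce94a108420e84210842108420e
start-15b = vec 0x94a5284212941d08421084210841d0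
start-15d = vec 0x949d084a5284a10842108421083a10
start-15d′ = vec 0x949ce8420e741d08421084210841d0
start-16e = vec 0x94a528420e741d08421084210841d0
start-16e′ = vec 0x8420e849d0939d0842108421084a50

rep-0 rep-2 rep-3 rep-4 rep-5 rep-6a rep-6b rep-7 rep-8a rep-8b rep-8c rep-9a rep-9b rep-10a rep-10b rep-10c rep-11a rep-11b rep-12a rep-12c rep-12d rep-12e rep-12f rep-13b rep-13c rep-14b rep-14d rep-14e rep-15b rep-15d rep-16a rep-16e : Vec24
rep-0 = 𝟎
rep-2 = rep-0 ⊕ + 1 ⊙ start-2
rep-3 = rep-2 ⊕ + 1 ⊙ start-3
rep-4 = rep-3 ⊕ + 1 ⊙ start-4
rep-5 = rep-3 ⊕ + 2 ⊙ start-5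
rep-6a = rep-4 ⊕ + 2 ⊙ start-6a
rep-6b = rep-4 ⊕ + 1 ⊙ start-6b
rep-7 = rep-5 ⊕ + 2 ⊙ start-7
rep-8a = + 2 ⊙ rep-2
rep-8b = rep-6a ⊕ + 2 ⊙ start-8b
rep-8c = rep-5 ⊕ + 3 ⊙ start-8c
rep-9a = rep-6a ⊕ + 3 ⊙ start-9a
rep-9b = rep-7 ⊕ + 2 ⊙ start-9b
rep-10a = rep-7 ⊕ + 3 ⊙ start-10a
rep-10b = rep-4 ⊕ + 1 ⊙ start-10b
rep-10c = rep-6a ⊕ + 1 ⊙ start-10c
rep-11a = rep-5 ⊕ + 1 ⊙ start-11a
rep-11b = rep-6a ⊕ + 1 ⊙ start-11b
rep-12a = + 2 ⊙ rep-3
rep-12c = rep-7 ⊕ + 1 ⊙ start-12c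
rep-12d = rep-6b ⊕ + 1 ⊙ start-12d
rep-12e = rep-6a ⊕ + 1 ⊙ start-12e
rep-12f = rep-7 ⊕ + 1 ⊙ start-12f
rep-13b = rep-7 ⊕ + 1 ⊙ start-13b
rep-13c = rep-7 ⊕ + 1 ⊙ start-13c
rep-14b = rep-6a ⊕ + 2 ⊙ start-14b
rep-14d = rep-8c ⊕ + 1 ⊙ start-14d
rep-14e = rep-8c ⊕ + 2 ⊙ start-14e
rep-15b = rep-7 ⊕ + 2 ⊙ start-15b
rep-15d = rep-7 ⊕ + 2 ⊙ start-15d
rep-16a = + 2 ⊙ rep-4
rep-16e = rep-8b ⊕ + 2 ⊙ start-16e

-- The two of the thirteen vectors in `nears-15d` for which the step by `4a` leaves the orbit of
-- `rep-15d`.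
near₁ near₂ : Vec24
near₁ = vec 0x83a10741ce839d084210841d0841d0
near₂ = vec 0x7b5f17bdef7be317bdef7be2f7c631

nears-15d : List Vec24
nears-15d = near₁ ∷ near₂ ∷ vec 0x73a50839ce83a10842108421084a10 ∷ vec 0x84212741ce83a12842108421084a12 ∷ vec 0x73a127421083a108421084210749d0 ∷ vec 0x83a1273a0e7421084210841d084a10 ∷ vec 0x83a12739d083a108421093a1084210 ∷ vec 0x83a12739d083a108421074a1084210 ∷ vec 0x83a527420e83a10841ce8421084210 ∷ vec 0x73a12741ce8421093a108421084210 ∷ vec 0x73a12741ce8421074a108421084210 ∷ vec 0x7be316bdef8bdf17be2f7bdef7c62f ∷ vec 0x7be316bdef7bdef7bdf17be2f8c5f1 ∷ []

q₁ q₂ : Vec24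
q₁ = rep-15d ⊕ + 4 ⊙ near₁
q₂ = rep-15d ⊕ + 4 ⊙ near₂

-- Short vectors congruent to the representatives of type at least 12 modulo 2Λ

short-12a short-12c short-12d short-12e short-12f short-13b short-13c short-14b short-14d short-14e short-15d short-16a short-16e : Vec24
short-12a = vec 0x842108421084210842108421084210
short-12c = vec 0x939ce94a108421284210842108420e
short-12d = vec 0x6c6318c6318c6318c6318c6318c5b5
short-12e = vec 0x842946321084210842108421084210
short-12f = vec 0x9bdeb8c5f18be317bdef7bdef7bdb1
short-13b = vec 0x7bdeb8c5f18be317bdef7bdef7be31
short-13c = vec 0x6b5b18c6318c6318c6318c6318c631
short-14b = vec 0xab6318c6318c6318c6318c6318c62d
short-14d = vec 0xa4210842108421084210842108420c
short-14e = vec 0x6c6318c6318c6318c6318c6318c631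
short-15d = vec 0x7ce737be318c62f8c6318c6318c62f
short-16a = vec 0x842108421084210842108421084210
short-16e = vec 0x8c6318c5ad8c62d8c6318c6316c5b1

half : Vec24 → Vec24
half = map (_/ℕ 2)

opaque
  unfolding basis

  aut-0f : IsAut mat-0f
  aut-0f = decided (IsAut? mat-0f) refl

  aut-0g : IsAut mat-0g
  aut-0g = decided (IsAut? mat-0g) refl

  aut-2f : IsAut mat-2f
  aut-2f = decided (IsAut? mat-2f) refl

  aut-2g : IsAut mat-2g
  aut-2g = decided (IsAut? mat-2g) refl

  aut-3f : IsAut mat-3f
  aut-3f = decided (IsAut? mat-3f) refl

  aut-3g : IsAut mat-3g
  aut-3g = decided (IsAut? mat-3g) refl

  aut-4f : IsAut mat-4f
  aut-4f = decided (IsAut? mat-4f) refl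

  aut-4g : IsAut mat-4g
  aut-4g = decided (IsAut? mat-4g) refl

  aut-5f : IsAut mat-5f
  aut-5f = decided (IsAut? mat-5f) refl

  aut-5g : IsAut mat-5g
  aut-5g = decided (IsAut? mat-5g) refl

  aut-6af : IsAut mat-6af
  aut-6af = decided (IsAut? mat-6af) refl

  aut-6ag : IsAut mat-6ag
  aut-6ag = decided (IsAut? mat-6ag) refl

  aut-6bf : IsAut mat-6bf
  aut-6bf = decided (IsAut? mat-6bf) refl

  aut-6bg : IsAut mat-6bg
  aut-6bg = decided (IsAut? mat-6bg) refl

  aut-7f : IsAut mat-7f
  aut-7f = decided (IsAut? mat-7f) refl

  aut-7g : IsAut mat-7g
  aut-7g = decided (IsAut? mat-7g) refl

  aut-8bf : IsAut mat-8bf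
  aut-8bf = decided (IsAut? mat-8bf) refl

  aut-8bg : IsAut mat-8bg
  aut-8bg = decided (IsAut? mat-8bg) refl

  aut-8cf : IsAut mat-8cf
  aut-8cf = decided (IsAut? mat-8cf) refl

  aut-8cg : IsAut mat-8cg
  aut-8cg = decided (IsAut? mat-8cg) refl

  aut-15d : IsAut mat-15d
  aut-15d = decided (IsAut? mat-15d) refl

  aut-16e : IsAut mat-16e
  aut-16e = decided (IsAut? mat-16e) refl

  aut-15b : IsAut mat-15b
  aut-15b = decided (IsAut? mat-15b) refl

  min-2 : Min start-2
  min-2 = decided (InΛ? start-2) refl , refl

  min-3 : Min start-3
  min-3 = decided (InΛ? start-3) refl , refl

  min-4 : Min start-4
  min-4 = decided (InΛ? start-4) refl , refl

  min-5 : Min start-5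
  min-5 = decided (InΛ? start-5) refl , refl

  min-6a : Min start-6a
  min-6a = decided (InΛ? start-6a) refl , refl

  min-6b : Min start-6b
  min-6b = decided (InΛ? start-6b) refl , refl

  min-7 : Min start-7
  min-7 = decided (InΛ? start-7) refl , refl

  min-8b : Min start-8b
  min-8b = decided (InΛ? start-8b) refl , refl

  min-8c : Min start-8c
  min-8c = decided (InΛ? start-8c) refl , refl

  min-9a : Min start-9a
  min-9a = decided (InΛ? start-9a) refl , refl

  min-9b : Min start-9b
  min-9b = decided (InΛ? start-9b) refl , refl

  min-10a : Min start-10a
  min-10a = decided (InΛ? start-10a) refl , refl

  min-10b : Min start-10b
  min-10b = decided (InΛ? start-10b) refl , refl

  min-10c : Min start-10c
  min-10c = decided (InΛ? start-10c) refl , refl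

  min-11a : Min start-11a
  min-11a = decided (InΛ? start-11a) refl , refl

  min-11b : Min start-11b
  min-11b = decided (InΛ? start-11b) refl , refl

  min-12c : Min start-12c
  min-12c = decided (InΛ? start-12c) refl , refl

  min-12d : Min start-12d
  min-12d = decided (InΛ? start-12d) refl , refl

  min-12e : Min start-12e
  min-12e = decided (InΛ? start-12e) refl , refl

  min-12f : Min start-12f
  min-12f = decided (InΛ? start-12f) refl , refl

  min-13b : Min start-13b
  min-13b = decided (InΛ? start-13b) refl , refl

  min-13c : Min start-13c
  min-13c = decided (InΛ? start-13c) refl , refl

  min-14b : Min start-14b
  min-14b = decided (InΛ? start-14b) refl , refl

  min-14d : Min start-14d
  min-14d = decided (InΛ? start-14d) refl , refl

  min-14e : Min start-14e
  min-14e = decided (InΛ? start-14e) refl , refl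

  min-15b : Min start-15b
  min-15b = decided (InΛ? start-15b) refl , refl

  min-15d : Min start-15d
  min-15d = decided (InΛ? start-15d) refl , refl

  min-16e : Min start-16e
  min-16e = decided (InΛ? start-16e) refl , refl

  min-15d′ : Min start-15d′
  min-15d′ = decided (InΛ? start-15d′) refl , refl

  min-16e′ : Min start-16e′
  min-16e′ = decided (InΛ? start-16e′) refl , refl

  min-near₁ : Min near₁
  min-near₁ = decided (InΛ? near₁) refl , refl

  min-near₂ : Min near₂
  min-near₂ = decided (InΛ? near₂) refl , refl

  short-12a∈ : InΛ short-12a × InΛ (half (rep-12a ⊖ short-12a))
  short-12a∈ = decided (InΛ? short-12a) refl , decided (InΛ? (half (rep-12a ⊖ short-12a))) refl

  short-12c∈ : InΛ short-12c × InΛ (half (rep-12c ⊖ short-12c))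
  short-12c∈ = decided (InΛ? short-12c) refl , decided (InΛ? (half (rep-12c ⊖ short-12c))) refl

  short-12d∈ : InΛ short-12d × InΛ (half (rep-12d ⊖ short-12d))
  short-12d∈ = decided (InΛ? short-12d) refl , decided (InΛ? (half (rep-12d ⊖ short-12d))) refl

  short-12e∈ : InΛ short-12e × InΛ (half (rep-12e ⊖ short-12e))
  short-12e∈ = decided (InΛ? short-12e) refl , decided (InΛ? (half (rep-12e ⊖ short-12e))) refl

  short-12f∈ : InΛ short-12f × InΛ (half (rep-12f ⊖ short-12f))
  short-12f∈ = decided (InΛ? short-12f) refl , decided (InΛ? (half (rep-12f ⊖ short-12f))) refl

  short-13b∈ : InΛ short-13b × InΛ (half (rep-13b ⊖ short-13b))
  short-13b∈ = decided (InΛ? short-13b) refl , decided (InΛ? (half (rep-13b ⊖ short-13b))) refl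

  short-13c∈ : InΛ short-13c × InΛ (half (rep-13c ⊖ short-13c))
  short-13c∈ = decided (InΛ? short-13c) refl , decided (InΛ? (half (rep-13c ⊖ short-13c))) refl

  short-14b∈ : InΛ short-14b × InΛ (half (rep-14b ⊖ short-14b))
  short-14b∈ = decided (InΛ? short-14b) refl , decided (InΛ? (half (rep-14b ⊖ short-14b))) refl

  short-14d∈ : InΛ short-14d × InΛ (half (rep-14d ⊖ short-14d))
  short-14d∈ = decided (InΛ? short-14d) refl , decided (InΛ? (half (rep-14d ⊖ short-14d))) refl

  short-14e∈ : InΛ short-14e × InΛ (half (rep-14e ⊖ short-14e))
  short-14e∈ = decided (InΛ? short-14e) refl , decided (InΛ? (half (rep-14e ⊖ short-14e))) refl

  short-15d∈ : InΛ short-15d × InΛ (half (rep-15d ⊖ short-15d))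
  short-15d∈ = decided (InΛ? short-15d) refl , decided (InΛ? (half (rep-15d ⊖ short-15d))) refl

  short-16a∈ : InΛ short-16a × InΛ (half (rep-16a ⊖ short-16a))
  short-16a∈ = decided (InΛ? short-16a) refl , decided (InΛ? (half (rep-16a ⊖ short-16a))) refl

  short-16e∈ : InΛ short-16e × InΛ (half (rep-16e ⊖ short-16e))
  short-16e∈ = decided (InΛ? short-16e) refl , decided (InΛ? (half (rep-16e ⊖ short-16e))) refl

  nears-min : All (λ a → Min a × value rep-15d a ≡ 64) nears-15d
  nears-min = decided (All.all? (λ a → (InΛ? a ×-dec form8 a a ℤ.≟ + 32) ×-dec value rep-15d a ℕ.≟ 64) nears-15d) refl

nears-many : AtLeast (λ a → Min a × value rep-15d a ≡ 64) 13
nears-many = nears-15d , decided (AllPairs.allPairs? (λ x y → ¬? (x ≟ᵥ y)) nears-15d) refl , nears-min , ℕₚ.≤-refl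

in-0 : InΛ rep-0
in-0 = Integral⇒InΛ Λ-𝟎

in-2 : InΛ rep-2
in-2 = Λ-closed-⊕ {rep-0} {+ 1 ⊙ start-2} in-0 (Λ-closed-⊙ (+ 1) {start-2} (proj₁ min-2))

in-3 : InΛ rep-3
in-3 = Λ-closed-⊕ {rep-2} {+ 1 ⊙ start-3} in-2 (Λ-closed-⊙ (+ 1) {start-3} (proj₁ min-3))

in-4 : InΛ rep-4
in-4 = Λ-closed-⊕ {rep-3} {+ 1 ⊙ start-4} in-3 (Λ-closed-⊙ (+ 1) {start-4} (proj₁ min-4))

in-5 : InΛ rep-5
in-5 = Λ-closed-⊕ {rep-3} {+ 2 ⊙ start-5} in-3 (Λ-closed-⊙ (+ 2) {start-5} (proj₁ min-5))

in-6a : InΛ rep-6a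
in-6a = Λ-closed-⊕ {rep-4} {+ 2 ⊙ start-6a} in-4 (Λ-closed-⊙ (+ 2) {start-6a} (proj₁ min-6a))

in-6b : InΛ rep-6b
in-6b = Λ-closed-⊕ {rep-4} {+ 1 ⊙ start-6b} in-4 (Λ-closed-⊙ (+ 1) {start-6b} (proj₁ min-6b))

in-7 : InΛ rep-7
in-7 = Λ-closed-⊕ {rep-5} {+ 2 ⊙ start-7} in-5 (Λ-closed-⊙ (+ 2) {start-7} (proj₁ min-7))

in-8a : InΛ rep-8a
in-8a = Λ-closed-⊙ (+ 2) {rep-2} in-2

in-8b : InΛ rep-8b
in-8b = Λ-closed-⊕ {rep-6a} {+ 2 ⊙ start-8b} in-6a (Λ-closed-⊙ (+ 2) {start-8b} (proj₁ min-8b))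

in-8c : InΛ rep-8c
in-8c = Λ-closed-⊕ {rep-5} {+ 3 ⊙ start-8c} in-5 (Λ-closed-⊙ (+ 3) {start-8c} (proj₁ min-8c))

in-9a : InΛ rep-9a
in-9a = Λ-closed-⊕ {rep-6a} {+ 3 ⊙ start-9a} in-6a (Λ-closed-⊙ (+ 3) {start-9a} (proj₁ min-9a))

in-9b : InΛ rep-9b
in-9b = Λ-closed-⊕ {rep-7} {+ 2 ⊙ start-9b} in-7 (Λ-closed-⊙ (+ 2) {start-9b} (proj₁ min-9b))

in-10a : InΛ rep-10a
in-10a = Λ-closed-⊕ {rep-7} {+ 3 ⊙ start-10a} in-7 (Λ-closed-⊙ (+ 3) {start-10a} (proj₁ min-10a))

in-10b : InΛ rep-10b
in-10b = Λ-closed-⊕ {rep-4} {+ 1 ⊙ start-10b} in-4 (Λ-closed-⊙ (+ 1) {start-10b} (proj₁ min-10b))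

in-10c : InΛ rep-10c
in-10c = Λ-closed-⊕ {rep-6a} {+ 1 ⊙ start-10c} in-6a (Λ-closed-⊙ (+ 1) {start-10c} (proj₁ min-10c))

in-11a : InΛ rep-11a
in-11a = Λ-closed-⊕ {rep-5} {+ 1 ⊙ start-11a} in-5 (Λ-closed-⊙ (+ 1) {start-11a} (proj₁ min-11a))

in-11b : InΛ rep-11b
in-11b = Λ-closed-⊕ {rep-6a} {+ 1 ⊙ start-11b} in-6a (Λ-closed-⊙ (+ 1) {start-11b} (proj₁ min-11b))

in-12a : InΛ rep-12a
in-12a = Λ-closed-⊙ (+ 2) {rep-3} in-3

in-12c : InΛ rep-12c
in-12c = Λ-closed-⊕ {rep-7} {+ 1 ⊙ start-12c} in-7 (Λ-closed-⊙ (+ 1) {start-12c} (proj₁ min-12c))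

in-12d : InΛ rep-12d
in-12d = Λ-closed-⊕ {rep-6b} {+ 1 ⊙ start-12d} in-6b (Λ-closed-⊙ (+ 1) {start-12d} (proj₁ min-12d))

in-12e : InΛ rep-12e
in-12e = Λ-closed-⊕ {rep-6a} {+ 1 ⊙ start-12e} in-6a (Λ-closed-⊙ (+ 1) {start-12e} (proj₁ min-12e))

in-12f : InΛ rep-12f
in-12f = Λ-closed-⊕ {rep-7} {+ 1 ⊙ start-12f} in-7 (Λ-closed-⊙ (+ 1) {start-12f} (proj₁ min-12f))

in-13b : InΛ rep-13b
in-13b = Λ-closed-⊕ {rep-7} {+ 1 ⊙ start-13b} in-7 (Λ-closed-⊙ (+ 1) {start-13b} (proj₁ min-13b))

in-13c : InΛ rep-13c
in-13c = Λ-closed-⊕ {rep-7} {+ 1 ⊙ start-13c} in-7 (Λ-closed-⊙ (+ 1) {start-13c} (proj₁ min-13c))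

in-14b : InΛ rep-14b
in-14b = Λ-closed-⊕ {rep-6a} {+ 2 ⊙ start-14b} in-6a (Λ-closed-⊙ (+ 2) {start-14b} (proj₁ min-14b))

in-14d : InΛ rep-14d
in-14d = Λ-closed-⊕ {rep-8c} {+ 1 ⊙ start-14d} in-8c (Λ-closed-⊙ (+ 1) {start-14d} (proj₁ min-14d))

in-14e : InΛ rep-14e
in-14e = Λ-closed-⊕ {rep-8c} {+ 2 ⊙ start-14e} in-8c (Λ-closed-⊙ (+ 2) {start-14e} (proj₁ min-14e))

in-15b : InΛ rep-15b
in-15b = Λ-closed-⊕ {rep-7} {+ 2 ⊙ start-15b} in-7 (Λ-closed-⊙ (+ 2) {start-15b} (proj₁ min-15b))

in-15d : InΛ rep-15d
in-15d = Λ-closed-⊕ {rep-7} {+ 2 ⊙ start-15d} in-7 (Λ-closed-⊙ (+ 2) {start-15d} (proj₁ min-15d))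

in-16a : InΛ rep-16a
in-16a = Λ-closed-⊙ (+ 2) {rep-4} in-4

in-16e : InΛ rep-16e
in-16e = Λ-closed-⊕ {rep-8b} {+ 2 ⊙ start-16e} in-8b (Λ-closed-⊙ (+ 2) {start-16e} (proj₁ min-16e))

site-0 : Site
site-0 = record { centre = rep-0 ; M₁ = mat-0f ; M₂ = mat-0g ; centre∈ = in-0 ; aut₁ = aut-0f ; aut₂ = aut-0g ; fix₁ = refl ; fix₂ = refl }

site-2 : Site
site-2 = record { centre = rep-2 ; M₁ = mat-2f ; M₂ = mat-2g ; centre∈ = in-2 ; aut₁ = aut-2f ; aut₂ = aut-2g ; fix₁ = refl ; fix₂ = refl }

site-3 : Site
site-3 = record { centre = rep-3 ; M₁ = mat-3f ; M₂ = mat-3g ; centre∈ = in-3 ; aut₁ = aut-3f ; aut₂ = aut-3g ; fix₁ = refl ; fix₂ = refl }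

site-4 : Site
site-4 = record { centre = rep-4 ; M₁ = mat-4f ; M₂ = mat-4g ; centre∈ = in-4 ; aut₁ = aut-4f ; aut₂ = aut-4g ; fix₁ = refl ; fix₂ = refl }

site-5 : Site
site-5 = record { centre = rep-5 ; M₁ = mat-5f ; M₂ = mat-5g ; centre∈ = in-5 ; aut₁ = aut-5f ; aut₂ = aut-5g ; fix₁ = refl ; fix₂ = refl }

site-6a : Site
site-6a = record { centre = rep-6a ; M₁ = mat-6af ; M₂ = mat-6ag ; centre∈ = in-6a ; aut₁ = aut-6af ; aut₂ = aut-6ag ; fix₁ = refl ; fix₂ = refl }

site-6b : Site
site-6b = record { centre = rep-6b ; M₁ = mat-6bf ; M₂ = mat-6bg ; centre∈ = in-6b ; aut₁ = aut-6bf ; aut₂ = aut-6bg ; fix₁ = refl ; fix₂ = refl }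

site-7 : Site
site-7 = record { centre = rep-7 ; M₁ = mat-7f ; M₂ = mat-7g ; centre∈ = in-7 ; aut₁ = aut-7f ; aut₂ = aut-7g ; fix₁ = refl ; fix₂ = refl }

site-8b : Site
site-8b = record { centre = rep-8b ; M₁ = mat-8bf ; M₂ = mat-8bg ; centre∈ = in-8b ; aut₁ = aut-8bf ; aut₂ = aut-8bg ; fix₁ = refl ; fix₂ = refl }

site-8c : Site
site-8c = record { centre = rep-8c ; M₁ = mat-8cf ; M₂ = mat-8cg ; centre∈ = in-8c ; aut₁ = aut-8cf ; aut₂ = aut-8cg ; fix₁ = refl ; fix₂ = refl }

-- One pass over the minimal vectors for every representative

jobs : List Job
jobs =
  job rep-0 64 0 0 0 ∷
  job rep-2 96 0 1 1654528 ∷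
  job rep-3 104 0 552 1930560 ∷
  job rep-4 104 0 2048 2091008 ∷
  job rep-5 88 0 2 2195264 ∷
  job rep-6a 88 0 24 2261760 ∷
  job rep-6b 96 0 891 2227968 ∷
  job rep-7 88 0 100 2303296 ∷
  job rep-8a 64 1 1 1507328 ∷
  job rep-8b 88 0 256 2328576 ∷
  job rep-8c 72 0 1 2293760 ∷
  job rep-9a 72 0 1 2342720 ∷
  job rep-9b 88 0 486 2343744 ∷
  job rep-10a 72 0 2 2351872 ∷
  job rep-10b 64 1 1 2309888 ∷
  job rep-10c 80 0 100 2320128 ∷
  job rep-11a 64 1 1 2352448 ∷
  job rep-11b 72 0 8 2356544 ∷
  job rep-12a 64 0 0 1572864 ∷
  job rep-12c 72 0 23 2326528 ∷
  job rep-12d 64 3 3 2353152 ∷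
  job rep-12e 64 1 1 2357248 ∷
  job rep-12f 72 0 24 2359296 ∷
  job rep-13b 64 1 1 2360128 ∷
  job rep-13c 64 2 2 2359104 ∷
  job rep-14b 64 5 5 2360064 ∷
  job rep-14d 64 2 2 2328320 ∷
  job rep-14e 72 7 64 2326272 ∷
  job rep-15b 64 12 12 2360640 ∷
  job rep-15d 64 13 13 2360640 ∷
  job rep-16a 64 46 46 1572864 ∷
  job rep-16e 64 29 29 2361344 ∷
  job q₁ 64 12 12 2360640 ∷
  job q₂ 64 12 12 2360640 ∷
  []

c-16e : Vec24
c-16e = + 2 ⊙ short-16e ⊖ rep-16e

-- The list of codes is an argument, so that all tests share one evaluation of `minCodes`. The bound
-- 196560 is the number of minimal vectors that `reach-2` produces.
audit : List ℕ → Bool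
audit cs = (length cs ℕ.≤ᵇ 196560) ∧ (length (joint short-16e c-16e 96 64 cs) ℕ.≤ᵇ 1) ∧ scanJobs cs jobs

opaque
  unfolding codewords

  audited : audit minCodes ≡ true
  audited = refl

jobs-fit : All Fit jobs
jobs-fit = decided (All.all? Fit? jobs) refl

all-profiles : All JobProfile jobs
all-profiles = profiles jobs-fit (proj₂ (∧-true {length (joint short-16e c-16e 96 64 minCodes) ℕ.≤ᵇ 1} (proj₂ (∧-true {length minCodes ℕ.≤ᵇ 196560} audited))))

profile-0 : Profile rep-0 64 0 0 0
profile-0 = All.lookup all-profiles {job rep-0 64 0 0 0} (here refl)

profile-2 : Profile rep-2 96 0 1 1654528
profile-2 = All.lookup all-profiles {job rep-2 96 0 1 1654528} (there (here refl))

profile-3 : Profile rep-3 104 0 552 1930560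
profile-3 = All.lookup all-profiles {job rep-3 104 0 552 1930560} (there (there (here refl)))

profile-4 : Profile rep-4 104 0 2048 2091008
profile-4 = All.lookup all-profiles {job rep-4 104 0 2048 2091008} (there (there (there (here refl))))

profile-5 : Profile rep-5 88 0 2 2195264
profile-5 = All.lookup all-profiles {job rep-5 88 0 2 2195264} (there (there (there (there (here refl)))))

profile-6a : Profile rep-6a 88 0 24 2261760
profile-6a = All.lookup all-profiles {job rep-6a 88 0 24 2261760} (there (there (there (there (there (here refl))))))

profile-6b : Profile rep-6b 96 0 891 2227968
profile-6b = All.lookup all-profiles {job rep-6b 96 0 891 2227968} (there (there (there (there (there (there (here refl)))))))

profile-7 : Profile rep-7 88 0 100 2303296
profile-7 = All.lookup all-profiles {job rep-7 88 0 100 2303296} (there (there (there (there (there (there (there (here refl))))))))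

profile-8a : Profile rep-8a 64 1 1 1507328
profile-8a = All.lookup all-profiles {job rep-8a 64 1 1 1507328} (there (there (there (there (there (there (there (there (here refl)))))))))

profile-8b : Profile rep-8b 88 0 256 2328576
profile-8b = All.lookup all-profiles {job rep-8b 88 0 256 2328576} (there (there (there (there (there (there (there (there (there (here refl))))))))))

profile-8c : Profile rep-8c 72 0 1 2293760
profile-8c = All.lookup all-profiles {job rep-8c 72 0 1 2293760} (there (there (there (there (there (there (there (there (there (there (here refl)))))))))))

profile-9a : Profile rep-9a 72 0 1 2342720
profile-9a = All.lookup all-profiles {job rep-9a 72 0 1 2342720} (there (there (there (there (there (there (there (there (there (there (there (here refl))))))))))))

profile-9b : Profile rep-9b 88 0 486 2343744
profile-9b = All.lookup all-profiles {job rep-9b 88 0 486 2343744} (there (there (there (there (there (there (there (there (there (there (there (there (here refl)))))))))))))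

profile-10a : Profile rep-10a 72 0 2 2351872
profile-10a = All.lookup all-profiles {job rep-10a 72 0 2 2351872} (there (there (there (there (there (there (there (there (there (there (there (there (there (here refl))))))))))))))

profile-10b : Profile rep-10b 64 1 1 2309888
profile-10b = All.lookup all-profiles {job rep-10b 64 1 1 2309888} (there (there (there (there (there (there (there (there (there (there (there (there (there (there (here refl)))))))))))))))

profile-10c : Profile rep-10c 80 0 100 2320128
profile-10c = All.lookup all-profiles {job rep-10c 80 0 100 2320128} (there (there (there (there (there (there (there (there (there (there (there (there (there (there (there (here refl))))))))))))))))

profile-11a : Profile rep-11a 64 1 1 2352448
profile-11a = All.lookup all-profiles {job rep-11a 64 1 1 2352448} (there (there (there (there (there (there (there (there (there (there (there (there (there (there (there (there (here refl)))))))))))))))))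

profile-11b : Profile rep-11b 72 0 8 2356544
profile-11b = All.lookup all-profiles {job rep-11b 72 0 8 2356544} (there (there (there (there (there (there (there (there (there (there (there (there (there (there (there (there (there (here refl))))))))))))))))))

profile-12a : Profile rep-12a 64 0 0 1572864
profile-12a = All.lookup all-profiles {job rep-12a 64 0 0 1572864} (there (there (there (there (there (there (there (there (there (there (there (there (there (there (there (there (there (there (here refl)))))))))))))))))))

profile-12c : Profile rep-12c 72 0 23 2326528
profile-12c = All.lookup all-profiles {job rep-12c 72 0 23 2326528} (there (there (there (there (there (there (there (there (there (there (there (there (there (there (there (there (there (there (there (here refl))))))))))))))))))))

profile-12d : Profile rep-12d 64 3 3 2353152
profile-12d = All.lookup all-profiles {job rep-12d 64 3 3 2353152} (there (there (there (there (there (there (there (there (there (there (there (there (there (there (there (there (there (there (there (there (here refl)))))))))))))))))))))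

profile-12e : Profile rep-12e 64 1 1 2357248
profile-12e = All.lookup all-profiles {job rep-12e 64 1 1 2357248} (there (there (there (there (there (there (there (there (there (there (there (there (there (there (there (there (there (there (there (there (there (here refl))))))))))))))))))))))

profile-12f : Profile rep-12f 72 0 24 2359296
profile-12f = All.lookup all-profiles {job rep-12f 72 0 24 2359296} (there (there (there (there (there (there (there (there (there (there (there (there (there (there (there (there (there (there (there (there (there (there (here refl)))))))))))))))))))))))

profile-13b : Profile rep-13b 64 1 1 2360128
profile-13b = All.lookup all-profiles {job rep-13b 64 1 1 2360128} (there (there (there (there (there (there (there (there (there (there (there (there (there (there (there (there (there (there (there (there (there (there (there (here refl))))))))))))))))))))))))

profile-13c : Profile rep-13c 64 2 2 2359104
profile-13c = All.lookup all-profiles {job rep-13c 64 2 2 2359104} (there (there (there (there (there (there (there (there (there (there (there (there (there (there (there (there (there (there (there (there (there (there (there (there (here refl)))))))))))))))))))))))))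

profile-14b : Profile rep-14b 64 5 5 2360064
profile-14b = All.lookup all-profiles {job rep-14b 64 5 5 2360064} (there (there (there (there (there (there (there (there (there (there (there (there (there (there (there (there (there (there (there (there (there (there (there (there (there (here refl))))))))))))))))))))))))))

profile-14d : Profile rep-14d 64 2 2 2328320
profile-14d = All.lookup all-profiles {job rep-14d 64 2 2 2328320} (there (there (there (there (there (there (there (there (there (there (there (there (there (there (there (there (there (there (there (there (there (there (there (there (there (there (here refl)))))))))))))))))))))))))))

profile-14e : Profile rep-14e 72 7 64 2326272
profile-14e = All.lookup all-profiles {job rep-14e 72 7 64 2326272} (there (there (there (there (there (there (there (there (there (there (there (there (there (there (there (there (there (there (there (there (there (there (there (there (there (there (there (here refl))))))))))))))))))))))))))))

profile-15b : Profile rep-15b 64 12 12 2360640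
profile-15b = All.lookup all-profiles {job rep-15b 64 12 12 2360640} (there (there (there (there (there (there (there (there (there (there (there (there (there (there (there (there (there (there (there (there (there (there (there (there (there (there (there (there (here refl)))))))))))))))))))))))))))))

profile-15d : Profile rep-15d 64 13 13 2360640
profile-15d = All.lookup all-profiles {job rep-15d 64 13 13 2360640} (there (there (there (there (there (there (there (there (there (there (there (there (there (there (there (there (there (there (there (there (there (there (there (there (there (there (there (there (there (here refl))))))))))))))))))))))))))))))

profile-16a : Profile rep-16a 64 46 46 1572864
profile-16a = All.lookup all-profiles {job rep-16a 64 46 46 1572864} (there (there (there (there (there (there (there (there (there (there (there (there (there (there (there (there (there (there (there (there (there (there (there (there (there (there (there (there (there (there (here refl)))))))))))))))))))))))))))))))

profile-16e : Profile rep-16e 64 29 29 2361344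
profile-16e = All.lookup all-profiles {job rep-16e 64 29 29 2361344} (there (there (there (there (there (there (there (there (there (there (there (there (there (there (there (there (there (there (there (there (there (there (there (there (there (there (there (there (there (there (there (here refl))))))))))))))))))))))))))))))))

profile-q₁ : Profile q₁ 64 12 12 2360640
profile-q₁ = All.lookup all-profiles {job q₁ 64 12 12 2360640} (there (there (there (there (there (there (there (there (there (there (there (there (there (there (there (there (there (there (there (there (there (there (there (there (there (there (there (there (there (there (there (there (here refl)))))))))))))))))))))))))))))))))

profile-q₂ : Profile q₂ 64 12 12 2360640
profile-q₂ = All.lookup all-profiles {job q₂ 64 12 12 2360640} (there (there (there (there (there (there (there (there (there (there (there (there (there (there (there (there (there (there (there (there (there (there (there (there (there (there (there (there (there (there (there (there (there (here refl))))))))))))))))))))))))))))))))))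

-- Sizes of the orbits from below

runs-2 : List Run
runs-2 = (start-2 , 6138 , 0x37ffffffffffffffffffffffffffffffffffffffffffffffffffffffffffffffffffffffffffffffffffffffffffffffffffffffffffffffffffffffffffffffffffffffffffffffffffffffffffffffffffffffffffffffffffffffffffffffffffffffffffffffffffffffffffffffffffffffffffffffffffffffffffffffffffffffffffffffffffffffffffffffffffffffffffffffffffffffffffffffffffffffffffffffffffffffffffffffffffffffffffffffffffffffffffffffffffffffffffffffffffffffffffffffffffffffffffffffffffffffffffffffffffffffffffffffffffffffffffffffffffffffffffffffffffffffffffffffffffffffffffffffffffffffffffffffffffffffffffffffffffffffffffffffffffffffffffffffffffffffffffffffffffffffffffffffffffffffffffffffffffffffffffffffffffffffffffffffffffffffffffffffffffffffffffffffffffffffffffffffffffffffffffffffffffffffffffffffffffffffffffffffffffffffffffffffffffffffffffffffffffffffffffffffffffffffffffffffffffffffffffffffffffffffffffffffffffffffffffffffffffffffffffffffffffffffffffffffffffffffffffffffffffffffffffffffffffffffffffffffffffffffffffffffffffffffffffffffffffffffffffffffffffffffffffffffffffffffffffffffffffffffffffffffffffffffffffffffffffffffffffffffffffffffffffffffffffffffffffffffffffffffffffffffffffffffffffffffffffffffffffffffffffffffffffffffffffffffffffffffffffffffffffffffffffffffffffffffffffffffffffffffffffffffffffffffffffffffffffffffffffffffffffffffffffffffffffffffffffffffffffffffffffffffffffffffffffffffffffffffffffffffffffffffffffffffffffffffffffffffffffffffffffffffffffffffffffffffffffffffffffffffffffffffffffffffffffffffffffffffffffffffffffffffffffffffffff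fffffffffffffffffffffffffffffffffffffffffffffffffffffffffffffffffffffffffffffffffffffffffffffffffffffffffffffffffffffffffffffffffffffffffffffffffffffffffffffffffffffffffffffffffffffffffffffffffffffffffffffffffffffffffffffffffffffffffffffffffffffffffffffffffffffffffffffffffffffffffffffffffffffffffffffffffffffffffffffffffffffffffffffffffffffffffffffffffffffffffffffffffffffffffffffffffffffffffffffffffffffffffffffffffffffffffffffffffffffffffffffffffffffffffffffc9fffffffffffffffffffffffffffffffffffffffffffffffffffffffffffffffffffffffffffffffffffffffffffd3fffffffff13fffffffffffffffffffffffffffffffffffffffffffffffffffffffffffffffffffffffffffffffffffffffffffffffebfffafffe0fffffffffffffffffffffffffffffffffffffffffffd1fffffffffffffffffffffffffffffffffffffffffffffffffffffffffffffffffffffffffd4fffffffffffffffffffe2fffffffffffffff47ffffffffffffffffffffffffffffffffffffffffffffffffff46f7fffffffff96bfffffffffffe3ffffffffffffffffffffffffffcffffffff3ffffff47fffffffffffffffffffffffffeffdbfffffffffffff7ffffffffffffffffffffffffffffffff1ffffffffffffff47f2dffffffffffffffffffffffffffd04bfffffcbfbfc65ffffff3ffffffffffffff53035bfedffffffffffd1c1bfffffffd37bfa7fffffff4bfffffffff6ff8fc540fffffc32ff4b4025ffffd1004bf5fe5ffffd453ffffc3ffd6ffff3fff4fd2fe1fe2ffffddfff3bbff120914023ffc2cc80811a5fef17ffd636affffc60762cb3892d397ffffa3f73ffffffffd6ff283ffedffffc3127feafd4fd5fd2fe6fffe7f090d7ffd3bc9ff7fffffffcbfff1d6cfeffffffff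fe4953fe3ffffd7f4c330ffddfcbfd20b2ffffff28cc504b0dc7285f07034fd5103d3ffff4adfd1fcd4fffc841063ffc53f9083fff45158428c5333968ff2063c044a106322fc8145085144387125fff0efcc228507ffc53425070065095135054043411472014bf40530c04173faffb943830c42802800c610457ffdcfc2379ffffc300b289b8720d5bffff0950d63c3cba0861ce35404a03821118ac00b80cc5049188dc52a6ff9292d852c3355d2dfd23441c7088048086211013fcc40157918b1444843060d34160420904432c051404628603708624000f5480412051c004f04d2443001043cb34c0d2309108182088c3f5440120420073c12421c314100a084b860870000c30800cbc800432c00c72410b62020032c408d14310604d145d0124708b24a14306e14a5820c00440320501c91880001811c72c20c104900308638b1090000c904d1c008218300218b0c01c30050c41091420831840c40475840c118014d30714210243f3842050c51400430851431d604100308800908100800334708018004101208114408314004b0040822830841061800800401484031831401430060001c5bc10032423021d138910b00014018000014024408514a04800504420704120e1821474400871c10002020110002c00860c004b04300b00300720e084585108b8300000528a2440490c22051061803010020832070412030441400c30411830022c244200600604800704004c34d0cb20600008710f1c51030002ca0821c00801010050010c10420c11011ca0840410090440cd2431830810871820010430900401800401430091060460c110b04418604304010904018408814a0001001020121030010022421004441040080820020800040430451802400422c61050810030400800400802060020050811800020010822003410002010801010050030430800040432021041430490471c21000800003911040c10c10443412430011030410031010c30410840000040411410500c00c41401411001000c13400000020880051834430840c23060030820430401cc14010000300101004004208024000200400508b0410c40452010c00801c208300310700000014000114328800200108118310e0010001402400021400821830032c20050810410870522030c10812020830031c10070040000420010451040c00410010831001c01512430001020c11c0002104304002040000002001000088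1401021800041442410000440020441c00040812400000400821400810800440c40011870812080000821400470823000011800810430010000000810090020030010410070c01c100200014004108100300104a1040000410800020010020002801cc0410010020000010000000010820840010c40800400c00400410c01800800c10000c01000001000010410440c30000130030040000401c11000400c00820460400c11c40801010850c40011050c50800420040000800010000400400410800c10010c10030030400010030c11430c20801000000000001000820c308b2010c10401420430830800410430400010000800040010030000000010400820800020000400400410410440050800410000890400810410c11800001411020060840030800410c00000410010420c400100000004110a0c10011030010000c60011000800420000800031420010800020421c00000000010420010410000400400c40040400400000000010800011810400430050011000030010400010000041850400c50060012c00410011400c40030820030840010000430400c40400021411000480400000010c00010000010800400020420400420010000400800000010060400400020400c20000030410010000810000810400000401000450800410420400410410440411041420010000800030420030c31400411010401800020000810c00400000030000000010800000431c00030420800010000000012810410000000000c10000460030030000000030810400000000071000000420010400020400410c10040010800000800010031040011000c00000470000000440000000420030020001c00c30060000420010010400020420830c30000400410001020000000800870000010400000400000400400400011000040c00400000000430400000430000000820010000000800400010800000000020010400010c00420040400400800430000c20000000000010010020010000000030c00000c00400810400020000000000c10000000460410820010010400400810020010410400020010000010000010c00410420420000000000c20000800000000030c00400410420000440060400400800000000430c00400010000000000020000c00000000420800000020020400010000000000800020420000800010000400800000400000030800410000000010030000000800010800020410400440000400000400010010020400030000000000000020410400000400000010030010820830000000010000800000010000010010010800000000010000000400000000830000c00000800400400410010000010011000000000000000000000000010020400000000000400010010410410000400400420400000400400010410040000000001000400411000010000010c00010400010000400400410800410c0000000043002001000041000000040000041040000000000002041000001040000041000041080002000080001040040040000040081000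0010400000400010000800400010010000c10000000000030000400020000000010810010800400000000000810000010020000400010000810810000000000800010000000800400c10400400000000010010410000010400000010000030000400000410400000000010400000000c10020020000000010010810000020000000020020000010400010400000400400800000010000800010000000010000400000010010000000000010010010000010000000400010000000800400000000000010420000000000010000410010000010000400410000010400000000000000000000000400000040000000020000400000000000800000400000400400820400000010010010000000000000000000000410000000000800810010010800000810000000000000010010000410000000010000010000810400000c00800000420000c00000400010000010000000010000000000000000000400000000010400000000400000000000000000000000020000000400010400000010400000000010000c00000000000000400000000000000400c00000000400000000c00000000400000000400000000000000000000000020000400000000000000000010000000000010000000000010000000000000400000000420000000000000000410000000000400000000000000000400400000000410000000000000000010000000010400400010000000000000000000020000000000000000000000010000000010000000400000000400000010000000000000000000000010020000000000000000010410000000000000000010000000000000000000000000400010000000010000000c0000000001000000041001001000001000041001000000040000000000001000000000000040000000000000003001000000000000000000000000040000000001000003040000000080000001040000000000000000000000001000080000001040040000000000000000080040000000080040000000040002000000002001000000000000040000000000000000041000001000040000000000000000000000002000001000000080000001000000000001000000000000000000000000040040000000000000000000000001000000040000000001000000040000000000000000000040040000000000000000080000000040000000000040001000040000040000000000040000000000000000000000002000040000000000000000000000001040000000000040000000000000000000000001000000001000000000001000000000001000000000000000000000000040000000000001000000000000001000040040000000000000000000000001000000000000000000000000040000000000000040000000000000001001000001000000000040001000000000000000000000000040040000000000000000000000001000001000000000000000000000000040000000000000000000000001000000040000000000000000000000001000000000000000000000000040000000000000000000000001000000000000000000000000040000000000000000000000000) ∷ []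

reach-2 : Reach 196560 mat-0f mat-0g runs-2
reach-2 = reach refl

runs-3 : List Run
runs-3 = (start-3 , 2176 , 0x63fffffffffffffffffffffffffffffffffffffffffffffffffffffffffffffffffffffffffffffffffffffffffffffffffffffff4ffffffffffffffffffffffffd0fff2ff8bfffffff23ffffffffcbff7fff0c3ffffd8ffffc9fd8ebf3e8fc7fc04c0f40510fc1fe5c7ffffe3f24ad66fc306a409a80fd6fd185c26c4945d3fc353ffd1fc2480d13702a19192e45fff80e10534310034abf06c21f398700008d31303f0c02c6d7f32248414b11238581f00a35428c10a1890a30591cdf461c10007c126931178628f3004ce05fa030c62d12c40036061062662c00014050024441921480831c13370422c40481411c71c85872cc2c00c004138d08214330018e04034320b0c10c010224904100110204928b3d16c00c45c71c4b0a28004008410b1413400060590812000010080c300308304401e0c224a04500918e2410c030010004018108718804500f78f08d00308104310008719334604008400c10204704300d0811410c91430830160800052020820000c40c00c10c304110600620418600138410010b00c1c10800000890000411410c40007450030420c60c21830442c10420c00801500410051c00c01c02490001832060c028c0001030c01410c110600c2001010410001020061820801c20010801c40c01410c60000c008114200614a0820011000440810020800010000031810840c01820c21400410020400800001c30000c00430400c10c00820010000031000820430c41001410440410001801010420010c10001810030441c00000000400810000410c50410000800010060010000000421010001400000000420801410000000013400040830402030041000851010c00000410400021801410420c00000010030010c40430c00040020810010c10c02400030000010400002400c000004000010404204010004608208b0430830400420420800010820010850c40820010010000c40411830010850c10400400c10410020c01800040411400000840c0040041085000042081002001000002004003000040001008100000001001041000080042102080100041083081003002000001000042000080000106042041001002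0410841030001000820000000800020000000860410400000020020000000080030810000010410420400000030410000020001410440440000000020000820010400000400010410030800400011010810000010410010c10810020000000410c40000030040020c20000010410440010000c00020000010400400800050000400010010400410000051000400400400010400400030010000c30000400010000c00010c20440430000030430400400020420410010000810c00000440810000010000000820000030000010000000000400800800c10010000010010820c30400c10000010800010400000000020020000000000c00000410820410030040000000820000020000000000c00000410010000020000400000400000000010000410800010040810010000010000000400400020000400010010030000010010410000010000000400010000010000400010000800000000400430800000000040010000400000010800430000000410410000010030000000000800000c00000000020010800020400400800800400410410010010800010c00010410000010000000400000000010020400400010000000020000000000c20020400000400010000000000400000000010c00000800000000010000c00000010000000410000000400400400010010000010010000000000800000020000010430000000030000800000000010000000800400400000000010000010000000410000010010000400000c00000000410000000020000410000000000410010000800000400000000010000000010000010000000400000000010000010000400000000010000000010000000000400000000010400000010000000000400000010000000000410000400010000000000400000000010000000000400000010000010c0000001000000001000000000040000000040000000001001000000000040000040001001000000002000000000040000000001000040000000001000000000040000000001000000000040040000000040000000001000000000080000000001000000000040000000001000000000040000000001000000000040000000001000000000040000000001000000000040000000001000000000040000000001000000000040000000001000000) ∷ []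

reach-3 : Reach 47104 mat-2f mat-2g runs-3
reach-3 = reach refl

runs-4 : List Run
runs-4 = (start-4 , 1734 , 0x23fffffedfffffffffffffffffffffebffffffffffffffffffffffffffffffffe2fffffffd3a3ffec47fffffff04f27fffffc557ffff27f8ffb6a84c37fff0a3ffee25a1f4fd0fe1fc027ffc017f73fcc98c4906dff1ff1bf58cdd43d871b04febfa49c43709a1a0d012a34018afc1d55681fc88c604c0bff0a19844c3104832c315a3d10422ce9490822580015c30c627c3460015520590416405c020b0080c801f0860825477c61001944eb00e0880c515a1c70c60d70042d252a0882952891091c50c114b0ca28510834310100a5811404c409034520c04a0030c11060820000ca0010921400813020810800ca05114100c24148614510004608e18d1031410800841411c800c2472000c31431110c000028415214b0882824491060050402862471c01013410c010100518508c0400c10051402800020400410050470c41c30c82030121811410420870010000840020800400830c320118104014a18218104804324a1860001451410801c00030061000012011c40400010800010800010021421011c70800c20420471030040012880000000060412452420c70460001010030080000000870410c20800802041800040830820000410830850c00810010800820c41820000020401000c00000400020020400020810460480010400410440400010020413411c30810871010850011000010410020c10c70420830c10410020c01030040c10430410000420800000050000410450110000030010430401000c00420020c50051400000010010000c40040000011020020090811001c00010400800c30481010000410000800000001400410030400400810000020010000800020400400000401400800040840820020001000400021000820400410410c00810020030000400020c00010010810440410000000000000410400400010400800800000000000010000010410400000030000000800020000020000010010800400400800030001000000400820c01010810c40400000400000000000050030000430810000000030000040410400c20010401020c00000010020000030010000000020010410820010010000000400c10400410800400000400800400400410440010410420400020000010410000420820000000000000400000000010010010000000420c00020000800400800401c00010c00400000810010410411000030000410030400000400010000410000820000000400000410000000010000430810c00000010010000000420400000000c00400401410000010000820400000000400400000000000010400000000400000400020000810000400000000000010420400010000000400000000000010000000440430000400000000410420000000000010000400410010000000000010000010000000000800000000000000000010000400000000000400000000c0002040000042001000001001000000000000000040000000000000000000001000000000000080000000000000000000001000000000000040040000000000000000000000002000000000001000000000001000040000040000000000000000000000001000000000000041000000000000000000000000040000000000000000000000001000000000000000000000000040000000000000000000000001000002000041000000000000000000000000040040000000000000000000000001000000000001080000000000000000080000000000000000000000001000000000000000000000001000000000000000000000000040000000000000000000000000)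 ∷ []

reach-4 : Reach 48600 mat-3f mat-3g runs-4
reach-4 = reach refl

runs-5 : List Run
runs-5 = (start-5 , 27 , 0x39fe7fff03f0051c3040041100040001000040000) ∷ []

reach-5 : Reach 552 mat-3f mat-3g runs-5
reach-5 = reach refl

runs-6a : List Run
runs-6a = (start-6a , 82 , 0x1bfffffffffffc743f5c100f0d13450451c21000830c20031440000800400810420010000830000000000000c0001000001041001000000080000000000) ∷ []

reach-6a : Reach 2048 mat-4f mat-4g runs-6a
reach-6a = reach refl

runs-6b : List Run
runs-6b = (start-6b , 52 , 0xffffffff7ff7ff50b50d1d650324910b0c00430000000000020c0000080001000081040000000) ∷ []

reach-6b : Reach 1012 mat-4f mat-4g runs-6b
reach-6b = reach refl

runs-7 : List Run
runs-7 = (start-7 , 185 , 0x231bfb7530b588102e4b6853c028fa001080501402000041062400810000500c00421020c01c00410800c0140041080080002042002000081000001080081001082004001080001103041000040000000002000001004040041040000000040000000041000000000040040000080000081041000000000040000000000000001000000000000000000000) ∷ []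

reach-7 : Reach 4050 mat-5f mat-5g runs-7
reach-7 = reach refl

runs-8b : List Run
runs-8b = (start-8b , 478 , 0x7bffffffffffffffffffffffffffffa3ffc3dbffccfcb53fb7fc3f92030630c40fa5a0147cc0c00410879800534082092e9c890c128c40030a00b15050b0ad0c218408814500004704834614100c0841831404051c10c00c90c00830430c20820030000470472001493031411050413000402c30011000000c10010060000c20010000830c10061c000000100100204d0000000840c60041050c20020810400820000020000810800000040400810800400800470020000010010000440001c00410400000010000070000840410400800010810000000c20011420400420000000010040000000000010010410400000410000020810430000400c0001001002040000000002001000000003000000000000000100000000000000002001000001040000000040000000000000001000000000000001040000000000000080040000000001000000000000001000001000000000000000041000000000040000000000000000) ∷ []

reach-8b : Reach 6072 mat-6af mat-6ag runs-8b
reach-8b = reach refl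

runs-8c : List Run
runs-8c = (start-8c , 0 , 0x0) ∷ []

reach-8c : Reach 2 mat-5f mat-5g runs-8c
reach-8c = reach refl

runs-9a : List Run
runs-9a = (start-9a , 3 , 0xc101) ∷ []

reach-9a : Reach 24 mat-6af mat-6ag runs-9a
reach-9a = reach refl

runs-9b : List Run
runs-9b = (start-9b , 291 , 0xf6ffff20cd3bffe6c422046c10600c0b550804300430802490081541886811473431c23c108a1861c91802440420011030c00820800081810421900411811c10040820010800440430810001810820821411411411840c51400800000011400840000000c80410420000c00830000821020000400800810810000000c00400000000420000410000c00010000c0000000000001005000001001040000000080000002040040001000001040000000000001000000000000040000000040000040000040000000000001001001000000000000040000000000000) ∷ []

reach-9b : Reach 5600 mat-7f mat-7g runs-9b
reach-9b = reach refl

runs-10a : List Run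
runs-10a = (start-10a , 5 , 0x80000) ∷ []

reach-10a : Reach 100 mat-7f mat-7g runs-10a
reach-10a = reach refl

runs-10b : List Run
runs-10b = (start-10b , 3 , 0x11083) ∷ []

reach-10b : Reach 46 mat-4f mat-4g runs-10b
reach-10b = reach refl

runs-10c : List Run
runs-10c = (start-10c , 24 , 0x3ff00718344110c3c0040000000000000000) ∷ []

reach-10c : Reach 276 mat-6af mat-6ag runs-10c
reach-10c = reach refl

runs-11a : List Run
runs-11a = (start-11a , 12 , 0x450000060c0000000) ∷ []

reach-11a : Reach 275 mat-5f mat-5g runs-11a
reach-11a = reach refl

runs-11b : List Run
runs-11b = (start-11b , 470 , 0x83ffffffffffffffffffffff332fd0fff57208be05bf3fc07f21ad1d6742161d4b0c61450101802030021101c00411040c10420830460c601328b10a2c014120744000000401000334404300d0020011800c22c02c61c818004600004010900508a0460430c00820000800870c20020001830c30070c10c00031000000810800c00021880040810430c00c10010000000810c10020030c10050c00400020070410c20801040c11020010011000000000400870000800020401010001000020000410880400000420000000000040010410040800000410010400400800000400000400c0000004000000000004001000000000002002040000040000001042000000040000000000000002000040000000040000000000000001001040000000000040000000000001000000040040000000040040001000000000000000040000000040000000000000001000000001000000000000000040000000000000000) ∷ []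

reach-11b : Reach 6072 mat-6af mat-6ag runs-11b
reach-11b = reach refl

runs-12c : List Run
runs-12c = (start-12c , 5 , 0x5042000) ∷ []

reach-12c : Reach 100 mat-7f mat-7g runs-12c
reach-12c = reach refl

runs-12d : List Run
runs-12d = (start-12d , 35 , 0x1ffe40020042c00021030020c5081000080000000000040000000) ∷ []

reach-12d : Reach 891 mat-6bf mat-6bg runs-12d
reach-12d = reach refl

runs-12e : List Run
runs-12e = (start-12e , 66 , 0x4bffffffffc850360880611804820b1400840000c10c1042040001000081000081001003000000000040000000000000000) ∷ []

reach-12e : Reach 759 mat-6af mat-6ag runs-12e
reach-12e = reach refl

runs-12f : List Run
runs-12f = (start-12f , 297 , 0x3dfffffffdffffffffd34846733d506c9d22dd902bc10db9861428432011800403860832c80101c408f04600014900940300204d0c11c104d04b0000010c34010851820c40413010010800010000c30830020031c00000810420400431010810000400400000000411400c00000400010840410010010000810000420000810000000010000020410400420000000000000400800000400410000000010010000000400010c0001040000000040001000000000000041000001040000040000040000000040001000000000000040000040000000000001040000000000000) ∷ []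

reach-12f : Reach 5600 mat-7f mat-7g runs-12f
reach-12f = reach refl

runs-13b : List Run
runs-13b = (start-13b , 19 , 0x40051431891010c00c3041001000) ∷ []

reach-13b : Reach 352 mat-7f mat-7g runs-13b
reach-13b = reach refl

runs-13c : List Run
runs-13c = (start-13c , 57 , 0x379d21cc54900134f0c51031400020810050400040410000020800800010000000010400000000c1000000) ∷ []

reach-13c : Reach 1100 mat-7f mat-7g runs-13c
reach-13c = reach refl

runs-14b : List Run
runs-14b = (start-14b , 4004 , 0x3fffffffffcdffffffffffffffffffffffc5ffffffffffffffffffffffffffffffffffffffffff7fffff6bfffffffffffff557fffffffffefffffffffffffffff5b5fe7ffff3ffff6ff45dbffff0fe74bffcbfff805ffffff1ffacffdbfee6703bffffc3fc2d3cafffffffffe7f73f21bfc25da15596c4da4fffff058ffffc1fd1dcd47f27f83ffc8a22fdcd7f4955c1fc7fd5ff951a0eacbf423ffffe9244167b5a7d1fe0fffc602933219ff1782b0e92fd0fd4ad5a7f68b02518363f10c2ac44d40f49e6486caacc6d5287fce74d103c95e5431a4016500c9a4606648415800130e48444f59341cfc20081871c32ad5491100091085659e215a0075c65494970407ce2c890a44d2d722625504515037f0070831cc20210125a288098295089c1019b06d54038210104911f1415c9bbd1817816052032d114234a7950916cc39d10348308b2084c618a5c30e00cc1c00870122861880c44421050463ce6981131d038420788000008411314d24845468328044c08e08200658018f40304a0822863c22411500452c704e2410050411415821800491c128b1151d25c11031433c42c92802038c218200b0c164034500508100f14400200b2030402c22004802030c60432440423c314a00e08008324268005708102839700b0071800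c53442630442840400823438860c104404d0426c058000500450208100710019014b0823810c02c120000208709d0520c248320618b14c0430cb1030563400820c414408004204004b1450800c40c604234308704910a34834700138800928d08004014504014000110604408308008200820d0400030020470c51c12c01c42020402050c11c02000091c40810400810400060820c510000524114b0060820440861012420011c418014104504208b0c004b00308304008a0c028000a04428b2050c10c80030440c40830c004b0430411490c600410208504800f1050c00030440c60421463030060000050481060060030410030441022c00851030870040040030851436c708004200018a1000000050011040c71410420000400401430ca0c02000430401c01810812440402c22810000c40c10841000000c30450c20400010400430860040430810823001020403070810c22850020410000830440471420810010852892820010830810841c30420030441811c60000430070c300b2400010011100c00c92400011030820400c00400410c00810011470871c30c00410010420800870492c10401020001440430430000090423020410071cb10104800a10510010c0430400821430823020802050490c10021410810000c00000030832000000010430820810001081c00010410cb00000300004300208304200200100020708708610100708000b0002c404020100204a0441820020400400010010c80000030811470803802010800420001030000440000400800400420440000830840420410c03810c20000000830010410410810040081050010400010000400000800010400001400010410020420010c00c20401001800460090c10410800000010c10c00010000830010011411000430000420422811400c20460470000c20430471410000c00070030020c300000204400304010508108c1000040420000830410420000c10410080010010411450020460000001c10051c60810400030860000800420031010410440400010020041810000400010451460400c00800801400001810c20440800002810020030c10060c20000410411020440400011010400010410041400440001020420410010000410000010000420010020810800410002000000000c00411810010410000401810020400800400400000400000000040401000000400000420000c20000830c10010010000410030410041010820430020400010401040800020400010010020030c00800040000010020440c40430000800020400830010c00820000002010000020000400400420010810c00430430040010020020000000010c00000400811000820000000410000010420020010440401010020020400010400010000030020010410010400c2080003000040001003040041000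0801801420001000000000020c00440400030800000400c10020410000c20020c00010410000400840000000030021050000030000010400001000010000400000400400400800010800040410020000000010420010810c01010000400050002000000000020020020000010400000c40000400000410c00400000000000800800000010810010000410420000070410010000000400001400400410c00000c00410420410000000000820000000010010000000010c00030010020000810000410000000010000000400400400810410400800000420000000410410000000010000000010000000400020000400400c00400020c11010000010800000410000410410010000400000010000000000000000c00410000010000000c00010010420000400000000000000020400411c00810000000400000410400000410000800000430020c00400800000c10400020000460001000000400030400010000400000000400010000000810000000010000000010000000400800000010000400410000400001800c00800c00010420001000000020400000410400000000010000020000400c00800410400020000000010000020000000000410000000400020010000000020400000000000410400010430410000410000000010400000810400400400000c00000000010010400400010000000011000400c00000000400400400400000000020010000800800400010000400420400010400c00000000400000000000410400000400010000400000800010400000000000000030810000010000800000000010400400030410000000000c00020000800010010400000400000410410800000800000000000000020000000400000400400810010000410000000400400000000000000010000810000000030410400c00400000c00000010000000000010000020010000010020000000000000000810000000000000000800410000400000000000000010000000400800000400800000810010000410400000400000000010000010010400010400030430000000410000000010020030800000000400810000000000010400010000010c00010010420000000c00010010400010400000400000c20000000000000010000000000800000400010800010010000000000010000020410000400000000010000400000000400400000020410000810000010010400400000400000000000000020000010000000000000000400000000400000000800000000010000400000000000000010000010000000410000000800000000020010000000000400010800000000000000400000010000010000000400400400000010000010000010400000000000000010000000000c0001000000000001000000000000001000002001001001000000000000000080000000000080000000040000080000082000000000000000080000000000000040000000000000001000000000000040000000040000000001000000000000000041000000000041000001000041000000000000000040002000000001040040000000000000001000000000000000040000040000000000000001001040000000000000001000000000000040000000000041000000000000000080000000040000000001000000040001000000000000040000040000000000000001000001000000000000000080000000000001001000000000000040000001000000000000040040000000000000001000000000000040000000040000000000000001000000000000042000000000000000040000002000000000000000041000002000000000001000040000001001000000000000002000000000000000040000000000000001000000000000000040000000000000002000000000000040000000000000001000000040000000000000001000000000000000040000000000001000000000000000040000040000000000000001000000000000000040000000000000001000000000000000040000000000000001000000000000000040000000000000001000000000000000040000000000000000)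 ∷ []

reach-14b : Reach 53130 mat-6af mat-6ag runs-14b
reach-14b = reach refl

runs-14d : List Run
runs-14d = (start-14d , 10 , 0x2cd005001042080) ∷ []

reach-14d : Reach 275 mat-8cf mat-8cg runs-14d
reach-14d = reach refl

runs-14e : List Run
runs-14e = (start-14e , 812 , 0xc3ffffffffffffffffffffffffffffffffffffffd9ffffffffffffffffffffffff3ffdf9d2f1bffecf8a5bf9bffc63ff2bf1fff81e9f03f0ce00f79507ffdd1c55b1152052fcb60936d93fa0b28624c58130300d2464471463441021873c300000401341133409c30100d2400cc04b0843c90070c00570450061031c000d28328018100b24f1c40421451801841050cc10700014208304f0850470401010850010c00c00010830400c11c30040020c30000861c11400800001031480000062830860401830090412430c10080450010810040000c20450060001000090070010020c10010810430c00400000810000c20870010000811460820030c104300100110100b0000800410010000000800010000000c00020420410000020c20000890401020400000420021010020010020c31400810860c00000800400400000400010860021c00810810000010810000010000800420801000800410400410800c30800000410000400800010800410410c10c1043000001000082001040000000000000040000080082081040000040000000041040002002002080080002040000002000040080000000000001040001000000080041000001000000000000001000001000040000001000000000000041001000000040000000040000000000001000000002000000000000001001000002040000000000000040000040000000000000040040000000000000040000000000000040000000040001000001000000000000001000000000001000000000000001000000000000001000000000000001000000000000001000000000000001000000000000001000000000000000) ∷ []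

reach-14e : Reach 22275 mat-8cf mat-8cg runs-14e
reach-14e = reach refl

runs-15b : List Run
runs-15b = (start-15b , 290 , 0x59c83f3fb73f4a7fce20051c14d3d368b2507d304a1c51440d23870021c00446440010031c00c514400a0870d20040850400800413002000c50010850020431430420000461000821c00410800030840010020c00410c2001004083106040001004000000080100041000000000000040041042000040000002042001002041001000002001000041000000001040000000001001000001000040000042000000001040000000040000001000000000000040001000000000001000000000000040000000000001000040000000001000000080000000000000) ∷ []

reach-15b : Reach 5600 mat-7f mat-7g runs-15b
reach-15b = reach refl

runs-15d : List Run
runs-15d = (start-15d , 1623 , 0x1efffffffffffffffe3ffffffffffffffffefffcdffffffbfffffffffff53f5ffffffffffffff0ff3bfffffffafffe4232ffffffffffffa3351efcafcefffff70b5aa1a4a93ffd2fca51127333ffd0b099e538b0bf7d2083b9838d5a7889f127d84cd640a5639e25e1ca08008b04a003c58841a779832e5140848fce06c040ac50c137d0d52c47905c009168a2cb1c20cc0d5019bd405080174030710d30a0450851201c03040ca1474010802030456c000b4840c30060090011801507c90c06c910e24124300a0005c00400800000410c41010850881970c208b1c20020402c21804874421c80420092834430421090d70460002c01801c100600200100004214040000c0840c60800400411480c21c410504200110438000f0c10041400c10423800434060400470410473021c53020431040420801820420400460820430031040c024c1814040400460420421010860021080010060030c11840800c004304d2c20820c000a0410410000800c20410021410c10011000000801011c41000420821001820030c01410430c004d0410081051082401c10400400000050042010010430011060440800400400000400010000410400020000402850880410420010010050c00030000c304004200004000a0000000010410020041c20000000810400810410060400030070000c30800420821c0001001001081001101000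04300114004a0410412010800400c00460450000000800040000810040000020000401040400000800000020041430810420000810030820020030010000020440010800400800400020050000000c10000021000800030020000000c00800c00401400020420000020440410410410800000810000000001000010000021010000020400811400020400400010000400000040020010010410420000010400810400000000810002000000800000410400400011410000010000400c00010010030000000000001000010000000000800400010400010000000010c30020000410800000010400010020000800000000000010440000010010010410800000000010020000000400410000010000000400000000410000000020410400000800000020000000000400400000410810c00000420000000410010000010000000800000400040010400000000000010010000000000020010430010400000020010400400000400000000010000000000000400000010010000c10000010000000000400000400800010000010010000000400000000410000000800000410000000000000c0000000000001000040081001040000001001080000080000000000001000001000000000000044000000000000042000040000040000000001041000000000000041001001000000040000000000001000000000040000001000000000000040000000000001000000000001000000040000000000001040000001000000041000001000000000000040000000001000000040000000000001000000040040001000001000000000000041000000000001000000000000040000000000001000000001000000040000000000001000000000001000000000000041000000000000040040000000000040000000000001000000000000040000000001000000000000040000000000040000000000001000000000000040000000000000) ∷ (start-15d′ , 302 , 0xa3fffffffffffdffffffffff1d64ceff449e0937522115ce1855c700f15919419b0c501054a6440c02810010800c20490410420800c00000820422831420822830040000001892402810030c00c30810060011830c30400400811430010010420400430400800040c00820010c01000811010401c50400401010000000c0040042000140000001000041081103000041000041001000001000001001040040000040041002040040040040000000000001040000000000001000000000000040000000080000001000000000000041000040000000000040000000000001000000000) ∷ []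

reach-15d : Reach 36400 mat-7f mat-7g runs-15d
reach-15d = reach refl

runs-16e : List Run
runs-16e = (start-16e , 619 , 0x34fffffffffffffffffffffffffffffffffffffffffffffffffff740ff21fffc6fbfffffe857ffffffffc3fffdfffcdfe9fffffb09828014727ffff03f9af70407323d6c560510116ffdd04868509d04311814614a0c30cb0c10c261b0801c220b0011dc0030c01c10300410836030676c48011481190021041491450c22800400430001470472810020800000000881410010070c30090410020410000800c00810830c211b0441001410000c11000410000420410810830410410040000010440421020c10800020430890000800400c30800410400830430c01010420000800400000011420000800000000430820410401010000000000400400010c00400040420000000010000820000000400010020000000020000000410010400400000000820400030000000800400000000810010400400010000000810000000400400400000030400010000000c0081001000000041001000000000000001000000001000000001043001040000080001001000000100000000000003040000001001040040000000000000000001040040000000000000000040000000000000000002040040000000000000000001000000040000000000000000001000000000000000000040000000000000000000) ∷ (start-16e′ , 23 , 0x25ffff416ab240002048000001000001000) ∷ []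

reach-16e : Reach 13920 mat-8bf mat-8bg runs-16e
reach-16e = reach refl

many-0 : AtLeast (InOrbit rep-0) 1
many-0 = rep-0 ∷ [] , [] ∷ [] , orbit-refl ∷ [] , ℕₚ.≤-refl

many-2 : AtLeast (InOrbit rep-2) 196560
many-2 = leap site-0 {r = rep-2} {β = 1} {c = 1} {n = 196560} {N = 0} {N′ = 32} runs-2 in-2 many-0 profile-2 ((min-2 , orbit-refl) ∷ []) reach-2 refl refl (ℕₚ.≤ᵇ⇒≤ 32 256 tt) refl refl

many-3 : AtLeast (InOrbit rep-3) 16773120
many-3 = leap site-2 {r = rep-3} {β = 1} {c = 196560} {n = 47104} {N = 32} {N′ = 48} runs-3 in-3 many-2 profile-3 ((min-3 , orbit-refl) ∷ []) reach-3 refl refl (ℕₚ.≤ᵇ⇒≤ 48 256 tt) refl refl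

many-4 : AtLeast (InOrbit rep-4) 398034000
many-4 = leap site-3 {r = rep-4} {β = 1} {c = 16773120} {n = 48600} {N = 48} {N′ = 64} runs-4 in-4 many-3 profile-4 ((min-4 , orbit-refl) ∷ []) reach-4 refl refl (ℕₚ.≤ᵇ⇒≤ 64 256 tt) refl refl

many-5 : AtLeast (InOrbit rep-5) 4629381120
many-5 = leap site-3 {r = rep-5} {β = 2} {c = 16773120} {n = 552} {N = 48} {N′ = 80} runs-5 in-5 many-3 profile-5 ((min-5 , orbit-refl) ∷ []) reach-5 refl refl (ℕₚ.≤ᵇ⇒≤ 80 256 tt) refl refl

many-6a : AtLeast (InOrbit rep-6a) 33965568000
many-6a = leap site-4 {r = rep-6a} {β = 2} {c = 398034000} {n = 2048} {N = 64} {N′ = 96} runs-6a in-6a many-4 profile-6a ((min-6a , orbit-refl) ∷ []) reach-6a refl refl (ℕₚ.≤ᵇ⇒≤ 96 256 tt) refl refl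

many-6b : AtLeast (InOrbit rep-6b) 452088000
many-6b = leap site-4 {r = rep-6b} {β = 1} {c = 398034000} {n = 1012} {N = 64} {N′ = 96} runs-6b in-6b many-4 profile-6b ((min-6b , orbit-refl) ∷ []) reach-6b refl refl (ℕₚ.≤ᵇ⇒≤ 96 256 tt) refl refl

many-7 : AtLeast (InOrbit rep-7) 187489935360
many-7 = leap site-5 {r = rep-7} {β = 2} {c = 4629381120} {n = 4050} {N = 80} {N′ = 112} runs-7 in-7 many-5 profile-7 ((min-7 , orbit-refl) ∷ []) reach-7 refl refl (ℕₚ.≤ᵇ⇒≤ 112 256 tt) refl refl

many-8a : AtLeast (InOrbit rep-8a) 196560
many-8a = doubled-orbit in-2 many-2

many-8b : AtLeast (InOrbit rep-8b) 805620816000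
many-8b = leap site-6a {r = rep-8b} {β = 2} {c = 33965568000} {n = 6072} {N = 96} {N′ = 128} runs-8b in-8b many-6a profile-8b ((min-8b , orbit-refl) ∷ []) reach-8b refl refl (ℕₚ.≤ᵇ⇒≤ 128 256 tt) refl refl

many-8c : AtLeast (InOrbit rep-8c) 9258762240
many-8c = leap site-5 {r = rep-8c} {β = 3} {c = 4629381120} {n = 2} {N = 80} {N′ = 128} runs-8c in-8c many-5 profile-8c ((min-8c , orbit-refl) ∷ []) reach-8c refl refl (ℕₚ.≤ᵇ⇒≤ 128 256 tt) refl refl

many-9a : AtLeast (InOrbit rep-9a) 815173632000
many-9a = leap site-6a {r = rep-9a} {β = 3} {c = 33965568000} {n = 24} {N = 96} {N′ = 144} runs-9a in-9a many-6a profile-9a ((min-9a , orbit-refl) ∷ []) reach-9a refl refl (ℕₚ.≤ᵇ⇒≤ 144 256 tt) refl refl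

many-9b : AtLeast (InOrbit rep-9b) 2160377856000
many-9b = leap site-7 {r = rep-9b} {β = 2} {c = 187489935360} {n = 5600} {N = 112} {N′ = 144} runs-9b in-9b many-7 profile-9b ((min-9b , orbit-refl) ∷ []) reach-9b refl refl (ℕₚ.≤ᵇ⇒≤ 144 256 tt) refl refl

many-10a : AtLeast (InOrbit rep-10a) 9374496768000
many-10a = leap site-7 {r = rep-10a} {β = 3} {c = 187489935360} {n = 100} {N = 112} {N′ = 160} runs-10a in-10a many-7 profile-10a ((min-10a , orbit-refl) ∷ []) reach-10a refl refl (ℕₚ.≤ᵇ⇒≤ 160 256 tt) refl refl

many-10b : AtLeast (InOrbit rep-10b) 18309564000
many-10b = leap site-4 {r = rep-10b} {β = 1} {c = 398034000} {n = 46} {N = 64} {N′ = 160} runs-10b in-10b many-4 profile-10b ((min-10b , orbit-refl) ∷ []) reach-10b refl refl (ℕₚ.≤ᵇ⇒≤ 160 256 tt) refl refl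

many-10c : AtLeast (InOrbit rep-10c) 93744967680
many-10c = leap site-6a {r = rep-10c} {β = 1} {c = 33965568000} {n = 276} {N = 96} {N′ = 160} runs-10c in-10c many-6a profile-10c ((min-10c , orbit-refl) ∷ []) reach-10c refl refl (ℕₚ.≤ᵇ⇒≤ 160 256 tt) refl refl

many-11a : AtLeast (InOrbit rep-11a) 1273079808000
many-11a = leap site-5 {r = rep-11a} {β = 1} {c = 4629381120} {n = 275} {N = 80} {N′ = 176} runs-11a in-11a many-5 profile-11a ((min-11a , orbit-refl) ∷ []) reach-11a refl refl (ℕₚ.≤ᵇ⇒≤ 176 256 tt) refl refl

many-11b : AtLeast (InOrbit rep-11b) 25779866112000
many-11b = leap site-6a {r = rep-11b} {β = 1} {c = 33965568000} {n = 6072} {N = 96} {N′ = 176} runs-11b in-11b many-6a profile-11b ((min-11b , orbit-refl) ∷ []) reach-11b refl refl (ℕₚ.≤ᵇ⇒≤ 176 256 tt) refl refl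

many-12a : AtLeast (InOrbit rep-12a) 16773120
many-12a = doubled-orbit in-3 many-3

many-12c : AtLeast (InOrbit rep-12c) 815173632000
many-12c = leap site-7 {r = rep-12c} {β = 1} {c = 187489935360} {n = 100} {N = 112} {N′ = 192} runs-12c in-12c many-7 profile-12c ((min-12c , orbit-refl) ∷ []) reach-12c refl refl (ℕₚ.≤ᵇ⇒≤ 192 256 tt) refl refl

many-12d : AtLeast (InOrbit rep-12d) 134270136000
many-12d = leap site-6b {r = rep-12d} {β = 1} {c = 452088000} {n = 891} {N = 96} {N′ = 192} runs-12d in-12d many-6b profile-12d ((min-12d , orbit-refl) ∷ []) reach-12d refl refl (ℕₚ.≤ᵇ⇒≤ 192 256 tt) refl refl

many-12e : AtLeast (InOrbit rep-12e) 25779866112000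
many-12e = leap site-6a {r = rep-12e} {β = 1} {c = 33965568000} {n = 759} {N = 96} {N′ = 192} runs-12e in-12e many-6a profile-12e ((min-12e , orbit-refl) ∷ []) reach-12e refl refl (ℕₚ.≤ᵇ⇒≤ 192 256 tt) refl refl

many-12f : AtLeast (InOrbit rep-12f) 43747651584000
many-12f = leap site-7 {r = rep-12f} {β = 1} {c = 187489935360} {n = 5600} {N = 112} {N′ = 192} runs-12f in-12f many-7 profile-12f ((min-12f , orbit-refl) ∷ []) reach-12f refl refl (ℕₚ.≤ᵇ⇒≤ 192 256 tt) refl refl

many-13b : AtLeast (InOrbit rep-13b) 65996457246720
many-13b = leap site-7 {r = rep-13b} {β = 1} {c = 187489935360} {n = 352} {N = 112} {N′ = 208} runs-13b in-13b many-7 profile-13b ((min-13b , orbit-refl) ∷ []) reach-13b refl refl (ℕₚ.≤ᵇ⇒≤ 208 256 tt) refl refl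

many-13c : AtLeast (InOrbit rep-13c) 103119464448000
many-13c = leap site-7 {r = rep-13c} {β = 1} {c = 187489935360} {n = 1100} {N = 112} {N′ = 208} runs-13c in-13c many-7 profile-13c ((min-13c , orbit-refl) ∷ []) reach-13c refl refl (ℕₚ.≤ᵇ⇒≤ 208 256 tt) refl refl

many-14b : AtLeast (InOrbit rep-14b) 360918125568000
many-14b = leap site-6a {r = rep-14b} {β = 2} {c = 33965568000} {n = 53130} {N = 96} {N′ = 224} runs-14b in-14b many-6a profile-14b ((min-14b , orbit-refl) ∷ []) reach-14b refl refl (ℕₚ.≤ᵇ⇒≤ 224 256 tt) refl refl

many-14d : AtLeast (InOrbit rep-14d) 1273079808000
many-14d = leap site-8c {r = rep-14d} {β = 1} {c = 9258762240} {n = 275} {N = 128} {N′ = 224} runs-14d in-14d many-8c profile-14d ((min-14d , orbit-refl) ∷ []) reach-14d refl refl (ℕₚ.≤ᵇ⇒≤ 224 256 tt) refl refl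

many-14e : AtLeast (InOrbit rep-14e) 3222483264000
many-14e = leap site-8c {r = rep-14e} {β = 2} {c = 9258762240} {n = 22275} {N = 128} {N′ = 224} runs-14e in-14e many-8c profile-14e ((min-14e , orbit-refl) ∷ []) reach-14e refl refl (ℕₚ.≤ᵇ⇒≤ 224 256 tt) refl refl

many-15b : AtLeast (InOrbit rep-15b) 87495303168000
many-15b = leap site-7 {r = rep-15b} {β = 2} {c = 187489935360} {n = 5600} {N = 112} {N′ = 240} runs-15b in-15b many-7 profile-15b ((min-15b , orbit-refl) ∷ []) reach-15b refl refl (ℕₚ.≤ᵇ⇒≤ 240 256 tt) refl refl

-- The minimal vectors leading from `rep-7` to this orbit are collected in two runs, starting at
-- `start-15d` and `start-15d′`. The matrix `mat-15d` shows that both lead to the same orbit;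
-- together they give the 36400 required.
many-15d : AtLeast (InOrbit rep-15d) 524971819008000
many-15d = leap site-7 {r = rep-15d} {β = 2} {c = 187489935360} {n = 36400} {N = 112} {N′ = 240} runs-15d in-15d many-7 profile-15d ((min-15d , orbit-refl) ∷ (min-15d′ , act mat-15d , act-Co₀ aut-15d , refl) ∷ []) reach-15d refl refl (ℕₚ.≤ᵇ⇒≤ 240 256 tt) refl refl

many-16a : AtLeast (InOrbit rep-16a) 398034000
many-16a = doubled-orbit in-4 many-4

many-16e : AtLeast (InOrbit rep-16e) 386697991680000
many-16e = leap site-8b {r = rep-16e} {β = 2} {c = 805620816000} {n = 13920} {N = 128} {N′ = 256} runs-16e in-16e many-8b profile-16e ((min-16e , orbit-refl) ∷ (min-16e′ , act mat-16e , act-Co₀ aut-16e , refl) ∷ []) reach-16e refl refl (ℕₚ.≤ᵇ⇒≤ 256 256 tt) refl refl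

minimals : AtLeast Min (length minCodes)
minimals = let l , u , ps , n≤ = leads-many site-0 {r = rep-2} {β = 1} {n = 196560} runs-2 ((min-2 , orbit-refl) ∷ []) reach-2 in
  l , u , All.map proj₁ ps , ℕₚ.≤-trans (ℕₚ.≤ᵇ⇒≤ (length minCodes) 196560 (subst T (sym (proj₁ (∧-true {length minCodes ℕ.≤ᵇ 196560} audited))) tt)) n≤

-- The shortest vectors of the classes

class-0 : Class rep-0 1
class-0 = class-short (ℕₚ.<ᵇ⇒< (norm rep-0) 192 tt) profile-0

class-2 : Class rep-2 1
class-2 = class-short (ℕₚ.<ᵇ⇒< (norm rep-2) 192 tt) profile-2

class-3 : Class rep-3 1
class-3 = class-short (ℕₚ.<ᵇ⇒< (norm rep-3) 192 tt) profile-3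

class-4 : Class rep-4 1
class-4 = class-short (ℕₚ.<ᵇ⇒< (norm rep-4) 192 tt) profile-4

class-5 : Class rep-5 1
class-5 = class-short (ℕₚ.<ᵇ⇒< (norm rep-5) 192 tt) profile-5

class-6a : Class rep-6a 1
class-6a = class-short (ℕₚ.<ᵇ⇒< (norm rep-6a) 192 tt) profile-6a

class-6b : Class rep-6b 1
class-6b = class-short (ℕₚ.<ᵇ⇒< (norm rep-6b) 192 tt) profile-6b

class-7 : Class rep-7 1
class-7 = class-short (ℕₚ.<ᵇ⇒< (norm rep-7) 192 tt) profile-7

class-8a : Class rep-8a 2
class-8a = class-short (ℕₚ.<ᵇ⇒< (norm rep-8a) 192 tt) profile-8a

class-8b : Class rep-8b 1
class-8b = class-short (ℕₚ.<ᵇ⇒< (norm rep-8b) 192 tt) profile-8b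

class-8c : Class rep-8c 1
class-8c = class-short (ℕₚ.<ᵇ⇒< (norm rep-8c) 192 tt) profile-8c

class-9a : Class rep-9a 1
class-9a = class-short (ℕₚ.<ᵇ⇒< (norm rep-9a) 192 tt) profile-9a

class-9b : Class rep-9b 1
class-9b = class-short (ℕₚ.<ᵇ⇒< (norm rep-9b) 192 tt) profile-9b

class-10a : Class rep-10a 1
class-10a = class-short (ℕₚ.<ᵇ⇒< (norm rep-10a) 192 tt) profile-10a

class-10b : Class rep-10b 2
class-10b = class-short (ℕₚ.<ᵇ⇒< (norm rep-10b) 192 tt) profile-10b

class-10c : Class rep-10c 1
class-10c = class-short (ℕₚ.<ᵇ⇒< (norm rep-10c) 192 tt) profile-10c

class-11a : Class rep-11a 2
class-11a = class-short (ℕₚ.<ᵇ⇒< (norm rep-11a) 192 tt) profile-11a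

class-11b : Class rep-11b 1
class-11b = class-short (ℕₚ.<ᵇ⇒< (norm rep-11b) 192 tt) profile-11b

-- `rep-12a` is twice a lattice vector and `short-12a` is zero. Both candidates are therefore the
-- negative of the representative, which accounts for the second vector of the class; the same
-- happens for `rep-16a`.
class-12a : Class rep-12a 2
class-12a = class-long {y₀ = short-12a} {z₀ = half (rep-12a ⊖ short-12a)} {b₁ = true} {b₂ = false} (ℕₚ.≤ᵇ⇒≤ (norm rep-12a) 256 tt) profile-12a (proj₁ short-12a∈) (proj₂ short-12a∈) refl (ℕₚ.≤ᵇ⇒≤ (norm short-12a) 64 tt) (third-none (inj₁ (λ ()))) (candidate refl (λ _ → refl)) (λ _ e n → ⊥-elim (n e))

class-12c : Class rep-12c 1
class-12c = class-long {y₀ = short-12c} {z₀ = half (rep-12c ⊖ short-12c)} {b₁ = false} {b₂ = false} (ℕₚ.≤ᵇ⇒≤ (norm rep-12c) 256 tt) profile-12c (proj₁ short-12c∈) (proj₂ short-12c∈) refl (ℕₚ.≤ᵇ⇒≤ (norm short-12c) 64 tt) (third-none (inj₁ (λ ()))) (candidate refl (λ ())) (λ f e _ → candidate refl (λ ()) f e)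

class-12d : Class rep-12d 4
class-12d = class-long {y₀ = short-12d} {z₀ = half (rep-12d ⊖ short-12d)} {b₁ = false} {b₂ = false} (ℕₚ.≤ᵇ⇒≤ (norm rep-12d) 256 tt) profile-12d (proj₁ short-12d∈) (proj₂ short-12d∈) refl (ℕₚ.≤ᵇ⇒≤ (norm short-12d) 64 tt) (third-none (inj₁ (λ ()))) (candidate refl (λ ())) (λ f e _ → candidate refl (λ ()) f e)

class-12e : Class rep-12e 2
class-12e = class-long {y₀ = short-12e} {z₀ = half (rep-12e ⊖ short-12e)} {b₁ = false} {b₂ = false} (ℕₚ.≤ᵇ⇒≤ (norm rep-12e) 256 tt) profile-12e (proj₁ short-12e∈) (proj₂ short-12e∈) refl (ℕₚ.≤ᵇ⇒≤ (norm short-12e) 64 tt) (third-none (inj₁ (λ ()))) (candidate refl (λ ())) (λ f e _ → candidate refl (λ ()) f e)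

class-12f : Class rep-12f 1
class-12f = class-long {y₀ = short-12f} {z₀ = half (rep-12f ⊖ short-12f)} {b₁ = false} {b₂ = false} (ℕₚ.≤ᵇ⇒≤ (norm rep-12f) 256 tt) profile-12f (proj₁ short-12f∈) (proj₂ short-12f∈) refl (ℕₚ.≤ᵇ⇒≤ (norm short-12f) 64 tt) (third-none (inj₁ (λ ()))) (candidate refl (λ ())) (λ f e _ → candidate refl (λ ()) f e)

class-13b : Class rep-13b 2
class-13b = class-long {y₀ = short-13b} {z₀ = half (rep-13b ⊖ short-13b)} {b₁ = false} {b₂ = false} (ℕₚ.≤ᵇ⇒≤ (norm rep-13b) 256 tt) profile-13b (proj₁ short-13b∈) (proj₂ short-13b∈) refl (ℕₚ.≤ᵇ⇒≤ (norm short-13b) 64 tt) (third-none (inj₁ (λ ()))) (candidate refl (λ ())) (λ f e _ → candidate refl (λ ()) f e)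

class-13c : Class rep-13c 3
class-13c = class-long {y₀ = short-13c} {z₀ = half (rep-13c ⊖ short-13c)} {b₁ = false} {b₂ = false} (ℕₚ.≤ᵇ⇒≤ (norm rep-13c) 256 tt) profile-13c (proj₁ short-13c∈) (proj₂ short-13c∈) refl (ℕₚ.≤ᵇ⇒≤ (norm short-13c) 64 tt) (third-none (inj₁ (λ ()))) (candidate refl (λ ())) (λ f e _ → candidate refl (λ ()) f e)

class-14b : Class rep-14b 6
class-14b = class-long {y₀ = short-14b} {z₀ = half (rep-14b ⊖ short-14b)} {b₁ = false} {b₂ = false} (ℕₚ.≤ᵇ⇒≤ (norm rep-14b) 256 tt) profile-14b (proj₁ short-14b∈) (proj₂ short-14b∈) refl (ℕₚ.≤ᵇ⇒≤ (norm short-14b) 64 tt) (third-none (inj₁ (λ ()))) (candidate refl (λ ())) (λ f e _ → candidate refl (λ ()) f e)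

class-14d : Class rep-14d 4
class-14d = class-long {y₀ = short-14d} {z₀ = half (rep-14d ⊖ short-14d)} {b₁ = true} {b₂ = false} (ℕₚ.≤ᵇ⇒≤ (norm rep-14d) 256 tt) profile-14d (proj₁ short-14d∈) (proj₂ short-14d∈) refl (ℕₚ.≤ᵇ⇒≤ (norm short-14d) 64 tt) (third-none (inj₁ (λ ()))) (candidate refl (λ _ → refl)) (λ f e _ → candidate refl (λ ()) f e)

class-14e : Class rep-14e 8
class-14e = class-long {y₀ = short-14e} {z₀ = half (rep-14e ⊖ short-14e)} {b₁ = false} {b₂ = false} (ℕₚ.≤ᵇ⇒≤ (norm rep-14e) 256 tt) profile-14e (proj₁ short-14e∈) (proj₂ short-14e∈) refl (ℕₚ.≤ᵇ⇒≤ (norm short-14e) 64 tt) (third-none (inj₁ (λ ()))) (candidate refl (λ ())) (λ f e _ → candidate refl (λ ()) f e)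

class-15d : Class rep-15d 14
class-15d = class-long {y₀ = short-15d} {z₀ = half (rep-15d ⊖ short-15d)} {b₁ = false} {b₂ = false} (ℕₚ.≤ᵇ⇒≤ (norm rep-15d) 256 tt) profile-15d (proj₁ short-15d∈) (proj₂ short-15d∈) refl (ℕₚ.≤ᵇ⇒≤ (norm short-15d) 64 tt) (third-none (inj₁ (λ ()))) (candidate refl (λ ())) (λ f e _ → candidate refl (λ ()) f e)

class-16a : Class rep-16a 48
class-16a = class-long {y₀ = short-16a} {z₀ = half (rep-16a ⊖ short-16a)} {b₁ = true} {b₂ = false} (ℕₚ.≤ᵇ⇒≤ (norm rep-16a) 256 tt) profile-16a (proj₁ short-16a∈) (proj₂ short-16a∈) refl (ℕₚ.≤ᵇ⇒≤ (norm short-16a) 64 tt) (third-none (inj₂ (λ ()))) (candidate refl (λ _ → refl)) (λ _ e n → ⊥-elim (n e))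

class-16e : Class rep-16e 32
class-16e = class-long {y₀ = short-16e} {z₀ = half (rep-16e ⊖ short-16e)} {b₁ = true} {b₂ = false} (ℕₚ.≤ᵇ⇒≤ (norm rep-16e) 256 tt) profile-16e (proj₁ short-16e∈) (proj₂ short-16e∈) refl (ℕₚ.≤ᵇ⇒≤ (norm short-16e) 64 tt) (third-some {r = rep-16e} {y₀ = short-16e} refl (joint-bound {short-16e} {c-16e} (ℕₚ.≤ᵇ⇒≤ (norm short-16e) 256 tt) (ℕₚ.≤ᵇ⇒≤ (norm c-16e) 256 tt) (proj₁ (∧-true {length (joint short-16e c-16e 96 64 minCodes) ℕ.≤ᵇ 1} (proj₂ (∧-true {length minCodes ℕ.≤ᵇ 196560} audited)))))) (candidate refl (λ _ → refl)) (λ f e _ → candidate refl (λ ()) f e)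

-- The table of orbits and its verification

specs : List Spec
specs =
  spec 0 1 1 1 1 0 ∷
  spec 2 196560 1 196560 1 1654528 ∷
  spec 3 16773120 1 16773120 1 1930560 ∷
  spec 4 398034000 1 398034000 1 2091008 ∷
  spec 5 4629381120 1 4629381120 1 2195264 ∷
  spec 6 33965568000 1 33965568000 1 2261760 ∷
  spec 6 452088000 1 452088000 1 2227968 ∷
  spec 7 187489935360 1 187489935360 1 2303296 ∷
  spec 8 196560 2 98280 2 1507328 ∷
  spec 8 805620816000 1 805620816000 1 2328576 ∷
  spec 8 9258762240 1 9258762240 1 2293760 ∷
  spec 9 815173632000 1 815173632000 1 2342720 ∷
  spec 9 2160377856000 1 2160377856000 1 2343744 ∷
  spec 10 9374496768000 1 9374496768000 1 2351872 ∷
  spec 10 18309564000 2 9154782000 2 2309888 ∷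
  spec 10 93744967680 1 93744967680 1 2320128 ∷
  spec 11 1273079808000 2 636539904000 2 2352448 ∷
  spec 11 25779866112000 1 25779866112000 1 2356544 ∷
  spec 12 16773120 2 8386560 2 1572864 ∷
  spec 12 815173632000 1 815173632000 1 2326528 ∷
  spec 12 134270136000 4 33567534000 4 2353152 ∷
  spec 12 25779866112000 2 12889933056000 2 2357248 ∷
  spec 12 43747651584000 1 43747651584000 1 2359296 ∷
  spec 13 65996457246720 2 32998228623360 2 2360128 ∷
  spec 13 103119464448000 3 34373154816000 3 2359104 ∷
  spec 14 360918125568000 6 60153020928000 6 2360064 ∷
  spec 14 1273079808000 4 318269952000 4 2328320 ∷
  spec 14 3222483264000 8 402810408000 8 2326272 ∷
  spec 15 524971819008000 12 43747651584000 14 2360640 ∷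
  spec 16 398034000 48 8292375 48 1572864 ∷
  spec 16 386697991680000 32 12084312240000 32 2361344 ∷
  []

≈-step : ∀ {r a} → Min a → (r ⊕ + 4 ⊙ a) ≈ r
≈-step {r} {a} m = a , proj₁ m , ⊕-⊖ r (+ 4 ⊙ a)

-- `rep-15d` has the 13 minimal vectors of `nears-15d` at inner product -64, while `x` has at most
-- 12.
∉-15d : ∀ {x t ats S} → norm x ℕ.≤ 256 → Profile x t 12 ats S → ¬ InOrbit rep-15d x
∉-15d {x} h pr = other-orbit {rep-15d} {x} {13} {12} (ℕₚ.≤ᵇ⇒≤ (norm rep-15d) 256 tt) h in-15d nears-many (Profile.near pr) ℕₚ.≤-refl

q₁∉ : ¬ InOrbit rep-15d q₁
q₁∉ = ∉-15d {q₁} (ℕₚ.≤ᵇ⇒≤ (norm q₁) 256 tt) profile-q₁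

q₂∉ : ¬ InOrbit rep-15d q₂
q₂∉ = ∉-15d {q₂} (ℕₚ.≤ᵇ⇒≤ (norm q₂) 256 tt) profile-q₂

-- Of the at most 14 shortest vectors in the class, the two vectors `q₁` and `q₂` lie outside the
-- orbit.
few-15d : AtMost (λ u → InOrbit rep-15d u × u ≈ rep-15d) 12
few-15d = AtMost-remove {Q = λ u → Near rep-15d u × u ≢ q₂} q₁ (λ (o , e) → (e , ℕₚ.≤-reflexive (norm-orbit in-15d o)) , (λ { refl → q₂∉ o }))
  ((≈-step {rep-15d} {near₁} min-near₁ , ℕₚ.≤ᵇ⇒≤ (norm q₁) (norm rep-15d) tt) , decided (¬? (q₁ ≟ᵥ q₂)) refl) (λ (o , _) → q₁∉ o)
  (AtMost-remove {Q = Near rep-15d} q₂ proj₁ (≈-step {rep-15d} {near₂} min-near₂ , ℕₚ.≤ᵇ⇒≤ (norm q₂) (norm rep-15d) tt) (λ (_ , n) → n refl) (Class.bounded class-15d))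

frames : All Frame specs
frames =
  plainFrame (spec 0 1 1 1 1 0) in-0 refl (ℕₚ.≤ᵇ⇒≤ 0 16 tt) many-0 refl _ profile-0 class-0 refl ∷
  plainFrame (spec 2 196560 1 196560 1 1654528) in-2 refl (ℕₚ.≤ᵇ⇒≤ 2 16 tt) many-2 refl _ profile-2 class-2 refl ∷
  plainFrame (spec 3 16773120 1 16773120 1 1930560) in-3 refl (ℕₚ.≤ᵇ⇒≤ 3 16 tt) many-3 refl _ profile-3 class-3 refl ∷
  plainFrame (spec 4 398034000 1 398034000 1 2091008) in-4 refl (ℕₚ.≤ᵇ⇒≤ 4 16 tt) many-4 refl _ profile-4 class-4 refl ∷
  plainFrame (spec 5 4629381120 1 4629381120 1 2195264) in-5 refl (ℕₚ.≤ᵇ⇒≤ 5 16 tt) many-5 refl _ profile-5 class-5 refl ∷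
  plainFrame (spec 6 33965568000 1 33965568000 1 2261760) in-6a refl (ℕₚ.≤ᵇ⇒≤ 6 16 tt) many-6a refl _ profile-6a class-6a refl ∷
  plainFrame (spec 6 452088000 1 452088000 1 2227968) in-6b refl (ℕₚ.≤ᵇ⇒≤ 6 16 tt) many-6b refl _ profile-6b class-6b refl ∷
  plainFrame (spec 7 187489935360 1 187489935360 1 2303296) in-7 refl (ℕₚ.≤ᵇ⇒≤ 7 16 tt) many-7 refl _ profile-7 class-7 refl ∷
  plainFrame (spec 8 196560 2 98280 2 1507328) in-8a refl (ℕₚ.≤ᵇ⇒≤ 8 16 tt) many-8a refl _ profile-8a class-8a refl ∷
  plainFrame (spec 8 805620816000 1 805620816000 1 2328576) in-8b refl (ℕₚ.≤ᵇ⇒≤ 8 16 tt) many-8b refl _ profile-8b class-8b refl ∷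
  plainFrame (spec 8 9258762240 1 9258762240 1 2293760) in-8c refl (ℕₚ.≤ᵇ⇒≤ 8 16 tt) many-8c refl _ profile-8c class-8c refl ∷
  plainFrame (spec 9 815173632000 1 815173632000 1 2342720) in-9a refl (ℕₚ.≤ᵇ⇒≤ 9 16 tt) many-9a refl _ profile-9a class-9a refl ∷
  plainFrame (spec 9 2160377856000 1 2160377856000 1 2343744) in-9b refl (ℕₚ.≤ᵇ⇒≤ 9 16 tt) many-9b refl _ profile-9b class-9b refl ∷
  plainFrame (spec 10 9374496768000 1 9374496768000 1 2351872) in-10a refl (ℕₚ.≤ᵇ⇒≤ 10 16 tt) many-10a refl _ profile-10a class-10a refl ∷
  plainFrame (spec 10 18309564000 2 9154782000 2 2309888) in-10b refl (ℕₚ.≤ᵇ⇒≤ 10 16 tt) many-10b refl _ profile-10b class-10b refl ∷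
  plainFrame (spec 10 93744967680 1 93744967680 1 2320128) in-10c refl (ℕₚ.≤ᵇ⇒≤ 10 16 tt) many-10c refl _ profile-10c class-10c refl ∷
  plainFrame (spec 11 1273079808000 2 636539904000 2 2352448) in-11a refl (ℕₚ.≤ᵇ⇒≤ 11 16 tt) many-11a refl _ profile-11a class-11a refl ∷
  plainFrame (spec 11 25779866112000 1 25779866112000 1 2356544) in-11b refl (ℕₚ.≤ᵇ⇒≤ 11 16 tt) many-11b refl _ profile-11b class-11b refl ∷
  plainFrame (spec 12 16773120 2 8386560 2 1572864) in-12a refl (ℕₚ.≤ᵇ⇒≤ 12 16 tt) many-12a refl _ profile-12a class-12a refl ∷
  plainFrame (spec 12 815173632000 1 815173632000 1 2326528) in-12c refl (ℕₚ.≤ᵇ⇒≤ 12 16 tt) many-12c refl _ profile-12c class-12c refl ∷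
  plainFrame (spec 12 134270136000 4 33567534000 4 2353152) in-12d refl (ℕₚ.≤ᵇ⇒≤ 12 16 tt) many-12d refl _ profile-12d class-12d refl ∷
  plainFrame (spec 12 25779866112000 2 12889933056000 2 2357248) in-12e refl (ℕₚ.≤ᵇ⇒≤ 12 16 tt) many-12e refl _ profile-12e class-12e refl ∷
  plainFrame (spec 12 43747651584000 1 43747651584000 1 2359296) in-12f refl (ℕₚ.≤ᵇ⇒≤ 12 16 tt) many-12f refl _ profile-12f class-12f refl ∷
  plainFrame (spec 13 65996457246720 2 32998228623360 2 2360128) in-13b refl (ℕₚ.≤ᵇ⇒≤ 13 16 tt) many-13b refl _ profile-13b class-13b refl ∷
  plainFrame (spec 13 103119464448000 3 34373154816000 3 2359104) in-13c refl (ℕₚ.≤ᵇ⇒≤ 13 16 tt) many-13c refl _ profile-13c class-13c refl ∷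
  plainFrame (spec 14 360918125568000 6 60153020928000 6 2360064) in-14b refl (ℕₚ.≤ᵇ⇒≤ 14 16 tt) many-14b refl _ profile-14b class-14b refl ∷
  plainFrame (spec 14 1273079808000 4 318269952000 4 2328320) in-14d refl (ℕₚ.≤ᵇ⇒≤ 14 16 tt) many-14d refl _ profile-14d class-14d refl ∷
  plainFrame (spec 14 3222483264000 8 402810408000 8 2326272) in-14e refl (ℕₚ.≤ᵇ⇒≤ 14 16 tt) many-14e refl _ profile-14e class-14e refl ∷
  record { rep = rep-15d ; rep∈Λ = in-15d ; rep-norm = refl ; type≤ = ℕₚ.≤ᵇ⇒≤ 15 16 tt ; many = many-15d ; card≡ = refl ; weight≢0 = _ ; near-class = class-15d ; few = few-15d ; sums = Profile.sums profile-15d } ∷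
  plainFrame (spec 16 398034000 48 8292375 48 1572864) in-16a refl (ℕₚ.≤ᵇ⇒≤ 16 16 tt) many-16a refl _ profile-16a class-16a refl ∷
  plainFrame (spec 16 386697991680000 32 12084312240000 32 2361344) in-16e refl (ℕₚ.≤ᵇ⇒≤ 16 16 tt) many-16e refl _ profile-16e class-16e refl ∷
  []

opaque
  separated-specs : AllPairs Separated specs
  separated-specs = decided (AllPairs.allPairs? (λ s s′ → ¬? (type s ℕ.≟ type s′) ⊎-dec ¬? (checksum s ℕ.≟ checksum s′)) specs) refl

  plain-specs : All (λ s → type s ≢ 15 → bound s ≡ weight s) specs
  plain-specs = decided (All.all? (λ s → ¬? (type s ℕ.≟ 15) →-dec (bound s ℕ.≟ weight s)) specs) refl

  checksum-15 : All (λ s → type s ≡ 15 → checksum s ≡ 2360640) specs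
  checksum-15 = decided (All.all? (λ s → (type s ℕ.≟ 15) →-dec (checksum s ℕ.≟ 2360640)) specs) refl

  excluded-specs : All (λ e → All (λ s → excluded (Entry.type e) (Entry.card e) s ≡ true) specs) appearing
  excluded-specs = decided (All.all? (λ e → All.all? (λ s → excluded (Entry.type e) (Entry.card e) s Data.Bool.≟ true) specs) appearing) refl

  matching-specs : All (λ e → All (λ s → type s ≡ Entry.type e → card s ≡ Entry.card e → Entry.type e ≢ 15 → weight s ≡ Entry.weight e) specs) appearing
  matching-specs = decided (All.all? (λ e → All.all? (λ s → (type s ℕ.≟ Entry.type e) →-dec ((card s ℕ.≟ Entry.card e) →-dec (¬? (Entry.type e ℕ.≟ 15) →-dec (weight s ℕ.≟ Entry.weight e)))) specs) appearing) refl

  weight-15 : All (λ e → Entry.type e ≡ 15 → Entry.weight e ≡ 14) appearing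
  weight-15 = decided (All.all? (λ e → (Entry.type e ℕ.≟ 15) →-dec (Entry.weight e ℕ.≟ 14)) appearing) refl

  appearing-specs : All (λ s → Any (λ e → type s ≡ Entry.type e × card s ≡ Entry.card e) appearing) specs
  appearing-specs = decided (All.all? (λ s → Any.any? (λ e → (type s ℕ.≟ Entry.type e) ×-dec (card s ℕ.≟ Entry.card e)) appearing) specs) refl

spec-15d : Spec
spec-15d = spec 15 524971819008000 12 43747651584000 14 2360640

i-15d : spec-15d ∈ specs
i-15d = there (there (there (there (there (there (there (there (there (there (there (there (there (there (there (there (there (there (there (there (there (there (there (there (there (there (there (there (here refl))))))))))))))))))))))))))))

-- Two separated entries of type 15 would have different checksums, but all entries of this type
-- share one.
only-15 : ∀ {s} (i : s ∈ specs) → type s ≡ 15 → _≡_ {A = ∃ (_∈ specs)} (s , i) (spec-15d , i-15d)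
only-15 {s} i t≡ = [ id , [ clash , (λ r → clash (flip r)) ]′ ]′ (AllPairs-cases separated-specs i i-15d)
  where
  flip : Separated spec-15d s → Separated s spec-15d
  flip = [ (λ n → inj₁ (n ∘ sym)) , (λ n → inj₂ (n ∘ sym)) ]′
  clash : Separated s spec-15d → _≡_ {A = ∃ (_∈ specs)} (s , i) (spec-15d , i-15d)
  clash (inj₁ n) = ⊥-elim (n t≡)
  clash (inj₂ n) = ⊥-elim (n (All.lookup checksum-15 i t≡))

-- Links the vector whose orbit has been measured from below with one that is visibly congruent to
-- `rep-15d`.
q-orbit : InOrbit rep-15b q₁
q-orbit = act mat-15b , act-Co₀ aut-15b , refl

-- 2 is 14 - 12, the places that the orbit of `rep-15d` leaves free in a class, and 87495303168000 =
-- 2 · 43747651584000 is exactly the lower bound found for the orbit of `rep-15b`.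
module Final = Conclusion frames minimals separated-specs refl i-15d q₁ {w = 2} {c = 87495303168000} (orbit-Λ in-15b q-orbit) (≈-step {rep-15d} {near₁} min-near₁) refl
  (AtLeast-⊆ (orbit-trans (orbit-sym in-15b q-orbit)) many-15b) refl refl q₁∉ refl (λ ())
  (λ i → All.lookup plain-specs i) only-15 (λ j i → All.lookup (All.lookup excluded-specs j) i) (λ j i → All.lookup (All.lookup matching-specs j) i)
  (λ j → All.lookup weight-15 j) (λ i → All.lookup appearing-specs i)

-- The two orbits of type 15, recognised by their sizes, and the weighted equality

import Data.Rational as ℚ

entry-15b : ⟨ 15 , |O₁₅ᵦ| , 14 ⟩ ∈ appearing
entry-15b = there (there (there (there (there (there (there (there (there (there (there (there (there (there (there (there (there (there (there (there (there (there (there (there (there (there (there (there (here refl))))))))))))))))))))))))))))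

entry-15d : ⟨ 15 , |O₁₅d| , 14 ⟩ ∈ appearing
entry-15d = there (there (there (there (there (there (there (there (there (there (there (there (there (there (there (there (there (there (there (there (there (there (there (there (there (there (there (there (there (here refl)))))))))))))))))))))))))))))

orbit-15b : ∀ {v} → IsOrbit 15 |O₁₅ᵦ| v → InOrbit q₁ v
orbit-15b io@(_ , _ , hs) = Final.is-q (Final.mixed-orbit entry-15b refl io) hs

orbit-15d : ∀ {v} → IsOrbit 15 |O₁₅d| v → InOrbit rep-15d v
orbit-15d io@(_ , _ , hs) = Final.is-r (Final.mixed-orbit entry-15d refl io) hs

either-15 : ∀ {v} → IsOrbit 15 |O₁₅ᵦ| v ⊎ IsOrbit 15 |O₁₅d| v → Final.M.Either v
either-15 = [ inj₂ ∘ orbit-15b , inj₁ ∘ orbit-15d ]′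

other-15 : ∀ {u} → InΛ u → HasType u 15 → Final.M.Either u → IsOrbit 15 |O₁₅ᵦ| u ⊎ IsOrbit 15 |O₁₅d| u
other-15 iu ty (inj₂ o) = inj₁ (iu , ty , orbit-size-conj (orbit-Λ in-15b q-orbit) o Final.M.q-size)
other-15 iu ty (inj₁ o) = inj₂ (iu , ty , orbit-size-conj in-15d o (Excluding.orbit-size frames minimals separated-specs refl i-15d))

theorem7p1 :
      ((+ (4 ℕ.^ 24)) ℚ./ 1 ≡
         (+ 1) ℚ./ 1 ℚ.+ (+ |O₂|) ℚ./ 1 ℚ.+ (+ |O₃|) ℚ./ 1 ℚ.+ (+ |O₄|) ℚ./ 1 ℚ.+ (+ |O₅|) ℚ./ 1
         ℚ.+ (+ |O₆ₐ|) ℚ./ 1 ℚ.+ (+ |O₆ᵦ|) ℚ./ 1 ℚ.+ (+ |O₇|) ℚ./ 1 ℚ.+ (+ |O₈ₐ|) ℚ./ 2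
         ℚ.+ (+ |O₈ᵦ|) ℚ./ 1 ℚ.+ (+ |O₈c|) ℚ./ 1 ℚ.+ (+ |O₉ₐ|) ℚ./ 1 ℚ.+ (+ |O₉ᵦ|) ℚ./ 1
         ℚ.+ (+ |O₁₀ₐ|) ℚ./ 1 ℚ.+ (+ |O₁₀ᵦ|) ℚ./ 2 ℚ.+ (+ |O₁₀c|) ℚ./ 1 ℚ.+ (+ |O₁₁ₐ|) ℚ./ 2
         ℚ.+ (+ |O₁₁ᵦ|) ℚ./ 1 ℚ.+ (+ |O₁₂ₐ|) ℚ./ 2 ℚ.+ (+ |O₁₂c|) ℚ./ 1 ℚ.+ (+ |O₁₂d|) ℚ./ 4
         ℚ.+ (+ |O₁₂e|) ℚ./ 2 ℚ.+ (+ |O₁₂f|) ℚ./ 1 ℚ.+ (+ |O₁₃ᵦ|) ℚ./ 2 ℚ.+ (+ |O₁₃c|) ℚ./ 3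
         ℚ.+ (+ |O₁₄ᵦ|) ℚ./ 6 ℚ.+ (+ |O₁₄d|) ℚ./ 4 ℚ.+ (+ |O₁₄e|) ℚ./ 8
         ℚ.+ (+ (|O₁₅ᵦ| ℕ.+ |O₁₅d|)) ℚ./ 14
         ℚ.+ (+ |O₁₆ₐ|) ℚ./ 48 ℚ.+ (+ |O₁₆e|) ℚ./ 32)
    × (∀ e → e ∈ appearing → ∀ v → IsOrbit (Entry.type e) (Entry.card e) v →
         MinimalInClass v × HasSize (Weight4 v) (Entry.weight e))
    × (∀ x → InΛ x → ∃ λ v → In4Λ (x -ᵥ v) ×
         Any (λ e → IsOrbit (Entry.type e) (Entry.card e) v) appearing)
    × (∀ v u → IsOrbit 15 |O₁₅ᵦ| v → IsOrbit 15 |O₁₅d| u → Conj4 v u)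
    × (∀ v u → (IsOrbit 15 |O₁₅ᵦ| v ⊎ IsOrbit 15 |O₁₅d| v) →
         InΛ u → HasType u 15 → ¬ IsOrbit 15 |O₁₅ᵦ| u → ¬ IsOrbit 15 |O₁₅d| u →
         ¬ Conj4 v u)
    × (∀ e → e ∈ appearing → Entry.type e ≢ 15 →
         ∀ v → IsOrbit (Entry.type e) (Entry.card e) v →
         (∀ u → InΛ u → TypeAtMost u (Entry.type e) → ¬ InOrbit v u → ¬ Conj4 v u)
         × HasSize (OrbitWeight4 v) (Entry.weight e))
    × (∀ v → IsOrbit 15 |O₁₅ᵦ| v → HasSize (OrbitWeight4 v) 2 × HasSize (Weight4 v) 14)
    × (∀ v → IsOrbit 15 |O₁₅d| v → HasSize (OrbitWeight4 v) 12 × HasSize (Weight4 v) 14)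
theorem7p1 = refl
  , Final.minimal-and-weight
  , Final.represented
  , (λ v u iv iu → Final.M.conjugate (orbit-15b iv) (orbit-15d iu))
  , (λ v u iv iu ty not-b not-d c → [ not-b , not-d ]′ (other-15 iu ty
      -- 240 = 16 · 15 is the norm of the vectors of type 15.
      (Final.isolated-mixed (either-15 iv) (trans (norm≡ {u} {240} ty) (sym (norm≡ {v} {240} ([ proj₁ ∘ proj₂ , proj₁ ∘ proj₂ ]′ iv)))) iu c)))
  , Final.isolated-plain
  , (λ v iv → Final.M.q-weight (orbit-15b iv) , Final.M.vector-weight (either-15 (inj₁ iv)))
  , (λ v iv → Final.M.r-weight (orbit-15d iv) , Final.M.vector-weight (either-15 (inj₂ iv)))
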